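{- There is a polynomial-time algorithm that solves the Stochastic Boolean Function Evaluation (SBFE) problem for CDNF formulas with approximation factor $O(\log kd)$, where $k$ is the number of clauses in the CNF formula and $d$ is the number of terms in the DNF formula of the input CDNF formula. That is, on every input (CDNF formula, probability vector $p$, cost vector $c$), the expected testing cost of the algorithm is at most $O(\log kd)$ times the minimum expected testing cost of any strategy evaluating the function.
   Context: Stochastic Boolean Function Evaluation (SBFE): the input is a representation of a Boolean function $f:\{0,1\}^n\to\{0,1\}$ from a fixed class, a probability vector $p=(p_1,\dots,p_n)$ with $0<p_i<1$, and a cost vector $c=(c_1,\dots,c_n)$ with $c_i\ge 0$. An unknown input $x\in\{0,1\}^n$ is drawn from the product distribution $D_p$ with $\Pr[x_i=1]=p_i$. The value of $x_i$ can be learned only by "testing" $i$ at cost $c_i$. A strategy (adaptive decision tree) tests variables sequentially, the choice of next test possibly depending on previous outcomes, and must continue until the observed partial assignment $b\in\{0,1,*\}^n$ ($b_i=*$ meaning untested) is a $0$-certificate or a $1$-certificate of $f$, then outputs $f(x)$. Here $b$ is a $0$-certificate ($1$-certificate) if $f(a)=0$ ($f(a)=1$) for every $a\in\{0,1\}^n$ agreeing with $b$ on all coordinates where $b_i\ne *$. The cost of a strategy is its expected total testing cost for $x\sim D_p$; an optimal strategy minimizes this. The running time of an algorithm is the worst-case time it takes to determine the next variable to test or to compute the output after the last test. A CDNF formula for $f$ is a pair $(\phi_0,\phi_1)$ where $\phi_0$ is a CNF formula and $\phi_1$ is a DNF formula, both representing $f$.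
   Formalization: The probabilities p_i and the costs c_i are taken to be rational numbers, given to the algorithm in binary, instead of arbitrary real numbers. -}

module Defs where

open import Data.Nat using (ℕ; zero; suc; _+_; _*_; _^_)
open import Data.Nat.Binary.Base as B using (ℕᵇ; 2[1+_]; 1+[2_])
open import Data.Integer using (ℤ; +_; -[1+_])
import Data.Integer as ℤ
open import Data.Rational using (ℚ; ↥_; ↧ₙ_; 0ℚ; 1ℚ) renaming (_+_ to _+ℚ_; _*_ to _*ℚ_; _-_ to _-ℚ_)
open import Data.Fin using (Fin; toℕ)
open import Data.Bool using (Bool; true; false; not; _∧_; _∨_; if_then_else_)
open import Data.Maybe using (Maybe; just; nothing)
open import Data.List using (List; []; _∷_; _++_; concatMap; map; foldr; length)
open import Data.Vec using (Vec; []; _∷_; lookup; _[_]≔_; replicate)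
open import Data.Product using (Σ; _×_; _,_; proj₁; proj₂)
open import Relation.Binary.PropositionalEquality using (_≡_)

record Literal (n : ℕ) : Set where
  constructor lit
  field
    var      : Fin n
    positive : Bool

Clause : ℕ → Set
Clause n = List (Literal n)

Term : ℕ → Set
Term n = List (Literal n)

CNF : ℕ → Set
CNF n = List (Clause n)

DNF : ℕ → Set
DNF n = List (Term n)

evalLit : ∀ {n} → Vec Bool n → Literal n → Bool
evalLit a (lit i true)  = lookup a i
evalLit a (lit i false) = not (lookup a i)

evalClause : ∀ {n} → Vec Bool n → Clause n → Bool
evalClause a = foldr (λ l r → evalLit a l ∨ r) false

evalTerm : ∀ {n} → Vec Bool n → Term n → Bool
evalTerm a = foldr (λ l r → evalLit a l ∧ r) true

evalCNF : ∀ {n} → CNF n → Vec Bool n → Bool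
evalCNF φ a = foldr (λ C r → evalClause a C ∧ r) true φ

evalDNF : ∀ {n} → DNF n → Vec Bool n → Bool
evalDNF φ a = foldr (λ T r → evalTerm a T ∨ r) false φ

Partial : ℕ → Set
Partial n = Vec (Maybe Bool) n   -- nothing = untested (*)

Agrees : ∀ {n} → Vec Bool n → Partial n → Set
Agrees {n} a b = ∀ (i : Fin n) (w : Bool) → lookup b i ≡ just w → lookup a i ≡ w

IsCertificate : ∀ {n} → (Vec Bool n → Bool) → Bool → Partial n → Set
IsCertificate f v b = ∀ a → Agrees a b → f a ≡ v

data Tree (n : ℕ) : Set where
  leaf : Bool → Tree n
  test : Fin n → Tree n → Tree n → Tree n       -- test x_i; subtree for x_i = 0, for x_i = 1

runTree : ∀ {n} → Tree n → Vec Bool n → Partial n → Bool × Partial n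
runTree (leaf v) x b = v , b
runTree (test i t0 t1) x b with lookup x i
... | false = runTree t0 x (b [ i ]≔ just false)
... | true  = runTree t1 x (b [ i ]≔ just true)

costOn : ∀ {n} → Vec ℚ n → Tree n → Vec Bool n → ℚ
costOn c (leaf v) x = 0ℚ
costOn c (test i t0 t1) x with lookup x i
... | false = lookup c i +ℚ costOn c t0 x
... | true  = lookup c i +ℚ costOn c t1 x

Evaluates : ∀ {n} → (Vec Bool n → Bool) → Tree n → Set
Evaluates {n} f t = ∀ (x : Vec Bool n) →
  IsCertificate f (proj₁ (runTree t x (replicate n nothing)))
                  (proj₂ (runTree t x (replicate n nothing)))

allInputs : (n : ℕ) → List (Vec Bool n)
allInputs zero    = [] ∷ []
allInputs (suc n) = map (false ∷_) (allInputs n) ++ map (true ∷_) (allInputs n)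

prob : ∀ {n} → Vec ℚ n → Vec Bool n → ℚ
prob [] [] = 1ℚ
prob (q ∷ p) (true  ∷ x) = q *ℚ prob p x
prob (q ∷ p) (false ∷ x) = (1ℚ -ℚ q) *ℚ prob p x

expectedCost : ∀ {n} → Vec ℚ n → Vec ℚ n → Tree n → ℚ
expectedCost {n} p c t = foldr (λ x r → prob p x *ℚ costOn c t x +ℚ r) 0ℚ (allInputs n)

-- Turing machines (single tape, two-way infinite, blank-filled)

data Sym : Set where
  blank o0 o1 lb rb : Sym     -- blank, bit 0, bit 1, '[', ']'

data Move : Set where
  L R S : Move

record TM : Set where
  field
    States : ℕ
    start  : Fin States
    δ      : Fin States → Sym → Maybe (Fin States × Sym × Move)  -- nothing = halt

record Config (M : TM) : Set where
  constructor conf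
  field
    state : Fin (TM.States M)
    left  : List Sym     -- cells left of head, nearest first
    head  : Sym
    right : List Sym

moveHead : ∀ {M} → Fin (TM.States M) → List Sym → Sym → List Sym → Move → Config M
moveHead q []      h r L = conf q [] blank (h ∷ r)
moveHead q (l ∷ ls) h r L = conf q ls l (h ∷ r)
moveHead q ls h []       R = conf q (h ∷ ls) blank []
moveHead q ls h (r ∷ rs) R = conf q (h ∷ ls) r rs
moveHead q ls h r S = conf q ls h r

run : (M : TM) → ℕ → Config M → Maybe (Config M)
run M fuel (conf q l h r) with TM.δ M q h
run M fuel       (conf q l h r) | nothing = just (conf q l h r)
run M zero       (conf q l h r) | just _  = nothing
run M (suc fuel) (conf q l h r) | just (q' , s , m) = run M fuel (moveHead {M} q' l s r m)

initial : (M : TM) → List Sym → Config M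
initial M []      = conf (TM.start M) [] blank []
initial M (s ∷ w) = conf (TM.start M) [] s w

readOut : List Sym → List Sym
readOut []          = []
readOut (blank ∷ _) = []
readOut (s ∷ w)     = s ∷ readOut w

output : ∀ {M} → Config M → List Sym
output (conf q l h r) = readOut (h ∷ r)

HaltsWith : (M : TM) → ℕ → List Sym → List Sym → Set
HaltsWith M t w out = Σ (Config M) λ c → (run M t (initial M w) ≡ just c) × (output c ≡ out)

bits : ℕᵇ → List Sym       -- bijective base-2 digits, length O(log n)
bits B.zero    = []
bits 2[1+ x ]  = o1 ∷ bits x
bits 1+[2 x ]  = o0 ∷ bits x

encℕ : ℕ → List Sym
encℕ m = lb ∷ bits (B.fromℕ m) ++ rb ∷ []

encBool : Bool → List Sym
encBool false = o0 ∷ []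
encBool true  = o1 ∷ []

encList : ∀ {A : Set} → (A → List Sym) → List A → List Sym
encList e xs = lb ∷ concatMap e xs ++ rb ∷ []

encVec : ∀ {A : Set} {n} → (A → List Sym) → Vec A n → List Sym
encVec e []       = lb ∷ rb ∷ []
encVec e (x ∷ xs) = lb ∷ e x ++ encVec e xs ++ rb ∷ []

encFin : ∀ {n} → Fin n → List Sym
encFin i = encℕ (toℕ i)

encℤ : ℤ → List Sym
encℤ (+ m)     = lb ∷ o0 ∷ encℕ m ++ rb ∷ []
encℤ -[1+ m ]  = lb ∷ o1 ∷ encℕ m ++ rb ∷ []

encℚ : ℚ → List Sym
encℚ q = lb ∷ encℤ (↥ q) ++ encℕ (↧ₙ q) ++ rb ∷ []

encLit : ∀ {n} → Literal n → List Sym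
encLit (lit i s) = lb ∷ encFin i ++ encBool s ++ rb ∷ []

encInstance : (n : ℕ) → CNF n → DNF n → Vec ℚ n → Vec ℚ n → List Sym
encInstance n φ0 φ1 p c =
  lb ∷ encℕ n ++ encList (encList encLit) φ0 ++ encList (encList encLit) φ1
     ++ encVec encℚ p ++ encVec encℚ c ++ rb ∷ []

History : ℕ → Set
History n = List (Fin n × Bool)

encHistory : ∀ {n} → History n → List Sym
encHistory = encList (λ { (i , v) → lb ∷ encFin i ++ encBool v ++ rb ∷ [] })

encTest : ∀ {n} → Fin n → List Sym
encTest i = lb ∷ o0 ∷ encFin i ++ rb ∷ []

encOutput : Bool → List Sym
encOutput v = lb ∷ o1 ∷ encBool v ++ rb ∷ []

-- The algorithm M, with per-decision time bound T, on instance encoding w,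
-- realises the strategy t after history h: at each node it determines (within
-- T steps, from the instance and all outcomes so far) the next variable to test,
-- or the output at a leaf.
Implements : ∀ {n} → TM → ℕ → List Sym → History n → Tree n → Set
Implements M T w h (leaf v) =
  HaltsWith M T (lb ∷ w ++ encHistory h ++ rb ∷ []) (encOutput v)
Implements M T w h (test i t0 t1) =
  HaltsWith M T (lb ∷ w ++ encHistory h ++ rb ∷ []) (encTest i)
  × Implements M T w (h ++ (i , false) ∷ []) t0
  × Implements M T w (h ++ (i , true) ∷ []) t1

{-# OPTIONS --safe #-}
-- The algorithm is an adaptive greedy policy.  Call a clause (term) unresolved if no observed outcome
-- makes it true (false), ignoring tautological groups; f is certified as soon as no clause, or no term,
-- is unresolved.  Let r₁ and r₀ count the unresolved clauses and terms.  If outcome v of test j resolves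
-- u clauses, then r₁ r₀ drops by the mass m = u r₀, and symmetrically for terms.  The policy minimises,
-- up to a constant factor, the price θ = c j / (Pr[x j = v] m) over all j, v and the two families.
--
-- Let ψ be the maximum of the prices paid so far.  Telescoping over ψ bounds the expected cost of the
-- policy by the expected sum of (Δψ) r₁ r₀.  Any strategy evaluating f must, on input x, have tested
-- variables hitting every unresolved clause or every unresolved term, so r₁ r₀ is at most the sum of the
-- masses of its tests.  Since the price of j bounds ψ while j has positive mass, the total charge
-- Pr[x j = v] Σ (Δψ) m of test j is at most a constant times c j (1 + log (k d)), and whether the other
-- strategy tests j does not depend on x j.
--
-- Products are compared through sums of bit lengths of their factors, which costs only a constant factor
-- and leaves a Turing machine with nothing harder than counting.  The machine is compiled from a small
-- language whose variables are counters, or pointers into the input word, of polynomial size, each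
-- represented by a mark on a track of the tape.
module Submission where

-- Prices need not increase along a path, which is why charges are measured against their running
-- maximum ψ. For an outcome v of a test j, ψ times the mass stays below a constant times
-- `c j / Pr[x j = v]` while the mass itself only falls, so the charge is a Stieltjes sum of the
-- mass against ψ. A real logarithm is avoided by replacing the mass m with `2 ^ bl m - 1`, where
-- `bl` is the bit length: the logarithm is then a count of doublings.
--
-- The potential is the product r₁ r₀ because a strategy establishes only one of the two values. It
-- hits all groups of one family, and which family depends on the input; the product lets either
-- family alone account for everything.
--
-- The final constant is 4 times 2^12: two outcomes of a test, two families, and six factors on each
-- side of a comparison of prices, each known up to a factor 2 in either direction. A sum of six
-- such lengths stays below eight times the input length, hence the eightfold repetition of every
-- symbol. Tests of cost 0 are treated apart, since 0 has no logarithm.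

-- Structured programs on a one-sided tape, and their compilation to Turing machines.

module TapeProgram where

  open import Defs using (Sym; blank; Move; L; R; S; TM; Config; conf; moveHead; run)
  open import Data.Nat using (ℕ; zero; suc; _+_; _≤_; _<_; s≤s; _≡ᵇ_)
  open import Data.Nat.Properties using (≤-trans; ≤-refl; +-mono-≤; ≤-reflexive)
  open import Data.Bool using (Bool; true; false; if_then_else_)
  open import Data.Fin using (Fin; zero; suc; splitAt; _↑ˡ_; _↑ʳ_)
  open import Data.Fin.Properties using (splitAt-↑ˡ; splitAt-↑ʳ)
  open import Data.List using (List; []; _∷_)
  open import Data.Maybe using (Maybe; just; nothing)
  import Data.Maybe as Maybe
  open import Data.Product using (Σ; _×_; _,_; proj₁; proj₂)
  open import Data.Sum using (_⊎_; inj₁; inj₂; [_,_]′)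
  open import Data.Empty using (⊥)
  open import Data.Unit using (⊤; tt)
  open import Relation.Binary.PropositionalEquality using (_≡_; refl; sym; trans; cong; subst)

  data Prog : Set where
    wr    : Sym → Prog
    mvR   : Prog
    mvL   : Prog
    _⨾_   : Prog → Prog → Prog
    ifS   : (Sym → Bool) → Prog → Prog → Prog
    while : (Sym → Bool) → Prog → Prog

  infixr 4 _⨾_

  Tape : Set
  Tape = ℕ → Sym

  upd : Tape → ℕ → Sym → Tape
  upd τ p s i = if i ≡ᵇ p then s else τ i

  -- Big-step execution from tape and head position to tape and head position; the last index
  -- is an upper bound on the number of steps.  Cell 0 is never left to the left.
  data Exec : Prog → Tape → ℕ → Tape → ℕ → ℕ → Set where
    xwr  : ∀ {s τ p} → Exec (wr s) τ p (upd τ p s) p 1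
    xR   : ∀ {τ p} → Exec mvR τ p τ (suc p) 1
    xL   : ∀ {τ p} → Exec mvL τ (suc p) τ p 1
    xseq : ∀ {P Q τ p τ₁ p₁ τ₂ p₂ t₁ t₂} →
           Exec P τ p τ₁ p₁ t₁ → Exec Q τ₁ p₁ τ₂ p₂ t₂ → Exec (P ⨾ Q) τ p τ₂ p₂ (t₁ + t₂)
    xift : ∀ {c P Q τ p τ₁ p₁ t} → c (τ p) ≡ true →
           Exec P τ p τ₁ p₁ t → Exec (ifS c P Q) τ p τ₁ p₁ (suc t)
    xiff : ∀ {c P Q τ p τ₁ p₁ t} → c (τ p) ≡ false →
           Exec Q τ p τ₁ p₁ t → Exec (ifS c P Q) τ p τ₁ p₁ (suc t)
    xwhf : ∀ {c P τ p} → c (τ p) ≡ false → Exec (while c P) τ p τ p 1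
    xwht : ∀ {c P τ p τ₁ p₁ τ₂ p₂ t₁ t₂} → c (τ p) ≡ true →
           Exec P τ p τ₁ p₁ t₁ → Exec (while c P) τ₁ p₁ τ₂ p₂ t₂ →
           Exec (while c P) τ p τ₂ p₂ (suc (t₁ + t₂))
    xwk  : ∀ {P τ p τ₁ p₁ t t'} → t ≤ t' → Exec P τ p τ₁ p₁ t → Exec P τ p τ₁ p₁ t'

  Pos : Prog → Set
  Pos (wr s)      = ⊤
  Pos mvR         = ⊤
  Pos mvL         = ⊤
  Pos (P ⨾ Q)     = Pos P ⊎ Pos Q
  Pos (ifS c P Q) = ⊤ ⊎ (Pos P ⊎ Pos Q)
  Pos (while c P) = ⊤ ⊎ Pos P

  entry : (P : Prog) → Pos P
  entry (wr s)      = tt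
  entry mvR         = tt
  entry mvL         = tt
  entry (P ⨾ Q)     = inj₁ (entry P)
  entry (ifS c P Q) = inj₁ tt
  entry (while c P) = inj₁ tt

  next : {A B : Set} → (A → B) → B → Maybe A → B
  next f b (just a) = f a
  next f b nothing  = b

  -- A next point `nothing` means leaving `P`. Where that leads is decided by the surrounding
  -- program, so composition merely rewires exits.
  δP : (P : Prog) → Pos P → Sym → Maybe (Pos P) × Sym × Move
  δP (wr s) _ h = nothing , s , S
  δP mvR _ h = nothing , h , R
  δP mvL _ h = nothing , h , L
  δP (P ⨾ Q) (inj₁ a) h =
    just (next inj₁ (inj₂ (entry Q)) (proj₁ (δP P a h))) , proj₂ (δP P a h)
  δP (P ⨾ Q) (inj₂ b) h = Maybe.map inj₂ (proj₁ (δP Q b h)) , proj₂ (δP Q b h)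
  δP (ifS c P Q) (inj₁ _) h =
    just (inj₂ (if c h then inj₁ (entry P) else inj₂ (entry Q))) , h , S
  δP (ifS c P Q) (inj₂ (inj₁ a)) h =
    Maybe.map (λ x → inj₂ (inj₁ x)) (proj₁ (δP P a h)) , proj₂ (δP P a h)
  δP (ifS c P Q) (inj₂ (inj₂ b)) h =
    Maybe.map (λ x → inj₂ (inj₂ x)) (proj₁ (δP Q b h)) , proj₂ (δP Q b h)
  δP (while c P) (inj₁ _) h = (if c h then just (inj₂ (entry P)) else nothing) , h , S
  δP (while c P) (inj₂ a) h = just (next inj₂ (inj₁ tt) (proj₁ (δP P a h))) , proj₂ (δP P a h)

  size : Prog → ℕ
  size (wr s)      = 1
  size mvR         = 1
  size mvL         = 1
  size (P ⨾ Q)     = size P + size Q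
  size (ifS c P Q) = 1 + (size P + size Q)
  size (while c P) = 1 + size P

  toFin : (P : Prog) → Pos P → Fin (size P)
  toFin (wr s) _ = zero
  toFin mvR _ = zero
  toFin mvL _ = zero
  toFin (P ⨾ Q) (inj₁ a) = toFin P a ↑ˡ size Q
  toFin (P ⨾ Q) (inj₂ b) = size P ↑ʳ toFin Q b
  toFin (ifS c P Q) (inj₁ _) = zero
  toFin (ifS c P Q) (inj₂ (inj₁ a)) = suc (toFin P a ↑ˡ size Q)
  toFin (ifS c P Q) (inj₂ (inj₂ b)) = suc (size P ↑ʳ toFin Q b)
  toFin (while c P) (inj₁ _) = zero
  toFin (while c P) (inj₂ a) = suc (toFin P a)

  fromFin : (P : Prog) → Fin (size P) → Pos P
  fromFin (wr s) _ = tt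
  fromFin mvR _ = tt
  fromFin mvL _ = tt
  fromFin (P ⨾ Q) i = [ (λ a → inj₁ (fromFin P a)) , (λ b → inj₂ (fromFin Q b)) ]′ (splitAt (size P) i)
  fromFin (ifS c P Q) zero = inj₁ tt
  fromFin (ifS c P Q) (suc i) =
    inj₂ ([ (λ a → inj₁ (fromFin P a)) , (λ b → inj₂ (fromFin Q b)) ]′ (splitAt (size P) i))
  fromFin (while c P) zero = inj₁ tt
  fromFin (while c P) (suc i) = inj₂ (fromFin P i)

  from-to : (P : Prog) (a : Pos P) → fromFin P (toFin P a) ≡ a
  from-to (wr s) _ = refl
  from-to mvR _ = refl
  from-to mvL _ = refl
  from-to (P ⨾ Q) (inj₁ a) rewrite splitAt-↑ˡ (size P) (toFin P a) (size Q) = cong inj₁ (from-to P a)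
  from-to (P ⨾ Q) (inj₂ b) rewrite splitAt-↑ʳ (size P) (size Q) (toFin Q b) = cong inj₂ (from-to Q b)
  from-to (ifS c P Q) (inj₁ _) = refl
  from-to (ifS c P Q) (inj₂ (inj₁ a)) rewrite splitAt-↑ˡ (size P) (toFin P a) (size Q) =
    cong (λ x → inj₂ (inj₁ x)) (from-to P a)
  from-to (ifS c P Q) (inj₂ (inj₂ b)) rewrite splitAt-↑ʳ (size P) (size Q) (toFin Q b) =
    cong (λ x → inj₂ (inj₂ x)) (from-to Q b)
  from-to (while c P) (inj₁ _) = refl
  from-to (while c P) (inj₂ a) = cong inj₂ (from-to P a)

  -- State `zero` is the only halting state; leaving the whole program leads there.
  state : (P : Prog) → Maybe (Pos P) → Fin (suc (size P))
  state P = next (λ a → suc (toFin P a)) zero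

  δM : (P : Prog) → Fin (suc (size P)) → Sym → Maybe (Fin (suc (size P)) × Sym × Move)
  δM P zero    h = nothing
  δM P (suc i) h = just (state P (proj₁ (δP P (fromFin P i) h)) , proj₂ (δP P (fromFin P i) h))

  machine : Prog → TM
  machine P = record { States = suc (size P) ; start = suc (toFin P (entry P)) ; δ = δM P }

  nth : List Sym → ℕ → Sym
  nth []      _       = blank
  nth (x ∷ l) zero    = x
  nth (x ∷ l) (suc i) = nth l i

  leftOf : Tape → ℕ → ℕ → Sym
  leftOf τ zero    i       = blank
  leftOf τ (suc p) zero    = τ p
  leftOf τ (suc p) (suc i) = leftOf τ p i

  -- The lists are compared with the tape through `nth`, which pads with blanks. Thus it does not
  -- matter how many trailing blanks a configuration has already materialised.
  record Holds (τ : Tape) (p : ℕ) (l : List Sym) (h : Sym) (r : List Sym) : Set where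
    constructor holds
    field
      atL : ∀ i → nth l i ≡ leftOf τ p i
      atH : h ≡ τ p
      atR : ∀ i → nth r i ≡ τ (suc p + i)

  ≡ᵇ-refl : ∀ n → (n ≡ᵇ n) ≡ true
  ≡ᵇ-refl zero    = refl
  ≡ᵇ-refl (suc n) = ≡ᵇ-refl n

  <⇒≢ᵇ : ∀ {m n} → m < n → (m ≡ᵇ n) ≡ false
  <⇒≢ᵇ {zero} (s≤s _) = refl
  <⇒≢ᵇ {suc m} (s≤s l) = <⇒≢ᵇ l

  >⇒≢ᵇ : ∀ {m n} → n < m → (m ≡ᵇ n) ≡ false
  >⇒≢ᵇ {n = zero} (s≤s _) = refl
  >⇒≢ᵇ {n = suc n} (s≤s l) = >⇒≢ᵇ l

  upd-same : ∀ τ p s → upd τ p s p ≡ s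
  upd-same τ p s rewrite ≡ᵇ-refl p = refl

  upd-other : ∀ τ p s {i} → (i ≡ᵇ p) ≡ false → upd τ p s i ≡ τ i
  upd-other τ p s e rewrite e = refl

  open import Data.Nat.Properties using (m≤m+n)

  leftOf-upd : ∀ τ p q s i → p ≤ q → leftOf (upd τ q s) p i ≡ leftOf τ p i
  leftOf-upd τ zero q s i le = refl
  leftOf-upd τ (suc p) q s zero le = upd-other τ q s (<⇒≢ᵇ le)
  leftOf-upd τ (suc p) q s (suc i) le = leftOf-upd τ p q s i (≤-trans (m≤m+n p 1) (≤-trans (≤-reflexive (lem p)) le))
    where
      open import Data.Nat.Properties using (+-comm)
      lem : ∀ p → p + 1 ≡ suc p
      lem p = +-comm p 1

  holds-wr : ∀ {τ p l h r} s → Holds τ p l h r → Holds (upd τ p s) p l s r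
  holds-wr {τ} {p} s (holds a b c) =
    holds (λ i → trans (a i) (sym (leftOf-upd τ p p s i ≤-refl)))
          (sym (upd-same τ p s))
          (λ i → trans (c i) (sym (upd-other τ p s (>⇒≢ᵇ (s≤s (m≤m+n p i))))))

  module _ (P : Prog) where

    open import Data.Nat.Properties using (+-suc; +-identityʳ)

    M : TM
    M = machine P

    stepConf : Config M → Maybe (Config M)
    stepConf (conf q l h r) with TM.δ M q h
    ... | nothing           = nothing
    ... | just (q' , s , m) = just (moveHead {M} q' l s r m)

    data Steps : ℕ → Config M → Config M → Set where
      done : ∀ {c} → Steps 0 c c
      more : ∀ {n c c₁ c₂} → stepConf c ≡ just c₁ → Steps n c₁ c₂ → Steps (suc n) c c₂

    steps-++ : ∀ {m n c c₁ c₂} → Steps m c c₁ → Steps n c₁ c₂ → Steps (m + n) c c₂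
    steps-++ done t = t
    steps-++ (more e s) t = more e (steps-++ s t)

    run-steps : ∀ {n fuel c l h r} → Steps n c (conf zero l h r) → n ≤ fuel → run M fuel c ≡ just (conf zero l h r)
    run-steps {fuel = zero} done le = refl
    run-steps {fuel = suc _} done le = refl
    run-steps {fuel = suc f} {c = conf (suc i) l₁ h₁ r₁} (more refl s) (s≤s le) = run-steps s le

    Rep : Maybe (Pos P) → Tape → ℕ → Config M → Set
    Rep a τ p (conf q l h r) = (q ≡ state P a) × Holds τ p l h r

    applyMove : Move → ℕ → ℕ → Set
    applyMove S p p' = p ≡ p'
    applyMove R p p' = suc p ≡ p'
    applyMove L p p' = p ≡ suc p'

    one-step : ∀ {a τ p c b s m p'} → Rep (just a) τ p c → δP P a (τ p) ≡ (b , s , m) →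
               applyMove m p p' → Σ (Config M) λ c' → (stepConf c ≡ just c') × Rep b (upd τ p s) p' c'
    one-step {a} {τ} {p} {conf q l h r} {b} {s} {m} {p'} (refl , H) e am
      with holds-wr s H | Holds.atH H
    ... | H' | refl rewrite from-to P a | e = _ , refl , moved m am l r H'
      where
        moved : ∀ m → applyMove m p p' → ∀ l r → Holds (upd τ p s) p l s r →
                Rep b (upd τ p s) p' (moveHead {M} (state P b) l s r m)
        moved S refl [] [] H = refl , H
        moved S refl [] (x ∷ r) H = refl , H
        moved S refl (x ∷ l) [] H = refl , H
        moved S refl (x ∷ l) (y ∷ r) H = refl , H
        moved R refl [] [] (holds a b c) =
          refl , holds (λ { zero → b ; (suc i) → a i })
                       (trans (c 0) (cong (λ z → upd τ p s (suc z)) (+-identityʳ p)))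
                       (λ i → trans (c (suc i)) (cong (λ z → upd τ p s (suc z)) (+-suc p i)))
        moved R refl [] (y ∷ r) (holds a b c) =
          refl , holds (λ { zero → b ; (suc i) → a i })
                       (trans (c 0) (cong (λ z → upd τ p s (suc z)) (+-identityʳ p)))
                       (λ i → trans (c (suc i)) (cong (λ z → upd τ p s (suc z)) (+-suc p i)))
        moved R refl (x ∷ l) [] (holds a b c) =
          refl , holds (λ { zero → b ; (suc i) → a i })
                       (trans (c 0) (cong (λ z → upd τ p s (suc z)) (+-identityʳ p)))
                       (λ i → trans (c (suc i)) (cong (λ z → upd τ p s (suc z)) (+-suc p i)))
        moved R refl (x ∷ l) (y ∷ r) (holds a b c) =
          refl , holds (λ { zero → b ; (suc i) → a i })
                       (trans (c 0) (cong (λ z → upd τ p s (suc z)) (+-identityʳ p)))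
                       (λ i → trans (c (suc i)) (cong (λ z → upd τ p s (suc z)) (+-suc p i)))
        moved L refl [] r (holds a b c) =
          refl , holds (λ i → a (suc i)) (a 0)
            (λ { zero → trans b (cong (λ z → upd τ p s (suc z)) (sym (+-identityʳ p')))
               ; (suc i) → trans (c i) (cong (λ z → upd τ p s (suc z)) (sym (+-suc p' i))) })
        moved L refl (x ∷ l) r (holds a b c) =
          refl , holds (λ i → a (suc i)) (a 0)
            (λ { zero → trans b (cong (λ z → upd τ p s (suc z)) (sym (+-identityʳ p')))
               ; (suc i) → trans (c i) (cong (λ z → upd τ p s (suc z)) (sym (+-suc p' i))) })

    holds-ext : ∀ {τ τ' p l h r} → (∀ i → τ i ≡ τ' i) → Holds τ p l h r → Holds τ' p l h r
    holds-ext {p = p} e (holds a b c) =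
      holds (λ i → trans (a i) (leftOf-ext p i)) (trans b (e p)) (λ i → trans (c i) (e _))
      where
        leftOf-ext : ∀ p i → leftOf _ p i ≡ leftOf _ p i
        leftOf-ext zero    i       = refl
        leftOf-ext (suc p) zero    = e p
        leftOf-ext (suc p) (suc i) = leftOf-ext p i

    upd-id : ∀ τ p i → upd τ p (τ p) i ≡ τ i
    upd-id τ p i with i ≡ᵇ p in e
    ... | false = refl
    ... | true  = cong τ (sym (≡ᵇ⇒≡ i p (subst T (sym e) tt)))
      where
        open import Data.Nat.Properties using (≡ᵇ⇒≡)
        open import Data.Bool using (T)

    still-step : ∀ {a τ p c b m p'} → Rep (just a) τ p c → δP P a (τ p) ≡ (b , τ p , m) →
                 applyMove m p p' → Σ (Config M) λ c' → (stepConf c ≡ just c') × Rep b τ p' c'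
    still-step {τ = τ} {p} {conf _ _ _ _} ρ e am with one-step ρ e am
    ... | conf q l h r , s , (eq , H) = conf q l h r , s , (eq , holds-ext (upd-id τ p) H)

    -- A subprogram Q of P, located by its control points and the point reached on leaving it.
    record Inside (Q : Prog) (emb : Pos Q → Pos P) (exit : Maybe (Pos P)) : Set where
      field
        commutes : ∀ a h → δP P (emb a) h ≡ (next (λ x → just (emb x)) exit (proj₁ (δP Q a h)) , proj₂ (δP Q a h))

    open Inside

    Goes : Pos P → Maybe (Pos P) → Tape → ℕ → Tape → ℕ → ℕ → Set
    Goes a b τ p τ' p' t = ∀ c → Rep (just a) τ p c →
      Σ ℕ λ n → (n ≤ t) × Σ (Config M) λ c' → Steps n c c' × Rep b τ' p' c'

    -- Generalised over the embedding and the exit, so that the induction on the derivation can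
    -- descend into subprograms: the exit of the first half of a sequence is the entry of the
    -- second, and the exit of a loop body is the test of the loop.
    exec-steps : ∀ {Q emb exit τ p τ' p' t} → Inside Q emb exit → Exec Q τ p τ' p' t →
                 Goes (emb (entry Q)) exit τ p τ' p' t
    exec-steps I xwr c ρ =
      let (c' , s , ρ') = one-step ρ (commutes I tt _) refl in 1 , ≤-refl , c' , more s done , ρ'
    exec-steps I xR c ρ =
      let (c' , s , ρ') = still-step ρ (commutes I tt _) refl in 1 , ≤-refl , c' , more s done , ρ'
    exec-steps I xL c ρ =
      let (c' , s , ρ') = still-step ρ (commutes I tt _) refl in 1 , ≤-refl , c' , more s done , ρ'
    exec-steps {P₁ ⨾ P₂} {emb} I (xseq e₁ e₂) c ρ =
      let (n₁ , l₁ , c₁ , s₁ , ρ₁) = exec-steps {emb = λ a → emb (inj₁ a)} {exit = just (emb (inj₂ (entry P₂)))} I₁ e₁ c ρ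
          (n₂ , l₂ , c₂ , s₂ , ρ₂) = exec-steps {emb = λ a → emb (inj₂ a)} I₂ e₂ c₁ ρ₁
      in n₁ + n₂ , +-mono-≤ l₁ l₂ , c₂ , steps-++ s₁ s₂ , ρ₂
      where
        I₁ : Inside P₁ (λ a → emb (inj₁ a)) (just (emb (inj₂ (entry P₂))))
        commutes I₁ a h with δP P₁ a h | commutes I (inj₁ a) h
        ... | just x  , _ | e = e
        ... | nothing , _ | e = e
        I₂ : Inside P₂ (λ a → emb (inj₂ a)) _
        commutes I₂ a h with δP P₂ a h | commutes I (inj₂ a) h
        ... | just x  , _ | e = e
        ... | nothing , _ | e = e
    exec-steps {ifS d P₁ P₂} {emb} {τ = τ} {p} I (xift b e₁) c ρ =
      let (c₀ , s₀ , ρ₀) = still-step ρ ent refl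
          (n₁ , l₁ , c₁ , s₁ , ρ₁) = exec-steps {emb = λ a → emb (inj₂ (inj₁ a))} I₁ e₁ c₀ ρ₀
      in suc n₁ , s≤s l₁ , c₁ , more s₀ s₁ , ρ₁
      where
        ent : δP P (emb (inj₁ tt)) (τ p) ≡ (just (emb (inj₂ (inj₁ (entry P₁)))) , τ p , S)
        ent with commutes I (inj₁ tt) (τ p)
        ... | q rewrite b = q
        I₁ : Inside P₁ (λ a → emb (inj₂ (inj₁ a))) _
        commutes I₁ a h with δP P₁ a h | commutes I (inj₂ (inj₁ a)) h
        ... | just x  , _ | e = e
        ... | nothing , _ | e = e
    exec-steps {ifS d P₁ P₂} {emb} {τ = τ} {p} I (xiff b e₁) c ρ =
      let (c₀ , s₀ , ρ₀) = still-step ρ ent refl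
          (n₁ , l₁ , c₁ , s₁ , ρ₁) = exec-steps {emb = λ a → emb (inj₂ (inj₂ a))} I₁ e₁ c₀ ρ₀
      in suc n₁ , s≤s l₁ , c₁ , more s₀ s₁ , ρ₁
      where
        ent : δP P (emb (inj₁ tt)) (τ p) ≡ (just (emb (inj₂ (inj₂ (entry P₂)))) , τ p , S)
        ent with commutes I (inj₁ tt) (τ p)
        ... | q rewrite b = q
        I₁ : Inside P₂ (λ a → emb (inj₂ (inj₂ a))) _
        commutes I₁ a h with δP P₂ a h | commutes I (inj₂ (inj₂ a)) h
        ... | just x  , _ | e = e
        ... | nothing , _ | e = e
    exec-steps {while d P₁} {emb} {exit} {τ = τ} {p} I (xwhf b) c ρ =
      let (c₀ , s₀ , ρ₀) = still-step ρ ent refl in 1 , ≤-refl , c₀ , more s₀ done , ρ₀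
      where
        ent : δP P (emb (inj₁ tt)) (τ p) ≡ (exit , τ p , S)
        ent with commutes I (inj₁ tt) (τ p)
        ... | q rewrite b = q
    exec-steps {while d P₁} {emb} {exit} {τ = τ} {p} I (xwht b e₁ e₂) c ρ =
      let (c₀ , s₀ , ρ₀) = still-step ρ ent refl
          (n₁ , l₁ , c₁ , s₁ , ρ₁) = exec-steps {emb = λ a → emb (inj₂ a)} I₁ e₁ c₀ ρ₀
          (n₂ , l₂ , c₂ , s₂ , ρ₂) = exec-steps {emb = emb} I e₂ c₁ ρ₁
      in suc (n₁ + n₂) , s≤s (+-mono-≤ l₁ l₂) , c₂ , more s₀ (steps-++ s₁ s₂) , ρ₂
      where
        ent : δP P (emb (inj₁ tt)) (τ p) ≡ (just (emb (inj₂ (entry P₁))) , τ p , S)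
        ent with commutes I (inj₁ tt) (τ p)
        ... | q rewrite b = q
        I₁ : Inside P₁ (λ a → emb (inj₂ a)) (just (emb (inj₁ tt)))
        commutes I₁ a h with δP P₁ a h | commutes I (inj₂ a) h
        ... | just x  , _ | e = e
        ... | nothing , _ | e = e
    exec-steps I (xwk le e) c ρ =
      let (n , l , rest) = exec-steps I e c ρ in n , ≤-trans l le , rest

    whole : Inside P (λ a → a) nothing
    commutes whole a h with δP P a h
    ... | just x  , _ = refl
    ... | nothing , _ = refl

  open import Defs using (initial; HaltsWith; readOut; o0; o1; lb; rb)

  inputTape : List Sym → Tape
  inputTape w zero    = blank
  inputTape w (suc i) = nth w i

  OutAt : Tape → ℕ → List Sym → Set
  OutAt τ p []      = τ p ≡ blank
  OutAt τ p (s ∷ l) = τ p ≡ s × (s ≡ blank → ⊥) × OutAt τ (suc p) l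

  readOut-correct : ∀ τ out l p → (∀ i → nth l i ≡ τ (p + i)) → OutAt τ p out → readOut l ≡ out
  readOut-correct τ out l p e O = go out l p e O
    where
      open import Data.Empty using (⊥-elim)
      open import Data.Nat.Properties using (+-identityʳ; +-suc)
      e0 : ∀ {l} p → (∀ i → nth l i ≡ τ (p + i)) → nth l 0 ≡ τ p
      e0 p e = trans (e 0) (cong τ (+-identityʳ p))
      es : ∀ {x l} p → (∀ i → nth (x ∷ l) i ≡ τ (p + i)) → ∀ i → nth l i ≡ τ (suc p + i)
      es p e i = trans (e (suc i)) (cong τ (+-suc p i))
      read-cons : ∀ s l → (s ≡ blank → ⊥) → readOut (s ∷ l) ≡ s ∷ readOut l
      read-cons blank l n = ⊥-elim (n refl)
      read-cons o0 l n = refl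
      read-cons o1 l n = refl
      read-cons lb l n = refl
      read-cons rb l n = refl
      go : ∀ out l p → (∀ i → nth l i ≡ τ (p + i)) → OutAt τ p out → readOut l ≡ out
      go [] [] p e O = refl
      go [] (x ∷ l) p e O with trans (e0 {x ∷ l} p e) O
      ... | refl = refl
      go (s ∷ out) [] p e (a , n , O) = ⊥-elim (n (sym (trans (e0 {[]} p e) a)))
      go (s ∷ out) (x ∷ l) p e (a , n , O) with trans (e0 {x ∷ l} p e) a
      ... | refl = trans (read-cons x l n) (cong (x ∷_) (go out l (suc p) (es p e) O))

  exec-halts : ∀ {P s w τ p T out} → Exec P (inputTape (s ∷ w)) 1 τ p T → OutAt τ p out →
               HaltsWith (machine P) T (s ∷ w) out
  exec-halts {P} {s} {w} {τ} {p} E O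
    with exec-steps P (whole P) E (initial (machine P) (s ∷ w))
           (refl , holds (λ { zero → refl ; (suc i) → refl }) refl (λ i → refl))
  ... | n , le , conf q l h r , st , (refl , holds a b c) =
    conf zero l h r , run-steps P st le , readOut-correct τ _ (h ∷ r) p (λ { zero → trans b (cong τ (sym (+-identityʳ p))) ; (suc i) → trans (c i) (cong τ (sym (+-suc p i))) }) O
    where open import Data.Nat.Properties using (+-identityʳ; +-suc)

-- Variables as marks on the tracks of a tape of blocks.

module BlockTape where

  open import Defs using (Sym; blank; o0; o1; lb; rb)
  open TapeProgram
  open import Data.Nat using (ℕ; zero; suc; _+_; _*_; _≤_; _<_; z≤n; s≤s; _≡ᵇ_; pred)
  open import Data.Nat.Properties
  open import Data.Bool using (Bool; true; false; if_then_else_; _∧_; T)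
  open import Data.List using (List; _∷_)
  open import Data.Empty using (⊥; ⊥-elim)
  open import Data.Unit using (tt)
  open import Data.Product using (Σ; _×_; _,_; proj₁; proj₂)
  open import Relation.Nullary using (yes; no)
  open import Relation.Binary.PropositionalEquality using (_≡_; refl; sym; trans; cong; subst; _≢_)

  eqS : Sym → Sym → Bool
  eqS blank blank = true
  eqS o0 o0 = true
  eqS o1 o1 = true
  eqS lb lb = true
  eqS rb rb = true
  eqS _ _ = false

  nonB : Sym → Bool
  nonB blank = false
  nonB _     = true

  bit : Bool → Sym
  bit false = o0
  bit true  = o1

  nonB-bit : ∀ b → nonB (bit b) ≡ true
  nonB-bit false = refl
  nonB-bit true  = refl

  -- `mvR ⨾ mvL` serves as the idle program; in the opposite order it would have no execution at
  -- cell 0.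
  rights lefts : ℕ → Prog
  rights zero    = mvR ⨾ mvL
  rights (suc n) = rights n ⨾ mvR
  lefts zero    = mvR ⨾ mvL
  lefts (suc n) = mvL ⨾ lefts n

  at : ∀ {P τ p τ' p₁ p₂ t} → p₁ ≡ p₂ → Exec P τ p τ' p₁ t → Exec P τ p τ' p₂ t
  at refl e = e

  from : ∀ {P τ p₁ p₂ τ' p' t} → p₁ ≡ p₂ → Exec P τ p₁ τ' p' t → Exec P τ p₂ τ' p' t
  from refl e = e

  within : ∀ {P τ p τ' p' t₁ t₂} → t₁ ≡ t₂ → Exec P τ p τ' p' t₁ → Exec P τ p τ' p' t₂
  within refl e = e

  x-rights : ∀ n {τ p} → Exec (rights n) τ p τ (n + p) (2 + n)
  x-rights zero    = xseq xR xL
  x-rights (suc n) = within (+-comm (2 + n) 1) (xseq (x-rights n) xR)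

  x-lefts : ∀ n {τ p} → Exec (lefts n) τ (n + p) τ p (2 + n)
  x-lefts zero    = xseq xR xL
  x-lefts (suc n) = xseq xL (x-lefts n)

  x-scanR : ∀ d {τ p} → (∀ i → i < d → nonB (τ (i + p)) ≡ true) → nonB (τ (d + p)) ≡ false →
            Exec (while nonB mvR) τ p τ (d + p) (1 + 2 * d)
  x-scanR zero f e = xwhf e
  x-scanR (suc d) {τ} {p} f e =
    at (+-suc d p)
      (within (cong (λ z → suc (suc z)) (sym (+-suc d (d + 0))))
        (xwht (f 0 (s≤s z≤n)) xR
          (x-scanR d (λ i l → trans (cong (λ z → nonB (τ z)) (+-suc i p)) (f (suc i) (s≤s l)))
                     (trans (cong (λ z → nonB (τ z)) (+-suc d p)) e))))

  x-scanL : ∀ d {τ p} → (∀ i → i < d → nonB (τ (suc i + p)) ≡ true) → nonB (τ p) ≡ false →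
            Exec (while nonB mvL) τ (d + p) τ p (1 + 2 * d)
  x-scanL zero f e = xwhf e
  x-scanL (suc d) {τ} {p} f e =
    within (cong (λ z → suc (suc z)) (sym (+-suc d (d + 0))))
      (xwht (f d ≤-refl) xL (x-scanL d (λ i l → f i (m≤n⇒m≤1+n l)) e))

  module BlockPrograms (K : ℕ) where

    B : ℕ
    B = suc K

    home : Prog
    home = while nonB mvL ⨾ mvR

    find : ℕ → Prog
    find x = rights (suc x) ⨾ while (eqS o0) (rights B) ⨾ lefts (suc x)

    setbit : ℕ → Sym → Prog
    setbit x s = rights (suc x) ⨾ wr s ⨾ lefts (suc x)

    -- While `P` runs, track `x` carries no mark at all. `P` has to lead the head from the old block
    -- of `x` to the new one.
    moveTo : ℕ → Prog → Prog
    moveTo x P = setbit x o0 ⨾ P ⨾ setbit x o1 ⨾ home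

    -- Two tracks hold the same number exactly if the block marked by `x` is also marked by `y`, so
    -- an equality test is one look into that block.
    branch : ℕ → ℕ → Prog → Prog → Prog
    branch x y P Q = find x ⨾ rights (suc y) ⨾ ifS (eqS o1) (lefts (suc y) ⨾ P) (lefts (suc y) ⨾ Q)

    -- Tracks 0 and 1 are constants marking the last and the first block. Comparing with them makes
    -- both moves saturate at the ends of the tape.
    rightP leftP : ℕ → Prog
    rightP x = branch x 0 home (moveTo x (rights B))
    leftP x = branch x 1 home (moveTo x (lefts B))

    copyP : ℕ → ℕ → Prog
    copyP x y = find x ⨾ moveTo x (home ⨾ find y)

    branchEq : ℕ → ℕ → Prog → Prog → Prog
    branchEq x y P Q = branch x y (home ⨾ P) (home ⨾ Q)

    branchSym : ℕ → Sym → Prog → Prog → Prog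
    branchSym x s P Q = find x ⨾ ifS (eqS s) (home ⨾ P) (home ⨾ Q)

    whileNE : ℕ → Prog → Prog
    whileNE x P = find x ⨾ mvR ⨾ while (eqS o0) (mvL ⨾ home ⨾ P ⨾ find x ⨾ mvR) ⨾ mvL ⨾ home

    emit : Sym → Prog
    emit s = while nonB mvR ⨾ mvR ⨾ while nonB mvR ⨾ wr s ⨾ while nonB mvL ⨾ mvL ⨾ while nonB mvL ⨾ mvR

  -- A tape divided into N + 1 blocks, starting at cell suc b; block k consists of the symbol
  -- sy k followed by one mark cell for each of the K tracks.  The blocks are
  -- delimited by blanks, and the output is collected behind the last block.
  module Blocks (K N b : ℕ) (sy : ℕ → Sym) where

    open BlockPrograms K public

    blk : ℕ → ℕ
    blk zero    = suc b
    blk (suc k) = B + blk k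

    blk-mono : ∀ {k l} → k ≤ l → blk k ≤ blk l
    blk-mono {zero} {zero} z≤n = ≤-refl
    blk-mono {zero} {suc l} z≤n = ≤-trans (blk-mono {zero} {l} z≤n) (m≤n+m (blk l) B)
    blk-mono (s≤s le) = +-monoʳ-≤ B (blk-mono le)

    blk-inj : ∀ a c k l → a < B → c < B → a + blk k ≡ c + blk l → a ≡ c × k ≡ l
    blk-inj a c zero zero _ _ e = +-cancelʳ-≡ (suc b) a c e , refl
    blk-inj a c zero (suc l) la lc e = ⊥-elim (<⇒≢ lt e)
      where
        lt : a + suc b < c + (B + blk l)
        lt = ≤-trans (+-mono-≤ la (blk-mono {zero} {l} z≤n)) (m≤n+m (B + blk l) c)
    blk-inj a c (suc k) zero la lc e = ⊥-elim (<⇒≢ lt (sym e))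
      where
        lt : c + suc b < a + (B + blk k)
        lt = ≤-trans (+-mono-≤ lc (blk-mono {zero} {k} z≤n)) (m≤n+m (B + blk k) a)
    blk-inj a c (suc k) (suc l) la lc e =
      let (p , q) = blk-inj a c k l la lc (+-cancelˡ-≡ B (a + blk k) (c + blk l)
                      (trans (swap B a (blk k)) (trans e (sym (swap B c (blk l)))))) in p , cong suc q
      where
        swap : ∀ x y z → x + (y + z) ≡ y + (x + z)
        swap x y z = trans (sym (+-assoc x y z)) (trans (cong (_+ z) (+-comm x y)) (+-assoc y x z))

    Marks : Set
    Marks = ℕ → ℕ → Bool

    record Good (mk : Marks) (out : List Sym) (τ : Tape) : Set where
      field
        symC : ∀ k → k ≤ N → τ (blk k) ≡ sy k
        mkC  : ∀ k j → k ≤ N → j < K → τ (suc j + blk k) ≡ bit (mk j k)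
        nbC  : ∀ i → suc b ≤ i → i < blk (suc N) → nonB (τ i) ≡ true
        lbC  : nonB (τ b) ≡ false
        outC : ∀ i → τ (i + blk (suc N)) ≡ nth (blank ∷ out) i

    open Good public

    setm : Marks → ℕ → ℕ → Bool → Marks
    setm mk x k v j l = if (j ≡ᵇ x) ∧ (l ≡ᵇ k) then v else mk j l

    ≢⇒≡ᵇ : ∀ {m n} → m ≢ n → (m ≡ᵇ n) ≡ false
    ≢⇒≡ᵇ {m} {n} ne with m ≡ᵇ n in e
    ... | false = refl
    ... | true  = ⊥-elim (ne (≡ᵇ⇒≡ m n (subst T (sym e) tt)))

    ≡ᵇ-true : ∀ {m n} → (m ≡ᵇ n) ≡ true → m ≡ n
    ≡ᵇ-true {m} {n} e = ≡ᵇ⇒≡ m n (subst T (sym e) tt)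

    cell< : ∀ {x k} → x < K → k ≤ N → suc x + blk k < blk (suc N)
    cell< {x} {k} lx lk = +-mono-≤ {suc (suc x)} {B} (s≤s lx) (blk-mono lk)

    cell> : ∀ {x k} → suc b ≤ suc x + blk k
    cell> {x} {k} = ≤-trans (blk-mono {zero} {k} z≤n) (m≤n+m (blk k) (suc x))

    upd-good : ∀ {mk out τ x k} v → x < K → k ≤ N → Good mk out τ →
               Good (setm mk x k v) out (upd τ (suc x + blk k) (bit v))
    symC (upd-good {τ = τ} {x} {k} v lx lk g) l ll =
      trans (upd-other τ (suc x + blk k) (bit v) (≢⇒≡ᵇ (λ e → 1+n≢0 (sym (proj₁ (blk-inj 0 (suc x) l k (s≤s z≤n) (s≤s lx) e)))))) (symC g l ll)
    mkC (upd-good {mk} {τ = τ} {x} {k} v lx lk g) l j ll lj with j ≡ᵇ x in ej | l ≡ᵇ k in el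
    ... | true  | true  rewrite ≡ᵇ-true {j} ej | ≡ᵇ-true {l} el = upd-same τ (suc x + blk k) (bit v)
    ... | true  | false = trans (upd-other τ (suc x + blk k) (bit v) (≢⇒≡ᵇ (λ e →
            absurd el (proj₂ (blk-inj (suc j) (suc x) l k (s≤s lj) (s≤s lx) e))))) (mkC g l j ll lj)
      where
        absurd : ∀ {m n} → (m ≡ᵇ n) ≡ false → m ≡ n → ⊥
        absurd {m} e refl with trans (sym (≡ᵇ-refl m)) e
        ... | ()
    ... | false | _ = trans (upd-other τ (suc x + blk k) (bit v) (≢⇒≡ᵇ (λ e →
            absurd ej (suc-injective (proj₁ (blk-inj (suc j) (suc x) l k (s≤s lj) (s≤s lx) e)))))) (mkC g l j ll lj)
      where
        absurd : ∀ {m n} → (m ≡ᵇ n) ≡ false → m ≡ n → ⊥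
        absurd {m} e refl with trans (sym (≡ᵇ-refl m)) e
        ... | ()
    nbC (upd-good {τ = τ} {x} {k} v lx lk g) i l₁ l₂ with i ≡ᵇ suc x + blk k
    ... | true  = nonB-bit v
    ... | false = nbC g i l₁ l₂
    lbC (upd-good {τ = τ} {x} {k} v lx lk g) =
      trans (cong nonB (upd-other τ (suc x + blk k) (bit v) (<⇒≢ᵇ (cell> {x} {k})))) (lbC g)
    outC (upd-good {τ = τ} {x} {k} v lx lk g) i =
      trans (upd-other τ (suc x + blk k) (bit v) (>⇒≢ᵇ (≤-trans (cell< lx lk) (m≤n+m _ i)))) (outC g i)

    good-ext : ∀ {mk mk' out τ} → (∀ j k → mk j k ≡ mk' j k) → Good mk out τ → Good mk' out τ
    symC (good-ext e g) = symC g
    mkC (good-ext e g) k j lk lj = trans (mkC g k j lk lj) (cong bit (e j k))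
    nbC (good-ext e g) = nbC g
    lbC (good-ext e g) = lbC g
    outC (good-ext e g) = outC g

    hop : ℕ
    hop = 5 + B

    tHome tFind tSet : ℕ
    tHome = 1 + 2 * blk (suc N) + 1
    tFind = hop + (1 + N * hop + hop)
    tSet  = hop + (1 + hop)

    x-home : ∀ {mk out τ k} → Good mk out τ → k ≤ N → Exec home τ (blk k) τ (suc b) tHome
    x-home {τ = τ} {k} g lk =
      xwk (+-monoˡ-≤ 1 (+-monoʳ-≤ 1 (*-monoʳ-≤ 2 (≤-trans (m≤m+n d b) (≤-trans (≤-reflexive dk) (blk-mono (≤-trans lk (n≤1+n N))))))))
        (xseq (from dk (x-scanL d {τ} {b} nz (lbC g))) xR)
      where
        open import Data.Nat using (_∸_)
        d : ℕ
        d = blk k ∸ b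
        dk : d + b ≡ blk k
        dk = m∸n+n≡m (≤-trans (n≤1+n b) (blk-mono {zero} {k} z≤n))
        nz : ∀ i → i < d → nonB (τ (suc i + b)) ≡ true
        nz i l = nbC g (suc i + b) (s≤s (m≤n+m b i))
          (≤-trans (s≤s (≤-trans (+-monoˡ-≤ b l) (≤-reflexive dk))) (+-mono-≤ {1} {B} (s≤s z≤n) (blk-mono lk)))

    eqO0 : ∀ v → eqS o0 (bit v) ≡ (if v then false else true)
    eqO0 false = refl
    eqO0 true = refl

    x-find : ∀ {mk out τ x q} → Good mk out τ → x < K → q ≤ N →
             mk x q ≡ true → (∀ k → k < q → mk x k ≡ false) → Exec (find x) τ (suc b) τ (blk q) tFind
    x-find {mk} {out} {τ} {x} {q} g lx lq found before =
      xseq (xwk big (x-rights (suc x)))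
        (xseq (xwk (s≤s (*-monoˡ-≤ hop lq)) (loop q 0 (+-identityʳ q))) (xwk big (x-lefts (suc x))))
      where
        big : suc (suc (suc x)) ≤ hop
        big = s≤s (s≤s (≤-trans (≤-trans lx (n≤1+n K)) (m≤n+m B 3)))
        test : ∀ k → k ≤ N → eqS o0 (τ (suc x + blk k)) ≡ (if mk x k then false else true)
        test k lk = trans (cong (eqS o0) (mkC g k x lk lx)) (eqO0 (mk x k))
        step : ∀ k → B + (suc x + blk k) ≡ suc x + blk (suc k)
        step k = trans (sym (+-assoc B (suc x) (blk k))) (trans (cong (_+ blk k) (+-comm B (suc x))) (+-assoc (suc x) B (blk k)))
        loop : ∀ d k → d + k ≡ q → Exec (while (eqS o0) (rights B)) τ (suc x + blk k) τ (suc x + blk q) (1 + d * hop)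
        loop zero k refl = xwhf (trans (test k lq) (cong (λ v → if v then false else true) found))
        loop (suc d) k e =
          xwk (s≤s (≤-reflexive (sym (lem d))))
            (xwht (trans (test k (≤-trans (<⇒≤ k<q) lq)) (cong (λ v → if v then false else true) (before k k<q)))
              (at (step k) (xwk (m≤n+m (2 + B) 2) (x-rights B)))
              (loop d (suc k) (trans (+-suc d k) e)))
          where
            k<q : k < q
            k<q = ≤-trans (m≤n+m (suc k) d) (≤-reflexive (trans (+-suc d k) e))
            lem : ∀ d → hop + d * hop ≡ (4 + B) + (1 + d * hop)
            lem d = cong (λ z → suc (suc (suc (suc z)))) (sym (+-suc B (d * hop)))

    x-setbit : ∀ {τ x} k s → x < K → Exec (setbit x s) τ (blk k) (upd τ (suc x + blk k) s) (blk k) tSet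
    x-setbit {x = x} k s lx = xseq (xwk big (x-rights (suc x))) (xseq xwr (xwk big (x-lefts (suc x))))
      where
        big : suc (suc (suc x)) ≤ hop
        big = s≤s (s≤s (≤-trans (≤-trans lx (n≤1+n K)) (m≤n+m B 3)))

    -- Every track carries exactly one mark, so a block number for each track determines all marks.
    mkOf : (ℕ → ℕ) → Marks
    mkOf q j k = k ≡ᵇ q j

    set : (ℕ → ℕ) → ℕ → ℕ → ℕ → ℕ
    set q x v j = if j ≡ᵇ x then v else q j

    set-same : ∀ q x v → set q x v x ≡ v
    set-same q x v rewrite ≡ᵇ-refl x = refl

    set-other : ∀ q x v {j} → j ≢ x → set q x v j ≡ q j
    set-other q x v ne rewrite ≢⇒≡ᵇ ne = refl

    setm-set : ∀ q x v j k → setm (setm (mkOf q) x (q x) false) x v true j k ≡ mkOf (set q x v) j k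
    setm-set q x v j k with j ≡ᵇ x in e
    ... | false = refl
    ... | true with k ≡ᵇ v
    ...   | true = refl
    ...   | false with k ≡ᵇ q x in f
    ...     | true  = refl
    ...     | false rewrite ≡ᵇ-true {j} e = f

    St : (ℕ → ℕ) → List Sym → Tape → Set
    St q out τ = Good (mkOf q) out τ × (∀ j → j < K → q j ≤ N) × q 0 ≡ N × q 1 ≡ 0

    -- Between operations the head rests on the first block, which makes all operations composable
    -- without tracking head positions.
    Op : Prog → (ℕ → ℕ) → List Sym → (ℕ → ℕ) → List Sym → ℕ → Set
    Op P q out q' out' T = ∀ τ → St q out τ → Σ Tape λ τ' → Exec P τ (suc b) τ' (suc b) T × St q' out' τ'

    op-seq : ∀ {P Q q o q₁ o₁ q₂ o₂ t₁ t₂} → Op P q o q₁ o₁ t₁ → Op Q q₁ o₁ q₂ o₂ t₂ → Op (P ⨾ Q) q o q₂ o₂ (t₁ + t₂)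
    op-seq A C τ s = let (τ₁ , e₁ , s₁) = A τ s ; (τ₂ , e₂ , s₂) = C τ₁ s₁ in τ₂ , xseq e₁ e₂ , s₂

    op-wk : ∀ {P q o q' o' t t'} → t ≤ t' → Op P q o q' o' t → Op P q o q' o' t'
    op-wk le A τ s = let (τ₁ , e₁ , s₁) = A τ s in τ₁ , xwk le e₁ , s₁

    find-q : ∀ {q out τ x} → St q out τ → x < K → Exec (find x) τ (suc b) τ (blk (q x)) tFind
    find-q {q} {x = x} (g , le , _) lx = x-find g lx (le x lx) (≡ᵇ-refl (q x)) (λ k l → <⇒≢ᵇ l)

    st-set : ∀ {q out τ x v} → 2 ≤ x → v ≤ N → Good (mkOf (set q x v)) out τ → (∀ j → j < K → q j ≤ N) → q 0 ≡ N → q 1 ≡ 0 →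
             St (set q x v) out τ
    st-set {q} {x = x} {v} (s≤s (s≤s _)) lv g le e f = g , le' , e , f
      where
        le' : ∀ j → j < K → set q x v j ≤ N
        le' j lj with j ≡ᵇ x
        ... | true = lv
        ... | false = le j lj

    x-moveTo : ∀ {q out τ x v P t} → 2 ≤ x → x < K → v ≤ N → St q out τ →
               (∀ τ' → Good (setm (mkOf q) x (q x) false) out τ' → Exec P τ' (blk (q x)) τ' (blk v) t) →
               Σ Tape λ τ' → Exec (moveTo x P) τ (blk (q x)) τ' (suc b) (tSet + (t + (tSet + tHome))) × St (set q x v) out τ'
    x-moveTo {q} {out} {τ} {x} {v} x≥2 lx lv (g , le , e , f) h =
      _ , xseq (x-setbit (q x) o0 lx) (xseq (h _ g₁) (xseq (x-setbit v o1 lx) (x-home {k = v} g₂ lv))) ,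
      st-set x≥2 lv (good-ext (setm-set q x v) g₂) le e f
      where
        g₁ : Good (setm (mkOf q) x (q x) false) out (upd τ (suc x + blk (q x)) o0)
        g₁ = upd-good false lx (le x lx) g
        g₂ : Good (setm (setm (mkOf q) x (q x) false) x v true) out (upd (upd τ (suc x + blk (q x)) o0) (suc x + blk v) o1)
        g₂ = upd-good true lx lv g₁

    branchTime : ℕ → ℕ
    branchTime t = tFind + (hop + suc (hop + t))

    eqO1 : ∀ v → eqS o1 (bit v) ≡ v
    eqO1 false = refl
    eqO1 true = refl

    x-branch : ∀ {q out τ x y P Q t τ' p'} → St q out τ → x < K → y < K →
               (q x ≡ q y → Exec P τ (blk (q x)) τ' p' t) → (q x ≢ q y → Exec Q τ (blk (q x)) τ' p' t) →
               Exec (branch x y P Q) τ (suc b) τ' p' (branchTime t)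
    x-branch {q} {out} {τ} {x} {y} s@(g , le , _) lx ly hp hq with q x ≡ᵇ q y in e
    ... | true  = xseq (find-q s lx) (xseq (xwk big (x-rights (suc y)))
                    (xift (trans (cong (eqS o1) (mkC g (q x) y (le x lx) ly)) (trans (eqO1 _) e))
                      (xseq (xwk big (x-lefts (suc y))) (hp (≡ᵇ-true {q x} e)))))
      where
        big : suc (suc (suc y)) ≤ hop
        big = s≤s (s≤s (≤-trans (≤-trans ly (n≤1+n K)) (m≤n+m B 3)))
    ... | false = xseq (find-q s lx) (xseq (xwk big (x-rights (suc y)))
                    (xiff (trans (cong (eqS o1) (mkC g (q x) y (le x lx) ly)) (trans (eqO1 _) e))
                      (xseq (xwk big (x-lefts (suc y))) (hq λ eq → true≢false (trans (sym (trans (cong (_≡ᵇ q y) eq) (≡ᵇ-refl (q y)))) e)))))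
      where
        true≢false : true ≡ false → ⊥
        true≢false ()
        big : suc (suc (suc y)) ≤ hop
        big = s≤s (s≤s (≤-trans (≤-trans ly (n≤1+n K)) (m≤n+m B 3)))

    next-block prev-block : ℕ → ℕ
    next-block k = if k ≡ᵇ N then k else suc k
    prev-block = pred

    tIn tMove : ℕ
    tIn = tSet + (hop + tFind + tHome + (tSet + tHome))
    tMove = branchTime (tIn + tHome)

    op-right : ∀ {q out x} → 2 ≤ x → x < K → Op (rightP x) q out (set q x (next-block (q x))) out tMove
    op-right {q} {out} {x} x≥2 lx τ s@(g , le , e , f) with q x ≡ᵇ N in eq
    ... | true  = τ , x-branch s lx (≤-trans (s≤s z≤n) lx)
                        (λ _ → xwk (m≤n+m tHome tIn) (x-home g (le x lx)))
                        (λ ne → ⊥-elim (ne (trans (≡ᵇ-true {q x} eq) (sym e)))) ,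
                  (good-ext same g , le' , e' , f')
      where
        setq : ∀ j → set q x (q x) j ≡ q j
        setq j with j ≡ᵇ x in h
        ... | true rewrite ≡ᵇ-true {j} h = refl
        ... | false = refl
        same : ∀ j k → mkOf q j k ≡ mkOf (set q x (q x)) j k
        same j k = cong (k ≡ᵇ_) (sym (setq j))
        le' : ∀ j → j < K → set q x (q x) j ≤ N
        le' j lj = ≤-trans (≤-reflexive (setq j)) (le j lj)
        e' : set q x (q x) 0 ≡ N
        e' = trans (setq 0) e
        f' : set q x (q x) 1 ≡ 0
        f' = trans (setq 1) f
    ... | false =
      let (τ' , ex , s') = x-moveTo {v = suc (q x)} x≥2 lx lt s λ τ' g' → at mid (xwk {t' = hop + tFind + tHome} long (x-rights B))
      in τ' , x-branch s lx (≤-trans (s≤s z≤n) lx) (λ h → ⊥-elim (nope (trans h e))) (λ _ → xwk (m≤m+n _ tHome) ex) , s'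
      where
        mid : B + blk (q x) ≡ blk (suc (q x))
        mid = refl
        long : 2 + B ≤ hop + tFind + tHome
        long = ≤-trans (m≤n+m (2 + B) 3) (≤-trans (m≤m+n hop tFind) (m≤m+n (hop + tFind) tHome))
        nope : q x ≡ N → ⊥
        nope h with trans (sym (trans (cong (_≡ᵇ N) h) (≡ᵇ-refl N))) eq
        ... | ()
        lt : suc (q x) ≤ N
        lt = ≤∧≢⇒< (le x lx) nope

    op-left : ∀ {q out x} → 2 ≤ x → x < K → Op (leftP x) q out (set q x (prev-block (q x))) out tMove
    op-left {q} {out} {x} x≥2 lx τ s@(g , le , e , f) with q x in eq
    ... | zero  = τ , from-eq (x-branch s lx (≤-trans x≥2 (<⇒≤ lx))
                        (λ _ → xwk (m≤n+m tHome tIn) (x-home g (le x lx)))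
                        (λ ne → ⊥-elim (ne (trans eq (sym f))))) ,
                  (good-ext same g , le' , trans (setq 0) e , trans (setq 1) f)
      where
        from-eq : ∀ {P τ p τ' p' t} → Exec P τ p τ' p' t → Exec P τ p τ' p' t
        from-eq h = h
        setq : ∀ j → set q x zero j ≡ q j
        setq j with j ≡ᵇ x in h
        ... | true rewrite ≡ᵇ-true {j} h = sym eq
        ... | false = refl
        same : ∀ j k → mkOf q j k ≡ mkOf (set q x zero) j k
        same j k = cong (k ≡ᵇ_) (sym (setq j))
        le' : ∀ j → j < K → set q x zero j ≤ N
        le' j lj = ≤-trans (≤-reflexive (setq j)) (le j lj)
    ... | suc k =
      let (τ' , ex , s') = x-moveTo {v = k} x≥2 lx (≤-trans (≤-trans (n≤1+n k) (≤-reflexive (sym eq))) (le x lx)) s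
                             λ τ' g' → from (cong blk (sym eq)) (xwk {t' = hop + tFind + tHome} long (x-lefts B))
      in τ' , x-branch s lx (≤-trans x≥2 (<⇒≤ lx)) (λ h → ⊥-elim (1+n≢0 (trans (sym eq) (trans h f)))) (λ _ → xwk (m≤m+n _ tHome) ex) , s'
      where
        long : 2 + B ≤ hop + tFind + tHome
        long = ≤-trans (m≤n+m (2 + B) 3) (≤-trans (m≤m+n hop tFind) (m≤m+n (hop + tFind) tHome))

    tCopy : ℕ
    tCopy = tFind + (tSet + (tHome + tFind + (tSet + tHome)))

    -- The two tracks have to differ because the mark of `x` is already erased when `y` is sought.
    op-copy : ∀ {q out x y} → 2 ≤ x → x < K → y < K → x ≢ y → Op (copyP x y) q out (set q x (q y)) out tCopy
    op-copy {q} {out} {x} {y} x≥2 lx ly ne τ s@(g , le , e , f) =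
      let (τ' , ex , s') = x-moveTo {v = q y} x≥2 lx (le y ly) s λ τ' g' →
            xseq (x-home g' (le x lx)) (x-find g' ly (le y ly) (trans (un (q y)) (≡ᵇ-refl (q y))) (λ k l → trans (un k) (<⇒≢ᵇ l)))
      in τ' , xseq (find-q s lx) ex , s'
      where
        un : ∀ k → setm (mkOf q) x (q x) false y k ≡ mkOf q y k
        un k rewrite ≢⇒≡ᵇ {y} {x} (λ r → ne (sym r)) = refl

    op-branchEq : ∀ {q out x y P Q q' out' t} → x < K → y < K →
                  (q x ≡ q y → Op P q out q' out' t) → (q x ≢ q y → Op Q q out q' out' t) →
                  Op (branchEq x y P Q) q out q' out' (branchTime (tHome + t))
    op-branchEq {q} {x = x} {y} lx ly hp hq τ s@(g , le , _) with q x ≟ q y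
      where open import Data.Nat using (_≟_)
    ... | yes e = let (τ' , ex , s') = hp e τ s in
          τ' , x-branch s lx ly (λ _ → xseq (x-home g (le x lx)) ex) (λ n → ⊥-elim (n e)) , s'
    ... | no ne = let (τ' , ex , s') = hq ne τ s in
          τ' , x-branch s lx ly (λ e → ⊥-elim (ne e)) (λ _ → xseq (x-home g (le x lx)) ex) , s'

    op-branchSym : ∀ {q out x c P Q q' out' t} → x < K →
                   (eqS c (sy (q x)) ≡ true → Op P q out q' out' t) → (eqS c (sy (q x)) ≡ false → Op Q q out q' out' t) →
                   Op (branchSym x c P Q) q out q' out' (tFind + suc (tHome + t))
    op-branchSym {q} {x = x} {c} lx hp hq τ s@(g , le , _) with eqS c (sy (q x)) in e
    ... | true = let (τ' , ex , s') = hp refl τ s in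
          τ' , xseq (find-q s lx) (xift (trans (cong (eqS c) (symC g (q x) (le x lx))) e) (xseq (x-home g (le x lx)) ex)) , s'
    ... | false = let (τ' , ex , s') = hq refl τ s in
          τ' , xseq (find-q s lx) (xiff (trans (cong (eqS c) (symC g (q x) (le x lx))) e) (xseq (x-home g (le x lx)) ex)) , s'

    tBody : ℕ → ℕ
    tBody t = suc (1 + (tHome + (t + (tFind + 1))))

    tWhile : ℕ → ℕ → ℕ
    tWhile n t = tFind + (1 + (1 + n * tBody t + (1 + tHome)))

    -- The block of track x counts the remaining rounds: the loop leaves when it reaches block N.
    op-while : ∀ {x P t} → x < K → (Inv : ℕ → (ℕ → ℕ) → List Sym → Set) →
               (∀ n q o → Inv (suc n) q o → Σ (ℕ → ℕ) λ q' → Σ (List Sym) λ o' → Op P q o q' o' t × Inv n q' o') →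
               (∀ n q o → Inv (suc n) q o → q x ≢ N) → (∀ q o → Inv 0 q o → q x ≡ N) →
               ∀ n q o → Inv n q o → Σ (ℕ → ℕ) λ q' → Σ (List Sym) λ o' →
               Op (whileNE x P) q o q' o' (tWhile n t) × Inv 0 q' o'
    op-while {x} {P} {t} lx Inv body going stop n q o i =
      let (q' , o' , op , i') = loop n q o i in
      q' , o' , (λ τ s → let (τ' , ex , s') = op τ s in
        τ' , xseq (find-q s lx) (xseq xR (xseq ex (xseq xL (x-home (proj₁ s') (proj₁ (proj₂ s') x lx))))) , s') , i'
      where
        W : Prog
        W = while (eqS o0) (mvL ⨾ home ⨾ P ⨾ find x ⨾ mvR)
        0<K : 0 < K
        0<K = ≤-trans (s≤s z≤n) lx
        test : ∀ {q o τ} → St q o τ → eqS o0 (τ (1 + blk (q x))) ≡ (if q x ≡ᵇ N then false else true)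
        test {q} (g , le , e , _) = trans (cong (eqS o0) (mkC g (q x) 0 (le x lx) 0<K)) (trans (eqO0 _) (cong (λ z → if q x ≡ᵇ z then false else true) e))
        loop : ∀ n q o → Inv n q o → Σ (ℕ → ℕ) λ q' → Σ (List Sym) λ o' →
               (∀ τ → St q o τ → Σ Tape λ τ' → Exec W τ (1 + blk (q x)) τ' (1 + blk (q' x)) (1 + n * tBody t) × St q' o' τ') × Inv 0 q' o'
        loop zero q o i = q , o , (λ τ s → τ , xwhf (trans (test s) (cong (λ z → if z then false else true) (trans (cong (_≡ᵇ N) (stop q o i)) (≡ᵇ-refl N)))) , s) , i
        loop (suc n) q o i =
          let (q₁ , o₁ , op , i₁) = body n q o i
              (q₂ , o₂ , lp , i₂) = loop n q₁ o₁ i₁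
          in q₂ , o₂ , (λ τ s → let (τ₁ , e₁ , s₁) = op τ s ; (τ₂ , e₂ , s₂) = lp τ₁ s₁ in
               τ₂ , xwk (s≤s (≤-reflexive (sym (+-suc-lem n)))) (xwht (trans (test s) (cong (λ z → if z then false else true) (≢⇒≡ᵇ (going n q o i))))
                      (xseq xL (xseq (x-home (proj₁ s) (proj₁ (proj₂ s) x lx)) (xseq e₁ (xseq (find-q s₁ lx) xR)))) e₂) , s₂) , i₂
          where
            +-suc-lem : ∀ n → tBody t + n * tBody t ≡ (1 + (tHome + (t + (tFind + 1)))) + (1 + n * tBody t)
            +-suc-lem n = sym (+-suc (1 + (tHome + (t + (tFind + 1)))) (n * tBody t))

-- Appending a symbol to the output behind the blocks.

module Emit where

  open import Defs using (Sym; blank)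
  open TapeProgram
  open BlockTape
  open import Data.Nat using (ℕ; zero; suc; _+_; _*_; _∸_; _≤_; _<_; z≤n; s≤s; _≡ᵇ_)
  open import Data.Nat.Properties
  open import Data.Bool using (true; false)
  open import Data.List using (List; []; _∷_; _++_; length)
  import Data.List.Properties as List
  open import Data.Empty using (⊥)
  open import Data.Unit using (⊤; tt)
  open import Data.Product using (_×_; _,_)
  open import Relation.Nullary using (yes; no)
  open import Relation.Binary.PropositionalEquality using (_≡_; refl; sym; trans; cong)

  NB : List Sym → Set
  NB []      = ⊤
  NB (s ∷ l) = nonB s ≡ true × NB l

  nb-++ : ∀ {l m} → NB l → NB m → NB (l ++ m)
  nb-++ {[]} a c = c
  nb-++ {_ ∷ l} (h , a) c = h , nb-++ {l} a c

  nb-nth : ∀ l i → NB l → i < length l → nonB (nth l i) ≡ true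
  nb-nth (s ∷ l) zero (h , _) _ = h
  nb-nth (s ∷ l) (suc i) (_ , a) (s≤s lt) = nb-nth l i a lt

  nth-shift : ∀ A {Z} i → nth (A ++ Z) (i + length A) ≡ nth Z i
  nth-shift [] {Z} i = cong (nth Z) (+-identityʳ i)
  nth-shift (x ∷ A) {Z} i = trans (cong (nth (x ∷ A ++ Z)) (+-suc i (length A))) (nth-shift A i)

  nth-left : ∀ X {Y} i → i < length X → nth (X ++ Y) i ≡ nth X i
  nth-left (x ∷ X) zero l = refl
  nth-left (x ∷ X) (suc i) (s≤s l) = nth-left X i l

  nth-end : ∀ X {Y} → nth (X ++ Y) (length X) ≡ nth Y 0
  nth-end [] = refl
  nth-end (x ∷ X) = nth-end X

  nth-beyond : ∀ X i → length X ≤ i → nth X i ≡ blank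
  nth-beyond [] i l = refl
  nth-beyond (x ∷ X) (suc i) (s≤s l) = nth-beyond X i l

  module Emission (K N b : ℕ) (sy : ℕ → Sym) where

    open Blocks K N b sy

    tEmit : ℕ → ℕ
    tEmit m = (1 + 2 * blk (suc N)) + (1 + ((1 + 2 * m) + (1 + ((1 + 2 * suc m) + (1 + ((1 + 2 * blk (suc N)) + 1))))))

    op-emit : ∀ {q out s m} → nonB s ≡ true → NB out → length out ≤ m → Op (emit s) q out q (out ++ s ∷ []) (tEmit m)
    op-emit {q} {out} {s} {m} ns nbo lm τ (g , rest) =
      τ' ,
      xseq (xwk (+-monoʳ-≤ 1 (*-monoʳ-≤ 2 (≤-trans (m≤m+n d₁ (suc b)) (≤-reflexive e₁)))) (at e₁ (x-scanR d₁ in-blocks sepB)))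
      (xseq xR
      (xseq (xwk (+-monoʳ-≤ 1 (*-monoʳ-≤ 2 lm)) (x-scanR (length out) out-cells out-end))
      (xseq xwr
      (xseq (xwk (+-monoʳ-≤ 1 (*-monoʳ-≤ 2 (s≤s lm))) (from (sym (+-suc (length out) sep)) (x-scanL (suc (length out)) back-out sepB')))
      (xseq (from e₂ xL)
      (xseq (xwk (+-monoʳ-≤ 1 (*-monoʳ-≤ 2 (≤-trans (m≤m+n d₂ b) (≤-trans (n≤1+n _) (≤-reflexive e₂))))) (x-scanL d₂ back-blocks left-end))
            xR)))))) ,
      (record { symC = λ k lk → trans (below (s≤s (≤-trans (blk-mono lk) (m≤n+m (blk N) K)))) (symC g k lk)
              ; mkC = λ k j lk lj → trans (below (cell< lj lk)) (mkC g k j lk lj)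
              ; nbC = λ i l₁ l₂ → trans (cong nonB (below l₂)) (nbC g i l₁ l₂)
              ; lbC = left-end
              ; outC = outC' } , rest)
      where
        sep p : ℕ
        sep = blk (suc N)
        p = length out + suc sep
        τ' : Tape
        τ' = upd τ p s
        below : ∀ {i} → i < sep → τ' i ≡ τ i
        below l = upd-other τ p s (<⇒≢ᵇ (≤-trans l (≤-trans (n≤1+n sep) (m≤n+m (suc sep) (length out)))))
        b<sep : b < sep
        b<sep = blk-mono {0} {suc N} z≤n
        d₁ d₂ : ℕ
        d₁ = sep ∸ suc b
        d₂ = K + blk N ∸ b
        e₁ : d₁ + suc b ≡ sep
        e₁ = m∸n+n≡m b<sep
        e₂ : suc (d₂ + b) ≡ sep
        e₂ = cong suc (m∸n+n≡m (≤-trans (≤-trans (n≤1+n b) (blk-mono {0} {N} z≤n)) (m≤n+m (blk N) K)))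
        in-blocks : ∀ i → i < d₁ → nonB (τ (i + suc b)) ≡ true
        in-blocks i l = nbC g _ (m≤n+m (suc b) i) (≤-trans (+-monoˡ-< (suc b) l) (≤-reflexive e₁))
        sepB : nonB (τ (d₁ + suc b)) ≡ false
        sepB = trans (cong (λ z → nonB (τ z)) e₁) (cong nonB (outC g 0))
        out-cells : ∀ i → i < length out → nonB (τ (i + suc sep)) ≡ true
        out-cells i l = trans (cong nonB (trans (cong τ (+-suc i sep)) (outC g (suc i)))) (nb-nth out i nbo l)
        out-end : nonB (τ (length out + suc sep)) ≡ false
        out-end = cong nonB (trans (cong τ (+-suc (length out) sep)) (trans (outC g (suc (length out))) (nth-beyond out (length out) ≤-refl)))
        out' : ∀ i → i ≤ length out → nth (out ++ s ∷ []) i ≡ τ' (suc i + sep)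
        out' i l with suc i + sep ≡ᵇ p in e
        ... | true = trans (cong (nth (out ++ s ∷ [])) (+-cancelʳ-≡ (suc sep) i (length out) (trans (+-suc i sep) (≡ᵇ-true e)))) (nth-end out)
        ... | false = trans (nth-left out i (≤∧≢⇒< l (λ r → lem (trans (sym (trans (cong (_≡ᵇ p) (trans (sym (+-suc i sep)) (cong (_+ suc sep) r))) (≡ᵇ-refl p))) e)))) (sym (outC g (suc i)))
          where
            lem : true ≡ false → ⊥
            lem ()
        outC' : ∀ i → τ' (i + sep) ≡ nth (blank ∷ out ++ s ∷ []) i
        outC' zero = trans (upd-other τ p s (<⇒≢ᵇ (m≤n+m (suc sep) (length out)))) (outC g 0)
        outC' (suc i) with i ≤? length out
        ... | yes l = sym (out' i l)
        ... | no nl = trans (upd-other τ p s (>⇒≢ᵇ (≤-trans (+-monoˡ-≤ (suc sep) (≰⇒> nl)) (≤-reflexive (+-suc i sep)))))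
                        (trans (outC g (suc i)) (trans (nth-beyond out i (<⇒≤ (≰⇒> nl)))
                          (sym (nth-beyond (out ++ s ∷ []) i (≤-trans (≤-reflexive (trans (List.length-++ out) (+-comm (length out) 1))) (≰⇒> nl))))))
        nb' : NB (out ++ s ∷ [])
        nb' = nb-++ {out} nbo (ns , tt)
        back-out : ∀ i → i < suc (length out) → nonB (τ' (suc i + sep)) ≡ true
        back-out i (s≤s l) = trans (cong nonB (sym (out' i l))) (nb-nth (out ++ s ∷ []) i nb' (≤-trans (s≤s l) (≤-reflexive (sym (trans (List.length-++ out) (+-comm (length out) 1))))))
        sepB' : nonB (τ' sep) ≡ false
        sepB' = cong nonB (outC' 0)
        back-blocks : ∀ i → i < d₂ → nonB (τ' (suc i + b)) ≡ true
        back-blocks i l = trans (cong nonB (below lt)) (nbC g _ (s≤s (m≤n+m b i)) lt)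
          where
            lt : suc i + b < sep
            lt = ≤-trans (s≤s (+-monoˡ-≤ b l)) (≤-reflexive e₂)
        left-end : nonB (τ' b) ≡ false
        left-end = trans (cong nonB (below b<sep)) (lbC g)

-- A small imperative language, its semantics and its compiler.

module Language where

  open import Defs using (Sym; rb)
  open TapeProgram
  open BlockTape
  open import Data.Nat using (ℕ; zero; suc; _+_; _*_; _∸_; _≤_; _<_; _<ᵇ_; pred; _⊔_)
  open import Data.Nat.Properties
  open import Data.Bool using (Bool; true; false; if_then_else_)
  open import Data.Fin using (Fin; zero; suc)
  open import Data.List using (List; []; _∷_; length)
  import Data.List.Properties as List
  open import Data.Vec using (Vec; []; _∷_; lookup; map; replicate; _[_]≔_) renaming (_++_ to _++ᵛ_)
  open import Relation.Binary.PropositionalEquality using (sym)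

  -- Values: a suffix of the input word, or a counter.
  data V : Set where
    cur : List Sym → V
    num : ℕ → V

  mutual
    data Cmd : ℕ → Set where
      skip : ∀ {k} → Cmd k
      _≔_  : ∀ {k} → Fin k → Exp k → Cmd k
      _▸_  : ∀ {k} → Cmd k → Cmd k → Cmd k
      ifz  : ∀ {k} → Fin k → Cmd k → Cmd k → Cmd k
      ifs  : ∀ {k} → Sym → Fin k → Cmd k → Cmd k → Cmd k
      loop : ∀ {k} → Fin k → Cmd k → Cmd k

    data Exp : ℕ → Set where
      zer  : ∀ {k} → Exp k
      var inc dec adv : ∀ {k} → Fin k → Exp k
      call : ∀ {k m} → Proc m → Vec (Fin k) m → Exp k

    -- A procedure with m parameters and l local variables, all of them initially 0.
    data Proc : ℕ → Set where
      proc : ∀ {m} (l : ℕ) → Cmd (m + l) → Fin (m + l) → Proc m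

  infix  6 _≔_
  infixr 5 _▸_

  iter : {A : Set} → (A → A) → ℕ → A → A
  iter g zero    a = a
  iter g (suc n) a = iter g n (g a)

  nthOr : Sym → List Sym → ℕ → Sym
  nthOr d []      _       = d
  nthOr d (x ∷ l) zero    = x
  nthOr d (x ∷ l) (suc i) = nthOr d l i

  -- Every input symbol is repeated eight times, so that counters may exceed the length of the input.
  expand : List Sym → List Sym
  expand []      = []
  expand (s ∷ w) = s ∷ s ∷ s ∷ s ∷ s ∷ s ∷ s ∷ s ∷ expand w

  headOr : Sym → List Sym → Sym
  headOr d []      = d
  headOr d (x ∷ l) = x

  module Semantics (w : List Sym) where

    cap : ℕ
    cap = length w * 8

    -- The number of blocks behind the marked one. A counter is stored as its distance from the last
    -- block, and a suffix as the first of the eight blocks of its head. Hence 0 and the empty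
    -- suffix are represented alike, and the test for either is a comparison with track 0.
    size' : V → ℕ
    size' (cur l) = length l * 8
    size' (num n) = n

    satSuc : ℕ → ℕ
    satSuc n = if n <ᵇ cap then suc n else n

    incV decV advV : V → V
    incV v = num (satSuc (size' v))
    decV v = num (pred (size' v))
    advV (cur [])      = cur []
    advV (cur (_ ∷ l)) = cur l
    advV (num n)       = num (n ∸ 8)

    isZ : V → Bool
    isZ (cur [])      = true
    isZ (cur (_ ∷ _)) = false
    isZ (num zero)    = true
    isZ (num (suc _)) = false

    -- A counter marks a block too, and that block bears a symbol. Giving it this meaning keeps
    -- semantics and tape in agreement without a typing discipline for variables.
    symbolAt : V → Sym
    symbolAt (cur l) = headOr rb l
    symbolAt (num n) = nthOr rb (expand w) (cap ∸ n)

    mutual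
      ⟦_⟧c : ∀ {k} → Cmd k → Vec V k → Vec V k
      ⟦ skip ⟧c ρ = ρ
      ⟦ x ≔ e ⟧c ρ = ρ [ x ]≔ ⟦ e ⟧e ρ
      ⟦ c ▸ d ⟧c ρ = ⟦ d ⟧c (⟦ c ⟧c ρ)
      ⟦ ifz x c d ⟧c ρ = if isZ (lookup ρ x) then ⟦ c ⟧c ρ else ⟦ d ⟧c ρ
      ⟦ ifs s x c d ⟧c ρ = if eqS s (symbolAt (lookup ρ x)) then ⟦ c ⟧c ρ else ⟦ d ⟧c ρ
      -- The number of rounds is fixed on entry. For a suffix it is eight per symbol, more than a
      -- scan needs, so loop bodies are written to be idle once their work is done.
      ⟦ loop x c ⟧c ρ = iter ⟦ c ⟧c (size' (lookup ρ x)) ρ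

      ⟦_⟧e : ∀ {k} → Exp k → Vec V k → V
      ⟦ zer ⟧e ρ = num 0
      ⟦ var x ⟧e ρ = lookup ρ x
      ⟦ inc x ⟧e ρ = incV (lookup ρ x)
      ⟦ dec x ⟧e ρ = decV (lookup ρ x)
      ⟦ adv x ⟧e ρ = advV (lookup ρ x)
      ⟦ call p xs ⟧e ρ = ⟦ p ⟧p (map (lookup ρ) xs)

      ⟦_⟧p : ∀ {m} → Proc m → Vec V m → V
      ⟦ proc l c r ⟧p vs = lookup (⟦ c ⟧c (vs ++ᵛ replicate l (num 0))) r

  mutual
    -- Calls are inlined and, `Proc` being inductive, cannot be recursive. The number of scratch
    -- tracks is therefore known when the program is compiled.
    spaceC : ∀ {k} → Cmd k → ℕ
    spaceC skip = 0
    spaceC (x ≔ e) = spaceE e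
    spaceC (c ▸ d) = spaceC c ⊔ spaceC d
    spaceC (ifz x c d) = spaceC c ⊔ spaceC d
    spaceC (ifs s x c d) = spaceC c ⊔ spaceC d
    spaceC (loop x c) = suc (spaceC c)

    spaceE : ∀ {k} → Exp k → ℕ
    spaceE (call (proc {m} l c r) xs) = (m + l) + spaceC c
    spaceE _ = 1

  tr : ∀ {k} → ℕ → Fin k → ℕ
  tr o zero    = o
  tr o (suc i) = tr (suc o) i

  tr≥ : ∀ {k} o (i : Fin k) → o ≤ tr o i
  tr≥ o zero    = ≤-refl
  tr≥ o (suc i) = ≤-trans (n≤1+n o) (tr≥ (suc o) i)

  tr< : ∀ {k} o (i : Fin k) → tr o i < o + k
  tr< {suc k} o zero    = ≤-trans (m≤m+n (suc o) k) (≤-reflexive (sym (+-suc o k)))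
  tr< {suc k} o (suc i) = ≤-trans (tr< (suc o) i) (≤-reflexive (sym (+-suc o k)))

  -- The track holding the value of a compiled expression. For a call it is the result variable
  -- inside the frame of the callee, which starts at `f`.
  loc : ∀ {k} → Exp k → ℕ → ℕ
  loc (call (proc l c r) xs) f = tr f r
  loc _ f = f

  module Compiler (K : ℕ) where

    open BlockPrograms K

    nop : Prog
    nop = mvR ⨾ mvL

    copies : ∀ {n} → Vec ℕ n → ℕ → Prog
    copies []       g = nop
    copies (s ∷ ss) g = copyP g s ⨾ copies ss (suc g)

    rightPs : ℕ → ℕ → Prog
    rightPs zero x = nop
    rightPs (suc n) x = rightP x ⨾ rightPs n x

    sources : ∀ {k m} → ℕ → Vec (Fin k) m → (l : ℕ) → Vec ℕ (m + l)
    sources o xs l = map (tr o) xs ++ᵛ replicate l 0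

    mutual
      -- The first number is the track of the first variable, the second the first free track.
      compC : ∀ {k} → Cmd k → ℕ → ℕ → Prog
      compC skip o f = nop
      compC (x ≔ e) o f = compE e o f ⨾ copyP (tr o x) (loc e f)
      compC (c ▸ d) o f = compC c o f ⨾ compC d o f
      compC (ifz x c d) o f = branchEq (tr o x) 0 (compC c o f) (compC d o f)
      compC (ifs s x c d) o f = branchSym (tr o x) s (compC c o f) (compC d o f)
      compC (loop x c) o f = copyP f (tr o x) ⨾ whileNE f (compC c o (suc f) ⨾ rightP f)

      compE : ∀ {k} → Exp k → ℕ → ℕ → Prog
      compE zer o f = copyP f 0
      compE (var x) o f = copyP f (tr o x)
      -- A counter is a distance from the last block, so it grows when its mark moves left.
      compE (inc x) o f = copyP f (tr o x) ⨾ leftP f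
      compE (dec x) o f = copyP f (tr o x) ⨾ rightP f
      compE (adv x) o f = copyP f (tr o x) ⨾ rightPs 8 f
      compE (call (proc {m} l c r) xs) o f = copies (sources o xs l) f ⨾ compC c f (f + (m + l))

  module Compile (K N b : ℕ) (sy : ℕ → Sym) where

    open Blocks K N b sy public
    open Compiler K public

    tCopies : ℕ → ℕ
    tCopies zero    = 2
    tCopies (suc n) = tCopy + tCopies n

    tRights : ℕ → ℕ
    tRights zero    = 2
    tRights (suc n) = tMove + tRights n

    mutual
      timeC : ∀ {k} → Cmd k → ℕ
      timeC skip = 2
      timeC (x ≔ e) = timeE e + tCopy
      timeC (c ▸ d) = timeC c + timeC d
      timeC (ifz x c d) = branchTime (tHome + (timeC c + timeC d))
      timeC (ifs s x c d) = tFind + suc (tHome + (timeC c + timeC d))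
      timeC (loop x c) = tCopy + tWhile N (timeC c + tMove)

      timeE : ∀ {k} → Exp k → ℕ
      timeE (call (proc {m} l c r) xs) = tCopies (m + l) + timeC c
      timeE (adv x) = tCopy + tRights 8
      timeE _ = tCopy + tMove

-- Spreading the input word over blocks.

module Init where

  open import Defs using (Sym; blank; o0; o1; lb; rb)
  open TapeProgram
  open BlockTape
  open Emit
  open Language using (nthOr; expand)
  open import Data.Nat using (ℕ; zero; suc; _+_; _*_; _∸_; _≤_; _<_; z≤n; s≤s; _≡ᵇ_)
  open import Data.Nat.Properties
  open import Data.Bool using (Bool; true; false; if_then_else_; not; _∧_; _∨_; T)
  open import Data.Bool.Properties using (∧-identityʳ; ∧-zeroʳ)
  open import Data.List using (List; []; _∷_; _++_; length; replicate)
  import Data.List.Properties as List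
  open import Data.Empty using (⊥; ⊥-elim)
  open import Data.Unit using (tt)
  open import Data.Product using (Σ; _×_; _,_; proj₁; proj₂)
  open import Relation.Binary.PropositionalEquality using (_≡_; refl; sym; trans; cong; cong₂; subst; _≢_)

  Tp : Tape → List Sym → Set
  Tp τ l = ∀ i → τ i ≡ nth l i

  tp-upd : ∀ {τ} A {x Z} s → Tp τ (A ++ x ∷ Z) → Tp (upd τ (length A) s) (A ++ s ∷ Z)
  tp-upd {τ} A {x} {Z} s t i with i ≡ᵇ length A in e
  ... | true  = trans (sym (nth-end A)) (cong (nth (A ++ s ∷ Z)) (sym (≡ᵇ⇒≡ i (length A) (subst T (sym e) tt))))
  ... | false = trans (t i) (lem A i e)
    where
      lem : ∀ A i → (i ≡ᵇ length A) ≡ false → nth (A ++ x ∷ Z) i ≡ nth (A ++ s ∷ Z) i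
      lem [] (suc i) e = refl
      lem (a ∷ A) zero e = refl
      lem (a ∷ A) (suc i) e = lem A i e

  tp-app : ∀ {τ} A s → Tp τ A → Tp (upd τ (length A) s) (A ++ s ∷ [])
  tp-app {τ} A s t = tp-upd A {blank} s (λ i → trans (t i) (lem A i))
    where
      lem : ∀ A i → nth A i ≡ nth (A ++ blank ∷ []) i
      lem [] zero = refl
      lem [] (suc i) = refl
      lem (a ∷ A) zero = refl
      lem (a ∷ A) (suc i) = lem A i

  tp-cast : ∀ {τ A A'} → A ≡ A' → Tp τ A → Tp τ A'
  tp-cast refl t = t

  scanR-list : ∀ {τ} A X Y → Tp τ (A ++ X ++ Y) → NB X → nth Y 0 ≡ blank →
               Exec (while nonB mvR) τ (length A) τ (length X + length A) (1 + 2 * length X)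
  scanR-list {τ} A X Y t nb e = x-scanR (length X)
    (λ i l → trans (cong nonB (trans (t _) (trans (nth-shift A i) (nth-left X i l)))) (nb-nth X i nb l))
    (cong nonB (trans (t _) (trans (nth-shift A (length X)) (trans (nth-end X) e))))

  scanL-list : ∀ {τ} A X Y → Tp τ (A ++ blank ∷ X ++ Y) → NB X →
               Exec (while nonB mvL) τ (length X + length A) τ (length A) (1 + 2 * length X)
  scanL-list {τ} A X Y t nb = x-scanL (length X)
    (λ i l → trans (cong nonB (trans (t _) (trans (nth-shift A (suc i)) (nth-left X i l)))) (nb-nth X i nb l))
    (cong nonB (trans (t _) (nth-end A)))

  writeL : List Sym → Prog
  writeL []       = mvR ⨾ mvL
  writeL (y ∷ ys) = wr y ⨾ mvR ⨾ writeL ys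

  x-writeL : ∀ ys {τ} A → Tp τ A → Σ Tape λ τ' → Exec (writeL ys) τ (length A) τ' (length ys + length A) (2 + 2 * length ys) × Tp τ' (A ++ ys)
  x-writeL [] {τ} A t = τ , xseq xR xL , tp-cast (sym (List.++-identityʳ A)) t
  x-writeL (y ∷ ys) A t =
    let (τ' , e , t') = x-writeL ys (A ++ y ∷ []) (tp-app A y t)
        len = trans (List.length-++ A) (+-comm (length A) 1)
    in τ' , within (cong (λ z → suc (suc z)) (sym (cong suc (+-suc (length ys) (length ys + 0)))))
              (xseq xwr (xseq xR (at (trans (cong (length ys +_) len) (+-suc (length ys) (length A))) (from len e)))) ,
       tp-cast (List.++-assoc A (y ∷ []) ys) t'

  blanks : ℕ → List Sym
  blanks n = replicate n blank

  blanks-snoc : ∀ n X → blanks n ++ blank ∷ X ≡ blanks (suc n) ++ X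
  blanks-snoc zero X = refl
  blanks-snoc (suc n) X = cong (blank ∷_) (blanks-snoc n X)

  len-blanks : ∀ n → length (blanks n) ≡ n
  len-blanks n = List.length-replicate n

  -- K = 3 + K' tracks: 0 marks the last block, 1 the first block, and 2 the input pointer.
  module Setup (K' : ℕ) where

    K B : ℕ
    K = 3 + K'
    B = suc K

    -- The last block represents 0, the initial value of all tracks from 3 on, and the constant of
    -- track 0. Tracks 1 and 2 are left unmarked here and receive their marks in the first block at
    -- the end of `init`. The symbol of this block, `rb`, is what reading past the end of the input
    -- yields.
    block endBlock : Sym → List Sym
    block s = s ∷ replicate K o0
    endBlock s = s ∷ o1 ∷ o0 ∷ o0 ∷ replicate K' o1

    chunk : Sym → List Sym
    chunk s = block s ++ block s ++ block s ++ block s ++ block s ++ block s ++ block s ++ block s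

    chunks : List Sym → List Sym
    chunks [] = []
    chunks (s ∷ w) = chunk s ++ chunks w

    nb-rep : ∀ n {s} → nonB s ≡ true → NB (replicate n s)
    nb-rep zero e = tt
    nb-rep (suc n) e = e , nb-rep n e

    nb-block : ∀ {s} → nonB s ≡ true → NB (block s)
    nb-block e = e , nb-rep K refl

    nb-chunk : ∀ {s} → nonB s ≡ true → NB (chunk s)
    nb-chunk {s} e = f (f (f (f (f (f (f n))))))
      where
        n : NB (block s)
        n = nb-block e
        f : ∀ {m} → NB m → NB (block s ++ m)
        f = nb-++ {block s} n

    nb-chunks : ∀ {w} → NB w → NB (chunks w)
    nb-chunks {[]} a = tt
    nb-chunks {s ∷ w} (e , a) = nb-++ {chunk s} (nb-chunk e) (nb-chunks {w} a)

    len-chunk : ∀ s → length (chunk s) ≡ 8 * B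
    len-chunk s = f (f (f (f (f (f (f (trans n (sym (+-identityʳ B)))))))))
      where
        n : length (block s) ≡ B
        n = cong suc (List.length-replicate K)
        f : ∀ {m k} → length m ≡ k → length (block s ++ m) ≡ B + k
        f e = trans (List.length-++ (block s)) (cong₂ _+_ n e)

    len-chunks : ∀ w → length (chunks w) ≡ length w * (8 * B)
    len-chunks [] = refl
    len-chunks (s ∷ w) = trans (List.length-++ (chunk s)) (cong₂ _+_ (len-chunk s) (len-chunks w))

    -- There is one copy for each symbol, since the symbol being spread is remembered by the control
    -- point alone. After the last input symbol the head comes to rest on an erased cell, and that
    -- blank ends the loop around `pieces`.
    piece : Sym → Prog
    piece s = wr blank ⨾ mvR ⨾ while nonB mvR ⨾ mvR ⨾ while nonB mvR ⨾ writeL (chunk s) ⨾ mvL ⨾ while nonB mvL ⨾ mvL ⨾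
              ifS nonB (while nonB mvL ⨾ mvR) (mvR ⨾ mvL)

    pieces : Prog
    pieces = ifS (eqS o0) (piece o0) (ifS (eqS o1) (piece o1) (ifS (eqS lb) (piece lb) (piece rb)))

    -- D: number of block cells written so far; m: length of the input still to be copied
    tPiece : ℕ → ℕ → ℕ
    tPiece D m = 1 + (1 + ((1 + 2 * m) + (1 + ((1 + 2 * D) + ((2 + 2 * (8 * B)) + (1 + ((1 + 2 * (8 * B + D)) + (1 + (1 + ((1 + 2 * m) + 2))))))))))

    x-piece : ∀ {τ} j s r ds → Tp τ (blanks (suc j) ++ (s ∷ r) ++ blank ∷ ds) → nonB s ≡ true → NB r → NB ds →
              Σ Tape λ τ' → Tp τ' (blanks (suc (suc j)) ++ r ++ blank ∷ (ds ++ chunk s)) ×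
              Σ ℕ λ p → (r ≡ [] → p ≡ suc j) × (r ≢ [] → p ≡ suc (suc j)) × Exec (piece s) τ (suc j) τ' p (tPiece (length ds) (length r))
    x-piece {τ} j s r ds t ns nr nd =
      τ₂ , t₂ , proj₁ last , proj₁ (proj₂ last) , proj₁ (proj₂ (proj₂ last)) ,
      xseq (at (len-blanks (suc j)) (from (len-blanks (suc j)) xwr))
      (xseq xR
      (xseq (from (len-blanks (suc (suc j))) (scanR-list (blanks (suc (suc j))) r (blanks-ds) t₁ nr refl))
      (xseq xR
      (xseq (from lenA (scanR-list A ds [] (tp-cast A-eq t₁) nd refl))
      (xseq (from lenAds (proj₁ (proj₂ wl)))
      (xseq (from e₅ xL)
      (xseq (xwk (≤-reflexive (cong (λ z → 1 + 2 * z) lenX)) (scanL-list A₀ X [] (tp-cast X-eq t₂) (nb-++ {ds} nd (nb-chunk ns))))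
      (xseq (from (sym lenA₀) xL) (proj₂ (proj₂ (proj₂ last)))))))))))
      where
        A A₀ X blanks-ds : List Sym
        blanks-ds = blank ∷ ds
        A₀ = blanks (suc (suc j)) ++ r
        A = A₀ ++ blank ∷ []
        X = ds ++ chunk s
        m D : ℕ
        m = length r
        D = length ds
        τ₁ : Tape
        τ₁ = upd τ (length (blanks (suc j))) blank
        t₁ : Tp τ₁ (blanks (suc (suc j)) ++ r ++ blank ∷ ds)
        t₁ = tp-cast (blanks-snoc (suc j) (r ++ blank ∷ ds)) (tp-upd (blanks (suc j)) blank t)
        A-eq : blanks (suc (suc j)) ++ r ++ blank ∷ ds ≡ A ++ ds ++ []
        A-eq = trans (sym (List.++-assoc (blanks (suc (suc j))) r (blank ∷ ds)))
                 (trans (cong (λ z → A₀ ++ blank ∷ z) (sym (List.++-identityʳ ds))) (sym (List.++-assoc A₀ (blank ∷ []) (ds ++ []))))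
        wl : Σ Tape λ τ' → Exec (writeL (chunk s)) τ₁ (length (A ++ ds)) τ' (length (chunk s) + length (A ++ ds)) (2 + 2 * (8 * B)) × Tp τ' ((A ++ ds) ++ chunk s)
        wl = subst (λ c → Σ Tape λ τ' → Exec (writeL (chunk s)) τ₁ (length (A ++ ds)) τ' (length (chunk s) + length (A ++ ds)) (2 + 2 * c) × Tp τ' ((A ++ ds) ++ chunk s))
               (len-chunk s) (x-writeL (chunk s) (A ++ ds) (tp-cast (trans A-eq (cong (A ++_) (List.++-identityʳ ds))) t₁))
        τ₂ : Tape
        τ₂ = proj₁ wl
        t₂ : Tp τ₂ (blanks (suc (suc j)) ++ r ++ blank ∷ (ds ++ chunk s))
        t₂ = tp-cast (trans (List.++-assoc A ds (chunk s)) (trans (List.++-assoc A₀ (blank ∷ []) X) (List.++-assoc (blanks (suc (suc j))) r (blank ∷ X)))) (proj₂ (proj₂ wl))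
        X-eq : blanks (suc (suc j)) ++ r ++ blank ∷ (ds ++ chunk s) ≡ A₀ ++ blank ∷ X ++ []
        X-eq = trans (sym (List.++-assoc (blanks (suc (suc j))) r (blank ∷ X))) (cong (λ z → A₀ ++ blank ∷ z) (sym (List.++-identityʳ X)))
        lenA₀' : length A₀ ≡ m + suc (suc j)
        lenA₀' = trans (List.length-++ (blanks (suc (suc j)))) (trans (cong (_+ m) (len-blanks (suc (suc j)))) (+-comm (suc (suc j)) m))
        lenA₀ : length A₀ ≡ suc (m + suc j)
        lenA₀ = trans lenA₀' (+-suc m (suc j))
        lenA : length A ≡ suc (m + length (blanks (suc (suc j))))
        lenA = trans (List.length-++ A₀) (trans (+-comm (length A₀) 1) (cong suc (trans lenA₀' (cong (m +_) (sym (len-blanks (suc (suc j))))))))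
        lenAds : length (A ++ ds) ≡ D + length A
        lenAds = trans (List.length-++ A) (+-comm (length A) D)
        lenX : length X ≡ 8 * B + D
        lenX = trans (List.length-++ ds) (trans (+-comm D (length (chunk s))) (cong (_+ D) (len-chunk s)))
        lenX' : length X ≡ length (chunk s) + D
        lenX' = trans (List.length-++ ds) (+-comm D (length (chunk s)))
        e₅ : suc (length X + length A₀) ≡ length (chunk s) + length (A ++ ds)
        e₅ = trans (cong suc (cong (_+ length A₀) lenX'))
               (trans (cong suc (+-assoc (length (chunk s)) D (length A₀)))
                 (trans (sym (+-suc (length (chunk s)) (D + length A₀)))
                   (cong (length (chunk s) +_) (trans (sym (+-suc D (length A₀))) (trans (cong (D +_) (sym (trans (List.length-++ A₀) (+-comm (length A₀) 1)))) (sym lenAds))))))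
        last : Σ ℕ λ p → (r ≡ [] → p ≡ suc j) × (r ≢ [] → p ≡ suc (suc j)) ×
               Exec (ifS nonB (while nonB mvL ⨾ mvR) (mvR ⨾ mvL)) τ₂ (m + suc j) τ₂ p (1 + ((1 + 2 * m) + 2))
        last = go r refl
          where
            go : ∀ r' → r' ≡ r → Σ ℕ λ p → (r ≡ [] → p ≡ suc j) × (r ≢ [] → p ≡ suc (suc j)) ×
               Exec (ifS nonB (while nonB mvL ⨾ mvR) (mvR ⨾ mvL)) τ₂ (m + suc j) τ₂ p (1 + ((1 + 2 * m) + 2))
            go [] refl = suc j , (λ _ → refl) , (λ n → ⊥-elim (n refl)) ,
              xiff (trans (cong nonB (t₂ (suc j))) (cong nonB (at-blank j))) (xwk (s≤s (s≤s z≤n)) (xseq xR xL))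
              where
                at-blank : ∀ j → nth (blanks (suc (suc j)) ++ blank ∷ (ds ++ chunk s)) (suc j) ≡ blank
                at-blank zero = refl
                at-blank (suc j) = at-blank j
            go (x ∷ r') refl = suc (suc j) , (λ ()) , (λ _ → refl) ,
              xift nz (xwk (+-monoʳ-≤ (1 + 2 * m) (s≤s z≤n)) (xseq (from (cong (m +_) (len-blanks (suc j))) (at (len-blanks (suc j)) scan)) xR))
              where
                t₃ : Tp τ₂ (blanks (suc j) ++ blank ∷ r ++ blank ∷ (ds ++ chunk s))
                t₃ = tp-cast (sym (blanks-snoc (suc j) (r ++ blank ∷ (ds ++ chunk s)))) t₂
                scan : Exec (while nonB mvL) τ₂ (m + length (blanks (suc j))) τ₂ (length (blanks (suc j))) (1 + 2 * m)
                scan = scanL-list (blanks (suc j)) r (blank ∷ (ds ++ chunk s)) t₃ nr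
                nz : nonB (τ₂ (m + suc j)) ≡ true
                nz = trans (cong nonB (trans (t₃ (m + suc j)) (trans (cong (λ z → nth (blanks (suc j) ++ blank ∷ r ++ blank ∷ (ds ++ chunk s)) (m + z)) (sym (len-blanks (suc j))))
                       (trans (nth-shift (blanks (suc j)) m) (nth-left r (length r') ≤-refl))))) (nb-nth r (length r') nr ≤-refl)

    x-pieces : ∀ {τ p τ' p' t} s → nonB s ≡ true → τ p ≡ s → Exec (piece s) τ p τ' p' t → Exec pieces τ p τ' p' (3 + t)
    x-pieces o0 n e x = xwk (m≤n+m _ 2) (xift (cong (eqS o0) e) x)
    x-pieces o1 n e x = xwk (m≤n+m _ 1) (xiff (cong (eqS o0) e) (xift (cong (eqS o1) e) x))
    x-pieces lb n e x = xiff (cong (eqS o0) e) (xiff (cong (eqS o1) e) (xift (cong (eqS lb) e) x))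
    x-pieces rb n e x = xiff (cong (eqS o0) e) (xiff (cong (eqS o1) e) (xiff (cong (eqS lb) e) x))

    tRound tLoop : ℕ → ℕ
    tRound n = suc (3 + tPiece (n * (8 * B)) n)
    tLoop n = 1 + n * tRound n

    nth-blanks : ∀ k X → nth (blanks (suc k) ++ X) k ≡ blank
    nth-blanks zero X = refl
    nth-blanks (suc k) X = nth-blanks k X

    tPiece-mono : ∀ {D D' m m'} → D ≤ D' → m ≤ m' → tPiece D m ≤ tPiece D' m'
    tPiece-mono a c = +-monoʳ-≤ 2 (+-mono-≤ (+-monoʳ-≤ 1 (*-monoʳ-≤ 2 c)) (+-monoʳ-≤ 1 (+-mono-≤ (+-monoʳ-≤ 1 (*-monoʳ-≤ 2 a))
      (+-monoʳ-≤ (2 + 2 * (8 * B)) (+-monoʳ-≤ 1 (+-mono-≤ (+-monoʳ-≤ 1 (*-monoʳ-≤ 2 (+-monoʳ-≤ (8 * B) a))) (+-monoʳ-≤ 2 (+-monoˡ-≤ 2 (+-monoʳ-≤ 1 (*-monoʳ-≤ 2 c)))))))))) 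

    x-loop : ∀ n {τ} j r ds p → Tp τ (blanks (suc j) ++ r ++ blank ∷ ds) → NB r → NB ds → (r ≡ [] → p ≡ j) → (r ≢ [] → p ≡ suc j) →
             length r ≤ n → length ds + length r * (8 * B) ≤ n * (8 * B) →
             Σ Tape λ τ' → Tp τ' (blanks (suc (length r + j)) ++ blank ∷ (ds ++ chunks r)) ×
             Exec (while nonB pieces) τ p τ' (length r + j) (1 + length r * tRound n)
    x-loop n {τ} j [] ds p t nr nd p₁ p₂ le₁ le₂ =
      τ , tp-cast (cong (λ z → blanks (suc j) ++ blank ∷ z) (sym (List.++-identityʳ ds))) t ,
      from (sym (p₁ refl)) (xwhf (cong nonB (trans (t j) (nth-blanks j (blank ∷ ds)))))
    x-loop n {τ} j (s ∷ r) ds p t (ns , nr) nd p₁ p₂ le₁ le₂ =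
      let (τ₁ , t₁ , p' , q₁ , q₂ , x₁) = x-piece j s r ds t ns nr nd
          (τ₂ , t₂ , x₂) = x-loop n (suc j) r (ds ++ chunk s) p' t₁ nr (nb-++ {ds} nd (nb-chunk ns)) q₁ q₂ (<⇒≤ le₁) le'
      in τ₂ , tp-cast (cong₂ (λ k z → blanks (suc k) ++ blank ∷ z) (+-suc (length r) j) (List.++-assoc ds (chunk s) (chunks r))) t₂ ,
         from (sym (p₂ (λ ())))
           (at (+-suc (length r) j)
             (xwk (s≤s bound)
               (xwht (trans (cong nonB here) ns) (x-pieces s ns here x₁) x₂)))
      where
        here : τ (suc j) ≡ s
        here = trans (t (suc j)) (trans (cong (nth (blanks (suc j) ++ (s ∷ r) ++ blank ∷ ds)) (sym (len-blanks (suc j)))) (nth-end (blanks (suc j))))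
        le' : length (ds ++ chunk s) + length r * (8 * B) ≤ n * (8 * B)
        le' = ≤-trans (≤-reflexive (trans (cong (_+ length r * (8 * B)) (trans (List.length-++ ds) (cong (length ds +_) (len-chunk s)))) (+-assoc (length ds) (8 * B) _))) le₂
        bound : (3 + tPiece (length ds) (length r)) + (1 + length r * tRound n) ≤ tRound n + length r * tRound n
        bound = ≤-trans (≤-reflexive (+-suc (3 + tPiece (length ds) (length r)) (length r * tRound n)))
                  (+-monoˡ-≤ (length r * tRound n) (s≤s (+-monoʳ-≤ 3 (tPiece-mono (≤-trans (m≤m+n (length ds) _) le₂) (<⇒≤ le₁)))))

    init : Prog
    init = while nonB pieces ⨾ mvR ⨾ mvR ⨾ while nonB mvR ⨾ writeL (endBlock rb) ⨾ mvL ⨾ while nonB mvL ⨾ mvR ⨾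
           (rights 2 ⨾ wr o1 ⨾ lefts 2) ⨾ (rights 3 ⨾ wr o1 ⨾ lefts 3)

    cells : List Sym → List Sym
    cells []      = endBlock rb
    cells (s ∷ u) = block s ++ cells u

    chunks-cells : ∀ w → chunks w ++ endBlock rb ≡ cells (expand w)
    chunks-cells [] = refl
    chunks-cells (s ∷ w) = trans (List.++-assoc (chunk s) (chunks w) (endBlock rb))
      (trans (f (block s ++ block s ++ block s ++ block s ++ block s ++ block s ++ block s)
        (f (block s ++ block s ++ block s ++ block s ++ block s ++ block s)
        (f (block s ++ block s ++ block s ++ block s ++ block s)
        (f (block s ++ block s ++ block s ++ block s)
        (f (block s ++ block s ++ block s) (f (block s ++ block s) (f (block s) refl)))))))
        (cong (λ z → block s ++ block s ++ block s ++ block s ++ block s ++ block s ++ block s ++ block s ++ z) (chunks-cells w)))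
      where
        f : ∀ A {Z W} → A ++ Z ≡ W → (block s ++ A) ++ Z ≡ block s ++ W
        f A {Z} e = trans (List.++-assoc (block s) A Z) (cong (block s ++_) e)

    len-block : ∀ s → length (block s) ≡ B
    len-block s = cong suc (List.length-replicate K)

    mark0 : ℕ → ℕ → ℕ → Bool
    mark0 N j k = (k ≡ᵇ N) ∧ not ((j ≡ᵇ 1) ∨ (j ≡ᵇ 2))

    shiftB : ∀ s u c k → nth (block s ++ cells u) (c + (B + k * B)) ≡ nth (cells u) (c + k * B)
    shiftB s u c k = trans (cong (nth (block s ++ cells u))
        (trans (cong (c +_) (+-comm B (k * B))) (trans (sym (+-assoc c (k * B) B)) (cong (c + k * B +_) (sym (len-block s))))))
      (nth-shift (block s) (c + k * B))

    nth-rep : ∀ n {s i} → i < n → nth (replicate n s) i ≡ s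
    nth-rep (suc n) {i = zero} l = refl
    nth-rep (suc n) {i = suc i} (s≤s l) = nth-rep n l

    sym-at : ∀ u k → k ≤ length u → nth (cells u) (k * B) ≡ nthOr rb u k
    sym-at [] zero l = refl
    sym-at (s ∷ u) zero l = refl
    sym-at (s ∷ u) (suc k) (s≤s l) = trans (shiftB s u 0 k) (sym-at u k l)

    mark-at : ∀ u k j → k ≤ length u → j < K → nth (cells u) (suc j + k * B) ≡ bit (mark0 (length u) j k)
    mark-at [] zero zero l lj = refl
    mark-at [] zero (suc zero) l lj = refl
    mark-at [] zero (suc (suc zero)) l lj = refl
    mark-at [] zero (suc (suc (suc j))) l (s≤s (s≤s (s≤s lj))) = trans (cong (nth (replicate K' o1)) (+-identityʳ j)) (nth-rep K' lj)
    mark-at (s ∷ u) zero j l lj = trans (cong (nth (block s ++ cells u)) (+-identityʳ (suc j)))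
      (trans (nth-left (replicate K o0) {cells u} j (≤-trans lj (≤-reflexive (sym (List.length-replicate K))))) (nth-rep K lj))
    mark-at (s ∷ u) (suc k) j (s≤s l) lj = trans (shiftB s u (suc j) k) (mark-at u k j l lj)

    nb-cells : ∀ {u} → NB u → NB (cells u)
    nb-cells {[]} a = refl , refl , refl , refl , nb-rep K' refl
    nb-cells {s ∷ u} (e , a) = nb-++ {block s} (nb-block e) (nb-cells a)

    len-end : length (endBlock rb) ≡ B
    len-end = cong (4 +_) (List.length-replicate K')

    len-cells : ∀ u → length (cells u) ≡ suc (length u) * B
    len-cells [] = trans len-end (sym (+-identityʳ B))
    len-cells (s ∷ u) = trans (List.length-++ (block s)) (cong₂ _+_ (len-block s) (len-cells u))

    len-expand : ∀ w → length (expand w) ≡ length w * 8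
    len-expand [] = refl
    len-expand (s ∷ w) = cong (8 +_) (len-expand w)

    nb-expand : ∀ {w} → NB w → NB (expand w)
    nb-expand {[]} a = tt
    nb-expand {s ∷ w} (e , a) = e , e , e , e , e , e , e , e , nb-expand a

    module Start (w : List Sym) (nw : NB w) (nonempty : w ≡ [] → ⊥) where

      n N : ℕ
      n = length w
      N = n * 8

      open Blocks K N (suc n) (nthOr rb (expand w))
        using (Good; blk; St; mkOf; setm; upd-good; good-ext)

      blk≡ : ∀ k → blk k ≡ k * B + length (blanks (suc (suc n)))
      blk≡ zero = sym (len-blanks (suc (suc n)))
      blk≡ (suc k) = trans (cong (B +_) (blk≡ k)) (sym (+-assoc B (k * B) _))

      q₀ : ℕ → ℕ
      q₀ j = if (j ≡ᵇ 1) ∨ (j ≡ᵇ 2) then 0 else N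

      u : List Sym
      u = expand w

      lenu : length u ≡ N
      lenu = len-expand w

      good₀ : ∀ {τ} → Tp τ (blanks (suc (suc n)) ++ cells u) → Good (mark0 N) [] τ
      Good.symC (good₀ t) k l = trans (t (blk k)) (trans (cong (nth (blanks (suc (suc n)) ++ cells u)) (blk≡ k))
        (trans (nth-shift (blanks (suc (suc n))) (k * B)) (sym-at u k (≤-trans l (≤-reflexive (sym lenu))))))
      Good.mkC (good₀ t) k j l lj = trans (t _) (trans (cong (nth (blanks (suc (suc n)) ++ cells u)) (cong (suc j +_) (blk≡ k)))
        (trans (cong (nth (blanks (suc (suc n)) ++ cells u)) (sym (+-assoc (suc j) (k * B) _)))
        (trans (nth-shift (blanks (suc (suc n))) (suc j + k * B))
        (trans (mark-at u k j (≤-trans l (≤-reflexive (sym lenu))) lj) (cong (λ z → bit (mark0 z j k)) lenu)))))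
      Good.nbC (good₀ t) i l₁ l₂ =
        trans (cong nonB (trans (t i) (trans (cong (nth (blanks (suc (suc n)) ++ cells u)) (sym back)) (nth-shift (blanks (suc (suc n))) i'))))
          (nb-nth (cells u) i' (nb-cells (nb-expand nw)) (+-cancelʳ-< (length (blanks (suc (suc n)))) i' _
            (≤-trans (≤-reflexive (cong suc back)) (≤-trans l₂ (≤-reflexive (trans (blk≡ (suc N)) (cong (_+ _) (sym (trans (len-cells u) (cong (λ z → suc z * B) lenu))))))))))
        where
          i' : ℕ
          i' = i ∸ length (blanks (suc (suc n)))
          back : i' + length (blanks (suc (suc n))) ≡ i
          back = m∸n+n≡m (≤-trans (≤-reflexive (len-blanks (suc (suc n)))) l₁)
      Good.lbC (good₀ t) = cong nonB (trans (t (suc n)) (nth-blanks (suc n) (cells u)))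
      Good.outC (good₀ t) i = trans (t _) (trans (nth-beyond (blanks (suc (suc n)) ++ cells u) _ far) (sym (none i)))
        where
          none : ∀ i → nth (blank ∷ []) i ≡ blank
          none zero = refl
          none (suc i) = refl
          far : length (blanks (suc (suc n)) ++ cells u) ≤ i + blk (suc N)
          far = ≤-trans (≤-reflexive (trans (List.length-++ (blanks (suc (suc n)))) (trans (+-comm _ (length (cells u)))
                  (trans (cong (_+ length (blanks (suc (suc n)))) (trans (len-cells u) (cong (λ z → suc z * B) lenu))) (sym (blk≡ (suc N)))))))
                  (m≤n+m (blk (suc N)) i)

      marks-eq : ∀ j k → setm (setm (mark0 N) 1 0 true) 2 0 true j k ≡ mkOf q₀ j k
      marks-eq zero k = ∧-identityʳ (k ≡ᵇ N)
      marks-eq (suc zero) zero = refl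
      marks-eq (suc zero) (suc k) = ∧-zeroʳ (suc k ≡ᵇ N)
      marks-eq (suc (suc zero)) zero = refl
      marks-eq (suc (suc zero)) (suc k) = ∧-zeroʳ (suc k ≡ᵇ N)
      marks-eq (suc (suc (suc j))) k = ∧-identityʳ (k ≡ᵇ N)

      q₀≤ : ∀ j → q₀ j ≤ N
      q₀≤ zero = ≤-refl
      q₀≤ (suc zero) = z≤n
      q₀≤ (suc (suc zero)) = z≤n
      q₀≤ (suc (suc (suc j))) = ≤-refl

      tInit : ℕ
      tInit = (1 + n * tRound n) + (1 + (1 + ((1 + 2 * (n * (8 * B))) + ((2 + 2 * B) + (1 + ((1 + 2 * (n * (8 * B) + B)) + (1 + ((4 + (1 + 4)) + (5 + (1 + 5)))))))))) 

      x-init : Σ Tape λ τ → Exec init (inputTape w) 1 τ (suc (suc n)) tInit × St q₀ [] τ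
      x-init =
        let (τ₁ , t₁ , x₁) = x-loop n 0 w [] 1 start nw tt (λ e → ⊥-elim (nonempty e)) (λ _ → refl) ≤-refl ≤-refl
            t₁' = tp-cast (trans (cong (λ z → blanks (suc z) ++ blank ∷ chunks w) (+-identityʳ n)) (blanks-snoc (suc n) (chunks w))) t₁
            (τ₂ , x₂ , t₂) = x-writeL (endBlock rb) (blanks (suc (suc n)) ++ chunks w) t₁'
            t₂' = tp-cast (List.++-assoc (blanks (suc (suc n))) (chunks w) (endBlock rb)) t₂
            g = good₀ (tp-cast (cong (blanks (suc (suc n)) ++_) (chunks-cells w)) t₂')
            g' = good-ext marks-eq (upd-good {x = 2} {0} true (s≤s (s≤s (s≤s z≤n))) z≤n (upd-good {x = 1} {0} true (s≤s (s≤s z≤n)) z≤n g))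
        in _ , xseq (at (+-identityʳ n) x₁) (xseq xR (xseq xR
               (xseq (xwk (≤-reflexive (cong (λ z → 1 + 2 * z) (len-chunks w))) (from (len-blanks (suc (suc n))) (scanR-list (blanks (suc (suc n))) (chunks w) [] (tp-cast (cong (blanks (suc (suc n)) ++_) (sym (List.++-identityʳ (chunks w)))) t₁') (nb-chunks nw) refl)))
               (xseq (xwk (≤-reflexive (cong (λ z → 2 + 2 * z) len-end)) (from (trans (List.length-++ (blanks (suc (suc n)))) (+-comm _ (length (chunks w)))) x₂))
               (xseq (from e₃ xL)
               (xseq (xwk (≤-reflexive (cong (λ z → 1 + 2 * z) lenX)) (from (cong (length X +_) (len-blanks (suc n))) (at (len-blanks (suc n)) (scanL-list (blanks (suc n)) X []
                        (tp-cast (trans (sym (blanks-snoc (suc n) X)) (cong (λ z → blanks (suc n) ++ blank ∷ z) (sym (List.++-identityʳ X)))) t₂') (nb-++ {chunks w} (nb-chunks nw) (refl , refl , refl , refl , nb-rep K' refl))))))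
               (xseq xR (xseq (xseq (x-rights 2) (xseq xwr (x-lefts 2))) (xseq (x-rights 3) (xseq xwr (x-lefts 3))))))))))) ,
           g' , (λ j _ → q₀≤ j) , refl , refl
        where
          X : List Sym
          X = chunks w ++ endBlock rb
          lenX : length X ≡ n * (8 * B) + B
          lenX = trans (List.length-++ (chunks w)) (cong₂ _+_ (len-chunks w) len-end)
          e₂ : length (blanks (suc (suc n)) ++ chunks w) ≡ length (chunks w) + suc (suc n)
          e₂ = trans (List.length-++ (blanks (suc (suc n)))) (trans (+-comm _ (length (chunks w))) (cong (length (chunks w) +_) (len-blanks (suc (suc n)))))
          e₃ : suc (length X + suc n) ≡ length (endBlock rb) + length (blanks (suc (suc n)) ++ chunks w)
          e₃ = sym (trans (cong (length (endBlock rb) +_) e₂) (trans (sym (+-assoc (length (endBlock rb)) (length (chunks w)) (suc (suc n))))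
                 (trans (cong (_+ suc (suc n)) (trans (+-comm (length (endBlock rb)) (length (chunks w))) (sym (List.length-++ (chunks w))))) (+-suc (length X) (suc n)))))
          start : Tp (inputTape w) (blanks 1 ++ w ++ blank ∷ [])
          start zero = refl
          start (suc i) = pad w i
            where
              pad : ∀ w i → nth w i ≡ nth (w ++ blank ∷ []) i
              pad [] zero = refl
              pad [] (suc i) = refl
              pad (x ∷ w) zero = refl
              pad (x ∷ w) (suc i) = pad w i

-- Correctness of the compiler.

module CompileOk where

  open Language
  open import Defs using (Sym; rb)
  open TapeProgram
  open BlockTape
  open import Data.Nat using (ℕ; zero; suc; _+_; _*_; _∸_; _≤_; _<_; z≤n; s≤s; _≡ᵇ_; _<ᵇ_; pred)
  open import Data.Nat.Properties
  open import Data.Bool using (true; false; T)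
  open import Data.Fin using (Fin; zero; suc)
  open import Data.List using (List; []; _∷_; _++_; length)
  import Data.List.Properties as List
  open import Data.Vec using (Vec; []; _∷_; lookup; map; replicate; _[_]≔_) renaming (_++_ to _++ᵛ_)
  open import Data.Empty using (⊥; ⊥-elim)
  open import Data.Unit using (⊤; tt)
  open import Data.Product using (Σ; _×_; _,_)
  open import Data.Sum using (_⊎_; inj₁; inj₂)
  open import Relation.Binary.PropositionalEquality using (_≡_; refl; sym; trans; cong; cong₂; subst; _≢_)

  module Correct (w : List Sym) (K b : ℕ) where

    open Semantics w
    open Compile K cap b (nthOr rb (expand w))

    Suffix : List Sym → Set
    Suffix l = Σ (List Sym) λ pre → w ≡ pre ++ l

    valid : V → Set
    valid (cur l) = Suffix l
    valid (num n) = n ≤ cap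

    phys : V → ℕ
    phys v = cap ∸ size' v

    size≤ : ∀ v → valid v → size' v ≤ cap
    size≤ (cur l) (pre , refl) = *-monoˡ-≤ 8 (≤-trans (m≤n+m (length l) (length pre)) (≤-reflexive (sym (List.length-++ pre))))
    size≤ (num n) le = le

    EnvAt : ∀ {k} → ℕ → Vec V k → (ℕ → ℕ) → Set
    EnvAt o []      q = ⊤
    EnvAt o (v ∷ ρ) q = (valid v × q o ≡ phys v) × EnvAt (suc o) ρ q

    env-lookup : ∀ {k o q} {ρ : Vec V k} (i : Fin k) → EnvAt o ρ q → valid (lookup ρ i) × q (tr o i) ≡ phys (lookup ρ i)
    env-lookup {ρ = v ∷ ρ} zero (h , t) = h
    env-lookup {ρ = v ∷ ρ} (suc i) (h , t) = env-lookup i t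

    env-same : ∀ {k o q q'} (ρ : Vec V k) → (∀ j → o ≤ j → j < o + k → q' j ≡ q j) → EnvAt o ρ q → EnvAt o ρ q'
    env-same [] f e = tt
    env-same {suc k} {o} (v ∷ ρ) f ((a , e) , t) =
      (a , trans (f o ≤-refl (≤-trans (m≤m+n (suc o) k) (≤-reflexive (sym (+-suc o k))))) e) ,
      env-same ρ (λ j l₁ l₂ → f j (<⇒≤ l₁) (≤-trans l₂ (≤-reflexive (sym (+-suc o k))))) t

    env-set : ∀ {k o q u v} (ρ : Vec V k) (x : Fin k) → valid v → u ≡ phys v → EnvAt o ρ q → EnvAt o (ρ [ x ]≔ v) (set q (tr o x) u)
    env-set {o = o} {q} {u} (_ ∷ ρ) zero a e (h , t) =
      (a , trans (set-same q o u) e) , env-same ρ (λ j l₁ l₂ → set-other q o u (λ r → <⇒≢ l₁ (sym r))) t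
    env-set {o = o} {q} {u} (_ ∷ ρ) (suc x) a e ((h₁ , h₂) , t) =
      (h₁ , trans (set-other q (tr (suc o) x) u (<⇒≢ (tr≥ (suc o) x))) h₂) , env-set ρ x a e t

    op-nop : ∀ {q out} → Op nop q out q out 2
    op-nop τ s = τ , xseq xR xL , s

    data Loads (q : ℕ → ℕ) (g : ℕ) : ∀ {n} → Vec ℕ n → Vec V n → Set where
      []  : Loads q g [] []
      _∷_ : ∀ {n s v} {ss : Vec ℕ n} {vs} → (s < g × valid v × q s ≡ phys v) → Loads q g ss vs → Loads q g (s ∷ ss) (v ∷ vs)

    loads-set : ∀ {q g n u} {ss : Vec ℕ n} {vs} → Loads q g ss vs → Loads (set q g u) (suc g) ss vs
    loads-set [] = []
    loads-set {q} {g} {u = u} ((l , a , e) ∷ r) = (m<n⇒m<1+n l , a , trans (set-other q g u (<⇒≢ l)) e) ∷ loads-set r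

    op-copies : ∀ {n q out g} {ss : Vec ℕ n} {vs} → 2 ≤ g → g + n ≤ K → Loads q g ss vs →
                Σ (ℕ → ℕ) λ q' → Op (copies ss g) q out q' out (tCopies n) × EnvAt g vs q' × (∀ j → j < g → q' j ≡ q j)
    op-copies g2 le [] = _ , op-nop , tt , λ j l → refl
    op-copies {suc n} {q} {g = g} {s ∷ ss} {v ∷ vs} g2 le ((l , a , e) ∷ r) =
      let (q' , op , env , same) = op-copies {g = suc g} (m≤n⇒m≤1+n g2) (≤-trans (≤-reflexive (sym (+-suc g n))) le) (loads-set {u = q s} r)
      in q' , op-seq (op-copy g2 g<K (<-trans l g<K) (λ eq → <⇒≢ l (sym eq))) op ,
         ((a , trans (same g ≤-refl) (trans (set-same q g (q s)) e)) , env) ,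
         λ j lj → trans (same j (m<n⇒m<1+n lj)) (set-other q g (q s) (<⇒≢ lj))
      where
        g<K : g < K
        g<K = ≤-trans (≤-trans (m≤m+n (suc g) n) (≤-reflexive (sym (+-suc g n)))) le

    loads-zeros : ∀ {q g} l → 0 < g → q 0 ≡ cap → Loads q g (replicate l 0) (replicate l (num 0))
    loads-zeros zero h e = []
    loads-zeros (suc l) h e = (h , z≤n , e) ∷ loads-zeros l h e

    loads-args : ∀ {k m o q g l} {ρ : Vec V k} (xs : Vec (Fin k) m) → o + k ≤ g → 0 < g → q 0 ≡ cap → EnvAt o ρ q →
                 Loads q g (sources o xs l) (map (lookup ρ) xs ++ᵛ replicate l (num 0))
    loads-args {l = l} [] le h e env = loads-zeros l h e
    loads-args {o = o} (x ∷ xs) le h e env =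
      let (a , p) = env-lookup x env in (≤-trans (tr< o x) le , a , p) ∷ loads-args xs le h e env

    Out : Set
    Out = List Sym

    Op' : Prog → (ℕ → ℕ) → Out → (ℕ → ℕ) → ℕ → Set
    Op' P q out q' t = Op P q out q' out t

    right-phys : ∀ v → valid v → next-block (phys v) ≡ cap ∸ pred (size' v)
    right-phys v a with size' v | size≤ v a
    ... | zero | le rewrite ≡ᵇ-refl cap = refl
    ... | suc n | le = trans (lem (cap ∸ suc n) (<⇒≢ᵇ (∸-monoʳ-< {o = 0} (s≤s z≤n) le))) (sym (trans (∸-suc' le) refl))
      where
        lem : ∀ k → (k ≡ᵇ cap) ≡ false → next-block k ≡ suc k
        lem k e rewrite e = refl
        ∸-suc' : ∀ {m n} → suc n ≤ m → m ∸ n ≡ suc (m ∸ suc n)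
        ∸-suc' {suc m} {zero} (s≤s l) = refl
        ∸-suc' {suc m} {suc n} (s≤s l) = ∸-suc' l

    left-phys : ∀ v → valid v → prev-block (phys v) ≡ cap ∸ satSuc (size' v)
    left-phys v a with size' v <ᵇ cap in e
    ... | true  = pred[m∸n]≡m∸[1+n] cap (size' v)
    ... | false = trans (cong pred z) (sym z)
      where
        z : cap ∸ size' v ≡ 0
        z = m≤n⇒m∸n≡0 {cap} {size' v} (≮⇒≥ {size' v} {cap} (λ l → subst T e (<⇒<ᵇ {size' v} {cap} l)))

    sat≤ : ∀ n → n ≤ cap → satSuc n ≤ cap
    sat≤ n le with n <ᵇ cap in e
    ... | true = <ᵇ⇒< n cap (subst T (sym e) tt)
    ... | false = le

    op-rights : ∀ n {q out x v} → 2 ≤ x → x < K → v ≤ cap → q x ≡ cap ∸ v →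
                Σ (ℕ → ℕ) λ q' → Op' (rightPs n x) q out q' (tRights n) × q' x ≡ cap ∸ (v ∸ n) × (∀ j → j < x → q' j ≡ q j)
    op-rights zero l2 lx lv e = _ , op-nop , e , λ j l → refl
    op-rights (suc n) {q} {out} {x} {v} l2 lx lv e =
      let (q' , op , e' , same) = op-rights n {set q x (next-block (q x))} {out} {x} {pred v} l2 lx (≤-trans pred[n]≤n lv)
                                    (trans (set-same q x (next-block (q x))) (trans (cong next-block e) (right-phys (num v) lv)))
      in q' , op-seq (op-right l2 lx) op , trans e' (cong (cap ∸_) (pd v n)) ,
         λ j l → trans (same j l) (set-other q x (next-block (q x)) (<⇒≢ l))
      where
        pd : ∀ v n → pred v ∸ n ≡ v ∸ suc n
        pd zero n = 0∸n≡0 n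
        pd (suc v) n = refl

    valid-adv : ∀ v → valid v → valid (advV v)
    valid-adv (cur []) a = a
    valid-adv (cur (x ∷ l)) (pre , e) = pre ++ x ∷ [] , trans e (sym (List.++-assoc pre (x ∷ []) l))
    valid-adv (num n) a = ≤-trans (m∸n≤m n 8) a

    size-adv : ∀ v → size' v ∸ 8 ≡ size' (advV v)
    size-adv (cur []) = refl
    size-adv (cur (x ∷ l)) = refl
    size-adv (num n) = refl

    symbol-phys : ∀ v → valid v → nthOr rb (expand w) (phys v) ≡ symbolAt v
    symbol-phys (num n) a = refl
    symbol-phys (cur l) (pre , e) = trans (cong₂ (λ u i → nthOr rb (expand u) i) e (idx pre e)) (rd pre)
      where
        idx : ∀ pre → w ≡ pre ++ l → cap ∸ length l * 8 ≡ length pre * 8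
        idx pre e = trans (cong (_∸ length l * 8) (trans (cong (_* 8) (trans (cong length e) (List.length-++ pre))) (*-distribʳ-+ 8 (length pre) (length l)))) (m+n∸n≡m (length pre * 8) (length l * 8))
        hd : ∀ l → nthOr rb (expand l) 0 ≡ headOr rb l
        hd [] = refl
        hd (x ∷ l) = refl
        rd : ∀ pre → nthOr rb (expand (pre ++ l)) (length pre * 8) ≡ headOr rb l
        rd [] = hd l
        rd (x ∷ pre) = rd pre

    zero-phys : ∀ v → valid v → isZ v ≡ true → phys v ≡ cap
    zero-phys (cur []) a e = refl
    zero-phys (num zero) a e = refl

    nonzero-phys : ∀ v → valid v → isZ v ≡ false → phys v ≢ cap
    nonzero-phys (cur (x ∷ l)) a e = <⇒≢ (∸-monoʳ-< {o = 0} (s≤s z≤n) (size≤ (cur (x ∷ l)) a))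
    nonzero-phys (num (suc n)) a e = <⇒≢ (∸-monoʳ-< {o = 0} (s≤s z≤n) a)

    -- The frame condition: it lets a caller keep its variables, and a loop its round counter,
    -- across the commands inside.
    Keeps : ℕ → ℕ → ℕ → (ℕ → ℕ) → (ℕ → ℕ) → Set
    Keeps o k f q q' = ∀ j → j < f → (j < o ⊎ o + k ≤ j) → q' j ≡ q j

    mutual
      ok-C : ∀ {k} (c : Cmd k) {q out o f} (ρ : Vec V k) → q 0 ≡ cap → 2 ≤ o → o + k ≤ f → f + spaceC c ≤ K → EnvAt o ρ q →
             Σ (ℕ → ℕ) λ q' → Op' (compC c o f) q out q' (timeC c) × EnvAt o (⟦ c ⟧c ρ) q' × Keeps o k f q q'
      ok-C skip ρ z l2 lf lK env = _ , op-nop , env , λ j l s → refl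
      ok-C {k} (x ≔ e) {q} {out} {o} {f} ρ z l2 lf lK env =
        let (q₁ , op₁ , a , p , same) = ok-E e {q} {out} ρ z l2 lf lK env
            lx = tr< o x
        in set q₁ (tr o x) (q₁ (loc e f)) ,
           op-seq op₁ (op-copy (≤-trans l2 (tr≥ o x)) (≤-trans lx (≤-trans lf (≤-trans (m≤m+n f _) lK))) (loc< e f lK)
                        (λ eq → <⇒≢ (≤-trans (≤-trans lx lf) (loc≥ e f)) eq)) ,
           env-set ρ x a p (env-same ρ (λ j _ l → same j (≤-trans l lf)) env) ,
           λ j l s → trans (set-other q₁ (tr o x) _ (apart j s)) (same j l)
        where
          apart : ∀ j → (j < o ⊎ o + k ≤ j) → j ≢ tr o x
          apart j (inj₁ l) r = <⇒≢ (≤-trans l (tr≥ o x)) r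
          apart j (inj₂ l) r = <⇒≢ (≤-trans (tr< o x) l) (sym r)
      ok-C (c ▸ d) {f = f} ρ z l2 lf lK env =
        let (q₁ , op₁ , env₁ , k₁) = ok-C c ρ z l2 lf (≤-trans (+-monoʳ-≤ f (m≤m⊔n (spaceC c) (spaceC d))) lK) env
            (q₂ , op₂ , env₂ , k₂) = ok-C d (⟦ c ⟧c ρ) (trans (k₁ 0 (≤-trans (s≤s z≤n) (≤-trans l2 (≤-trans (m≤m+n _ _) lf))) (inj₁ (≤-trans (s≤s z≤n) l2))) z) l2 lf (≤-trans (+-monoʳ-≤ f (m≤n⊔m (spaceC c) (spaceC d))) lK) env₁
        in q₂ , op-seq op₁ op₂ , env₂ , λ j l s → trans (k₂ j l s) (k₁ j l s)
      ok-C (ifz x c d) {q} {out} {o} {f} ρ z l2 lf lK env with isZ (lookup ρ x) in e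
      ... | true =
        let (q₁ , op₁ , env₁ , k₁) = ok-C c ρ z l2 lf (≤-trans (+-monoʳ-≤ f (m≤m⊔n (spaceC c) (spaceC d))) lK) env
            (a , p) = env-lookup x env
        in q₁ , op-branchEq (≤-trans (tr< o x) (≤-trans lf (≤-trans (m≤m+n f _) lK))) (≤-trans (s≤s z≤n) (≤-trans l2 (≤-trans (m≤m+n o _) (≤-trans lf (≤-trans (m≤m+n f _) lK)))))
                  (λ _ → op-wk (m≤m+n _ _) op₁) (λ ne → ⊥-elim (ne (trans p (trans (zero-phys _ a e) (sym z))))) , env₁ , k₁
      ... | false =
        let (q₁ , op₁ , env₁ , k₁) = ok-C d ρ z l2 lf (≤-trans (+-monoʳ-≤ f (m≤n⊔m (spaceC c) (spaceC d))) lK) env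
            (a , p) = env-lookup x env
        in q₁ , op-branchEq (≤-trans (tr< o x) (≤-trans lf (≤-trans (m≤m+n f _) lK))) (≤-trans (s≤s z≤n) (≤-trans l2 (≤-trans (m≤m+n o _) (≤-trans lf (≤-trans (m≤m+n f _) lK)))))
                  (λ eq → ⊥-elim (nonzero-phys _ a e (trans (sym p) (trans eq z)))) (λ _ → op-wk (m≤n+m _ (timeC c)) op₁) , env₁ , k₁
      ok-C (ifs s x c d) {q} {out} {o} {f} ρ z l2 lf lK env with eqS s (symbolAt (lookup ρ x)) in e
      ... | true =
        let (q₁ , op₁ , env₁ , k₁) = ok-C c ρ z l2 lf (≤-trans (+-monoʳ-≤ f (m≤m⊔n (spaceC c) (spaceC d))) lK) env
            (a , p) = env-lookup x env
            e' = trans (cong (eqS s) (trans (cong (nthOr rb (expand w)) p) (symbol-phys _ a))) e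
        in q₁ , op-branchSym (≤-trans (tr< o x) (≤-trans lf (≤-trans (m≤m+n f _) lK)))
                  (λ _ → op-wk (m≤m+n _ _) op₁) (λ ne → ⊥-elim (t≢f (trans (sym e') ne))) , env₁ , k₁
        where
          t≢f : true ≡ false → ⊥
          t≢f ()
      ... | false =
        let (q₁ , op₁ , env₁ , k₁) = ok-C d ρ z l2 lf (≤-trans (+-monoʳ-≤ f (m≤n⊔m (spaceC c) (spaceC d))) lK) env
            (a , p) = env-lookup x env
            e' = trans (cong (eqS s) (trans (cong (nthOr rb (expand w)) p) (symbol-phys _ a))) e
        in q₁ , op-branchSym (≤-trans (tr< o x) (≤-trans lf (≤-trans (m≤m+n f _) lK)))
                  (λ ne → ⊥-elim (t≢f (trans (sym ne) e'))) (λ _ → op-wk (m≤n+m _ (timeC c)) op₁) , env₁ , k₁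
        where
          t≢f : true ≡ false → ⊥
          t≢f ()
      ok-C {k} (loop x c) {q} {out} {o} {f} ρ z l2 lf lK env =
        let (a , p) = env-lookup x env
            total = size' (lookup ρ x)
            q₀ = set q f (q (tr o x))
            (q₁ , o₁ , op₁ , (ρ₁ , eqρ , env₁ , _ , _ , k₁ , z₁ , oe)) =
              op-while {P = compC c o (suc f) ⨾ rightP f} {t = timeC c + tMove} f<K Inv body going stop total q₀ out
                (ρ , refl , env-same ρ (λ j _ l → set-other q f _ (<⇒≢ (≤-trans l lf))) env ,
                 trans (set-same q f _) p , size≤ _ a , (λ j l s → set-other q f _ (<⇒≢ l)) ,
                 trans (set-other q f _ (<⇒≢ (≤-trans (s≤s z≤n) f≥2))) z , refl)
        in q₁ , op-seq (op-copy f≥2 f<K (≤-trans (tr< o x) (≤-trans lf (<⇒≤ f<K))) (λ eq → <⇒≢ (≤-trans (tr< o x) lf) (sym eq)))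
                  (op-wk (+-monoʳ-≤ tFind (+-monoʳ-≤ 1 (+-monoˡ-≤ (1 + tHome) (+-monoʳ-≤ 1 (*-monoˡ-≤ (tBody (timeC c + tMove)) (size≤ _ a)))))) (subst (λ u → Op (whileNE f (compC c o (suc f) ⨾ rightP f)) q₀ out q₁ u (tWhile total (timeC c + tMove))) oe op₁)) ,
           subst (λ r → EnvAt o r q₁) eqρ env₁ , k₁
        where
          f≥2 : 2 ≤ f
          f≥2 = ≤-trans l2 (≤-trans (m≤m+n o k) lf)
          f<K : f < K
          f<K = ≤-trans (≤-trans (s≤s (m≤m+n f (spaceC c))) (≤-reflexive (sym (+-suc f (spaceC c))))) lK
          -- The invariant looks forward: `n` more rounds from the present environment give what all
          -- rounds give from the initial one. The mark of track `f` shows the same `n`.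
          Inv : ℕ → (ℕ → ℕ) → List Sym → Set
          Inv n q' out' = Σ (Vec V k) λ ρ' → iter ⟦ c ⟧c n ρ' ≡ iter ⟦ c ⟧c (size' (lookup ρ x)) ρ × EnvAt o ρ' q' ×
                          q' f ≡ cap ∸ n × n ≤ cap × Keeps o k f q q' × q' 0 ≡ cap × out' ≡ out
          body : ∀ n q' o' → Inv (suc n) q' o' → Σ (ℕ → ℕ) λ q'' → Σ (List Sym) λ o'' →
                 Op (compC c o (suc f) ⨾ rightP f) q' o' q'' o'' (timeC c + tMove) × Inv n q'' o''
          body n q' o' (ρ' , eq , env' , pf , le , ks , z' , oe) =
            let (q₁ , op₁ , env₁ , k₁) = ok-C c ρ' z' l2 (m≤n⇒m≤1+n lf) (≤-trans (≤-reflexive (sym (+-suc f (spaceC c)))) lK) env'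
                pf₁ = trans (k₁ f ≤-refl (inj₂ lf)) pf
            in set q₁ f (next-block (q₁ f)) , o' , op-seq op₁ (op-right f≥2 f<K) ,
               (⟦ c ⟧c ρ' , eq , env-same _ (λ j _ l → set-other q₁ f _ (<⇒≢ (≤-trans l lf))) env₁ ,
                trans (set-same q₁ f _) (trans (cong next-block pf₁) (right-phys (num (suc n)) le)) , <⇒≤ le ,
                (λ j l s → trans (set-other q₁ f _ (<⇒≢ l)) (trans (k₁ j (m<n⇒m<1+n l) s) (ks j l s))) ,
                trans (set-other q₁ f _ (<⇒≢ (≤-trans (s≤s z≤n) f≥2))) (trans (k₁ 0 (s≤s z≤n) (inj₁ (≤-trans (s≤s z≤n) l2))) z') , oe)
          going : ∀ n q' o' → Inv (suc n) q' o' → q' f ≢ cap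
          going n q' o' (_ , _ , _ , pf , le , _) h = nonzero-phys (num (suc n)) le refl (trans (sym pf) h)
          stop : ∀ q' o' → Inv 0 q' o' → q' f ≡ cap
          stop q' o' (_ , _ , _ , pf , _) = pf

      loc< : ∀ {k} (e : Exp k) f → f + spaceE e ≤ K → loc e f < K
      loc< zer f l = ≤-trans (≤-reflexive (+-comm 1 f)) l
      loc< (var x) f l = ≤-trans (≤-reflexive (+-comm 1 f)) l
      loc< (inc x) f l = ≤-trans (≤-reflexive (+-comm 1 f)) l
      loc< (dec x) f l = ≤-trans (≤-reflexive (+-comm 1 f)) l
      loc< (adv x) f l = ≤-trans (≤-reflexive (+-comm 1 f)) l
      loc< (call (proc {m} l c r) xs) f le = ≤-trans (tr< f r) (≤-trans (+-monoʳ-≤ f (m≤m+n (m + l) (spaceC c))) le)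

      loc≥ : ∀ {k} (e : Exp k) f → f ≤ loc e f
      loc≥ zer f = ≤-refl
      loc≥ (var x) f = ≤-refl
      loc≥ (inc x) f = ≤-refl
      loc≥ (dec x) f = ≤-refl
      loc≥ (adv x) f = ≤-refl
      loc≥ (call (proc l c r) xs) f = tr≥ f r

      ok-E : ∀ {k} (e : Exp k) {q out o f} (ρ : Vec V k) → q 0 ≡ cap → 2 ≤ o → o + k ≤ f → f + spaceE e ≤ K → EnvAt o ρ q →
             Σ (ℕ → ℕ) λ q' → Op' (compE e o f) q out q' (timeE e) × valid (⟦ e ⟧e ρ) × q' (loc e f) ≡ phys (⟦ e ⟧e ρ) × (∀ j → j < f → q' j ≡ q j)
      ok-E zer {q} {f = f} ρ z l2 lf lK env =
        set q f (q 0) , op-wk (m≤m+n _ _) (op-copy f≥2 (loc< (zer {0}) f lK) (≤-trans (s≤s z≤n) (loc< (zer {0}) f lK)) (λ r → <⇒≢ (≤-trans (s≤s z≤n) f≥2) (sym r))) ,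
        z≤n , trans (set-same q f _) z , λ j l → set-other q f _ (<⇒≢ l)
        where
          f≥2 : 2 ≤ f
          f≥2 = ≤-trans l2 (≤-trans (m≤m+n _ _) lf)
      ok-E (var x) {q} {out} {o} {f} ρ z l2 lf lK env =
        let (a , p) = env-lookup x env in
        set q f (q (tr o x)) , op-wk (m≤m+n _ _) (op-fetch x l2 lf lK) , a , trans (set-same q f _) p , λ j l → set-other q f _ (<⇒≢ l)
      ok-E (inc x) {q} {out} {o} {f} ρ z l2 lf lK env =
        let (a , p) = env-lookup x env
            q₁ = set q f (q (tr o x)) in
        set q₁ f (prev-block (q₁ f)) , op-seq (op-fetch x l2 lf lK) (op-left (≤-trans l2 (≤-trans (m≤m+n _ _) lf)) (loc< (zer {0}) f lK)) ,
        sat≤ _ (size≤ _ a) , trans (set-same q₁ f _) (trans (cong prev-block (trans (set-same q f _) p)) (left-phys _ a)) ,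
        λ j l → trans (set-other q₁ f _ (<⇒≢ l)) (set-other q f _ (<⇒≢ l))
      ok-E (dec x) {q} {out} {o} {f} ρ z l2 lf lK env =
        let (a , p) = env-lookup x env
            q₁ = set q f (q (tr o x)) in
        set q₁ f (next-block (q₁ f)) , op-seq (op-fetch x l2 lf lK) (op-right (≤-trans l2 (≤-trans (m≤m+n _ _) lf)) (loc< (zer {0}) f lK)) ,
        ≤-trans pred[n]≤n (size≤ _ a) , trans (set-same q₁ f _) (trans (cong next-block (trans (set-same q f _) p)) (right-phys _ a)) ,
        λ j l → trans (set-other q₁ f _ (<⇒≢ l)) (set-other q f _ (<⇒≢ l))
      ok-E (adv x) {q} {out} {o} {f} ρ z l2 lf lK env =
        let (a , p) = env-lookup x env
            q₁ = set q f (q (tr o x))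
            (q₂ , op₂ , e₂ , s₂) = op-rights 8 {q₁} {out} (≤-trans l2 (≤-trans (m≤m+n _ _) lf)) (loc< (zer {0}) f lK) (size≤ _ a) (trans (set-same q f _) p)
        in q₂ , op-seq (op-fetch x l2 lf lK) op₂ , valid-adv _ a , trans e₂ (cong (cap ∸_) (size-adv (lookup ρ x))) ,
           λ j l → trans (s₂ j l) (set-other q f _ (<⇒≢ l))
      ok-E (call (proc {m} l c r) xs) {q} {out} {o} {f} ρ z l2 lf lK env =
        let f≥2 = ≤-trans l2 (≤-trans (m≤m+n _ _) lf)
            (q₁ , op₁ , env₁ , s₁) = op-copies {q = q} {out} f≥2 (≤-trans (+-monoʳ-≤ f (m≤m+n (m + l) (spaceC c))) lK)
                                       (loads-args {l = l} xs lf (≤-trans (s≤s z≤n) f≥2) z env)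
            (q₂ , op₂ , env₂ , k₂) = ok-C c _ (trans (s₁ 0 (≤-trans (s≤s z≤n) f≥2)) z) f≥2 ≤-refl (≤-trans (≤-reflexive (+-assoc f (m + l) (spaceC c))) lK) env₁
            (a , p) = env-lookup r env₂
        in q₂ , op-seq op₁ op₂ , a , p , λ j lj → trans (k₂ j (≤-trans lj (m≤m+n f (m + l))) (inj₁ lj)) (s₁ j lj)

      op-fetch : ∀ {k} (x : Fin k) {q out o f} → 2 ≤ o → o + k ≤ f → f + 1 ≤ K → Op' (copyP f (tr o x)) q out (set q f (q (tr o x))) tCopy
      op-fetch x {o = o} {f} l2 lf lK =
        op-copy (≤-trans l2 (≤-trans (m≤m+n _ _) lf)) (loc< (zer {0}) f lK) (<-trans (≤-trans (tr< o x) lf) (loc< (zer {0}) f lK))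
          (λ r → <⇒≢ (≤-trans (tr< o x) lf) (sym r))

-- Polynomial bounds.

module Poly where

  open import Data.Nat using (ℕ; zero; suc; _+_; _*_; _^_; _≤_)
  open import Data.Nat.Properties
  open import Data.Nat.Solver using (module +-*-Solver)
  open import Data.Product using (Σ; _,_)
  open import Relation.Binary.PropositionalEquality using (_≡_; refl; sym; trans; cong)

  -- With the base `suc (size x)`, which is never 0, raising the exponent only weakens a bound. A
  -- sum may then simply add the exponents, as a product does.
  Poly : {A : Set} → (A → ℕ) → (A → ℕ) → Set
  Poly {A} size f = Σ ℕ λ a → Σ ℕ λ e → ∀ x → f x ≤ a * suc (size x) ^ e

  module _ {A : Set} {size : A → ℕ} where

    private
      pow-left : ∀ n e e' → suc n ^ e ≤ suc n ^ (e + e')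
      pow-left n e e' = ^-monoʳ-≤ (suc n) (m≤m+n e e')

    poly-const : ∀ c → Poly size (λ _ → c)
    poly-const c = c , 0 , λ x → ≤-reflexive (sym (*-identityʳ c))

    poly-size : Poly size size
    poly-size = 1 , 1 , λ x → ≤-trans (n≤1+n (size x)) (≤-reflexive (sym (trans (+-identityʳ (suc (size x) ^ 1)) (*-identityʳ (suc (size x))))))

    poly-≤ : ∀ {f g} → (∀ x → f x ≤ g x) → Poly size g → Poly size f
    poly-≤ le (a , e , h) = a , e , λ x → ≤-trans (le x) (h x)

    poly-+ : ∀ {f g} → Poly size f → Poly size g → Poly size (λ x → f x + g x)
    poly-+ (a , e , h) (a' , e' , h') = a + a' , e + e' , λ x → ≤-trans
      (+-mono-≤ (≤-trans (h x) (*-monoʳ-≤ a (pow-left (size x) e e')))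
                (≤-trans (h' x) (*-monoʳ-≤ a' (≤-trans (pow-left (size x) e' e) (≤-reflexive (cong (suc (size x) ^_) (+-comm e' e)))))))
      (≤-reflexive (sym (*-distribʳ-+ (suc (size x) ^ (e + e')) a a')))

    poly-* : ∀ {f g} → Poly size f → Poly size g → Poly size (λ x → f x * g x)
    poly-* (a , e , h) (a' , e' , h') = a * a' , e + e' , λ x → ≤-trans (*-mono-≤ (h x) (h' x))
      (≤-reflexive (trans (lem a (suc (size x) ^ e) a' (suc (size x) ^ e')) (cong (a * a' *_) (sym (^-distribˡ-+-* (suc (size x)) e e')))))
      where
        open +-*-Solver
        lem : ∀ a p b q → (a * p) * (b * q) ≡ a * b * (p * q)
        lem = solve 4 (λ a p b q → (a :* p) :* (b :* q) := a :* b :* (p :* q)) refl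

  poly-^ : {A : Set} {size : A → ℕ} {f : A → ℕ} → Poly size f → ∀ e → Poly size (λ x → f x ^ e)
  poly-^ h zero    = poly-const 1
  poly-^ h (suc e) = poly-* h (poly-^ h e)

  poly-compose : {A B : Set} {size : A → ℕ} {size' : B → ℕ} {f : A → ℕ} (g : B → A) →
                 Poly size f → Poly size' (λ y → size (g y)) → Poly size' (λ y → f (g y))
  poly-compose g (a , e , h) p =
    poly-≤ (λ y → h (g y)) (poly-* (poly-const a) (poly-^ (poly-+ (poly-const 1) p) e))

-- The machine around a main command: set-up, output and running time.

module Machine where

  open import Defs using (Sym; o0; o1; lb; rb)
  open TapeProgram
  open BlockTape
  open Emit
  open Init
  open Language
  open CompileOk
  open Poly
  open import Data.Nat using (ℕ; zero; suc; _+_; _*_; _∸_; _≤_; _<_; z≤n; s≤s)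
  open import Data.Nat.Properties
  open import Data.Bool using (true; false)
  open import Data.Fin using (Fin; zero; suc)
  open import Data.List using (List; []; _∷_; _++_; length)
  import Data.List.Properties as List
  open import Data.Vec using (Vec; []; _∷_; lookup; replicate)
  open import Data.Empty using (⊥; ⊥-elim)
  open import Data.Unit using (tt)
  open import Data.Sum using (inj₁)
  open import Data.Product using (Σ; _×_; _,_)
  open import Relation.Binary.PropositionalEquality using (_≡_; refl; sym; trans; cong; subst; _≢_)

  data Bits : List Sym → Set where
    []   : Bits []
    o0∷_ : ∀ {l} → Bits l → Bits (o0 ∷ l)
    o1∷_ : ∀ {l} → Bits l → Bits (o1 ∷ l)

  nb-bits : ∀ {l} → Bits l → NB l
  nb-bits [] = tt
  nb-bits (o0∷ d) = refl , nb-bits d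
  nb-bits (o1∷ d) = refl , nb-bits d

  -- The answer is 1 or 0 if variable iA or iB, respectively, is zero, and otherwise the test of
  -- the variable whose index starts at iX.
  data Answer {k} (w : List Sym) (iA iB iX : Fin k) (ρ : Vec V k) : List Sym → Set where
    ans1 : Semantics.isZ w (lookup ρ iA) ≡ true → Answer w iA iB iX ρ (lb ∷ o1 ∷ o1 ∷ rb ∷ [])
    ans0 : Semantics.isZ w (lookup ρ iA) ≡ false → Semantics.isZ w (lookup ρ iB) ≡ true →
           Answer w iA iB iX ρ (lb ∷ o1 ∷ o0 ∷ rb ∷ [])
    ansT : ∀ {bs rest} → Semantics.isZ w (lookup ρ iA) ≡ false → Semantics.isZ w (lookup ρ iB) ≡ false →
           Bits bs → lookup ρ iX ≡ cur (bs ++ rb ∷ rest) →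
           Answer w iA iB iX ρ (lb ∷ o0 ∷ lb ∷ bs ++ rb ∷ rb ∷ [])

  module Whole {k : ℕ} (main : Cmd (suc k)) (iA iB iX : Fin (suc k)) where

    K' : ℕ
    K' = k + spaceC main

    open Setup K' using (K; B; init; tRound; tPiece; module Start)

    open BlockPrograms K using (emit; branchSym; branchEq; copyP; whileNE)
    open Compiler K

    emits : List Sym → Prog
    emits []       = nop
    emits (s ∷ ss) = emit s ⨾ emits ss

    A' B' X' : ℕ
    A' = tr 2 iA
    B' = tr 2 iB
    X' = tr 2 iX

    -- On the closing bracket the pointer jumps to the last block, which is the exit condition of
    -- the loop around this step.
    bitStep : Prog
    bitStep = branchSym X' o0 (emit o0 ⨾ rightPs 8 X') (branchSym X' o1 (emit o1 ⨾ rightPs 8 X') (copyP X' 0))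

    finish : Prog
    finish = branchEq A' 0 (emits (lb ∷ o1 ∷ o1 ∷ rb ∷ []))
               (branchEq B' 0 (emits (lb ∷ o1 ∷ o0 ∷ rb ∷ []))
                 (emits (lb ∷ o0 ∷ lb ∷ []) ⨾ whileNE X' bitStep ⨾ emits (rb ∷ rb ∷ [])))

    program : Prog
    program = init ⨾ (compC main 2 (3 + k) ⨾ finish) ⨾ while nonB mvR ⨾ mvR

    module Times (N b : ℕ) (sy : ℕ → Sym) where

      open Compile K N b sy
      open Emission K N b sy

      tEmits : ℕ → ℕ → ℕ
      tEmits m zero    = 2
      tEmits m (suc l) = tEmit m + tEmits m l

      tAdv tStep tBits tFinish tRest : ℕ → ℕ
      tAdv m = tEmit m + tRights 8 + tCopy
      tStep m = tFind + suc (tHome + (tFind + suc (tHome + tAdv m)))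
      tBits m = tEmits m 3 + (tWhile m (tStep m) + tEmits m 2)
      tFinish m = branchTime (tHome + (tEmits m 4 + branchTime (tHome + (tEmits m 4 + tBits m))))
      tRest m = (timeC main + tFinish m) + ((1 + 2 * blk (suc N)) + 1)

    module Runs (w : List Sym) (nw : NB w) (nonempty : w ≡ [] → ⊥) where

      open Start w nw nonempty using (n; q₀; x-init; tInit)
      open Semantics w
      open Correct w K (suc n)
      open Emission K cap (suc n) (nthOr rb (expand w)) using (tEmit; op-emit)
      open Compile K cap (suc n) (nthOr rb (expand w))
        using (St; Op; op-seq; op-wk; op-branchEq; op-branchSym; op-while; op-copy; tCopy; tHome; tFind; tRights; tWhile; set; set-same; set-other; branchTime; blk; timeC; tBody)
      open Times cap (suc n) (nthOr rb (expand w))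
      open Blocks K cap (suc n) (nthOr rb (expand w)) using (blk-mono; nbC; outC)

      ρ₀ : Vec V (suc k)
      ρ₀ = cur w ∷ replicate k (num 0)

      env₀ : EnvAt 2 ρ₀ q₀
      env₀ = (([] , refl) , sym (n∸n≡0 cap)) , zeros k 3 (s≤s (s≤s (s≤s z≤n)))
        where
          q₀-high : ∀ o → 3 ≤ o → q₀ o ≡ cap
          q₀-high (suc (suc (suc o))) l = refl
          q₀-high (suc zero) (s≤s ())
          q₀-high (suc (suc zero)) (s≤s (s≤s ()))
          zeros : ∀ k o → 3 ≤ o → EnvAt o (replicate k (num 0)) q₀
          zeros zero o l = tt
          zeros (suc k) o l = (z≤n , q₀-high o l) , zeros k (suc o) (m≤n⇒m≤1+n l)

      op-emits : ∀ {q out m} l → NB l → NB out → length out + length l ≤ m → Op (emits l) q out q (out ++ l) (tEmits m (length l))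
      op-emits {q} {out} [] nl no le = subst (λ o → Op nop q out q o 2) (sym (List.++-identityʳ out)) op-nop
      op-emits {q} {out} {m} (s ∷ l) (ns , nl) no le =
        subst (λ o → Op (emits (s ∷ l)) q out q o (tEmits m (suc (length l)))) (List.++-assoc out (s ∷ []) l)
          (op-seq (op-emit ns no (≤-trans (m≤m+n (length out) _) le))
            (op-emits l nl (nb-++ {out} no (ns , tt))
              (≤-trans (≤-reflexive (trans (cong (_+ length l) (trans (List.length-++ out) (+-comm (length out) 1))) (sym (+-suc (length out) (length l))))) le)))

      module _ {q : ℕ → ℕ} (z : q 0 ≡ cap) (X<K : X' < K) where

        X≥2 : 2 ≤ X'
        X≥2 = tr≥ 2 iX

        op-bits : ∀ {bs rest out m} → Bits bs → Suffix (bs ++ rb ∷ rest) → q X' ≡ phys (cur (bs ++ rb ∷ rest)) → NB out → length out + suc (length bs) ≤ m →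
                  Σ (ℕ → ℕ) λ q' → Op (whileNE X' bitStep) q out q' (out ++ bs) (tWhile m (tStep m))
        op-bits {bs} {rest} {out} {m} dbs sfx pX no le =
          let (q' , o' , op , (_ , _ , e , _)) = op-while {t = tStep m} X<K Inv body going stop (suc (length bs)) q out
                                         (z , bs , (dbs , refl , sfx , pX , no , refl , le))
          in q' , subst (λ o → Op (whileNE X' bitStep) q out q' o (tWhile m (tStep m))) e
               (op-wk (+-monoʳ-≤ tFind (+-monoʳ-≤ 1 (+-monoˡ-≤ (1 + tHome) (+-monoʳ-≤ 1 (*-monoˡ-≤ (tBody (tStep m)) (≤-trans (m≤n+m _ (length out)) le)))))) op)
          where
            -- One round for each remaining digit and a last one for the closing bracket, hence the
            -- shift by one.
            Cond : ℕ → (ℕ → ℕ) → List Sym → List Sym → Set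
            Cond zero q' o' bs' = o' ≡ out ++ bs × q' X' ≡ cap
            Cond (suc l) q' o' bs' = Bits bs' × l ≡ length bs' × Suffix (bs' ++ rb ∷ rest) × q' X' ≡ phys (cur (bs' ++ rb ∷ rest)) × NB o' ×
                                     o' ++ bs' ≡ out ++ bs × length o' + suc (length bs') ≤ m
            Inv : ℕ → (ℕ → ℕ) → List Sym → Set
            Inv l q' o' = q' 0 ≡ cap × Σ (List Sym) λ bs' → Cond l q' o' bs'
            going : ∀ l q' o' → Inv (suc l) q' o' → q' X' ≢ cap
            going l q' o' (_ , [] , _ , _ , s , p , _) h = nonzero-phys (cur (rb ∷ rest)) s refl (trans (sym p) h)
            going l q' o' (_ , b ∷ bs' , _ , _ , s , p , _) h = nonzero-phys (cur (b ∷ bs' ++ rb ∷ rest)) s refl (trans (sym p) h)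
            stop : ∀ q' o' → Inv 0 q' o' → q' X' ≡ cap
            stop q' o' (_ , _ , _ , e) = e
            t₁ : ℕ
            t₁ = tAdv m
            t≢f : true ≡ false → ⊥
            t≢f ()
            reads : ∀ {q' l s s'} → Suffix (s ∷ l) → q' X' ≡ phys (cur (s ∷ l)) → eqS s' (nthOr rb (expand w) (q' X')) ≡ eqS s' s
            reads {s' = s'} sf p = cong (eqS s') (trans (cong (nthOr rb (expand w)) p) (symbol-phys _ sf))
            body : ∀ l q' o' → Inv (suc l) q' o' → Σ (ℕ → ℕ) λ q'' → Σ (List Sym) λ o'' → Op bitStep q' o' q'' o'' (tStep m) × Inv l q'' o''
            body l q' o' (z' , [] , [] , refl , s , p , no' , e , le') =
              set q' X' (q' 0) , o' ,
              op-branchSym X<K (λ h → ⊥-elim (t≢f (trans (sym h) (reads {q'} s p))))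
                (λ _ → op-branchSym X<K (λ h → ⊥-elim (t≢f (trans (sym h) (reads {q'} s p))))
                  (λ _ → op-wk (m≤n+m tCopy (tEmit m + tRights 8)) (op-copy X≥2 X<K (≤-trans (s≤s z≤n) X<K) (λ r → <⇒≢ (≤-trans (s≤s z≤n) X≥2) (sym r))))) ,
              (trans (set-other q' X' _ (<⇒≢ (≤-trans (s≤s z≤n) X≥2))) z' , [] , trans (sym (List.++-identityʳ o')) e , trans (set-same q' X' _) z')
            body (suc l) q' o' (z' , .o0 ∷ bs' , (o0∷ d) , refl , s , p , no' , e , le') =
              let (q₁ , op₁ , p₁ , k₁) = op-rights 8 {q'} {o' ++ o0 ∷ []} X≥2 X<K (size≤ _ s) p
              in q₁ , o' ++ o0 ∷ [] ,
                 op-branchSym X<K (λ _ → op-wk (≤-trans (m≤m+n _ tCopy) (≤-trans (m≤n+m _ (suc tHome)) (≤-trans (≤-reflexive (sym refl)) (m≤n+m _ tFind)))) (op-seq (op-emit refl no' (≤-trans (m≤m+n (length o') _) le')) op₁))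
                   (λ h → ⊥-elim (t≢f (sym (trans (sym h) (reads {q'} s p))))) ,
                 (trans (k₁ 0 (≤-trans (s≤s z≤n) X≥2)) z' , bs' , d , refl , valid-adv (cur (o0 ∷ bs' ++ rb ∷ rest)) s , p₁ , nb-++ {o'} no' (refl , tt) ,
                  trans (List.++-assoc o' (o0 ∷ []) bs') e , ≤-trans (≤-reflexive (len-snoc o')) le')
              where
                len-snoc : ∀ o' → length (o' ++ o0 ∷ []) + suc (length bs') ≡ length o' + suc (suc (length bs'))
                len-snoc o' = trans (cong (_+ suc (length bs')) (trans (List.length-++ o') (+-comm (length o') 1))) (sym (+-suc (length o') (suc (length bs'))))
            body (suc l) q' o' (z' , .o1 ∷ bs' , (o1∷ d) , refl , s , p , no' , e , le') =
              let (q₁ , op₁ , p₁ , k₁) = op-rights 8 {q'} {o' ++ o1 ∷ []} X≥2 X<K (size≤ _ s) p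
              in q₁ , o' ++ o1 ∷ [] ,
                 op-branchSym X<K (λ h → ⊥-elim (t≢f (trans (sym h) (reads {q'} s p))))
                   (λ _ → op-branchSym X<K (λ _ → op-wk (m≤m+n _ tCopy) (op-seq (op-emit refl no' (≤-trans (m≤m+n (length o') _) le')) op₁))
                     (λ h → ⊥-elim (t≢f (sym (trans (sym h) (reads {q'} s p)))))) ,
                 (trans (k₁ 0 (≤-trans (s≤s z≤n) X≥2)) z' , bs' , d , refl , valid-adv (cur (o1 ∷ bs' ++ rb ∷ rest)) s , p₁ , nb-++ {o'} no' (refl , tt) ,
                  trans (List.++-assoc o' (o1 ∷ []) bs') e , ≤-trans (≤-reflexive (len-snoc o')) le')
              where
                len-snoc : ∀ o' → length (o' ++ o1 ∷ []) + suc (length bs') ≡ length o' + suc (suc (length bs'))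
                len-snoc o' = trans (cong (_+ suc (length bs')) (trans (List.length-++ o') (+-comm (length o') 1))) (sym (+-suc (length o') (suc (length bs'))))

      tr<K : ∀ (i : Fin (suc k)) → tr 2 i < K
      tr<K i = ≤-trans (tr< 2 i) (s≤s (s≤s (s≤s (m≤m+n k (spaceC main)))))

      0<K : 0 < K
      0<K = s≤s z≤n

      bits-short : ∀ {bs rest} → Suffix (bs ++ rb ∷ rest) → suc (length bs) ≤ n
      bits-short {bs} {rest} (pre , e) = ≤-trans
        (≤-trans (s≤s (m≤m+n (length bs) (length rest)))
          (≤-trans (≤-reflexive (sym (trans (List.length-++ bs) (+-suc (length bs) (length rest))))) (m≤n+m _ (length pre))))
        (≤-reflexive (sym (trans (cong length e) (List.length-++ pre))))

      nb-answer : ∀ {ρ : Vec V (suc k)} {out} → Answer w iA iB iX ρ out → NB out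
      nb-answer (ans1 _) = refl , refl , refl , refl , tt
      nb-answer (ans0 _ _) = refl , refl , refl , refl , tt
      nb-answer (ansT _ _ d _) = refl , refl , refl , nb-++ (nb-bits d) (refl , refl , tt)

      op-finish : ∀ {ρ : Vec V (suc k)} {q out} → Answer w iA iB iX ρ out → q 0 ≡ cap → EnvAt 2 ρ q →
                  Σ (ℕ → ℕ) λ q' → Op finish q [] q' out (tFinish (5 + n))
      op-finish {q = q} (ans1 a) z env =
        let (v , p) = env-lookup iA env in
        q , op-branchEq (tr<K iA) 0<K
              (λ _ → op-wk (m≤m+n (tEmits (5 + n) 4) _) (op-emits {m = 5 + n} _ (refl , refl , refl , refl , tt) tt (s≤s (s≤s (s≤s (s≤s z≤n))))))
              (λ ne → ⊥-elim (ne (trans p (trans (zero-phys _ v a) (sym z)))))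
      op-finish {q = q} (ans0 a a') z env =
        let (v , p) = env-lookup iA env
            (v' , p') = env-lookup iB env in
        q , op-branchEq (tr<K iA) 0<K (λ e → ⊥-elim (nonzero-phys _ v a (trans (sym p) (trans e z))))
              (λ _ → op-wk (m≤n+m _ (tEmits (5 + n) 4)) (op-branchEq (tr<K iB) 0<K
                (λ _ → op-wk (m≤m+n (tEmits (5 + n) 4) _) (op-emits {m = 5 + n} _ (refl , refl , refl , refl , tt) tt (s≤s (s≤s (s≤s (s≤s z≤n))))))
                (λ ne → ⊥-elim (ne (trans p' (trans (zero-phys _ v' a') (sym z)))))))
      op-finish {q = q} (ansT {bs} {rest} a a' d e) z env =
        let (v , p) = env-lookup iA env
            (v' , p') = env-lookup iB env
            (v'' , p'') = env-lookup iX env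
            sfx = subst valid e v''
            short = bits-short {bs} {rest} sfx
            (q₁ , op₁) = op-bits {q} z (tr<K iX) {out = lb ∷ o0 ∷ lb ∷ []} {m = 5 + n} d sfx (trans p'' (cong phys e)) (refl , refl , refl , tt)
                           (s≤s (s≤s (s≤s (≤-trans short (m≤n+m n 2)))))
        in q₁ , op-branchEq (tr<K iA) 0<K (λ e → ⊥-elim (nonzero-phys _ v a (trans (sym p) (trans e z))))
              (λ _ → op-wk (m≤n+m _ (tEmits (5 + n) 4)) (op-branchEq (tr<K iB) 0<K
                (λ e → ⊥-elim (nonzero-phys _ v' a' (trans (sym p') (trans e z))))
                (λ _ → op-wk (m≤n+m _ (tEmits (5 + n) 4))
                  (op-seq (op-emits {m = 5 + n} (lb ∷ o0 ∷ lb ∷ []) (refl , refl , refl , tt) tt (s≤s (s≤s (s≤s z≤n))))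
                  (op-seq op₁ (op-emits {m = 5 + n} (rb ∷ rb ∷ []) (refl , refl , tt) (refl , refl , refl , nb-bits d)
                    (s≤s (s≤s (s≤s (≤-trans (≤-reflexive (+-comm (length bs) 2)) (s≤s (≤-trans short (n≤1+n n)))))))))))))

      total : ℕ
      total = tInit + tRest (5 + n)

      outAt : ∀ out τ p → NB out → (∀ i → τ (i + p) ≡ nth out i) → OutAt τ p out
      outAt [] τ p nb f = f 0
      outAt (s ∷ out) τ p (e , nb) f = f 0 , (λ { refl → nope e }) , outAt out τ (suc p) nb (λ i → trans (cong τ (+-suc i p)) (f (suc i)))
        where
          nope : false ≡ true → ⊥
          nope ()

      halts : ∀ {out} → Answer w iA iB iX (⟦ main ⟧c ρ₀) out → Σ Tape λ τ → Σ ℕ λ p → Exec program (inputTape w) 1 τ p total × OutAt τ p out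
      halts {out} ans =
        let (τ₁ , x₁ , s₁) = x-init
            (q₂ , op₂ , env₂ , k₂) = ok-C main {q₀} {[]} {2} {3 + k} ρ₀ refl ≤-refl ≤-refl ≤-refl env₀
            (q₃ , op₃) = op-finish {q = q₂} ans (trans (k₂ 0 (s≤s z≤n) (inj₁ (s≤s z≤n))) refl) env₂
            (τ₃ , x₃ , (g , _)) = op-seq op₂ op₃ τ₁ s₁
        in τ₃ , suc (blk (suc cap)) ,
           xseq x₁ (xseq x₃ (xseq (xwk (+-monoʳ-≤ 1 (*-monoʳ-≤ 2 (≤-trans (m≤m+n d (suc (suc n))) (≤-reflexive e₁))))
             (at e₁ (x-scanR d (λ i l → nbC g _ (m≤n+m (suc (suc n)) i) (≤-trans (+-monoˡ-< (suc (suc n)) l) (≤-reflexive e₁)))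
                               (trans (cong (λ z → nonB (τ₃ z)) e₁) (cong nonB (outC g 0)))))) xR)) ,
           outAt out τ₃ (suc (blk (suc cap))) (nb-answer ans) (λ i → trans (cong τ₃ (+-suc i (blk (suc cap)))) (outC g (suc i)))
        where
          d : ℕ
          d = blk (suc cap) ∸ suc (suc n)
          e₁ : d + suc (suc n) ≡ blk (suc cap)
          e₁ = m∸n+n≡m (blk-mono {0} {suc cap} z≤n)

    record Input : Set where
      constructor input
      field
        word     : List Sym
        nonblank : NB word
        nonempty : word ≡ [] → ⊥

    len : Input → ℕ
    len x = length (Input.word x)

    module At (x : Input) where
      private
        w = Input.word x
        n' = length w
      open Times (n' * 8) (suc n') (nthOr rb (expand w)) public
      open Compile K (n' * 8) (suc n') (nthOr rb (expand w)) public
      open Emission K (n' * 8) (suc n') (nthOr rb (expand w)) using (tEmit) public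

    pc : ∀ {f} → (c : ℕ) → (∀ (x : Input) → f x ≡ c) → Poly len f
    pc c h = poly-≤ (λ x → ≤-reflexive (h x)) (poly-const c)

    p-cap : Poly len (λ x → len x * 8)
    p-cap = poly-* poly-size (poly-const 8)

    p-blk : Poly len (λ x → At.blk x (suc (len x * 8)))
    p-blk = poly-≤ (λ x → ≤-reflexive (blk-eq x (suc (len x * 8)))) (poly-+ (poly-* (poly-+ (poly-const 1) p-cap) (poly-const B)) (poly-+ (poly-const 2) poly-size))
      where
        blk-eq : ∀ x l → At.blk x l ≡ l * B + (2 + len x)
        blk-eq x zero = refl
        blk-eq x (suc l) = trans (cong (B +_) (blk-eq x l)) (sym (+-assoc B (l * B) (2 + len x)))

    p-home : Poly len At.tHome
    p-home = poly-+ (poly-+ (poly-const 1) (poly-* (poly-const 2) p-blk)) (poly-const 1)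

    p-find : Poly len At.tFind
    p-find = poly-+ (poly-const (5 + B)) (poly-+ (poly-+ (poly-const 1) (poly-* p-cap (poly-const (5 + B)))) (poly-const (5 + B)))

    p-set : Poly len At.tSet
    p-set = poly-const _

    p-branch : ∀ {f} → Poly len f → Poly len (λ x → At.branchTime x (f x))
    p-branch pf = poly-+ p-find (poly-+ (poly-const (5 + B)) (poly-+ (poly-const 1) (poly-+ (poly-const (5 + B)) pf)))

    p-move : Poly len At.tMove
    p-move = p-branch (poly-+ (poly-+ p-set (poly-+ (poly-+ (poly-+ (poly-const (5 + B)) p-find) p-home) (poly-+ p-set p-home))) p-home)

    p-copy : Poly len At.tCopy
    p-copy = poly-+ p-find (poly-+ p-set (poly-+ (poly-+ p-home p-find) (poly-+ p-set p-home)))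

    p-while : ∀ {f g} → Poly len f → Poly len g → Poly len (λ x → At.tWhile x (f x) (g x))
    p-while pf pg = poly-+ p-find (poly-+ (poly-const 1) (poly-+ (poly-+ (poly-const 1) (poly-* pf
      (poly-+ (poly-const 2) (poly-+ p-home (poly-+ pg (poly-+ p-find (poly-const 1))))))) (poly-+ (poly-const 1) p-home)))

    p-copies : ∀ l → Poly len (λ x → At.tCopies x l)
    p-copies zero = poly-const 2
    p-copies (suc l) = poly-+ p-copy (p-copies l)

    p-rights : ∀ l → Poly len (λ x → At.tRights x l)
    p-rights zero = poly-const 2
    p-rights (suc l) = poly-+ p-move (p-rights l)

    mutual
      p-C : ∀ {m} (c : Cmd m) → Poly len (λ x → At.timeC x c)
      p-C skip = poly-const 2
      p-C (x ≔ e) = poly-+ (p-E e) p-copy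
      p-C (c ▸ d) = poly-+ (p-C c) (p-C d)
      p-C (ifz x c d) = p-branch (poly-+ p-home (poly-+ (p-C c) (p-C d)))
      p-C (ifs s x c d) = poly-+ p-find (poly-+ (poly-const 1) (poly-+ p-home (poly-+ (p-C c) (p-C d))))
      p-C (loop x c) = poly-+ p-copy (p-while p-cap (poly-+ (p-C c) p-move))

      p-E : ∀ {m} (e : Exp m) → Poly len (λ x → At.timeE x e)
      p-E zer = poly-+ p-copy p-move
      p-E (var x) = poly-+ p-copy p-move
      p-E (inc x) = poly-+ p-copy p-move
      p-E (dec x) = poly-+ p-copy p-move
      p-E (adv x) = poly-+ p-copy (p-rights 8)
      p-E (call (proc {m} l c r) xs) = poly-+ (p-copies (m + l)) (p-C c)

    p-emit : ∀ {f} → Poly len f → Poly len (λ x → At.tEmit x (f x))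
    p-emit pf = poly-+ seek (poly-+ (poly-const 1) (poly-+ (poly-+ (poly-const 1) (poly-* (poly-const 2) pf)) (poly-+ (poly-const 1)
      (poly-+ (poly-+ (poly-const 1) (poly-* (poly-const 2) (poly-+ (poly-const 1) pf))) (poly-+ (poly-const 1) (poly-+ seek (poly-const 1)))))))
      where
        seek : Poly len (λ x → 1 + 2 * At.blk x (suc (len x * 8)))
        seek = poly-+ (poly-const 1) (poly-* (poly-const 2) p-blk)

    p-emits : ∀ {f} l → Poly len f → Poly len (λ x → At.tEmits x (f x) l)
    p-emits zero pf = poly-const 2
    p-emits (suc l) pf = poly-+ (p-emit pf) (p-emits l pf)

    p-rest : ∀ {f} → Poly len f → Poly len (λ x → At.tRest x (f x))
    p-rest {f} pf = poly-+ (poly-+ (p-C main) p-fin) (poly-+ (poly-+ (poly-const 1) (poly-* (poly-const 2) p-blk)) (poly-const 1))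
      where
        p-step : Poly len (λ x → At.tStep x (f x))
        p-step = poly-+ p-find (poly-+ (poly-const 1) (poly-+ p-home (poly-+ p-find (poly-+ (poly-const 1) (poly-+ p-home (poly-+ (poly-+ (p-emit pf) (p-rights 8)) p-copy))))))
        p-bits : Poly len (λ x → At.tBits x (f x))
        p-bits = poly-+ (p-emits 3 pf) (poly-+ (p-while pf p-step) (p-emits 2 pf))
        p-fin : Poly len (λ x → At.tFinish x (f x))
        p-fin = p-branch (poly-+ p-home (poly-+ (p-emits 4 pf) (p-branch (poly-+ p-home (poly-+ (p-emits 4 pf) p-bits)))))

    opaque
      totalTime : Input → ℕ
      totalTime x = Runs.total (Input.word x) (Input.nonblank x) (Input.nonempty x)

      totalTime-def : ∀ x → Runs.total (Input.word x) (Input.nonblank x) (Input.nonempty x) ≡ totalTime x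
      totalTime-def x = refl

      p-total : Poly len totalTime
      p-total = poly-+ p-init (p-rest (poly-+ (poly-const 5) poly-size))
        where
          k1 : Poly len (λ _ → 1)
          k1 = poly-const 1
          k2 : Poly len (λ _ → 2)
          k2 = poly-const 2
          k8B : Poly len (λ _ → 8 * B)
          k8B = poly-const (8 * B)
          p-D : Poly len (λ x → len x * (8 * B))
          p-D = poly-* poly-size k8B
          p-piece : Poly len (λ x → tPiece (len x * (8 * B)) (len x))
          p-piece = poly-+ k1 (poly-+ k1 (poly-+ (poly-+ k1 (poly-* k2 poly-size)) (poly-+ k1 (poly-+ (poly-+ k1 (poly-* k2 p-D))
            (poly-+ (poly-+ k2 (poly-* k2 k8B)) (poly-+ k1 (poly-+ (poly-+ k1 (poly-* k2 (poly-+ k8B p-D))) (poly-+ k1 (poly-+ k1 (poly-+ (poly-+ k1 (poly-* k2 poly-size)) k2))))))))))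
          p-init : Poly len (λ x → Start.tInit (Input.word x) (Input.nonblank x) (Input.nonempty x))
          p-init = poly-+ (poly-+ k1 (poly-* poly-size (poly-+ (poly-const 4) p-piece))) (poly-+ k1 (poly-+ k1 (poly-+ (poly-+ k1 (poly-* k2 p-D))
            (poly-+ (poly-+ k2 (poly-* k2 (poly-const B))) (poly-+ k1 (poly-+ (poly-+ k1 (poly-* k2 (poly-+ p-D (poly-const B)))) (poly-const _)))))))

    halting : ∀ (x : Input) {out} →
              Answer (Input.word x) iA iB iX (Semantics.⟦_⟧c (Input.word x) main (Runs.ρ₀ (Input.word x) (Input.nonblank x) (Input.nonempty x))) out →
              Σ Tape λ τ → Σ ℕ λ p → Exec program (inputTape (Input.word x)) 1 τ p (totalTime x) × OutAt τ p out
    halting x ans = let (τ , p , e , o) = Runs.halts (Input.word x) (Input.nonblank x) (Input.nonempty x) ans in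
      τ , p , subst (Exec program (inputTape (Input.word x)) 1 τ p) (totalTime-def x) e , o

-- The decision procedure as a program of the language.

module Programs where

  open import Defs using (o0; o1; lb; rb)
  open Language
  open import Data.Nat using (zero; suc)
  open import Data.Bool using (Bool; true; false; if_then_else_; not)
  open import Data.Fin using (Fin; zero; suc)
  open import Data.Vec using ([]; _∷_)
  open import Relation.Binary.PropositionalEquality using (_≡_; refl)

  v0 : ∀ {n} → Fin (1 Data.Nat.+ n)
  v0 = zero
  v1 : ∀ {n} → Fin (2 Data.Nat.+ n)
  v1 = suc zero
  v2 : ∀ {n} → Fin (3 Data.Nat.+ n)
  v2 = suc v1
  v3 : ∀ {n} → Fin (4 Data.Nat.+ n)
  v3 = suc v2
  v4 : ∀ {n} → Fin (5 Data.Nat.+ n)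
  v4 = suc v3
  v5 : ∀ {n} → Fin (6 Data.Nat.+ n)
  v5 = suc v4
  v6 : ∀ {n} → Fin (7 Data.Nat.+ n)
  v6 = suc v5
  v7 : ∀ {n} → Fin (8 Data.Nat.+ n)
  v7 = suc v6
  v8 : ∀ {n} → Fin (9 Data.Nat.+ n)
  v8 = suc v7
  v9 : ∀ {n} → Fin (10 Data.Nat.+ n)
  v9 = suc v8
  v10 : ∀ {n} → Fin (11 Data.Nat.+ n)
  v10 = suc v9

  whenZ unlessZ : ∀ {k} → Fin k → Cmd k → Cmd k
  whenZ x c = ifz x c skip
  unlessZ x c = ifz x skip c

  one : ∀ {k} → Fin k → Cmd k
  one x = x ≔ zer ▸ x ≔ inc x

  -- `v1` is the depth of nesting; at depth 0 the step is idle, which absorbs the surplus rounds of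
  -- the loop.
  skipStep : Cmd 2
  skipStep = unlessZ v1 (ifs lb v0 (v1 ≔ inc v1) (ifs rb v0 (v1 ≔ dec v1) skip) ▸ v0 ≔ adv v0)

  opaque
    -- The end of the bracketed word starting at the argument.
    skipP : Proc 1
    skipP = proc 1 (v1 ≔ inc v1 ▸ v0 ≔ adv v0 ▸ loop v0 skipStep) v0

    skipP-def : skipP ≡ proc 1 (v1 ≔ inc v1 ▸ v0 ≔ adv v0 ▸ loop v0 skipStep) v0
    skipP-def = refl

  -- Runs the command for every item of the list whose items start at x.
  each : ∀ {k} → Fin k → Cmd k → Cmd k
  each x c = loop x (ifs lb x (c ▸ x ≔ call skipP (x ∷ [])) skip)

  -- Both pointers stall at the first disagreement. Afterwards the numerals were equal exactly if
  -- both pointers stand on a closing bracket.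
  eqStep : Cmd 3
  eqStep = ifs o0 v0 (ifs o0 v1 both skip) (ifs o1 v0 (ifs o1 v1 both skip) skip)
    where
      both : Cmd 3
      both = v0 ≔ adv v0 ▸ v1 ≔ adv v1

  opaque
    eqP : Proc 2
    eqP = proc 1 (loop v0 eqStep ▸ ifs rb v0 (ifs rb v1 (v2 ≔ inc v2) skip) skip) v2

    eqP-def : eqP ≡ proc 1 (loop v0 eqStep ▸ ifs rb v0 (ifs rb v1 (v2 ≔ inc v2) skip) skip) v2
    eqP-def = refl

  hasSigns : Bool → Cmd 8
  hasSigns opp = ifs o0 v3 (ifs o0 v5 same diff) (ifs o0 v5 diff same)
    where
      same diff : Cmd 8
      same = if opp then skip else one v6
      diff = if opp then one v6 else skip

  hasStep : Bool → Cmd 8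
  hasStep opp = v5 ≔ adv v1 ▸ v4 ≔ adv v5 ▸ v5 ≔ call skipP (v5 ∷ []) ▸ v7 ≔ call eqP (v2 ∷ v4 ∷ []) ▸ unlessZ v7 (hasSigns opp)

  opaque
    -- Does the list contain the literal, or (opp = true) the complementary literal?
    hasP : Bool → Proc 2
    hasP opp = proc 6 (v3 ≔ adv v0 ▸ v2 ≔ adv v3 ▸ v3 ≔ call skipP (v3 ∷ []) ▸ v1 ≔ adv v1 ▸ each v1 (hasStep opp)) v6

    hasP-def : ∀ opp → hasP opp ≡ proc 6 (v3 ≔ adv v0 ▸ v2 ≔ adv v3 ▸ v3 ≔ call skipP (v3 ∷ []) ▸ v1 ≔ adv v1 ▸ each v1 (hasStep opp)) v6
    hasP-def opp = refl

  -- Looking for the complement of a literal within its own group detects tautologies. Looking for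
  -- the literal or its complement in the history detects a hit; which of the two is sought depends
  -- on the family.
  unresStep : Bool → Cmd 5
  unresStep b = v3 ≔ call (hasP true) (v2 ∷ v0 ∷ []) ▸ unlessZ v3 (v4 ≔ zer) ▸
                v3 ≔ call (hasP (not b)) (v2 ∷ v1 ∷ []) ▸ unlessZ v3 (v4 ≔ zer)

  opaque
    unresP : Bool → Proc 2
    unresP b = proc 3 (v4 ≔ inc v4 ▸ v2 ≔ adv v0 ▸ each v2 (unresStep b)) v4

    unresP-def : ∀ b → unresP b ≡ proc 3 (v4 ≔ inc v4 ▸ v2 ≔ adv v0 ▸ each v2 (unresStep b)) v4
    unresP-def b = refl

  rStep : Bool → Cmd 4
  rStep b = v3 ≔ call (unresP b) (v0 ∷ v1 ∷ []) ▸ unlessZ v3 (v2 ≔ inc v2)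

  uStep : Bool → Cmd 5
  uStep b = v4 ≔ call (unresP b) (v0 ∷ v1 ∷ []) ▸ unlessZ v4 (v4 ≔ call (hasP false) (v2 ∷ v0 ∷ []) ▸ unlessZ v4 (v3 ≔ inc v3))

  opaque
    rP : Bool → Proc 2
    rP b = proc 2 (v0 ≔ adv v0 ▸ each v0 (rStep b)) v2

    uP : Bool → Proc 3
    uP b = proc 2 (v0 ≔ adv v0 ▸ each v0 (uStep b)) v3

    rP-def : ∀ b → rP b ≡ proc 2 (v0 ≔ adv v0 ▸ each v0 (rStep b)) v2
    rP-def b = refl

    uP-def : ∀ b → uP b ≡ proc 2 (v0 ≔ adv v0 ▸ each v0 (uStep b)) v3
    uP-def b = refl

  lenStep : Cmd 2
  lenStep = ifs rb v0 skip (v1 ≔ inc v1 ▸ v0 ≔ adv v0)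

  halfStep : Cmd 2
  halfStep = v0 ≔ dec v0 ▸ unlessZ v0 (v0 ≔ dec v0 ▸ v1 ≔ inc v1)

  parityStep : Cmd 2
  parityStep = ifz v1 (v1 ≔ inc v1) (v1 ≔ zer)

  addStep subStep : Cmd 2
  addStep = v0 ≔ inc v0
  subStep = v0 ≔ dec v0

  opaque
    lenP : Proc 2
    lenP = proc 0 (v0 ≔ adv v0 ▸ loop v0 lenStep) v1

    halfP parityP : Proc 1
    halfP = proc 1 (loop v0 halfStep) v1
    parityP = proc 1 (loop v0 parityStep) v1

    addP subP : Proc 2
    addP = proc 0 (loop v1 addStep) v0
    subP = proc 0 (loop v1 subStep) v0

    lenP-def : lenP ≡ proc 0 (v0 ≔ adv v0 ▸ loop v0 lenStep) v1
    lenP-def = refl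

    halfP-def : halfP ≡ proc 1 (loop v0 halfStep) v1
    halfP-def = refl

    parityP-def : parityP ≡ proc 1 (loop v0 parityStep) v1
    parityP-def = refl

    addP-def : addP ≡ proc 0 (loop v1 addStep) v0
    addP-def = refl

    subP-def : subP ≡ proc 0 (loop v1 subStep) v0
    subP-def = refl

  lgStep : Cmd 2
  lgStep = unlessZ v0 (v1 ≔ inc v1 ▸ v0 ≔ call halfP (v0 ∷ []))

  -- The numerals have digits 1 and 2, the difference gets digits 0 and 1. `v6` becomes the carry
  -- plus one, plus one, plus the digit of b, minus that of a; this lies between 0 and 5. The total
  -- offset 2 is even, so the parity of `v6` is the next digit of the difference, and its half is
  -- the next carry plus one.
  diffDigits diffTail diffStep diffLast : Cmd 8
  diffDigits =
    v6 ≔ inc v3 ▸ ifs o0 v1 (v6 ≔ inc v6) (v6 ≔ inc v6 ▸ v6 ≔ inc v6) ▸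
    ifs o0 v0 (v6 ≔ dec v6 ▸ v0 ≔ adv v0) (ifs o1 v0 (v6 ≔ dec v6 ▸ v6 ≔ dec v6 ▸ v0 ≔ adv v0) skip)
  diffTail =
    v4 ≔ inc v4 ▸ v3 ≔ call halfP (v6 ∷ []) ▸ v7 ≔ call parityP (v6 ∷ []) ▸ unlessZ v7 (v5 ≔ var v4) ▸ v1 ≔ adv v1
  diffStep = ifs rb v1 skip (diffDigits ▸ diffTail)
  diffLast = v3 ≔ dec v3 ▸ unlessZ v3 (v5 ≔ inc v4)

  idxStep : Cmd 3
  idxStep = ifs o0 v0 (plus ▸ double) (ifs o1 v0 (plus ▸ plus ▸ double) skip)
    where
      plus double : Cmd 3
      plus = v1 ≔ call addP (v1 ∷ v2 ∷ [])
      double = v2 ≔ call addP (v2 ∷ v2 ∷ []) ▸ v0 ≔ adv v0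

  nthStep : Cmd 2
  nthStep = v0 ≔ adv v0 ▸ v0 ≔ call skipP (v0 ∷ [])

  opaque
    lgP : Proc 2
    lgP = proc 0 (loop v0 lgStep) v1

    -- The arguments are numerals a < b and a counter; adds the binary length of b - a to the
    -- counter.  v3 holds the carry plus one, v5 the position behind the last nonzero digit.
    diffP : Proc 3
    diffP = proc 5 (v0 ≔ adv v0 ▸ v1 ≔ adv v1 ▸ v3 ≔ inc v3 ▸ v4 ≔ var v2 ▸ v5 ≔ var v2 ▸ loop v1 diffStep ▸ diffLast) v5

    idxP : Proc 1
    idxP = proc 2 (v2 ≔ inc v2 ▸ v0 ≔ adv v0 ▸ loop v0 idxStep) v1

    nthP : Proc 2
    nthP = proc 0 (loop v1 nthStep ▸ v0 ≔ adv v0) v0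

    lgP-def : lgP ≡ proc 0 (loop v0 lgStep) v1
    lgP-def = refl

    diffP-def : diffP ≡ proc 5 (v0 ≔ adv v0 ▸ v1 ≔ adv v1 ▸ v3 ≔ inc v3 ▸ v4 ≔ var v2 ▸ v5 ≔ var v2 ▸ loop v1 diffStep ▸ diffLast) v5
    diffP-def = refl

    idxP-def : idxP ≡ proc 2 (v2 ≔ inc v2 ▸ v0 ≔ adv v0 ▸ loop v0 idxStep) v1
    idxP-def = refl

    nthP-def : nthP ≡ proc 0 (loop v1 nthStep ▸ v0 ≔ adv v0) v0
    nthP-def = refl

  opaque
    -- The three advances of `numP` pass the bracket of the rational, the bracket of its numerator
    -- and the sign of the numerator; `denP` skips the numerator as a whole.
    numP denP : Proc 2
    numP = proc 1 (v2 ≔ adv v0 ▸ v2 ≔ call idxP (v2 ∷ []) ▸ v1 ≔ call nthP (v1 ∷ v2 ∷ []) ▸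
                   v1 ≔ adv v1 ▸ v1 ≔ adv v1 ▸ v1 ≔ adv v1) v1
    denP = proc 1 (v2 ≔ adv v0 ▸ v2 ≔ call idxP (v2 ∷ []) ▸ v1 ≔ call nthP (v1 ∷ v2 ∷ []) ▸
                   v1 ≔ adv v1 ▸ v1 ≔ call skipP (v1 ∷ [])) v1

    numP-def : numP ≡ proc 1 (v2 ≔ adv v0 ▸ v2 ≔ call idxP (v2 ∷ []) ▸ v1 ≔ call nthP (v1 ∷ v2 ∷ []) ▸
             v1 ≔ adv v1 ▸ v1 ≔ adv v1 ▸ v1 ≔ adv v1) v1
    numP-def = refl

    denP-def : denP ≡ proc 1 (v2 ≔ adv v0 ▸ v2 ≔ call idxP (v2 ∷ []) ▸ v1 ≔ call nthP (v1 ∷ v2 ∷ []) ▸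
             v1 ≔ adv v1 ▸ v1 ≔ call skipP (v1 ∷ [])) v1
    denP-def = refl

  plainCmd minusCmd : Cmd 9
  plainCmd = v6 ≔ call lenP (v8 ∷ v6 ∷ [])
  minusCmd = v7 ≔ call denP (v0 ∷ v4 ∷ []) ▸ v6 ≔ call diffP (v8 ∷ v7 ∷ v6 ∷ [])

  hitStart : Cmd 9
  hitStart = v7 ≔ adv v0 ▸ v7 ≔ call skipP (v7 ∷ []) ▸ v8 ≔ call numP (v0 ∷ v4 ∷ [])

  -- A positive literal is hit with probability p in a clause and 1 - p in a term, and conversely
  -- for a negative one. Over the denominator of p, the probability 1 - p has the numerator
  -- denominator minus numerator, whose length `minusCmd` computes.
  hitCmd : Bool → Cmd 9
  hitCmd b = hitStart ▸ ifs o0 v7 (if b then minusCmd else plainCmd) (if b then plainCmd else minusCmd)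

  gainStart : Cmd 9
  gainStart = v7 ≔ call denP (v0 ∷ v5 ∷ []) ▸ v6 ≔ call lenP (v7 ∷ v6 ∷ [])

  gainEnd : Bool → Cmd 9
  gainEnd b = v7 ≔ call (uP b) (v1 ∷ v3 ∷ v0 ∷ []) ▸ v6 ≔ call lgP (v7 ∷ v6 ∷ []) ▸
              v7 ≔ call (rP (not b)) (v2 ∷ v3 ∷ []) ▸ v6 ≔ call lgP (v7 ∷ v6 ∷ [])

  opaque
    -- The price is a fraction. The factors of its numerator, namely the numerator of the cost and
    -- the denominator of the probability, are measured here; those of its denominator are measured
    -- by `gainP`. Prices are compared by cross sums, a level plus the gain of the other literal, so
    -- that no negative logarithm appears.
    levelP : Proc 3
    levelP = proc 2 (v3 ≔ call numP (v0 ∷ v2 ∷ []) ▸ v4 ≔ call lenP (v3 ∷ v4 ∷ []) ▸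
                     v3 ≔ call denP (v0 ∷ v1 ∷ []) ▸ v4 ≔ call lenP (v3 ∷ v4 ∷ [])) v4

    -- Arguments: literal, its family, the other family, history, probabilities, costs.
    gainP : Bool → Proc 6
    gainP b = proc 3 (gainStart ▸ hitCmd b ▸ gainEnd b) v6

    levelP-def : levelP ≡ proc 2 (v3 ≔ call numP (v0 ∷ v2 ∷ []) ▸ v4 ≔ call lenP (v3 ∷ v4 ∷ []) ▸
             v3 ≔ call denP (v0 ∷ v1 ∷ []) ▸ v4 ≔ call lenP (v3 ∷ v4 ∷ [])) v4
    levelP-def = refl

    gainP-def : ∀ b → gainP b ≡ proc 3 (gainStart ▸ hitCmd b ▸ gainEnd b) v6
    gainP-def b = refl

  gainCall : ∀ {k} → Bool → Fin k → Fin k → Fin k → Fin k → Fin k → Fin k → Exp k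
  gainCall true  l a b h p c = call (gainP true) (l ∷ a ∷ b ∷ h ∷ p ∷ c ∷ [])
  gainCall false l a b h p c = call (gainP false) (l ∷ b ∷ a ∷ h ∷ p ∷ c ∷ [])

  leStart : Fin 11 → Cmd 11
  leStart x = v7 ≔ call numP (x ∷ v6 ∷ []) ▸ v7 ≔ adv v7

  -- A cost of 0 has an empty numeral and no logarithm. Such literals are recognised by their
  -- closing bracket and precede all others before any sum is formed.
  leSums leCompare leCmd : Bool → Bool → Cmd 11
  leSums b b' =
    v8 ≔ call levelP (v0 ∷ v5 ∷ v6 ∷ []) ▸ v9 ≔ gainCall b' v1 v2 v3 v4 v5 v6 ▸ v8 ≔ call addP (v8 ∷ v9 ∷ []) ▸
    v7 ≔ call levelP (v1 ∷ v5 ∷ v6 ∷ []) ▸ v9 ≔ gainCall b v0 v2 v3 v4 v5 v6 ▸ v7 ≔ call addP (v7 ∷ v9 ∷ []) ▸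
    v8 ≔ call subP (v8 ∷ v7 ∷ [])
  leCompare b b' = leSums b b' ▸ whenZ v8 (v10 ≔ inc v10)
  leCmd b b' = leStart v0 ▸ ifs rb v7 (v10 ≔ inc v10) (leStart v1 ▸ ifs rb v7 skip (leCompare b b'))

  opaque
    -- Arguments: two literals, clauses, terms, history, probabilities, costs.
    leP : Bool → Bool → Proc 7
    leP b b' = proc 4 (leCmd b b') v10

    leP-def : ∀ b b' → leP b b' ≡ proc 4 (leCmd b b') v10
    leP-def b b' = refl

  -- In `v7` the value 0 stands for no literal found so far; a pointer to a literal is never empty,
  -- so the two cannot be confused.
  consider : Bool → Cmd 9
  consider b = ifz v7 (v7 ≔ var v6) (v8 ≔ call (leP b b) (v6 ∷ v7 ∷ v0 ∷ v1 ∷ v2 ∷ v3 ∷ v4 ∷ []) ▸ unlessZ v8 (v7 ≔ var v6))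

  litRest litStep : Bool → Cmd 9
  litRest b = v8 ≔ call (hasP true) (v6 ∷ v2 ∷ []) ▸ whenZ v8 (consider b)
  litStep b = v8 ≔ call (hasP false) (v6 ∷ v2 ∷ []) ▸ whenZ v8 (litRest b)

  groupRest groupStep : Bool → Cmd 9
  groupRest b = v6 ≔ adv v5 ▸ each v6 (litStep b)
  groupStep b = v8 ≔ call (unresP b) (v5 ∷ v2 ∷ []) ▸ unlessZ v8 (groupRest b)

  opaque
    -- Arguments: clauses, terms, history, probabilities, costs.
    bestP : Bool → Proc 5
    bestP b = proc 4 (v5 ≔ (if b then adv v0 else adv v1) ▸ each v5 (groupStep b)) v7

    bestP-def : ∀ b → bestP b ≡ proc 4 (v5 ≔ (if b then adv v0 else adv v1) ▸ each v5 (groupStep b)) v7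
    bestP-def b = refl

  parseCmd countCmd bestCmd pickCmd chooseCmd : Cmd 11
  parseCmd = v0 ≔ adv v0 ▸ v1 ≔ call skipP (v0 ∷ []) ▸ v0 ≔ adv v0 ▸ v2 ≔ call skipP (v0 ∷ []) ▸ v3 ≔ call skipP (v2 ∷ []) ▸
             v4 ≔ call skipP (v3 ∷ []) ▸ v5 ≔ call skipP (v4 ∷ [])
  countCmd = v6 ≔ call (rP true) (v2 ∷ v1 ∷ []) ▸ v7 ≔ call (rP false) (v3 ∷ v1 ∷ [])
  bestCmd = v8 ≔ call (bestP true) (v2 ∷ v3 ∷ v1 ∷ v4 ∷ v5 ∷ []) ▸ v9 ≔ call (bestP false) (v2 ∷ v3 ∷ v1 ∷ v4 ∷ v5 ∷ [])
  pickCmd = ifz v8 (v8 ≔ var v9)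
              (unlessZ v9 (v10 ≔ call (leP true false) (v8 ∷ v9 ∷ v2 ∷ v3 ∷ v1 ∷ v4 ∷ v5 ∷ []) ▸ whenZ v10 (v8 ≔ var v9)))
  chooseCmd = bestCmd ▸ pickCmd ▸ v8 ≔ adv v8 ▸ v8 ≔ adv v8

  opaque
    frontCmd restCmd : Cmd 11
    frontCmd = parseCmd ▸ countCmd
    restCmd  = unlessZ v6 (unlessZ v7 chooseCmd)

    frontCmd-def : frontCmd ≡ parseCmd ▸ countCmd
    frontCmd-def = refl

    restCmd-def : restCmd ≡ unlessZ v6 (unlessZ v7 chooseCmd)
    restCmd-def = refl

  decideCmd : Cmd 11
  decideCmd = frontCmd ▸ restCmd

-- Encodings as words, skipping of brackets, and literal search.

module Words where

  open import Defs using (Sym; o0; o1; lb; rb; Literal; bits)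
  open Literal
  open Language hiding (var)
  open Programs
  open Machine using (Bits; []; o0∷_; o1∷_)
  open import Data.Nat using (ℕ; zero; suc; _+_; _*_; _∸_; _≤_; _<_; z≤n; s≤s; _<ᵇ_)
  open import Data.Nat.Properties
  open import Data.Nat.Binary.Base as B using (ℕᵇ; 2[1+_]; 1+[2_])
  open import Data.Bool using (Bool; true; false; if_then_else_; not; _∧_; _∨_; _xor_)
  open import Data.Bool.Properties using (∨-assoc; ∨-identityʳ)
  open import Data.Fin using (Fin; zero; suc; toℕ)
  open import Data.List using (List; []; _∷_; _++_; length)
  import Data.List.Properties as List
  open import Data.Vec using (Vec; []; _∷_; lookup)
  open import Data.Product using (Σ; _×_; _,_)
  open import Relation.Binary.PropositionalEquality using (_≡_; refl; sym; trans; cong; subst)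

  bits-Bits : ∀ x → Bits (bits x)
  bits-Bits B.zero   = []
  bits-Bits 2[1+ x ] = o1∷ bits-Bits x
  bits-Bits 1+[2 x ] = o0∷ bits-Bits x

  module _ {A : Set} (g : A → A) where

    iter-stable : ∀ n {a} → g a ≡ a → iter g n a ≡ a
    iter-stable zero e = refl
    iter-stable (suc n) e = trans (cong (iter g n) e) (iter-stable n e)

    iter-+ : ∀ m n {a} → iter g (m + n) a ≡ iter g n (iter g m a)
    iter-+ zero n = refl
    iter-+ (suc m) n = iter-+ m n

    -- Loops usually run for more rounds than needed; a fixed point absorbs the surplus.
    iter-reach : ∀ {m n a b} → m ≤ n → iter g m a ≡ b → g b ≡ b → iter g n a ≡ b
    iter-reach {m} {n} {a} le e st =
      trans (cong (λ z → iter g z a) (sym (m+[n∸m]≡n le)))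
        (trans (iter-+ m (n ∸ m)) (trans (cong (iter g (n ∸ m)) e) (iter-stable (n ∸ m) st)))

    iter-list : {I : Set} (Inv : List I → A → Set) → (∀ x xs a → Inv (x ∷ xs) a → Inv xs (g a)) →
                (∀ a → Inv [] a → g a ≡ a) → ∀ xs n a → length xs ≤ n → Inv xs a → Inv [] (iter g n a)
    iter-list Inv step stop [] n a le i = subst (Inv []) (sym (iter-stable n (stop a i))) i
    iter-list Inv step stop (x ∷ xs) (suc n) a (s≤s le) i = iter-list Inv step stop xs n (g a) le (step x xs a i)

  ≤*8 : ∀ {m n} → m ≤ n → m ≤ n * 8
  ≤*8 {m} {n} le = ≤-trans le (≤-trans (≤-reflexive (sym (*-identityʳ n))) (*-monoʳ-≤ n (s≤s z≤n)))

  -- Encodings as functions of the symbols that follow them.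
  Form : Set
  Form = List Sym → List Sym

  bracket : Form → Form
  bracket f r = lb ∷ f (rb ∷ r)

  opaque
    binary : ℕ → ℕᵇ
    binary = B.fromℕ

  numB : ℕ → List Sym
  numB m = bits (binary m)

  numW : ℕ → Form
  numW m = bracket (numB m ++_)

  sg : Bool → Sym
  sg false = o0
  sg true  = o1

  forms : {A : Set} → (A → Form) → List A → Form
  forms e []       r = r
  forms e (a ∷ as) r = e a (forms e as r)

  idxW : ∀ {n} → Fin n → Form
  idxW i = numW (toℕ i)

  litW : ∀ {n} → Literal n → Form
  litW ℓ = bracket (λ r → idxW (var ℓ) (sg (positive ℓ) ∷ r))

  groupW : ∀ {n} → List (Literal n) → Form
  groupW G = bracket (forms litW G)

  familyW : ∀ {n} → List (List (Literal n)) → Form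
  familyW F = bracket (forms groupW F)

  eqᵇ : ℕᵇ → ℕᵇ → Bool
  eqᵇ B.zero B.zero = true
  eqᵇ 2[1+ x ] 2[1+ y ] = eqᵇ x y
  eqᵇ 1+[2 x ] 1+[2 y ] = eqᵇ x y
  eqᵇ _ _ = false

  idxEq : ∀ {n} → Fin n → Fin n → Bool
  idxEq i j = eqᵇ (binary (toℕ i)) (binary (toℕ j))

  matches : ∀ {n} → Bool → Literal n → Literal n → Bool
  matches opp ℓ g = idxEq (var ℓ) (var g) ∧ (if positive ℓ xor positive g then opp else not opp)

  hasB : ∀ {n} → Bool → Literal n → List (Literal n) → Bool
  hasB opp ℓ []      = false
  hasB opp ℓ (g ∷ G) = matches opp ℓ g ∨ hasB opp ℓ G

  unresGo : ∀ {n} → Bool → List (Literal n) → List (Literal n) → List (Literal n) → Bool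
  unresGo b H G []      = true
  unresGo b H G (ℓ ∷ K) = (not (hasB true ℓ G) ∧ not (hasB (not b) ℓ H)) ∧ unresGo b H G K

  -- Neither tautological nor containing a literal hit by the history; the clauses (b = true) are
  -- hit by literals of the history, the terms (b = false) by complements of such literals.
  unresB : ∀ {n} → Bool → List (Literal n) → List (Literal n) → Bool
  unresB b H G = unresGo b H G G

  count : {A : Set} → (A → Bool) → List A → ℕ
  count f []       = 0
  count f (x ∷ xs) = (if f x then 1 else 0) + count f xs

  count≤ : ∀ {A : Set} (f : A → Bool) xs → count f xs ≤ length xs
  count≤ f [] = z≤n
  count≤ f (x ∷ xs) with f x
  ... | true  = s≤s (count≤ f xs)
  ... | false = m≤n⇒m≤1+n (count≤ f xs)

  rB : ∀ {n} → Bool → List (List (Literal n)) → List (Literal n) → ℕ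
  rB b F H = count (unresB b H) F

  uB : ∀ {n} → Bool → List (List (Literal n)) → List (Literal n) → Literal n → ℕ
  uB b F H ℓ = count (λ G → unresB b H G ∧ hasB false ℓ G) F

  module Specs (s₀ : Sym) (w' : List Sym) where

    w : List Sym
    w = s₀ ∷ w'

    open Semantics w public

    -- Satisfied by all parts of the input, with `cap` eight times as large. This is the only
    -- information about the input from which absence of saturation is derived.
    Fits : List Sym → Set
    Fits l = length l ≤ length w

    fits-cap : ∀ {m} → m ≤ length w → m ≤ cap
    fits-cap = ≤*8

    bv : Bool → V
    bv b = num (if b then 1 else 0)

    sat : ∀ {n} → n < cap → satSuc n ≡ suc n
    sat {n} l with n <ᵇ cap | <⇒<ᵇ {n} {cap} l
    ... | true | _ = refl

    -- Expresses that `f` is balanced: the scan crosses it in one step per symbol and returns to the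
    -- depth at which it started. The depth is bounded by requiring room for one increment per
    -- symbol, so the depth counter does not saturate on the way.
    Passes : Form → Set
    Passes f = ∀ r → Σ ℕ λ m → (m + length r ≡ length (f r)) ×
               (∀ d → suc d + length (f r) ≤ cap → iter ⟦ skipStep ⟧c m (cur (f r) ∷ num (suc d) ∷ []) ≡ cur r ∷ num (suc d) ∷ [])

    passes-longer : ∀ {f} → Passes f → ∀ r → length r ≤ length (f r)
    passes-longer p r = let (m , e , _) = p r in ≤-trans (m≤n+m (length r) m) (≤-reflexive e)

    passes-id : Passes (λ r → r)
    passes-id r = 0 , refl , λ d l → refl

    passes-∘ : ∀ {f g} → Passes f → Passes g → Passes (λ r → f (g r))
    passes-∘ {f} {g} pf pg r =
      let (m , e , h) = pf (g r)
          (m' , e' , h') = pg r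
      in m + m' , trans (+-assoc m m' (length r)) (trans (cong (m +_) e') e) ,
         λ d l → trans (iter-+ ⟦ skipStep ⟧c m m')
           (trans (cong (iter ⟦ skipStep ⟧c m') (h d l))
                  (h' d (≤-trans (+-monoʳ-≤ (suc d) (≤-trans (m≤n+m (length (g r)) m) (≤-reflexive e))) l)))

    passes-sg : ∀ b → Passes (sg b ∷_)
    passes-sg false r = 1 , refl , λ d l → refl
    passes-sg true r = 1 , refl , λ d l → refl

    passes-bits : ∀ {l} → Bits l → Passes (l ++_)
    passes-bits [] = passes-id
    passes-bits {o0 ∷ l} (o0∷ d) = passes-∘ {o0 ∷_} {l ++_} (passes-sg false) (passes-bits d)
    passes-bits {o1 ∷ l} (o1∷ d) = passes-∘ {o1 ∷_} {l ++_} (passes-sg true) (passes-bits d)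

    passes-bracket : ∀ {f} → Passes f → Passes (bracket f)
    passes-bracket {f} pf r =
      let (m , e , h) = pf (rb ∷ r)
      in suc (m + 1) , cong suc (trans (+-assoc m 1 (length r)) e) ,
         λ d l → let l' = ≤-trans (≤-reflexive (sym (+-suc (suc d) (length (f (rb ∷ r)))))) l in
         trans (cong (λ z → iter ⟦ skipStep ⟧c (m + 1) (cur (f (rb ∷ r)) ∷ num z ∷ [])) (sat (≤-trans (m≤m+n (suc (suc d)) _) l')))
           (trans (iter-+ ⟦ skipStep ⟧c m 1) (cong ⟦ skipStep ⟧c (h (suc d) l')))

    skip-ok : ∀ {f r} → Passes f → Fits (bracket f r) → ⟦ skipP ⟧p (cur (bracket f r) ∷ []) ≡ cur r
    skip-ok {f} {r} pf fits rewrite skipP-def =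
      let (m , e , h) = pf (rb ∷ r)
          le = ≤-trans (+-monoʳ-≤ m (s≤s z≤n)) (≤-reflexive e)
      in cong (λ ρ → lookup ρ zero) (iter-reach ⟦ skipStep ⟧c {m + 1} (≤*8 le) (trans (iter-+ ⟦ skipStep ⟧c m 1) (cong ⟦ skipStep ⟧c (h 0 (fits-cap fits)))) refl)

    record Enc (A : Set) : Set where
      field
        body   : A → Form
        passes : ∀ a → Passes (body a)

      item : A → Form
      item a = bracket (body a)

      passes-item : ∀ a → Passes (item a)
      passes-item a = passes-bracket (passes a)

      passes-items : ∀ as → Passes (forms item as)
      passes-items [] = passes-id
      passes-items (a ∷ as) = passes-∘ {item a} {forms item as} (passes-item a) (passes-items as)

      longer : ∀ as r → length as ≤ length (forms item as r)
      longer [] r = z≤n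
      longer (a ∷ as) r =
        s≤s (≤-trans (longer as r) (≤-trans (n≤1+n _) (passes-longer (passes a) (rb ∷ forms item as r))))

      fits-next : ∀ {a r} → Fits (item a r) → Fits r
      fits-next {a} {r} l = ≤-trans (passes-longer (passes-item a) r) l

      -- Inv as ρ: the items as are still to come.
      each-ok : ∀ {k} (x : Fin k) (c : Cmd k) (r : List Sym) (Inv : List A → Vec V k → Set) →
                (∀ as ρ → Inv as ρ → lookup ρ x ≡ cur (forms item as (rb ∷ r))) →
                (∀ a as ρ → Inv (a ∷ as) ρ → Inv as (⟦ c ▸ x ≔ call skipP (x ∷ []) ⟧c ρ)) →
                ∀ as ρ → Inv as ρ → Inv [] (⟦ each x c ⟧c ρ)
      each-ok x c r Inv pos step as ρ i =
        iter-list _ Inv step' stop as (size' (lookup ρ x)) ρ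
          (≤-trans (≤*8 (longer as (rb ∷ r))) (≤-reflexive (cong size' (sym (pos as ρ i))))) i
        where
          step' : ∀ a as ρ → Inv (a ∷ as) ρ → Inv as (⟦ ifs lb x (c ▸ x ≔ call skipP (x ∷ [])) skip ⟧c ρ)
          step' a as ρ i rewrite pos (a ∷ as) ρ i = step a as ρ i
          stop : ∀ ρ → Inv [] ρ → ⟦ ifs lb x (c ▸ x ≔ call skipP (x ∷ [])) skip ⟧c ρ ≡ ρ
          stop ρ i rewrite pos [] ρ i = refl

    passes-num : ∀ m → Passes (numW m)
    passes-num m = passes-bracket (passes-bits (bits-Bits (binary m)))

    module _ {n : ℕ} where

      litEnc : Enc (Literal n)
      litEnc = record { body = λ ℓ r → idxW (var ℓ) (sg (positive ℓ) ∷ r)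
                      ; passes = λ ℓ → passes-∘ {idxW (var ℓ)} {sg (positive ℓ) ∷_} (passes-num (toℕ (var ℓ))) (passes-sg (positive ℓ)) }

      groupEnc : Enc (List (Literal n))
      groupEnc = record { body = forms litW ; passes = Enc.passes-items litEnc }

      passes-family : ∀ (F : List (List (Literal n))) → Passes (forms groupW F)
      passes-family = Enc.passes-items groupEnc

    eqᵇ-run : ∀ x y r r' n → length (bits x) ≤ n →
              lookup (⟦ ifs rb v0 (ifs rb v1 (v2 ≔ inc v2) skip) skip ⟧c
                (iter ⟦ eqStep ⟧c n (cur (bits x ++ rb ∷ r) ∷ cur (bits y ++ rb ∷ r') ∷ num 0 ∷ []))) v2 ≡ bv (eqᵇ x y)
    eqᵇ-run B.zero B.zero r r' n l rewrite iter-stable ⟦ eqStep ⟧c n {cur (rb ∷ r) ∷ cur (rb ∷ r') ∷ num 0 ∷ []} refl = refl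
    eqᵇ-run B.zero 2[1+ y ] r r' n l rewrite iter-stable ⟦ eqStep ⟧c n {cur (rb ∷ r) ∷ cur (bits 2[1+ y ] ++ rb ∷ r') ∷ num 0 ∷ []} refl = refl
    eqᵇ-run B.zero 1+[2 y ] r r' n l rewrite iter-stable ⟦ eqStep ⟧c n {cur (rb ∷ r) ∷ cur (bits 1+[2 y ] ++ rb ∷ r') ∷ num 0 ∷ []} refl = refl
    eqᵇ-run 2[1+ x ] B.zero r r' n l rewrite iter-stable ⟦ eqStep ⟧c n {cur (bits 2[1+ x ] ++ rb ∷ r) ∷ cur (rb ∷ r') ∷ num 0 ∷ []} refl = refl
    eqᵇ-run 1+[2 x ] B.zero r r' n l rewrite iter-stable ⟦ eqStep ⟧c n {cur (bits 1+[2 x ] ++ rb ∷ r) ∷ cur (rb ∷ r') ∷ num 0 ∷ []} refl = refl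
    eqᵇ-run 2[1+ x ] 1+[2 y ] r r' n l rewrite iter-stable ⟦ eqStep ⟧c n {cur (bits 2[1+ x ] ++ rb ∷ r) ∷ cur (bits 1+[2 y ] ++ rb ∷ r') ∷ num 0 ∷ []} refl = refl
    eqᵇ-run 1+[2 x ] 2[1+ y ] r r' n l rewrite iter-stable ⟦ eqStep ⟧c n {cur (bits 1+[2 x ] ++ rb ∷ r) ∷ cur (bits 2[1+ y ] ++ rb ∷ r') ∷ num 0 ∷ []} refl = refl
    eqᵇ-run 2[1+ x ] 2[1+ y ] r r' (suc n) (s≤s l) = eqᵇ-run x y r r' n l
    eqᵇ-run 1+[2 x ] 1+[2 y ] r r' (suc n) (s≤s l) = eqᵇ-run x y r r' n l

    eq-ok : ∀ {n} (i j : Fin n) r r' → ⟦ eqP ⟧p (cur (numB (toℕ i) ++ rb ∷ r) ∷ cur (numB (toℕ j) ++ rb ∷ r') ∷ []) ≡ bv (idxEq i j)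
    eq-ok i j r r' rewrite eqP-def = eqᵇ-run (binary (toℕ i)) (binary (toℕ j)) r r' _
      (≤*8 (≤-trans (m≤m+n (length (numB (toℕ i))) _) (≤-reflexive (sym (List.length-++ (numB (toℕ i)))))))

    skip-num : ∀ m r → Fits (numW m r) → ⟦ skipP ⟧p (cur (numW m r) ∷ []) ≡ cur r
    skip-num m r = skip-ok (passes-bits (bits-Bits (binary m)))

    signs-ok : ∀ opp s t b {x₀ x₁ x₂ x₄ x₇ u u'} →
               ⟦ hasSigns opp ⟧c (x₀ ∷ x₁ ∷ x₂ ∷ cur (sg s ∷ u) ∷ x₄ ∷ cur (sg t ∷ u') ∷ bv b ∷ x₇ ∷ []) ≡
               x₀ ∷ x₁ ∷ x₂ ∷ cur (sg s ∷ u) ∷ x₄ ∷ cur (sg t ∷ u') ∷ bv (b ∨ (if s xor t then opp else not opp)) ∷ x₇ ∷ []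
    signs-ok false false false false = refl
    signs-ok false false false true = refl
    signs-ok false false true false = refl
    signs-ok false false true true = refl
    signs-ok false true false false = refl
    signs-ok false true false true = refl
    signs-ok false true true false = refl
    signs-ok false true true true = refl
    signs-ok true false false false = refl
    signs-ok true false false true = refl
    signs-ok true false true false = refl
    signs-ok true false true true = refl
    signs-ok true true false false = refl
    signs-ok true true false true = refl
    signs-ok true true true false = refl
    signs-ok true true true true = refl

    module Has {n} (opp : Bool) (ℓ : Literal n) (G : List (Literal n)) (r r' : List Sym)
               (fℓ : Fits (litW ℓ r)) (fG : Fits (groupW G r')) where

      idx sgn : List Sym
      sgn = sg (positive ℓ) ∷ rb ∷ r
      idx = numB (toℕ (var ℓ)) ++ rb ∷ sgn

      Inv : List (Literal n) → Vec V 8 → Set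
      Inv G' ρ = Σ Bool λ b → Σ V λ t4 → Σ V λ t5 → Σ V λ t7 →
        ρ ≡ cur (litW ℓ r) ∷ cur (forms litW G' (rb ∷ r')) ∷ cur idx ∷ cur sgn ∷ t4 ∷ t5 ∷ bv b ∷ t7 ∷ [] ×
        (b ∨ hasB opp ℓ G' ≡ hasB opp ℓ G) × Fits (forms litW G' (rb ∷ r'))

      pos : ∀ as ρ → Inv as ρ → lookup ρ v1 ≡ cur (forms litW as (rb ∷ r'))
      pos as ρ (_ , _ , _ , _ , refl , _) = refl

      start : Vec V 8
      start = ⟦ v3 ≔ adv v0 ▸ v2 ≔ adv v3 ▸ v3 ≔ call skipP (v3 ∷ []) ▸ v1 ≔ adv v1 ⟧c (cur (litW ℓ r) ∷ cur (groupW G r') ∷ num 0 ∷ num 0 ∷ num 0 ∷ num 0 ∷ num 0 ∷ num 0 ∷ [])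

      start-ok : Inv G start
      start-ok rewrite skip-num (toℕ (var ℓ)) sgn (<⇒≤ fℓ) = false , _ , _ , _ , refl , refl , <⇒≤ fG

      step : ∀ g G' ρ → Inv (g ∷ G') ρ → Inv G' (⟦ hasStep opp ▸ v1 ≔ call skipP (v1 ∷ []) ⟧c ρ)
      step g G' ρ (b , _ , _ , _ , refl , e , f)
        rewrite skip-num (toℕ (var g)) (sg (positive g) ∷ rb ∷ forms litW G' (rb ∷ r')) (<⇒≤ f)
              | eq-ok (var ℓ) (var g) sgn (sg (positive g) ∷ rb ∷ forms litW G' (rb ∷ r'))
        with idxEq (var ℓ) (var g)
      ... | false rewrite skip-ok {Enc.body litEnc g} {forms litW G' (rb ∷ r')} (Enc.passes litEnc g) f =
        b , _ , _ , _ , refl , e , Enc.fits-next litEnc {g} f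
      ... | true
        rewrite signs-ok opp (positive ℓ) (positive g) b {cur (litW ℓ r)} {cur (litW g (forms litW G' (rb ∷ r')))} {cur idx}
                  {cur (numB (toℕ (var g)) ++ rb ∷ sg (positive g) ∷ rb ∷ forms litW G' (rb ∷ r'))} {num 1} {rb ∷ r} {rb ∷ forms litW G' (rb ∷ r')}
              | skip-ok {Enc.body litEnc g} {forms litW G' (rb ∷ r')} (Enc.passes litEnc g) f =
        _ , _ , _ , _ , refl , trans (∨-assoc b _ _) e , Enc.fits-next litEnc {g} f

    has-ok : ∀ {n} opp (ℓ : Literal n) G r r' → Fits (litW ℓ r) → Fits (groupW G r') →
             ⟦ hasP opp ⟧p (cur (litW ℓ r) ∷ cur (groupW G r') ∷ []) ≡ bv (hasB opp ℓ G)
    has-ok opp ℓ G r r' fℓ fG rewrite hasP-def opp =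
      let open Has opp ℓ G r r' fℓ fG
          (b , _ , _ , _ , e , h , _) = Enc.each-ok litEnc v1 (hasStep opp) r' Inv pos step G start start-ok
      in trans (cong (λ ρ → lookup ρ v6) e) (cong bv (trans (sym (∨-identityʳ b)) h))

-- Counting unresolved groups.

module Counting where

  open import Defs using (Sym; rb; Literal)
  open Literal
  open Language hiding (var)
  open Programs
  open Words
  open import Data.Nat using (ℕ; suc; _+_; _≤_; _<_; s≤s)
  open import Data.Nat.Properties
  open import Data.Bool using (Bool; true; false; not; _∧_)
  open import Data.Bool.Properties using (∧-identityʳ)
  open import Data.Fin using (suc)
  open import Data.List using (List; []; _∷_; length)
  open import Data.Vec using (Vec; []; _∷_; lookup)
  open import Data.Product using (Σ; _×_; _,_)
  open import Relation.Binary.PropositionalEquality using (_≡_; refl; sym; trans; cong)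

  module CountingSpecs (s₀ : Sym) (w' : List Sym) where

    open Specs s₀ w' public

    module Unres {n} (b : Bool) (G H : List (Literal n)) (r r' : List Sym)
                 (fG : Fits (groupW G r)) (fH : Fits (groupW H r')) where

      Inv : List (Literal n) → Vec V 5 → Set
      Inv G' ρ = Σ Bool λ a → Σ V λ t →
        ρ ≡ cur (groupW G r) ∷ cur (groupW H r') ∷ cur (forms litW G' (rb ∷ r)) ∷ t ∷ bv a ∷ [] ×
        (a ∧ unresGo b H G G' ≡ unresGo b H G G) × Fits (forms litW G' (rb ∷ r))

      pos : ∀ as ρ → Inv as ρ → lookup ρ v2 ≡ cur (forms litW as (rb ∷ r))
      pos as ρ (_ , _ , refl , _) = refl

      step : ∀ g G' ρ → Inv (g ∷ G') ρ → Inv G' (⟦ unresStep b ▸ v2 ≔ call skipP (v2 ∷ []) ⟧c ρ)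
      step g G' ρ (a , t , refl , e , f)
        rewrite has-ok true g G (forms litW G' (rb ∷ r)) r f fG
        with hasB true g G
      ... | true
        rewrite has-ok (not b) g H (forms litW G' (rb ∷ r)) r' f fH
        with hasB (not b) g H
      ...   | true rewrite skip-ok {Enc.body litEnc g} {forms litW G' (rb ∷ r)} (Enc.passes litEnc g) f =
        false , _ , refl , trans (sym (a∧f a)) e , Enc.fits-next litEnc {g} f
        where
          a∧f : ∀ a → a ∧ false ≡ false
          a∧f false = refl
          a∧f true = refl
      ...   | false rewrite skip-ok {Enc.body litEnc g} {forms litW G' (rb ∷ r)} (Enc.passes litEnc g) f =
        false , _ , refl , trans (sym (a∧f a)) e , Enc.fits-next litEnc {g} f
        where
          a∧f : ∀ a → a ∧ false ≡ false
          a∧f false = refl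
          a∧f true = refl
      step g G' ρ (a , t , refl , e , f) | false
        rewrite has-ok (not b) g H (forms litW G' (rb ∷ r)) r' f fH
        with hasB (not b) g H
      ... | true rewrite skip-ok {Enc.body litEnc g} {forms litW G' (rb ∷ r)} (Enc.passes litEnc g) f =
        false , _ , refl , trans (sym (a∧f a)) e , Enc.fits-next litEnc {g} f
        where
          a∧f : ∀ a → a ∧ false ≡ false
          a∧f false = refl
          a∧f true = refl
      ... | false rewrite skip-ok {Enc.body litEnc g} {forms litW G' (rb ∷ r)} (Enc.passes litEnc g) f =
        a , _ , refl , e , Enc.fits-next litEnc {g} f

    unres-ok : ∀ {n} b (G H : List (Literal n)) r r' → Fits (groupW G r) → Fits (groupW H r') →
               ⟦ unresP b ⟧p (cur (groupW G r) ∷ cur (groupW H r') ∷ []) ≡ bv (unresB b H G)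
    unres-ok b G H r r' fG fH rewrite unresP-def b =
      let open Unres b G H r r' fG fH
          (a , _ , e , h , _) = Enc.each-ok litEnc v2 (unresStep b) r Inv pos step G _ (true , num 0 , refl , refl , <⇒≤ fG)
      in trans (cong (λ ρ → lookup ρ v4) e) (cong bv (trans (sym (∧-identityʳ a)) h))

    length-groups : ∀ {n} (F : List (List (Literal n))) r → length F ≤ length (forms groupW F r)
    length-groups = Enc.longer groupEnc

    module Remaining {n} (b : Bool) (F : List (List (Literal n))) (H : List (Literal n)) (r r' : List Sym)
                     (fF : Fits (familyW F r)) (fH : Fits (groupW H r')) where

      -- Every group occupies at least one symbol of the input, so a count of groups cannot
      -- saturate.
      small : length F < cap
      small = ≤-trans (s≤s (length-groups F (rb ∷ r))) (fits-cap fF)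

      bump : ∀ {m k l} → m + suc k ≡ l → l ≤ length F → satSuc m ≡ suc m
      bump {m} {k} e le = sat (≤-trans (s≤s (≤-trans (m≤m+n m (suc k)) (≤-trans (≤-reflexive e) le))) small)

      Inv : List (List (Literal n)) → Vec V 4 → Set
      Inv F' ρ = Σ ℕ λ m → Σ V λ t →
        ρ ≡ cur (forms groupW F' (rb ∷ r)) ∷ cur (groupW H r') ∷ num m ∷ t ∷ [] ×
        (m + rB b F' H ≡ rB b F H) × Fits (forms groupW F' (rb ∷ r))

      pos : ∀ as ρ → Inv as ρ → lookup ρ v0 ≡ cur (forms groupW as (rb ∷ r))
      pos as ρ (_ , _ , refl , _) = refl

      step : ∀ G F' ρ → Inv (G ∷ F') ρ → Inv F' (⟦ rStep b ▸ v0 ≔ call skipP (v0 ∷ []) ⟧c ρ)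
      step G F' ρ (m , t , refl , e , f)
        rewrite unres-ok b G H (forms groupW F' (rb ∷ r)) r' f fH
        with unresB b H G
      ... | false rewrite skip-ok {forms litW G} {forms groupW F' (rb ∷ r)} (Enc.passes groupEnc G) f =
        m , _ , refl , e , Enc.fits-next groupEnc {G} f
      ... | true rewrite bump {m} e (count≤ (unresB b H) F) | skip-ok {forms litW G} {forms groupW F' (rb ∷ r)} (Enc.passes groupEnc G) f =
        suc m , _ , refl , trans (sym (+-suc m _)) e , Enc.fits-next groupEnc {G} f

      result : ⟦ rP b ⟧p (cur (familyW F r) ∷ cur (groupW H r') ∷ []) ≡ num (rB b F H)
      result rewrite rP-def b =
        let (m , _ , e , h , _) = Enc.each-ok groupEnc v0 (rStep b) r Inv pos step F _ (0 , num 0 , refl , refl , <⇒≤ fF)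
        in trans (cong (λ ρ → lookup ρ v2) e) (cong num (trans (sym (+-identityʳ m)) h))

      module _ (ℓ : Literal n) (r'' : List Sym) (fℓ : Fits (litW ℓ r'')) where

        InvU : List (List (Literal n)) → Vec V 5 → Set
        InvU F' ρ = Σ ℕ λ m → Σ V λ t →
          ρ ≡ cur (forms groupW F' (rb ∷ r)) ∷ cur (groupW H r') ∷ cur (litW ℓ r'') ∷ num m ∷ t ∷ [] ×
          (m + uB b F' H ℓ ≡ uB b F H ℓ) × Fits (forms groupW F' (rb ∷ r))

        posU : ∀ as ρ → InvU as ρ → lookup ρ v0 ≡ cur (forms groupW as (rb ∷ r))
        posU as ρ (_ , _ , refl , _) = refl

        stepU : ∀ G F' ρ → InvU (G ∷ F') ρ → InvU F' (⟦ uStep b ▸ v0 ≔ call skipP (v0 ∷ []) ⟧c ρ)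
        stepU G F' ρ (m , t , refl , e , f)
          rewrite unres-ok b G H (forms groupW F' (rb ∷ r)) r' f fH
          with unresB b H G
        ... | false rewrite skip-ok {forms litW G} {forms groupW F' (rb ∷ r)} (Enc.passes groupEnc G) f =
          m , _ , refl , e , Enc.fits-next groupEnc {G} f
        ... | true rewrite has-ok false ℓ G r'' (forms groupW F' (rb ∷ r)) fℓ f with hasB false ℓ G
        ...   | false rewrite skip-ok {forms litW G} {forms groupW F' (rb ∷ r)} (Enc.passes groupEnc G) f =
          m , _ , refl , e , Enc.fits-next groupEnc {G} f
        ...   | true rewrite bump {m} e (count≤ (λ G → unresB b H G ∧ hasB false ℓ G) F) | skip-ok {forms litW G} {forms groupW F' (rb ∷ r)} (Enc.passes groupEnc G) f =
          suc m , _ , refl , trans (sym (+-suc m _)) e , Enc.fits-next groupEnc {G} f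

        resultU : ⟦ uP b ⟧p (cur (familyW F r) ∷ cur (groupW H r') ∷ cur (litW ℓ r'') ∷ []) ≡ num (uB b F H ℓ)
        resultU rewrite uP-def b =
          let (m , _ , e , h , _) = Enc.each-ok groupEnc v0 (uStep b) r InvU posU stepU F _ (0 , num 0 , refl , refl , <⇒≤ fF)
          in trans (cong (λ ρ → lookup ρ v3) e) (cong num (trans (sym (+-identityʳ m)) h))

-- Numerals: lengths, halving, subtraction, and access to the rationals.

module Numerals where

  open import Defs using (Sym; o0; o1; rb; Literal; bits)
  open Literal
  open Language hiding (var)
  open Programs
  open Words
  open Machine using (Bits; []; o0∷_; o1∷_)
  open import Data.Nat using (ℕ; zero; suc; _+_; _*_; _∸_; _≤_; _<_; z≤n; s≤s; ⌊_/2⌋; pred)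
  open import Data.Nat.Properties
  open import Data.Nat.Binary.Base as B using (ℕᵇ; 2[1+_]; 1+[2_])
  open import Data.Nat.Binary.Properties using (toℕ-fromℕ)
  open import Data.Integer using (ℤ; +_; -[1+_])
  open import Data.Rational using (ℚ; ↥_; ↧ₙ_)
  open import Data.Bool using (true; false)
  open import Data.Fin using (Fin; zero; suc; toℕ)
  open import Data.List using (List; []; _∷_; _++_; length)
  import Data.List.Properties as List
  open import Data.Vec using (Vec; []; _∷_; lookup)
  open import Data.Product using (Σ; _×_; _,_; proj₁; proj₂)
  open import Relation.Binary.PropositionalEquality using (_≡_; refl; sym; trans; cong; subst)

  intW : ℤ → Form
  intW (+ m)    = bracket (λ r → o0 ∷ numW m r)
  intW -[1+ m ] = bracket (λ r → o1 ∷ numW m r)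

  ratW : ℚ → Form
  ratW q = bracket (λ r → intW (↥ q) (numW (↧ₙ q) r))

  vecW : ∀ {n} → Vec ℚ n → Form
  vecW []       = bracket (λ r → r)
  vecW (q ∷ qs) = bracket (λ r → ratW q (vecW qs r))

  par : ℕ → ℕ
  par 0             = 0
  par 1             = 1
  par (suc (suc n)) = par n

  -- Binary length by repeated halving; the first argument is fuel.
  blF : ℕ → ℕ → ℕ
  blF zero    n       = 0
  blF (suc f) zero    = blF f zero
  blF (suc f) (suc n) = suc (blF f ⌊ suc n /2⌋)

  bl : ℕ → ℕ
  bl n = blF n n

  blF≤ : ∀ f n → blF f n ≤ f
  blF≤ zero n = z≤n
  blF≤ (suc f) zero = m≤n⇒m≤1+n (blF≤ f zero)
  blF≤ (suc f) (suc n) = s≤s (blF≤ f ⌊ suc n /2⌋)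

  topOf : ℕ → ℕ → ℕ → ℕ
  topOf zero    p t = t
  topOf (suc _) p t = p

  -- Digitwise subtraction: minuend second; C is the carry plus one.
  diffD : ℕᵇ → ℕᵇ → ℕ → ℕ → ℕ → ℕ × ℕ × ℕ
  diffD a B.zero C p t = C , p , t
  diffD B.zero 1+[2 b ] C p t = diffD B.zero b ⌊ 2 + C /2⌋ (suc p) (topOf (par (2 + C)) (suc p) t)
  diffD 1+[2 a ] 1+[2 b ] C p t = diffD a b ⌊ 1 + C /2⌋ (suc p) (topOf (par (1 + C)) (suc p) t)
  diffD 2[1+ a ] 1+[2 b ] C p t = diffD a b ⌊ C /2⌋ (suc p) (topOf (par C) (suc p) t)
  diffD B.zero 2[1+ b ] C p t = diffD B.zero b ⌊ 3 + C /2⌋ (suc p) (topOf (par (3 + C)) (suc p) t)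
  diffD 1+[2 a ] 2[1+ b ] C p t = diffD a b ⌊ 2 + C /2⌋ (suc p) (topOf (par (2 + C)) (suc p) t)
  diffD 2[1+ a ] 2[1+ b ] C p t = diffD a b ⌊ 1 + C /2⌋ (suc p) (topOf (par (1 + C)) (suc p) t)

  diffRes : ℕ × ℕ × ℕ → ℕ
  diffRes (C , p , t) = topOf (pred C) (suc p) t

  pos≤ : ∀ a b C p t → proj₁ (proj₂ (diffD a b C p t)) ≤ p + length (bits b)
  pos≤ a B.zero C p t = m≤m+n p 0
  pos≤ B.zero 1+[2 b ] C p t = ≤-trans (pos≤ B.zero b _ (suc p) _) (≤-reflexive (sym (+-suc p (length (bits b)))))
  pos≤ 1+[2 a ] 1+[2 b ] C p t = ≤-trans (pos≤ a b _ (suc p) _) (≤-reflexive (sym (+-suc p (length (bits b)))))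
  pos≤ 2[1+ a ] 1+[2 b ] C p t = ≤-trans (pos≤ a b _ (suc p) _) (≤-reflexive (sym (+-suc p (length (bits b)))))
  pos≤ B.zero 2[1+ b ] C p t = ≤-trans (pos≤ B.zero b _ (suc p) _) (≤-reflexive (sym (+-suc p (length (bits b)))))
  pos≤ 1+[2 a ] 2[1+ b ] C p t = ≤-trans (pos≤ a b _ (suc p) _) (≤-reflexive (sym (+-suc p (length (bits b)))))
  pos≤ 2[1+ a ] 2[1+ b ] C p t = ≤-trans (pos≤ a b _ (suc p) _) (≤-reflexive (sym (+-suc p (length (bits b)))))

  topOf≤ : ∀ x {p t} → t ≤ p → topOf x (suc p) t ≤ suc p
  topOf≤ zero    l = m≤n⇒m≤1+n l
  topOf≤ (suc x) l = ≤-refl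

  top≤ : ∀ a b C p t → t ≤ p → proj₂ (proj₂ (diffD a b C p t)) ≤ proj₁ (proj₂ (diffD a b C p t))
  top≤ a B.zero C p t l = l
  top≤ B.zero 1+[2 b ] C p t l = top≤ B.zero b _ (suc p) _ (topOf≤ (par (2 + C)) l)
  top≤ 1+[2 a ] 1+[2 b ] C p t l = top≤ a b _ (suc p) _ (topOf≤ (par (1 + C)) l)
  top≤ 2[1+ a ] 1+[2 b ] C p t l = top≤ a b _ (suc p) _ (topOf≤ (par (C)) l)
  top≤ B.zero 2[1+ b ] C p t l = top≤ B.zero b _ (suc p) _ (topOf≤ (par (3 + C)) l)
  top≤ 1+[2 a ] 2[1+ b ] C p t l = top≤ a b _ (suc p) _ (topOf≤ (par (2 + C)) l)
  top≤ 2[1+ a ] 2[1+ b ] C p t l = top≤ a b _ (suc p) _ (topOf≤ (par (1 + C)) l)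

  diffRes≤ : ∀ a b k → diffRes (diffD a b 1 k k) ≤ k + suc (length (bits b))
  diffRes≤ a b k = ≤-trans (topOf≤ (pred (proj₁ (diffD a b 1 k k))) (top≤ a b 1 k k ≤-refl))
    (≤-trans (s≤s (pos≤ a b 1 k k)) (≤-reflexive (sym (+-suc k (length (bits b))))))

  module NumeralSpecs (s₀ : Sym) (w' : List Sym) where

    open Specs s₀ w'

    len-run : ∀ {l} → Bits l → ∀ r c → c + length l ≤ cap →
              iter ⟦ lenStep ⟧c (length l) (cur (l ++ rb ∷ r) ∷ num c ∷ []) ≡ cur (rb ∷ r) ∷ num (c + length l) ∷ []
    len-run [] r c le = cong (λ z → cur (rb ∷ r) ∷ num z ∷ []) (sym (+-identityʳ c))
    len-run {o0 ∷ l} (o0∷ d) r c le rewrite sat {c} (≤-trans (≤-trans (s≤s (m≤m+n c (length l))) (≤-reflexive (sym (+-suc c (length l))))) le) =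
      trans (len-run d r (suc c) (≤-trans (≤-reflexive (sym (+-suc c (length l)))) le)) (cong (λ z → cur (rb ∷ r) ∷ num z ∷ []) (sym (+-suc c (length l))))
    len-run {o1 ∷ l} (o1∷ d) r c le rewrite sat {c} (≤-trans (≤-trans (s≤s (m≤m+n c (length l))) (≤-reflexive (sym (+-suc c (length l))))) le) =
      trans (len-run d r (suc c) (≤-trans (≤-reflexive (sym (+-suc c (length l)))) le)) (cong (λ z → cur (rb ∷ r) ∷ num z ∷ []) (sym (+-suc c (length l))))

    numB≤ : ∀ m r → length (numB m) ≤ length (numB m ++ rb ∷ r)
    numB≤ m r = ≤-trans (m≤m+n (length (numB m)) _) (≤-reflexive (sym (List.length-++ (numB m))))

    fits-num : ∀ {m r} → Fits (numW m r) → suc (length (numB m)) ≤ length w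
    fits-num {m} {r} f = ≤-trans (s≤s (numB≤ m r)) f

    len-ok : ∀ m r c → c + length (numB m) ≤ cap → ⟦ lenP ⟧p (cur (numW m r) ∷ num c ∷ []) ≡ num (c + length (numB m))
    len-ok m r c le rewrite lenP-def =
      cong (λ ρ → lookup ρ v1) (iter-reach ⟦ lenStep ⟧c {length (numB m)} (≤*8 (numB≤ m r)) (len-run (bits-Bits (binary m)) r c le) refl)

    add-run : ∀ b a {x} → a + b ≤ cap → iter ⟦ addStep ⟧c b (num a ∷ x ∷ []) ≡ num (a + b) ∷ x ∷ []
    add-run zero a {x} le = cong (λ z → num z ∷ x ∷ []) (sym (+-identityʳ a))
    add-run (suc b) a {x} le rewrite sat {a} (≤-trans (≤-trans (s≤s (m≤m+n a b)) (≤-reflexive (sym (+-suc a b)))) le) =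
      trans (add-run b (suc a) (≤-trans (≤-reflexive (sym (+-suc a b))) le)) (cong (λ z → num z ∷ x ∷ []) (sym (+-suc a b)))

    add-ok : ∀ a b → a + b ≤ cap → ⟦ addP ⟧p (num a ∷ num b ∷ []) ≡ num (a + b)
    add-ok a b le rewrite addP-def = cong (λ ρ → lookup ρ v0) (add-run b a {num b} le)

    sub-run : ∀ b a {x} → iter ⟦ subStep ⟧c b (num a ∷ x ∷ []) ≡ num (a ∸ b) ∷ x ∷ []
    sub-run zero a = refl
    sub-run (suc b) zero {x} = trans (sub-run b 0) (cong (λ z → num z ∷ x ∷ []) (0∸n≡0 b))
    sub-run (suc b) (suc a) = sub-run b a

    sub-ok : ∀ a b → ⟦ subP ⟧p (num a ∷ num b ∷ []) ≡ num (a ∸ b)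
    sub-ok a b rewrite subP-def = cong (λ ρ → lookup ρ v0) (sub-run b a {num b})

    half-run : ∀ m n h → n ≤ m → h + n ≤ cap → iter ⟦ halfStep ⟧c m (num n ∷ num h ∷ []) ≡ num 0 ∷ num (h + ⌊ n /2⌋) ∷ []
    half-run m zero h l le rewrite iter-stable ⟦ halfStep ⟧c m {num 0 ∷ num h ∷ []} refl = cong (λ z → num 0 ∷ num z ∷ []) (sym (+-identityʳ h))
    half-run (suc m) 1 h l le rewrite iter-stable ⟦ halfStep ⟧c m {num 0 ∷ num h ∷ []} refl = cong (λ z → num 0 ∷ num z ∷ []) (sym (+-identityʳ h))
    half-run (suc m) (suc (suc n)) h (s≤s l) le rewrite sat {h} (≤-trans (≤-trans (s≤s (m≤m+n h (suc n))) (≤-reflexive (sym (+-suc h (suc n))))) le) =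
      trans (half-run m n (suc h) (<⇒≤ l) (≤-trans (≤-trans (≤-reflexive (sym (+-suc h n))) (+-monoʳ-≤ h (n≤1+n (suc n)))) le))
        (cong (λ z → num 0 ∷ num z ∷ []) (sym (+-suc h ⌊ n /2⌋)))

    half-ok : ∀ n → n ≤ cap → ⟦ halfP ⟧p (num n ∷ []) ≡ num ⌊ n /2⌋
    half-ok n le rewrite halfP-def = cong (λ ρ → lookup ρ v1) (half-run n n 0 ≤-refl le)

    parity-run : ∀ n {x} → iter ⟦ parityStep ⟧c n (x ∷ num 0 ∷ []) ≡ x ∷ num (par n) ∷ []
    parity-run 0 = refl
    parity-run 1 = refl
    parity-run (suc (suc n)) = parity-run n

    parity-ok : ∀ n → ⟦ parityP ⟧p (num n ∷ []) ≡ num (par n)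
    parity-ok n rewrite parityP-def = cong (λ ρ → lookup ρ v1) (parity-run n {num n})

    lg-run : ∀ f n c → n ≤ cap → c + f ≤ cap → lookup (iter ⟦ lgStep ⟧c f (num n ∷ num c ∷ [])) v1 ≡ num (c + blF f n)
    lg-run zero n c ln le = cong num (sym (+-identityʳ c))
    lg-run (suc f) zero c ln le = lg-run f zero c ln (≤-trans (+-monoʳ-≤ c (n≤1+n f)) le)
    lg-run (suc f) (suc n) c ln le
      rewrite sat {c} (≤-trans (≤-trans (s≤s (m≤m+n c f)) (≤-reflexive (sym (+-suc c f)))) le) | half-ok (suc n) ln =
      trans (lg-run f ⌊ suc n /2⌋ (suc c) (≤-trans (⌊n/2⌋≤n (suc n)) ln) (≤-trans (≤-reflexive (sym (+-suc c f))) le))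
        (cong num (sym (+-suc c (blF f ⌊ suc n /2⌋))))

    lg-ok : ∀ n c → c + n ≤ cap → ⟦ lgP ⟧p (num n ∷ num c ∷ []) ≡ num (c + bl n)
    lg-ok n c le rewrite lgP-def = lg-run n n c (≤-trans (m≤n+m n c) le) le

    half≤2 : ∀ {s} → s ≤ 5 → ⌊ s /2⌋ ≤ 2
    half≤2 l = ⌊n/2⌋-mono l

    5≤cap : 5 ≤ cap
    5≤cap = s≤s (s≤s (s≤s (s≤s (s≤s z≤n))))

    top-cmd : ∀ q {x₀ x₁ x₂ x₃ p t x₆} →
      ⟦ unlessZ v7 (v5 ≔ Language.var v4) ⟧c (x₀ ∷ x₁ ∷ x₂ ∷ x₃ ∷ num p ∷ num t ∷ x₆ ∷ num q ∷ []) ≡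
      x₀ ∷ x₁ ∷ x₂ ∷ x₃ ∷ num p ∷ num (topOf q p t) ∷ x₆ ∷ num q ∷ []
    top-cmd zero = refl
    top-cmd (suc q) = refl

    diff-tail-ok : ∀ s p {x₀ x l x₂ x₃ t x₇} → s ≤ 5 → p < cap →
      ⟦ diffTail ⟧c (x₀ ∷ cur (x ∷ l) ∷ x₂ ∷ x₃ ∷ num p ∷ num t ∷ num s ∷ x₇ ∷ []) ≡
      x₀ ∷ cur l ∷ x₂ ∷ num ⌊ s /2⌋ ∷ num (suc p) ∷ num (topOf (par s) (suc p) t) ∷ num s ∷ num (par s) ∷ []
    diff-tail-ok s p {x₀} {x} {l} {x₂} {x₃} {t} ls lp
      rewrite sat {p} lp | half-ok s (≤-trans ls 5≤cap) | parity-ok s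
            | top-cmd (par s) {x₀} {cur (x ∷ l)} {x₂} {num ⌊ s /2⌋} {suc p} {t} {num s} = refl

    record DiffEnd (ρ : Vec V 8) (res : ℕ × ℕ × ℕ) : Set where
      constructor diffEnd
      field
        x₀ x₁ x₂ x₆ x₇ : V
        shape : ρ ≡ x₀ ∷ x₁ ∷ x₂ ∷ num (proj₁ res) ∷ num (proj₁ (proj₂ res)) ∷ num (proj₂ (proj₂ res)) ∷ x₆ ∷ x₇ ∷ []

    module _ (C : ℕ) (lC : C ≤ 2) where

      sat0 : satSuc C ≡ suc C
      sat0 = sat (≤-trans (s≤s lC) (≤-trans (s≤s (s≤s (s≤s z≤n))) 5≤cap))

      sat1 : satSuc (suc C) ≡ 2 + C
      sat1 = sat (≤-trans (s≤s (s≤s lC)) (≤-trans (s≤s (s≤s (s≤s (s≤s z≤n)))) 5≤cap))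

      sat2 : satSuc (2 + C) ≡ 3 + C
      sat2 = sat (≤-trans (s≤s (s≤s (s≤s lC))) 5≤cap)

      digits01 : ∀ {u v x₂ p t x₆ x₇} →
        ⟦ diffDigits ⟧c (cur (rb ∷ u) ∷ cur (o0 ∷ v) ∷ x₂ ∷ num C ∷ num p ∷ num t ∷ x₆ ∷ x₇ ∷ []) ≡
        cur (rb ∷ u) ∷ cur (o0 ∷ v) ∷ x₂ ∷ num C ∷ num p ∷ num t ∷ num (2 + C) ∷ x₇ ∷ []
      digits01 rewrite sat0 | sat1 = refl

      digits11 : ∀ {u v x₂ p t x₆ x₇} →
        ⟦ diffDigits ⟧c (cur (o0 ∷ u) ∷ cur (o0 ∷ v) ∷ x₂ ∷ num C ∷ num p ∷ num t ∷ x₆ ∷ x₇ ∷ []) ≡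
        cur u ∷ cur (o0 ∷ v) ∷ x₂ ∷ num C ∷ num p ∷ num t ∷ num (1 + C) ∷ x₇ ∷ []
      digits11 rewrite sat0 | sat1 = refl

      digits21 : ∀ {u v x₂ p t x₆ x₇} →
        ⟦ diffDigits ⟧c (cur (o1 ∷ u) ∷ cur (o0 ∷ v) ∷ x₂ ∷ num C ∷ num p ∷ num t ∷ x₆ ∷ x₇ ∷ []) ≡
        cur u ∷ cur (o0 ∷ v) ∷ x₂ ∷ num C ∷ num p ∷ num t ∷ num (C) ∷ x₇ ∷ []
      digits21 rewrite sat0 | sat1 = refl

      digits02 : ∀ {u v x₂ p t x₆ x₇} →
        ⟦ diffDigits ⟧c (cur (rb ∷ u) ∷ cur (o1 ∷ v) ∷ x₂ ∷ num C ∷ num p ∷ num t ∷ x₆ ∷ x₇ ∷ []) ≡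
        cur (rb ∷ u) ∷ cur (o1 ∷ v) ∷ x₂ ∷ num C ∷ num p ∷ num t ∷ num (3 + C) ∷ x₇ ∷ []
      digits02 rewrite sat0 | sat1 | sat2 = refl

      digits12 : ∀ {u v x₂ p t x₆ x₇} →
        ⟦ diffDigits ⟧c (cur (o0 ∷ u) ∷ cur (o1 ∷ v) ∷ x₂ ∷ num C ∷ num p ∷ num t ∷ x₆ ∷ x₇ ∷ []) ≡
        cur u ∷ cur (o1 ∷ v) ∷ x₂ ∷ num C ∷ num p ∷ num t ∷ num (2 + C) ∷ x₇ ∷ []
      digits12 rewrite sat0 | sat1 | sat2 = refl

      digits22 : ∀ {u v x₂ p t x₆ x₇} →
        ⟦ diffDigits ⟧c (cur (o1 ∷ u) ∷ cur (o1 ∷ v) ∷ x₂ ∷ num C ∷ num p ∷ num t ∷ x₆ ∷ x₇ ∷ []) ≡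
        cur u ∷ cur (o1 ∷ v) ∷ x₂ ∷ num C ∷ num p ∷ num t ∷ num (1 + C) ∷ x₇ ∷ []
      digits22 rewrite sat0 | sat1 | sat2 = refl

    room : ∀ p b → p + suc (length (bits b)) ≤ cap → p < cap
    room p b lp = ≤-trans (≤-trans (s≤s (m≤m+n p _)) (≤-reflexive (sym (+-suc p (length (bits b)))))) lp

    diff-run : ∀ a b {r r' x₂ x₆ x₇} C p t n → C ≤ 2 → p + length (bits b) ≤ cap → length (bits b) ≤ n →
               DiffEnd (iter ⟦ diffStep ⟧c n (cur (bits a ++ rb ∷ r) ∷ cur (bits b ++ rb ∷ r') ∷ x₂ ∷ num C ∷ num p ∷ num t ∷ x₆ ∷ x₇ ∷ [])) (diffD a b C p t)
    diff-run a B.zero {r} {r'} {x₂} {x₆} {x₇} C p t n lC lp ln =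
      diffEnd _ _ _ _ _ (iter-stable ⟦ diffStep ⟧c n refl)
    diff-run B.zero 1+[2 b ] {r} {r'} {x₂} {x₆} {x₇} C p t (suc n) lC lp (s≤s ln) =
      subst (λ ρ → DiffEnd (iter ⟦ diffStep ⟧c n ρ) (diffD B.zero 1+[2 b ] C p t))
        (sym (trans (cong ⟦ diffTail ⟧c (digits01 C lC {p = p} {x₆ = x₆} {x₇ = x₇})) (diff-tail-ok (2 + C) p {x₃ = num C} {x₇ = x₇} (s≤s (s≤s (≤-trans lC (s≤s (s≤s z≤n))))) (room p b lp))))
        (diff-run B.zero b _ _ _ n (half≤2 (s≤s (s≤s (≤-trans lC (s≤s (s≤s z≤n)))))) (≤-trans (≤-reflexive (sym (+-suc p (length (bits b))))) lp) ln)
    diff-run 1+[2 a ] 1+[2 b ] {r} {r'} {x₂} {x₆} {x₇} C p t (suc n) lC lp (s≤s ln) =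
      subst (λ ρ → DiffEnd (iter ⟦ diffStep ⟧c n ρ) (diffD 1+[2 a ] 1+[2 b ] C p t))
        (sym (trans (cong ⟦ diffTail ⟧c (digits11 C lC {p = p} {x₆ = x₆} {x₇ = x₇})) (diff-tail-ok (1 + C) p {x₃ = num C} {x₇ = x₇} (s≤s (≤-trans lC (s≤s (s≤s z≤n)))) (room p b lp))))
        (diff-run a b _ _ _ n (half≤2 (s≤s (≤-trans lC (s≤s (s≤s z≤n))))) (≤-trans (≤-reflexive (sym (+-suc p (length (bits b))))) lp) ln)
    diff-run 2[1+ a ] 1+[2 b ] {r} {r'} {x₂} {x₆} {x₇} C p t (suc n) lC lp (s≤s ln) =
      subst (λ ρ → DiffEnd (iter ⟦ diffStep ⟧c n ρ) (diffD 2[1+ a ] 1+[2 b ] C p t))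
        (sym (trans (cong ⟦ diffTail ⟧c (digits21 C lC {p = p} {x₆ = x₆} {x₇ = x₇})) (diff-tail-ok C p {x₃ = num C} {x₇ = x₇} (≤-trans lC (s≤s (s≤s z≤n))) (room p b lp))))
        (diff-run a b _ _ _ n (half≤2 (≤-trans lC (s≤s (s≤s z≤n)))) (≤-trans (≤-reflexive (sym (+-suc p (length (bits b))))) lp) ln)
    diff-run B.zero 2[1+ b ] {r} {r'} {x₂} {x₆} {x₇} C p t (suc n) lC lp (s≤s ln) =
      subst (λ ρ → DiffEnd (iter ⟦ diffStep ⟧c n ρ) (diffD B.zero 2[1+ b ] C p t))
        (sym (trans (cong ⟦ diffTail ⟧c (digits02 C lC {p = p} {x₆ = x₆} {x₇ = x₇})) (diff-tail-ok (3 + C) p {x₃ = num C} {x₇ = x₇} (s≤s (s≤s (s≤s lC))) (room p b lp))))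
        (diff-run B.zero b _ _ _ n (half≤2 (s≤s (s≤s (s≤s lC)))) (≤-trans (≤-reflexive (sym (+-suc p (length (bits b))))) lp) ln)
    diff-run 1+[2 a ] 2[1+ b ] {r} {r'} {x₂} {x₆} {x₇} C p t (suc n) lC lp (s≤s ln) =
      subst (λ ρ → DiffEnd (iter ⟦ diffStep ⟧c n ρ) (diffD 1+[2 a ] 2[1+ b ] C p t))
        (sym (trans (cong ⟦ diffTail ⟧c (digits12 C lC {p = p} {x₆ = x₆} {x₇ = x₇})) (diff-tail-ok (2 + C) p {x₃ = num C} {x₇ = x₇} (s≤s (s≤s (≤-trans lC (s≤s (s≤s z≤n))))) (room p b lp))))
        (diff-run a b _ _ _ n (half≤2 (s≤s (s≤s (≤-trans lC (s≤s (s≤s z≤n)))))) (≤-trans (≤-reflexive (sym (+-suc p (length (bits b))))) lp) ln)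
    diff-run 2[1+ a ] 2[1+ b ] {r} {r'} {x₂} {x₆} {x₇} C p t (suc n) lC lp (s≤s ln) =
      subst (λ ρ → DiffEnd (iter ⟦ diffStep ⟧c n ρ) (diffD 2[1+ a ] 2[1+ b ] C p t))
        (sym (trans (cong ⟦ diffTail ⟧c (digits22 C lC {p = p} {x₆ = x₆} {x₇ = x₇})) (diff-tail-ok (1 + C) p {x₃ = num C} {x₇ = x₇} (s≤s (≤-trans lC (s≤s (s≤s z≤n)))) (room p b lp))))
        (diff-run a b _ _ _ n (half≤2 (s≤s (≤-trans lC (s≤s (s≤s z≤n))))) (≤-trans (≤-reflexive (sym (+-suc p (length (bits b))))) lp) ln)

    diff-ok : ∀ a b c r r' → c + suc (length (numB b)) ≤ cap →
              ⟦ diffP ⟧p (cur (numW a r) ∷ cur (numW b r') ∷ num c ∷ []) ≡ num (diffRes (diffD (binary a) (binary b) 1 c c))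
    diff-ok a b c r r' le =
      let run = diff-run (binary a) (binary b) {r} {r'} {num c} {num 0} {num 0} 1 c c (length (numB b ++ rb ∷ r') * 8) (s≤s z≤n) (≤-trans (+-monoʳ-≤ c (n≤1+n _)) le) (≤*8 (numB≤ b r'))
      in trans (cong (λ P → ⟦ P ⟧p (cur (numW a r) ∷ cur (numW b r') ∷ num c ∷ [])) diffP-def)
           (trans (cong (λ ρ → lookup (⟦ diffLast ⟧c ρ) v5) (DiffEnd.shape run))
             (last (diffD (binary a) (binary b) 1 c c) (≤-trans (≤-reflexive (sym (+-suc c _))) le) (pos≤ (binary a) (binary b) 1 c c)))
      where
        last : ∀ res {m x₀ x₁ x₂ x₆ x₇} → suc m ≤ cap → proj₁ (proj₂ res) ≤ m →
               lookup (⟦ diffLast ⟧c (x₀ ∷ x₁ ∷ x₂ ∷ num (proj₁ res) ∷ num (proj₁ (proj₂ res)) ∷ num (proj₂ (proj₂ res)) ∷ x₆ ∷ x₇ ∷ [])) v5 ≡ num (diffRes res)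
        last (0 , p , t) lm l = refl
        last (1 , p , t) lm l = refl
        last (suc (suc C) , p , t) lm l = cong num (sat (≤-trans (s≤s l) lm))

    -- The place value `p` is doubled once more after the last digit. As a numeral of value `x` has
    -- at most log₂ (x + 1) digits, the doubled weight ends at no more than `p * suc (B.toℕ x)`;
    -- hence the second bound.
    idx-run : ∀ x {r} v p n → v + p * B.toℕ x ≤ cap → p * suc (B.toℕ x) ≤ cap → length (bits x) ≤ n →
              lookup (iter ⟦ idxStep ⟧c n (cur (bits x ++ rb ∷ r) ∷ num v ∷ num p ∷ [])) v1 ≡ num (v + p * B.toℕ x)
    idx-run B.zero {r} v p n l₁ l₂ ln rewrite iter-stable ⟦ idxStep ⟧c n {cur (rb ∷ r) ∷ num v ∷ num p ∷ []} refl =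
      cong num (sym (trans (cong (λ z → v + z) (*-zeroʳ p)) (+-identityʳ v)))
    idx-run 1+[2 x ] {r} v p (suc n) l₁ l₂ (s≤s ln) =
      trans (cong (λ ρ → lookup (iter ⟦ idxStep ⟧c n ρ) v1) step-eq)
        (trans (idx-run x (v + p) (p + p) n (≤-trans (≤-reflexive val-eq) l₁) (≤-trans (≤-reflexive pow-eq) l₂) ln) (cong num val-eq))
      where
        open import Data.Nat.Solver using (module +-*-Solver)
        open +-*-Solver
        val-eq : (v + p) + (p + p) * B.toℕ x ≡ v + p * suc (2 * B.toℕ x)
        val-eq = solve 3 (λ v p x → (v :+ p) :+ (p :+ p) :* x := v :+ p :* (con 1 :+ con 2 :* x)) refl v p (B.toℕ x)
        pow-eq : (p + p) * suc (B.toℕ x) ≡ p * suc (suc (2 * B.toℕ x))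
        pow-eq = solve 2 (λ p x → (p :+ p) :* (con 1 :+ x) := p :* (con 2 :+ con 2 :* x)) refl p (B.toℕ x)
        step-eq : ⟦ idxStep ⟧c (cur (o0 ∷ bits x ++ rb ∷ r) ∷ num v ∷ num p ∷ []) ≡ cur (bits x ++ rb ∷ r) ∷ num (v + p) ∷ num (p + p) ∷ []
        step-eq rewrite add-ok v p (≤-trans (m≤m+n (v + p) _) (≤-trans (≤-reflexive val-eq) l₁))
                      | add-ok p p (≤-trans (m≤m*n (p + p) (suc (B.toℕ x))) (≤-trans (≤-reflexive pow-eq) l₂)) = refl
    idx-run 2[1+ x ] {r} v p (suc n) l₁ l₂ (s≤s ln) =
      trans (cong (λ ρ → lookup (iter ⟦ idxStep ⟧c n ρ) v1) step-eq)
        (trans (idx-run x (v + p + p) (p + p) n (≤-trans (≤-reflexive val-eq) l₁) (≤-trans pow-eq l₂) ln) (cong num val-eq))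
      where
        open import Data.Nat.Solver using (module +-*-Solver)
        open +-*-Solver
        val-eq : (v + p + p) + (p + p) * B.toℕ x ≡ v + p * (2 * suc (B.toℕ x))
        val-eq = solve 3 (λ v p x → (v :+ p :+ p) :+ (p :+ p) :* x := v :+ p :* (con 2 :* (con 1 :+ x))) refl v p (B.toℕ x)
        pow-eq : (p + p) * suc (B.toℕ x) ≤ p * suc (2 * suc (B.toℕ x))
        pow-eq = ≤-trans (≤-reflexive (solve 2 (λ p x → (p :+ p) :* (con 1 :+ x) := p :* (con 2 :* (con 1 :+ x))) refl p (B.toℕ x))) (*-monoʳ-≤ p (n≤1+n _))
        step-eq : ⟦ idxStep ⟧c (cur (o1 ∷ bits x ++ rb ∷ r) ∷ num v ∷ num p ∷ []) ≡ cur (bits x ++ rb ∷ r) ∷ num (v + p + p) ∷ num (p + p) ∷ []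
        step-eq rewrite add-ok v p (≤-trans (m≤m+n (v + p) _) (≤-trans (m≤m+n (v + p + p) _) (≤-trans (≤-reflexive val-eq) l₁)))
                      | add-ok (v + p) p (≤-trans (m≤m+n (v + p + p) _) (≤-trans (≤-reflexive val-eq) l₁))
                      | add-ok p p (≤-trans (m≤m*n (p + p) (suc (B.toℕ x))) (≤-trans pow-eq l₂)) = refl

    opaque
      unfolding binary

      binary-toℕ : ∀ m → B.toℕ (binary m) ≡ m
      binary-toℕ = toℕ-fromℕ

    idx-ok : ∀ m r → m < cap → ⟦ idxP ⟧p (cur (numW m r) ∷ []) ≡ num m
    idx-ok m r l rewrite idxP-def =
      trans (idx-run (binary m) 0 1 _ (≤-trans (≤-reflexive (trans (+-identityʳ _) (binary-toℕ m))) (<⇒≤ l))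
              (≤-trans (≤-reflexive (trans (+-identityʳ _) (cong suc (binary-toℕ m)))) l) (≤*8 (numB≤ m r)))
        (cong num (trans (+-identityʳ _) (binary-toℕ m)))

    passes-int : ∀ z → Passes (intW z)
    passes-int (+ m)    = passes-bracket (passes-∘ {o0 ∷_} {numW m} (passes-sg false) (passes-num m))
    passes-int -[1+ m ] = passes-bracket (passes-∘ {o1 ∷_} {numW m} (passes-sg true) (passes-num m))

    skip-int : ∀ z r → Fits (intW z r) → ⟦ skipP ⟧p (cur (intW z r) ∷ []) ≡ cur r
    skip-int (+ m) r = skip-ok (passes-∘ {o0 ∷_} {numW m} (passes-sg false) (passes-num m))
    skip-int -[1+ m ] r = skip-ok (passes-∘ {o1 ∷_} {numW m} (passes-sg true) (passes-num m))

    passes-rat : ∀ q → Passes (ratW q)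
    passes-rat q = passes-bracket (passes-∘ {intW (↥ q)} {numW (↧ₙ q)} (passes-int (↥ q)) (passes-num (↧ₙ q)))

    passes-vec : ∀ {n} (qs : Vec ℚ n) → Passes (vecW qs)
    passes-vec [] = passes-bracket passes-id
    passes-vec (q ∷ qs) = passes-bracket (passes-∘ {ratW q} {vecW qs} (passes-rat q) (passes-vec qs))

    vec-longer : ∀ {n} (qs : Vec ℚ n) r → n ≤ length (vecW qs r)
    vec-longer [] r = z≤n
    vec-longer (q ∷ qs) r = s≤s (≤-trans (vec-longer qs (rb ∷ r)) (passes-longer (passes-rat q) (vecW qs (rb ∷ r))))

    nth-run : ∀ {n} (qs : Vec ℚ n) (i : Fin n) {x} r → Fits (vecW qs r) →
              Σ (List Sym) λ r' → lookup (⟦ v0 ≔ adv v0 ⟧c (iter ⟦ nthStep ⟧c (toℕ i) (cur (vecW qs r) ∷ x ∷ []))) v0 ≡ cur (ratW (lookup qs i) r') × Fits (ratW (lookup qs i) r')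
    nth-run (q ∷ qs) zero r f = vecW qs (rb ∷ r) , refl , <⇒≤ f
    nth-run (q ∷ qs) (suc i) {x} r f
      rewrite skip-ok {λ r → intW (↥ q) (numW (↧ₙ q) r)} {vecW qs (rb ∷ r)} (passes-∘ {intW (↥ q)} {numW (↧ₙ q)} (passes-int (↥ q)) (passes-num (↧ₙ q))) (<⇒≤ f) =
      nth-run qs i {x} (rb ∷ r) (≤-trans (passes-longer (passes-rat q) (vecW qs (rb ∷ r))) (<⇒≤ f))

    nth-ok : ∀ {n} (qs : Vec ℚ n) (i : Fin n) r → Fits (vecW qs r) →
             Σ (List Sym) λ r' → ⟦ nthP ⟧p (cur (vecW qs r) ∷ num (toℕ i) ∷ []) ≡ cur (ratW (lookup qs i) r') × Fits (ratW (lookup qs i) r')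
    nth-ok qs i r f rewrite nthP-def = nth-run qs i r f

    toℕ<cap : ∀ {n} (qs : Vec ℚ n) (i : Fin n) r → Fits (vecW qs r) → toℕ i < cap
    toℕ<cap qs i r f = ≤-trans (toℕ<n i) (≤-trans (vec-longer qs r) (fits-cap f))
      where open import Data.Fin.Properties using (toℕ<n)

    num-ok : ∀ {n} (ℓ : Literal n) (qs : Vec ℚ n) r r' {m} → Fits (vecW qs r') → ↥ lookup qs (var ℓ) ≡ + m →
             Σ (List Sym) λ r'' → ⟦ numP ⟧p (cur (litW ℓ r) ∷ cur (vecW qs r') ∷ []) ≡ cur (numW m r'') × Fits (numW m r'')
    num-ok ℓ qs r r' {m} f e rewrite numP-def | idx-ok (toℕ (var ℓ)) (sg (positive ℓ) ∷ rb ∷ r) (toℕ<cap qs (var ℓ) r' f)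
      with nth-ok qs (var ℓ) r' f
    ... | r₁ , e₁ , f₁ rewrite e₁ | e = _ , refl , <⇒≤ (<⇒≤ (<⇒≤ f₁))

    den-ok : ∀ {n} (ℓ : Literal n) (qs : Vec ℚ n) r r' → Fits (vecW qs r') →
             Σ (List Sym) λ r'' → ⟦ denP ⟧p (cur (litW ℓ r) ∷ cur (vecW qs r') ∷ []) ≡ cur (numW (↧ₙ lookup qs (var ℓ)) r'') × Fits (numW (↧ₙ lookup qs (var ℓ)) r'')
    den-ok ℓ qs r r' f rewrite denP-def | idx-ok (toℕ (var ℓ)) (sg (positive ℓ) ∷ rb ∷ r) (toℕ<cap qs (var ℓ) r' f)
      with nth-ok qs (var ℓ) r' f
    ... | r₁ , e₁ , f₁ rewrite e₁ | skip-int (↥ lookup qs (var ℓ)) (numW (↧ₙ lookup qs (var ℓ)) (rb ∷ r₁)) (<⇒≤ f₁) =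
        _ , refl , ≤-trans (passes-longer (passes-int (↥ lookup qs (var ℓ))) _) (<⇒≤ f₁)

-- Prices of literals and their comparison.

module Decide where

  open import Defs using (Sym; o0; o1; rb; Literal)
  open Literal
  open Language hiding (var)
  open Programs
  open Words
  open Counting
  open Numerals
  open BlockTape using (eqS)
  open import Data.Nat using (ℕ; zero; suc; _+_; _∸_; _≤_; z≤n; s≤s)
  open import Data.Nat.Properties
  open import Data.Nat.Binary.Base as B using (2[1+_]; 1+[2_])
  open import Data.Nat.Solver using (module +-*-Solver)
  open import Data.Integer using (+_; ∣_∣)
  open import Data.Rational using (ℚ; ↥_; ↧ₙ_)
  open import Data.Bool using (Bool; true; false; if_then_else_; not; _∧_)
  open import Data.Fin using (Fin; zero; suc; toℕ)
  open import Data.List using (List; []; _∷_; _++_; length)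
  import Data.List.Properties as List
  open import Data.List.Relation.Unary.All as All using ([]; _∷_)
  open import Data.Vec using (Vec; []; _∷_; lookup)
  open import Data.Product using (Σ; _×_; _,_; proj₁; proj₂)
  open import Data.Sum using (_⊎_; inj₁; inj₂)
  open import Relation.Binary.PropositionalEquality using (_≡_; refl; sym; trans; cong; subst)

  nlen : ℕ → ℕ
  nlen m = length (numB m)

  isNil : List Sym → Bool
  isNil []      = true
  isNil (_ ∷ _) = false

  module Levels {n : ℕ} (φ₀ φ₁ : List (List (Literal n))) (H : List (Literal n)) (p c : Vec ℚ n) where

    fam : Bool → List (List (Literal n))
    fam b = if b then φ₀ else φ₁

    pᵢ cᵢ : Literal n → ℚ
    pᵢ ℓ = lookup p (var ℓ)
    cᵢ ℓ = lookup c (var ℓ)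

    free : Literal n → Bool
    free ℓ = isNil (numB ∣ ↥ cᵢ ℓ ∣)

    level : Literal n → ℕ
    level ℓ = nlen ∣ ↥ cᵢ ℓ ∣ + nlen (↧ₙ pᵢ ℓ)

    hitValue : Bool → Bool → Bool
    hitValue b s = if b then s else not s

    -- The number `k` is the length accumulated before; the program collects all lengths in one
    -- counter, and the subtraction starts its position count from there.
    hitLen : Bool → Literal n → ℕ → ℕ
    hitLen b ℓ k = if hitValue b (positive ℓ) then k + nlen ∣ ↥ pᵢ ℓ ∣
                   else diffRes (diffD (binary ∣ ↥ pᵢ ℓ ∣) (binary (↧ₙ pᵢ ℓ)) 1 k k)

    gain : Bool → Literal n → ℕ
    gain b ℓ = (hitLen b ℓ (nlen (↧ₙ cᵢ ℓ)) + bl (uB b (fam b) H ℓ)) + bl (rB (not b) (fam (not b)) H)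

    -- An order by `level - gain`, the approximate logarithm of the price, with the free literals
    -- placed below everything. The two families enter separately, so candidates of different
    -- families are comparable.
    Le : Bool → Bool → Literal n → Literal n → Set
    Le b b' ℓ ℓ' = free ℓ ≡ true ⊎ (free ℓ' ≡ false × level ℓ + gain b' ℓ' ≤ level ℓ' + gain b ℓ)

    le-refl : ∀ b ℓ → Le b b ℓ ℓ
    le-refl b ℓ with free ℓ in e
    ... | true  = inj₁ refl
    ... | false = inj₂ (refl , ≤-refl)

    le-trans : ∀ {b₁ b₂ b₃ ℓ₁ ℓ₂ ℓ₃} → Le b₁ b₂ ℓ₁ ℓ₂ → Le b₂ b₃ ℓ₂ ℓ₃ → Le b₁ b₃ ℓ₁ ℓ₃
    le-trans (inj₁ z) _ = inj₁ z
    le-trans (inj₂ (f , l)) (inj₁ z) with trans (sym f) z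
    ... | ()
    le-trans {b₁} {b₂} {b₃} {ℓ₁} {ℓ₂} {ℓ₃} (inj₂ (f , l)) (inj₂ (f' , l')) =
      inj₂ (f' , +-cancelʳ-≤ (gain b₂ ℓ₂ + level ℓ₂) _ _
        (≤-trans (≤-reflexive (sh (level ℓ₁) (gain b₂ ℓ₂) (level ℓ₂) (gain b₃ ℓ₃)))
          (≤-trans (+-mono-≤ l l') (≤-reflexive (sh' (level ℓ₂) (gain b₁ ℓ₁) (level ℓ₃) (gain b₂ ℓ₂))))))
      where
        open +-*-Solver
        sh : ∀ x y z u → (x + u) + (y + z) ≡ (x + y) + (z + u)
        sh = solve 4 (λ x y z u → (x :+ u) :+ (y :+ z) := (x :+ y) :+ (z :+ u)) refl
        sh' : ∀ x y z u → (x + y) + (z + u) ≡ (z + y) + (u + x)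
        sh' = solve 4 (λ x y z u → (x :+ y) :+ (z :+ u) := (z :+ y) :+ (u :+ x)) refl

    untested : Literal n → Bool
    untested ℓ = not (hasB false ℓ H) ∧ not (hasB true ℓ H)

    -- Listed as the search meets them, repetitions included, so that the invariant of the search
    -- can speak of the part already visited as a prefix.
    candsL : List (Literal n) → List (Literal n)
    candsL []      = []
    candsL (ℓ ∷ G) = (if untested ℓ then ℓ ∷ [] else []) ++ candsL G

    cands : Bool → List (List (Literal n)) → List (Literal n)
    cands b []      = []
    cands b (G ∷ F) = (if unresB b H G then candsL G else []) ++ cands b F

  module DecideSpecs (s₀ : Sym) (w' : List Sym) where

    open CountingSpecs s₀ w'
    open NumeralSpecs s₀ w' using (len-ok; lg-ok; diff-ok; num-ok; den-ok; add-ok; sub-ok; fits-num)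

    module Instance {n : ℕ} (φ₀ φ₁ : List (List (Literal n))) (H : List (Literal n)) (p c : Vec ℚ n)
                    (rA rB' rH rp rc : List Sym)
                    (fA : Fits (familyW φ₀ rA)) (fB : Fits (familyW φ₁ rB')) (fH : Fits (groupW H rH))
                    (fp : Fits (vecW p rp)) (fc : Fits (vecW c rc))
                    (hp : ∀ i → ↥ lookup p i ≡ + ∣ ↥ lookup p i ∣) (hc : ∀ i → ↥ lookup c i ≡ + ∣ ↥ lookup c i ∣) where

      open Levels φ₀ φ₁ H p c

      A^ B^ H^ p^ c^ : V
      A^ = cur (familyW φ₀ rA)
      B^ = cur (familyW φ₁ rB')
      H^ = cur (groupW H rH)
      p^ = cur (vecW p rp)
      c^ = cur (vecW c rc)

      W : ℕ
      W = length w

      numLen : ∀ {m r} → Fits (numW m r) → nlen m ≤ W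
      numLen {m} {r} f = <⇒≤ (fits-num {m} {r} f)

      2W≤ : W + W ≤ cap
      2W≤ = ≤-trans (≤-reflexive (solve 1 (λ x → x :+ x := x :* con 2) refl W)) (*-monoʳ-≤ W (s≤s (s≤s z≤n)))
        where open +-*-Solver

      4W≤ : (W + W) + (W + W) ≤ cap
      4W≤ = ≤-trans (≤-reflexive (solve 1 (λ x → (x :+ x) :+ (x :+ x) := x :* con 4) refl W)) (*-monoʳ-≤ W (s≤s (s≤s (s≤s (s≤s z≤n)))))
        where open +-*-Solver

      -- A level is at most `2W` and a gain at most `4W`, so the cross sums need six times the input
      -- length; the eightfold repetition of symbols leaves room for them.
      6W≤ : (W + W) + ((W + W) + (W + W)) ≤ cap
      6W≤ = ≤-trans (≤-reflexive (solve 1 (λ x → (x :+ x) :+ ((x :+ x) :+ (x :+ x)) := x :* con 6) refl W)) (*-monoʳ-≤ W (s≤s (s≤s (s≤s (s≤s (s≤s (s≤s z≤n)))))))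
        where open +-*-Solver

      level-ok : ∀ ℓ r → ⟦ levelP ⟧p (cur (litW ℓ r) ∷ p^ ∷ c^ ∷ []) ≡ num (level ℓ) × level ℓ ≤ W + W
      level-ok ℓ r with num-ok ℓ c r rc fc (hc (var ℓ)) | den-ok ℓ p r rp fp
      ... | r₁ , e₁ , f₁ | r₂ , e₂ , f₂ = go , +-mono-≤ (numLen {r = r₁} f₁) (numLen {r = r₂} f₂)
        where
          go : ⟦ levelP ⟧p (cur (litW ℓ r) ∷ p^ ∷ c^ ∷ []) ≡ num (level ℓ)
          go rewrite levelP-def | e₁ | len-ok ∣ ↥ cᵢ ℓ ∣ r₁ 0 (≤-trans (numLen {r = r₁} f₁) (≤*8 ≤-refl))
                   | e₂ | len-ok (↧ₙ pᵢ ℓ) r₂ (nlen ∣ ↥ cᵢ ℓ ∣) (≤-trans (+-mono-≤ (numLen {r = r₁} f₁) (numLen {r = r₂} f₂)) 2W≤) = refl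

      module _ (ℓ : Literal n) (r : List Sym) (k : ℕ) {r₁ r₂ : List Sym} (lk : k ≤ W) (fℓ : Fits (litW ℓ r))
               (e₁ : ⟦ numP ⟧p (cur (litW ℓ r) ∷ p^ ∷ []) ≡ cur (numW ∣ ↥ pᵢ ℓ ∣ r₁)) (f₁ : Fits (numW ∣ ↥ pᵢ ℓ ∣ r₁))
               (e₂ : ⟦ denP ⟧p (cur (litW ℓ r) ∷ p^ ∷ []) ≡ cur (numW (↧ₙ pᵢ ℓ) r₂)) (f₂ : Fits (numW (↧ₙ pᵢ ℓ) r₂)) where

        plain≤ : k + nlen ∣ ↥ pᵢ ℓ ∣ ≤ W + W
        plain≤ = +-mono-≤ lk (numLen {r = r₁} f₁)

        minus≤ : k + suc (nlen (↧ₙ pᵢ ℓ)) ≤ W + W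
        minus≤ = +-mono-≤ lk (fits-num {↧ₙ pᵢ ℓ} {r₂} f₂)

        module _ {x₁ x₂ x₃ x₅ : V} where

          state : ℕ → V → V → Vec V 9
          state m y z = cur (litW ℓ r) ∷ x₁ ∷ x₂ ∷ x₃ ∷ p^ ∷ x₅ ∷ num m ∷ y ∷ z ∷ []

          N^ D^ S^ : V
          N^ = cur (numW ∣ ↥ pᵢ ℓ ∣ r₁)
          D^ = cur (numW (↧ₙ pᵢ ℓ) r₂)
          S^ = cur (sg (positive ℓ) ∷ rb ∷ r)

          hit-start : ∀ y z → ⟦ hitStart ⟧c (state k y z) ≡ state k S^ N^
          hit-start y z rewrite skip-num (toℕ (var ℓ)) (sg (positive ℓ) ∷ rb ∷ r) (<⇒≤ fℓ) | e₁ = refl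

          plain-ok : ∀ y → ⟦ plainCmd ⟧c (state k y N^) ≡ state (k + nlen ∣ ↥ pᵢ ℓ ∣) y N^
          plain-ok y rewrite len-ok ∣ ↥ pᵢ ℓ ∣ r₁ k (≤-trans plain≤ 2W≤) = refl

          minus-ok : ∀ y → ⟦ minusCmd ⟧c (state k y N^) ≡ state (diffRes (diffD (binary ∣ ↥ pᵢ ℓ ∣) (binary (↧ₙ pᵢ ℓ)) 1 k k)) D^ N^
          minus-ok y = trans
            (cong (λ D → cur (litW ℓ r) ∷ x₁ ∷ x₂ ∷ x₃ ∷ p^ ∷ x₅ ∷ ⟦ diffP ⟧p (N^ ∷ D ∷ num k ∷ []) ∷ D ∷ N^ ∷ []) e₂)
            (cong (λ z → cur (litW ℓ r) ∷ x₁ ∷ x₂ ∷ x₃ ∷ p^ ∷ x₅ ∷ z ∷ D^ ∷ N^ ∷ []) (diff-ok ∣ ↥ pᵢ ℓ ∣ (↧ₙ pᵢ ℓ) k r₁ r₂ (≤-trans minus≤ 2W≤)))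

          hit-end : ∀ b s → positive ℓ ≡ s → Σ V λ y₇ →
                    ⟦ ifs o0 v7 (if b then minusCmd else plainCmd) (if b then plainCmd else minusCmd) ⟧c (state k (cur (sg s ∷ rb ∷ r)) N^) ≡ state (hitLen b ℓ k) y₇ N^
          hit-end true false refl = _ , minus-ok (cur (o0 ∷ rb ∷ r))
          hit-end true true refl = _ , plain-ok _
          hit-end false false refl = _ , plain-ok _
          hit-end false true refl = _ , minus-ok (cur (o1 ∷ rb ∷ r))

          hit : ∀ b y z → Σ V λ y₇ → ⟦ hitCmd b ⟧c (state k y z) ≡ state (hitLen b ℓ k) y₇ N^
          hit b y z = let (y₇ , e) = hit-end b (positive ℓ) refl in
            y₇ , trans (cong ⟦ ifs o0 v7 (if b then minusCmd else plainCmd) (if b then plainCmd else minusCmd) ⟧c (hit-start y z)) e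

        hit≤ : ∀ b → hitLen b ℓ k ≤ W + W
        hit≤ b with hitValue b (positive ℓ)
        ... | true  = plain≤
        ... | false = ≤-trans (diffRes≤ (binary ∣ ↥ pᵢ ℓ ∣) (binary (↧ₙ pᵢ ℓ)) k) minus≤

      famC : Bool → V
      famC b = if b then A^ else B^

      famR : Bool → List Sym
      famR b = if b then rA else rB'

      famC≡ : ∀ b → famC b ≡ cur (familyW (fam b) (famR b))
      famC≡ true  = refl
      famC≡ false = refl

      fam-fits : ∀ b → Fits (familyW (fam b) (famR b))
      fam-fits true  = fA
      fam-fits false = fB

      fam≤ : ∀ b → length (fam b) ≤ W
      fam≤ b = ≤-trans (≤-trans (length-groups (fam b) (rb ∷ famR b)) (n≤1+n _)) (fam-fits b)

      gain-ok : ∀ b ℓ r → Fits (litW ℓ r) →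
                ⟦ gainP b ⟧p (cur (litW ℓ r) ∷ famC b ∷ famC (not b) ∷ H^ ∷ p^ ∷ c^ ∷ []) ≡ num (gain b ℓ) × gain b ℓ ≤ (W + W) + (W + W)
      gain-ok b ℓ r fℓ with num-ok ℓ p r rp fp (hp (var ℓ)) | den-ok ℓ p r rp fp | den-ok ℓ c r rc fc
      ... | r₁ , e₁ , f₁ | r₂ , e₂ , f₂ | r₃ , e₃ , f₃ = go , bound
        where
          k : ℕ
          k = nlen (↧ₙ cᵢ ℓ)
          lk : k ≤ W
          lk = numLen {r = r₃} f₃
          u≤ : uB b (fam b) H ℓ ≤ W
          u≤ = ≤-trans (count≤ _ (fam b)) (fam≤ b)
          r≤ : rB (not b) (fam (not b)) H ≤ W
          r≤ = ≤-trans (count≤ _ (fam (not b))) (fam≤ (not b))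
          h≤ : hitLen b ℓ k ≤ W + W
          h≤ = hit≤ ℓ r k lk fℓ e₁ f₁ e₂ f₂ b
          1≤ : hitLen b ℓ k + uB b (fam b) H ℓ ≤ (W + W) + W
          1≤ = +-mono-≤ h≤ u≤
          2≤ : hitLen b ℓ k + bl (uB b (fam b) H ℓ) ≤ (W + W) + W
          2≤ = ≤-trans (+-monoʳ-≤ (hitLen b ℓ k) (blF≤ _ _)) 1≤
          3≤ : (hitLen b ℓ k + bl (uB b (fam b) H ℓ)) + rB (not b) (fam (not b)) H ≤ (W + W) + (W + W)
          3≤ = ≤-trans (+-mono-≤ 2≤ r≤) (≤-reflexive (+-assoc (W + W) W W))
          bound : gain b ℓ ≤ (W + W) + (W + W)
          bound = ≤-trans (+-monoʳ-≤ (hitLen b ℓ k + bl (uB b (fam b) H ℓ)) (blF≤ _ _)) 3≤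
          go : ⟦ gainP b ⟧p (cur (litW ℓ r) ∷ famC b ∷ famC (not b) ∷ H^ ∷ p^ ∷ c^ ∷ []) ≡ num (gain b ℓ)
          go =
            let (y₇ , e) = hit ℓ r k lk fℓ e₁ f₁ e₂ f₂ {famC b} {famC (not b)} {H^} {c^} b (cur (numW (↧ₙ cᵢ ℓ) r₃)) (num 0)
            in trans (cong (λ P → ⟦ P ⟧p (cur (litW ℓ r) ∷ famC b ∷ famC (not b) ∷ H^ ∷ p^ ∷ c^ ∷ [])) (gainP-def b))
                 (cong (λ ρ → lookup ρ v6) (trans (cong ⟦ hitCmd b ▸ gainEnd b ⟧c start) (trans (cong ⟦ gainEnd b ⟧c e) (end y₇ _))))
            where
              start : ⟦ gainStart ⟧c (cur (litW ℓ r) ∷ famC b ∷ famC (not b) ∷ H^ ∷ p^ ∷ c^ ∷ num 0 ∷ num 0 ∷ num 0 ∷ []) ≡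
                      cur (litW ℓ r) ∷ famC b ∷ famC (not b) ∷ H^ ∷ p^ ∷ c^ ∷ num k ∷ cur (numW (↧ₙ cᵢ ℓ) r₃) ∷ num 0 ∷ []
              start rewrite e₃ | len-ok (↧ₙ cᵢ ℓ) r₃ 0 (≤-trans lk (≤*8 ≤-refl)) = refl
              end : ∀ y₇ y₈ → ⟦ gainEnd b ⟧c (cur (litW ℓ r) ∷ famC b ∷ famC (not b) ∷ H^ ∷ p^ ∷ c^ ∷ num (hitLen b ℓ k) ∷ y₇ ∷ y₈ ∷ []) ≡
                    cur (litW ℓ r) ∷ famC b ∷ famC (not b) ∷ H^ ∷ p^ ∷ c^ ∷ num (gain b ℓ) ∷ num (rB (not b) (fam (not b)) H) ∷ y₈ ∷ []
              end y₇ y₈ rewrite famC≡ b | famC≡ (not b) | Remaining.resultU b (fam b) H (famR b) rH (fam-fits b) fH ℓ r fℓ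
                  | lg-ok (uB b (fam b) H ℓ) (hitLen b ℓ k) (≤-trans 1≤ (≤-trans (+-monoʳ-≤ (W + W) (m≤m+n W W)) 4W≤))
                  | Remaining.result (not b) (fam (not b)) H (famR (not b)) rH (fam-fits (not b)) fH
                  | lg-ok (rB (not b) (fam (not b)) H) (hitLen b ℓ k + bl (uB b (fam b) H ℓ)) (≤-trans 3≤ 4W≤) = refl

      rb-test : ∀ m r → eqS rb (symbolAt (cur (numB m ++ rb ∷ r))) ≡ isNil (numB m)
      rb-test m r with binary m
      ... | B.zero   = refl
      ... | 2[1+ x ] = refl
      ... | 1+[2 x ] = refl

      -- A negative answer carries the reverse comparison. The search needs this to keep its old
      -- literal when the new one is not better.
      LeRes : Bool → Bool → Literal n → Literal n → V → Set
      LeRes b b' ℓ ℓ' v = (v ≡ num 1 × Le b b' ℓ ℓ') ⊎ (v ≡ num 0 × Le b' b ℓ' ℓ)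

      module Comparison (b b' : Bool) (ℓ ℓ' : Literal n) (r r' : List Sym) (fℓ : Fits (litW ℓ r)) (fℓ' : Fits (litW ℓ' r')) where

        st : V → V → V → V → Vec V 11
        st x y z u = cur (litW ℓ r) ∷ cur (litW ℓ' r') ∷ A^ ∷ B^ ∷ H^ ∷ p^ ∷ c^ ∷ x ∷ y ∷ z ∷ u ∷ []

        X Y : ℕ
        X = level ℓ + gain b' ℓ'
        Y = level ℓ' + gain b ℓ

        gainCall-ok : ∀ b ℓ r → Fits (litW ℓ r) → ∀ {k} (ρ : Vec V k) (l a bb h pp cc : Fin k) →
                      lookup ρ l ≡ cur (litW ℓ r) → lookup ρ a ≡ A^ → lookup ρ bb ≡ B^ → lookup ρ h ≡ H^ → lookup ρ pp ≡ p^ → lookup ρ cc ≡ c^ →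
                      ⟦ gainCall b l a bb h pp cc ⟧e ρ ≡ num (gain b ℓ)
        gainCall-ok true ℓ r f ρ l a bb h pp cc e₁ e₂ e₃ e₄ e₅ e₆ rewrite e₁ | e₂ | e₃ | e₄ | e₅ | e₆ = proj₁ (gain-ok true ℓ r f)
        gainCall-ok false ℓ r f ρ l a bb h pp cc e₁ e₂ e₃ e₄ e₅ e₆ rewrite e₁ | e₂ | e₃ | e₄ | e₅ | e₆ = proj₁ (gain-ok false ℓ r f)

        sums-ok : ∀ x y z u → ⟦ leSums b b' ⟧c (st x y z u) ≡ st (num Y) (num (X ∸ Y)) (num (gain b ℓ)) u
        sums-ok x y z u =
          trans (cong (λ v → ⟦ t₁ ⟧c (st x v z u)) (proj₁ (level-ok ℓ r)))
          (trans (cong (λ v → ⟦ t₂ ⟧c (st x (num (level ℓ)) v u)) (gainCall-ok b' ℓ' r' fℓ' (st x (num (level ℓ)) z u) v1 v2 v3 v4 v5 v6 refl refl refl refl refl refl))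
          (trans (cong (λ v → ⟦ t₃ ⟧c (st x v (num (gain b' ℓ')) u)) (add-ok (level ℓ) (gain b' ℓ') (≤-trans (+-mono-≤ (proj₂ (level-ok ℓ r)) (proj₂ (gain-ok b' ℓ' r' fℓ'))) 6W≤)))
          (trans (cong (λ v → ⟦ t₄ ⟧c (st v (num X) (num (gain b' ℓ')) u)) (proj₁ (level-ok ℓ' r')))
          (trans (cong (λ v → ⟦ t₅ ⟧c (st (num (level ℓ')) (num X) v u)) (gainCall-ok b ℓ r fℓ (st (num (level ℓ')) (num X) (num (gain b' ℓ')) u) v0 v2 v3 v4 v5 v6 refl refl refl refl refl refl))
          (trans (cong (λ v → ⟦ t₆ ⟧c (st v (num X) (num (gain b ℓ)) u)) (add-ok (level ℓ') (gain b ℓ) (≤-trans (+-mono-≤ (proj₂ (level-ok ℓ' r')) (proj₂ (gain-ok b ℓ r fℓ))) 6W≤)))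
          (cong (λ v → st (num Y) v (num (gain b ℓ)) u) (sub-ok X Y)))))))
          where
            t₁ t₂ t₃ t₄ t₅ t₆ : Cmd 11
            t₆ = v8 ≔ call subP (v8 ∷ v7 ∷ [])
            t₅ = v7 ≔ call addP (v7 ∷ v9 ∷ []) ▸ t₆
            t₄ = v9 ≔ gainCall b v0 v2 v3 v4 v5 v6 ▸ t₅
            t₃ = v7 ≔ call levelP (v1 ∷ v5 ∷ v6 ∷ []) ▸ t₄
            t₂ = v8 ≔ call addP (v8 ∷ v9 ∷ []) ▸ t₃
            t₁ = v9 ≔ gainCall b' v1 v2 v3 v4 v5 v6 ▸ t₂

        result : ∀ s₁ s₂ {r₁ r₂} → ⟦ leStart v0 ⟧c (st (num 0) (num 0) (num 0) (num 0)) ≡ st (cur (numB s₁ ++ rb ∷ r₁)) (num 0) (num 0) (num 0) →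
                 (∀ x → ⟦ leStart v1 ⟧c (st x (num 0) (num 0) (num 0)) ≡ st (cur (numB s₂ ++ rb ∷ r₂)) (num 0) (num 0) (num 0)) →
                 isNil (numB s₁) ≡ free ℓ → isNil (numB s₂) ≡ free ℓ' →
                 LeRes b b' ℓ ℓ' (lookup (⟦ leCmd b b' ⟧c (st (num 0) (num 0) (num 0) (num 0))) v10)
        result s₁ s₂ {r₁} {r₂} e₁ e₂ z₁ z₂ = subst (LeRes b b' ℓ ℓ') (cong (λ ρ → lookup (⟦ Rest₁ ⟧c ρ) v10) (sym e₁)) part₁
          where
            Rest₁ Rest₂ : Cmd 11
            Rest₂ = ifs rb v7 skip (leCompare b b')
            Rest₁ = ifs rb v7 (v10 ≔ inc v10) (leStart v1 ▸ Rest₂)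
            part₃ : free ℓ ≡ false → free ℓ' ≡ false → ∀ x → LeRes b b' ℓ ℓ' (lookup (⟦ leCompare b b' ⟧c (st x (num 0) (num 0) (num 0))) v10)
            part₃ f f' x = subst (LeRes b b' ℓ ℓ') (cong (λ ρ → lookup (⟦ whenZ v8 (v10 ≔ inc v10) ⟧c ρ) v10) (sym (sums-ok x (num 0) (num 0) (num 0)))) compare
              where
                compare : LeRes b b' ℓ ℓ' (lookup (⟦ whenZ v8 (v10 ≔ inc v10) ⟧c (st (num Y) (num (X ∸ Y)) (num (gain b ℓ)) (num 0))) v10)
                compare with X ∸ Y in e
                ... | zero  = inj₁ (refl , inj₂ (f' , m∸n≡0⇒m≤n {X} {Y} e))
                ... | suc d = inj₂ (refl , inj₂ (f , ≰⇒≥ (λ le → 1+n≢0 (trans (sym e) (m≤n⇒m∸n≡0 le)))))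
            branch₂ : free ℓ ≡ false → ∀ t → eqS rb (symbolAt (cur (numB s₂ ++ rb ∷ r₂))) ≡ t → t ≡ free ℓ' →
                      LeRes b b' ℓ ℓ' (lookup (if t then st (cur (numB s₂ ++ rb ∷ r₂)) (num 0) (num 0) (num 0) else ⟦ leCompare b b' ⟧c (st (cur (numB s₂ ++ rb ∷ r₂)) (num 0) (num 0) (num 0))) v10)
            branch₂ f true e z = inj₂ (refl , inj₁ (sym z))
            branch₂ f false e z = part₃ f (sym z) _
            branch₁ : ∀ t → eqS rb (symbolAt (cur (numB s₁ ++ rb ∷ r₁))) ≡ t → t ≡ free ℓ →
                      LeRes b b' ℓ ℓ' (lookup (if t then st (cur (numB s₁ ++ rb ∷ r₁)) (num 0) (num 0) (num 1) else ⟦ leStart v1 ▸ Rest₂ ⟧c (st (cur (numB s₁ ++ rb ∷ r₁)) (num 0) (num 0) (num 0))) v10)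
            branch₁ true e z = inj₁ (refl , inj₁ (sym z))
            branch₁ false e z = subst (LeRes b b' ℓ ℓ') (cong (λ ρ → lookup (⟦ Rest₂ ⟧c ρ) v10) (sym (e₂ (cur (numB s₁ ++ rb ∷ r₁)))))
              (branch₂ (sym z) _ refl (trans (rb-test s₂ r₂) z₂))
            part₁ : LeRes b b' ℓ ℓ' (lookup (⟦ Rest₁ ⟧c (st (cur (numB s₁ ++ rb ∷ r₁)) (num 0) (num 0) (num 0))) v10)
            part₁ = branch₁ _ refl (trans (rb-test s₁ r₁) z₁)

      le-ok : ∀ b b' ℓ ℓ' r r' → Fits (litW ℓ r) → Fits (litW ℓ' r') →
              LeRes b b' ℓ ℓ' (⟦ leP b b' ⟧p (cur (litW ℓ r) ∷ cur (litW ℓ' r') ∷ A^ ∷ B^ ∷ H^ ∷ p^ ∷ c^ ∷ []))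
      le-ok b b' ℓ ℓ' r r' fℓ fℓ' with num-ok ℓ c r rc fc (hc (var ℓ)) | num-ok ℓ' c r' rc fc (hc (var ℓ'))
      ... | r₁ , e₁ , f₁ | r₂ , e₂ , f₂ =
        subst (LeRes b b' ℓ ℓ') (cong (λ P → ⟦ P ⟧p (cur (litW ℓ r) ∷ cur (litW ℓ' r') ∷ A^ ∷ B^ ∷ H^ ∷ p^ ∷ c^ ∷ [])) (sym (leP-def b b')))
          (result ∣ ↥ cᵢ ℓ ∣ ∣ ↥ cᵢ ℓ' ∣ {r₁} {r₂}
            (cong (λ z → st (advV z) (num 0) (num 0) (num 0)) e₁)
            (λ x → cong (λ z → st (advV z) (num 0) (num 0) (num 0)) e₂) refl refl)
        where open Comparison b b' ℓ ℓ' r r' fℓ fℓ'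

-- The search for a cheapest candidate, and the outcome of a decision.

module Search where

  open import Defs using (Sym; o0; o1; lb; rb; Literal)
  open Literal
  open Language hiding (var)
  open Programs
  open Words
  open Counting
  open Numerals
  open Decide
  open import Data.Nat using (ℕ; _+_)
  open import Data.Nat.Properties
  import Data.Nat.Binary.Base as B
  open import Data.Integer using (+_; ∣_∣)
  open import Data.Rational using (ℚ; ↥_)
  open import Data.Bool using (Bool; true; false; if_then_else_; not; _∧_)
  open import Data.Fin using (toℕ)
  open import Data.List using (List; []; _∷_; _++_)
  import Data.List.Properties as List
  open import Data.List.Relation.Unary.All as All using (All; []; _∷_)
  open import Data.List.Relation.Unary.All.Properties using (++⁺)
  open import Data.List.Membership.Propositional using (_∈_)
  open import Data.List.Membership.Propositional.Properties using (∈-++⁺ˡ; ∈-++⁺ʳ)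
  open import Data.List.Relation.Unary.Any using (here)
  open import Data.Vec using (Vec; []; _∷_; lookup)
  open import Data.Empty using (⊥; ⊥-elim)
  open import Data.Product using (Σ; _×_; _,_)
  open import Data.Sum using (_⊎_; inj₁; inj₂)
  open import Relation.Binary.PropositionalEquality using (_≡_; refl; sym; trans; cong; subst; _≢_)

  module SearchSpecs (s₀ : Sym) (w' : List Sym) where

    open CountingSpecs s₀ w'
    open DecideSpecs s₀ w'

    module Choice {n : ℕ} (φ₀ φ₁ : List (List (Literal n))) (H : List (Literal n)) (p c : Vec ℚ n)
                  (rA rB' rH rp rc : List Sym)
                  (fA : Fits (familyW φ₀ rA)) (fB : Fits (familyW φ₁ rB')) (fH : Fits (groupW H rH))
                  (fp : Fits (vecW p rp)) (fc : Fits (vecW c rc))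
                  (hp : ∀ i → ↥ lookup p i ≡ + ∣ ↥ lookup p i ∣) (hc : ∀ i → ↥ lookup c i ≡ + ∣ ↥ lookup c i ∣) where

      open Levels φ₀ φ₁ H p c
      open Instance φ₀ φ₁ H p c rA rB' rH rp rc fA fB fH fp fc hp hc

      Best : Bool → List (Literal n) → V → Set
      Best b done v = (v ≡ num 0 × done ≡ []) ⊎
        (Σ (Literal n) λ ℓ → Σ (List Sym) λ r → v ≡ cur (litW ℓ r) × Fits (litW ℓ r) × ℓ ∈ done × All (Le b b ℓ) done)

      module Search (b : Bool) where

        st : V → V → V → V → Vec V 9
        st x y z u = A^ ∷ B^ ∷ H^ ∷ p^ ∷ c^ ∷ x ∷ y ∷ z ∷ u ∷ []

        better : ∀ {done x ℓ r ℓ₀ r₀ v} → Fits (litW ℓ r) → Fits (litW ℓ₀ r₀) → ℓ₀ ∈ done → All (Le b b ℓ₀) done → LeRes b b ℓ ℓ₀ v →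
                 Σ V λ v' → Σ V λ t → ⟦ unlessZ v8 (v7 ≔ Language.var v6) ⟧c (st x (cur (litW ℓ r)) (cur (litW ℓ₀ r₀)) v) ≡ st x (cur (litW ℓ r)) v' t ×
                 Best b (done ++ ℓ ∷ []) v'
        better {done} {x} {ℓ} {r} f f₀ m best (inj₁ (refl , le)) = _ , _ , refl ,
          inj₂ (ℓ , r , refl , f , ∈-++⁺ʳ done (here refl) , ++⁺ (All.map (le-trans {b} {b} {b} le) best) (le-refl b ℓ ∷ []))
        better {ℓ₀ = ℓ₀} {r₀} f f₀ m best (inj₂ (refl , le)) = _ , _ , refl ,
          inj₂ (ℓ₀ , r₀ , refl , f₀ , ∈-++⁺ˡ m , ++⁺ best (le ∷ []))

        consider-ok : ∀ {done v x} ℓ r → Fits (litW ℓ r) → Best b done v →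
                      Σ V λ v' → Σ V λ t → ⟦ consider b ⟧c (st x (cur (litW ℓ r)) v (num 0)) ≡ st x (cur (litW ℓ r)) v' t × Best b (done ++ ℓ ∷ []) v'
        consider-ok ℓ r f (inj₁ (refl , refl)) = _ , _ , refl , inj₂ (ℓ , r , refl , f , here refl , le-refl b ℓ ∷ [])
        consider-ok {done} {x = x} ℓ r f (inj₂ (ℓ₀ , r₀ , refl , f₀ , m , best)) =
          better f f₀ m best (le-ok b b ℓ ℓ₀ r r₀ f f₀)

        lit-ok : ∀ {done v x u} ℓ r → Fits (litW ℓ r) → Best b done v →
                 Σ V λ v' → Σ V λ t → ⟦ litStep b ⟧c (st x (cur (litW ℓ r)) v u) ≡ st x (cur (litW ℓ r)) v' t ×
                 Best b (done ++ (if untested ℓ then ℓ ∷ [] else [])) v'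
        lit-ok {done} {v} {x} {u} ℓ r f best =
          let (v' , t , e , best') = step₁ (hasB false ℓ H) refl in
          v' , t , trans (cong (λ z → ⟦ whenZ v8 (litRest b) ⟧c (st x (cur (litW ℓ r)) v z)) (has-ok false ℓ H r rH f fH)) e , best'
          where
            pad : Best b (done ++ []) v
            pad = subst (λ d → Best b d v) (sym (List.++-identityʳ done)) best
            step₂ : ∀ a → hasB true ℓ H ≡ a → Σ V λ v' → Σ V λ t → ⟦ whenZ v8 (consider b) ⟧c (st x (cur (litW ℓ r)) v (bv a)) ≡ st x (cur (litW ℓ r)) v' t ×
                    Best b (done ++ (if not a then ℓ ∷ [] else [])) v'
            step₂ true e = v , num 1 , refl , pad
            step₂ false e = consider-ok ℓ r f best
            step₁ : ∀ a → hasB false ℓ H ≡ a → Σ V λ v' → Σ V λ t → ⟦ whenZ v8 (litRest b) ⟧c (st x (cur (litW ℓ r)) v (bv a)) ≡ st x (cur (litW ℓ r)) v' t ×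
                    Best b (done ++ (if not a ∧ not (hasB true ℓ H) then ℓ ∷ [] else [])) v'
            step₁ true e = v , num 1 , refl , pad
            step₁ false e = let (v' , t , e' , best') = step₂ (hasB true ℓ H) refl in
              v' , t , trans (cong (λ z → ⟦ whenZ v8 (consider b) ⟧c (st x (cur (litW ℓ r)) v z)) (has-ok true ℓ H r rH f fH)) e' , best'

        module Inner (x : V) (r : List Sym) (target : List (Literal n)) where

          Inv : List (Literal n) → Vec V 9 → Set
          Inv G' ρ = Σ V λ v → Σ V λ t → Σ (List (Literal n)) λ done →
            ρ ≡ st x (cur (forms litW G' (rb ∷ r))) v t × Best b done v × done ++ candsL G' ≡ target × Fits (forms litW G' (rb ∷ r))

          pos : ∀ as ρ → Inv as ρ → lookup ρ v6 ≡ cur (forms litW as (rb ∷ r))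
          pos as ρ (_ , _ , _ , refl , _) = refl

          step : ∀ g G' ρ → Inv (g ∷ G') ρ → Inv G' (⟦ litStep b ▸ v6 ≔ call skipP (v6 ∷ []) ⟧c ρ)
          step g G' ρ (v , t , done , refl , best , e , f) =
            let (v' , t' , e' , best') = lit-ok {u = t} g (forms litW G' (rb ∷ r)) f best in
            v' , t' , _ ,
            trans (cong ⟦ v6 ≔ call skipP (v6 ∷ []) ⟧c e')
              (cong (λ z → st x z v' t') (skip-ok {Enc.body litEnc g} {forms litW G' (rb ∷ r)} (Enc.passes litEnc g) f)) ,
            best' , trans (List.++-assoc done _ (candsL G')) e , Enc.fits-next litEnc {g} f

        group-ok : ∀ {done v y u} G r → Fits (groupW G r) → Best b done v →
                   Σ V λ y' → Σ V λ v' → Σ V λ t → ⟦ groupStep b ⟧c (st (cur (groupW G r)) y v u) ≡ st (cur (groupW G r)) y' v' t ×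
                   Best b (done ++ (if unresB b H G then candsL G else [])) v'
        group-ok {done} {v} {y} {u} G r f best =
          let (y' , v' , t , e , best') = step (unresB b H G) in
          y' , v' , t , trans (cong (λ z → ⟦ unlessZ v8 (groupRest b) ⟧c (st (cur (groupW G r)) y v z)) (unres-ok b G H r rH f fH)) e , best'
          where
            step : ∀ a → Σ V λ y' → Σ V λ v' → Σ V λ t → ⟦ unlessZ v8 (groupRest b) ⟧c (st (cur (groupW G r)) y v (bv a)) ≡ st (cur (groupW G r)) y' v' t ×
                   Best b (done ++ (if a then candsL G else [])) v'
            step false = y , v , num 0 , refl , subst (λ d → Best b d v) (sym (List.++-identityʳ done)) best
            step true =
              let open Inner (cur (groupW G r)) r (done ++ candsL G)
                  (v' , t , done' , e , best' , e' , _) = Enc.each-ok litEnc v6 (litStep b) r Inv pos (Inner.step (cur (groupW G r)) r (done ++ candsL G)) G _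
                                                            (v , num 1 , done , refl , best , refl , <⇒≤ f)
              in _ , v' , t , e , subst (λ d → Best b d v') (trans (sym (List.++-identityʳ done')) e') best'

        module Outer (r : List Sym) where

          Inv : List (List (Literal n)) → Vec V 9 → Set
          Inv F' ρ = Σ V λ y → Σ V λ v → Σ V λ t → Σ (List (Literal n)) λ done →
            ρ ≡ st (cur (forms groupW F' (rb ∷ r))) y v t × Best b done v × done ++ cands b F' ≡ cands b (fam b) × Fits (forms groupW F' (rb ∷ r))

          pos : ∀ as ρ → Inv as ρ → lookup ρ v5 ≡ cur (forms groupW as (rb ∷ r))
          pos as ρ (_ , _ , _ , _ , refl , _) = refl

          step : ∀ G F' ρ → Inv (G ∷ F') ρ → Inv F' (⟦ groupStep b ▸ v5 ≔ call skipP (v5 ∷ []) ⟧c ρ)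
          step G F' ρ (y , v , t , done , refl , best , e , f) =
            let (y' , v' , t' , e' , best') = group-ok {u = t} G (forms groupW F' (rb ∷ r)) f best in
            y' , v' , t' , _ ,
            trans (cong ⟦ v5 ≔ call skipP (v5 ∷ []) ⟧c e')
              (cong (λ z → st z y' v' t') (skip-ok {forms litW G} {forms groupW F' (rb ∷ r)} (Enc.passes groupEnc G) f)) ,
            best' , trans (List.++-assoc done _ (cands b F')) e , Enc.fits-next groupEnc {G} f

      best-ok : ∀ b → Best b (cands b (fam b)) (⟦ bestP b ⟧p (A^ ∷ B^ ∷ H^ ∷ p^ ∷ c^ ∷ []))
      best-ok b = subst (Best b (cands b (fam b))) (cong (λ P → ⟦ P ⟧p (A^ ∷ B^ ∷ H^ ∷ p^ ∷ c^ ∷ [])) (sym (bestP-def b))) (go b refl)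
        where
          open Search b
          go : ∀ a → a ≡ b → Best b (cands b (fam b)) (lookup (⟦ each v5 (groupStep b) ⟧c (⟦ v5 ≔ (if b then adv v0 else adv v1) ⟧c (st (num 0) (num 0) (num 0) (num 0)))) v7)
          go a refl =
            let open Outer (famR b)
                (y , v , t , done , e , best , e' , _) = Enc.each-ok groupEnc v5 (groupStep b) (famR b) Inv pos step (fam b) _
                  (num 0 , num 0 , num 0 , [] , start b , inj₁ (refl , refl) , refl , <⇒≤ (fam-fits b))
            in subst₂ (Best b) (trans (sym (List.++-identityʳ done)) e') (cong (λ ρ → lookup ρ v7) (sym e)) best
            where
              open import Relation.Binary.PropositionalEquality using (subst₂)
              start : ∀ b → ⟦ v5 ≔ (if b then adv v0 else adv v1) ⟧c (st (num 0) (num 0) (num 0) (num 0)) ≡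
                      st (cur (forms groupW (fam b) (rb ∷ famR b))) (num 0) (num 0) (num 0)
              start true = refl
              start false = refl

      Chosen : V → Set
      Chosen v = Σ Bool λ b → Σ (Literal n) λ ℓ → Σ (List Sym) λ r → v ≡ cur (litW ℓ r) × ℓ ∈ cands b (fam b) ×
                 (∀ b' ℓ' → ℓ' ∈ cands b' (fam b') → Le b b' ℓ ℓ')

      dst : V → V → V → V → V → V → Vec V 11
      dst x i j y z u = x ∷ H^ ∷ A^ ∷ B^ ∷ p^ ∷ c^ ∷ i ∷ j ∷ y ∷ z ∷ u ∷ []

      -- One comparison of the two family minima is enough: transitivity across families extends the
      -- lead of the winner over all candidates of the other family.
      switch : ∀ {x i j ℓ ℓ' r r' v} → ℓ ∈ cands true φ₀ → ℓ' ∈ cands false φ₁ →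
               All (Le true true ℓ) (cands true φ₀) → All (Le false false ℓ') (cands false φ₁) → LeRes true false ℓ ℓ' v →
               Σ V λ y → Σ V λ z → Σ V λ u →
               ⟦ whenZ v10 (v8 ≔ Language.var v9) ⟧c (dst x i j (cur (litW ℓ r)) (cur (litW ℓ' r')) v) ≡ dst x i j y z u × Chosen y
      switch {ℓ = ℓ} {r = r} m m' best best' (inj₁ (refl , le)) = _ , _ , _ , refl , true , ℓ , r , refl , m ,
        λ { true ℓ'' m'' → All.lookup best m'' ; false ℓ'' m'' → le-trans {true} {false} {false} le (All.lookup best' m'') }
      switch {ℓ' = ℓ'} {r' = r'} m m' best best' (inj₂ (refl , le)) = _ , _ , _ , refl , false , ℓ' , r' , refl , m' ,
        λ { true ℓ'' m'' → le-trans {false} {true} {true} le (All.lookup best m'') ; false ℓ'' m'' → All.lookup best' m'' }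

      pick-ok : ∀ {x i j v v'} → (cands true φ₀ ≡ [] → cands false φ₁ ≡ [] → ⊥) → Best true (cands true φ₀) v → Best false (cands false φ₁) v' →
                Σ V λ y → Σ V λ z → Σ V λ u → ⟦ pickCmd ⟧c (dst x i j v v' (num 0)) ≡ dst x i j y z u × Chosen y
      pick-ok ne (inj₁ (refl , e)) (inj₁ (refl , e')) = ⊥-elim (ne e e')
      pick-ok ne (inj₁ (refl , e)) (inj₂ (ℓ , r , refl , f , m , best)) = _ , _ , _ , refl , false , ℓ , r , refl , m ,
        λ { true ℓ' m' → ⊥-elim (none (subst (ℓ' ∈_) e m')) ; false ℓ' m' → All.lookup best m' }
        where
          none : ∀ {ℓ'} → ℓ' ∈ [] → ⊥
          none ()
      pick-ok ne (inj₂ (ℓ , r , refl , f , m , best)) (inj₁ (refl , e)) = _ , _ , _ , refl , true , ℓ , r , refl , m ,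
        λ { false ℓ' m' → ⊥-elim (none (subst (ℓ' ∈_) e m')) ; true ℓ' m' → All.lookup best m' }
        where
          none : ∀ {ℓ'} → ℓ' ∈ [] → ⊥
          none ()
      pick-ok {x} {i} {j} ne (inj₂ (ℓ , r , refl , f , m , best)) (inj₂ (ℓ' , r' , refl , f' , m' , best')) =
        switch m m' best best' (le-ok true false ℓ ℓ' r r' f f')

      data Outcome : List Sym → Set where
        accept : rB true φ₀ H ≡ 0 → Outcome (lb ∷ o1 ∷ o1 ∷ rb ∷ [])
        reject : rB true φ₀ H ≢ 0 → rB false φ₁ H ≡ 0 → Outcome (lb ∷ o1 ∷ o0 ∷ rb ∷ [])
        query  : ∀ b ℓ → rB true φ₀ H ≢ 0 → rB false φ₁ H ≢ 0 → ℓ ∈ cands b (fam b) → (∀ b' ℓ' → ℓ' ∈ cands b' (fam b') → Le b b' ℓ ℓ') →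
                 Outcome (lb ∷ o0 ∷ lb ∷ numB (toℕ (var ℓ)) ++ rb ∷ rb ∷ [])

      count-ok : ∀ x → ⟦ countCmd ⟧c (dst x (num 0) (num 0) (num 0) (num 0) (num 0)) ≡ dst x (num (rB true φ₀ H)) (num (rB false φ₁ H)) (num 0) (num 0) (num 0)
      count-ok x = trans (cong (λ v → ⟦ v7 ≔ call (rP false) (v3 ∷ v1 ∷ []) ⟧c (dst x v (num 0) (num 0) (num 0) (num 0))) (Remaining.result true φ₀ H rA rH fA fH))
                         (cong (λ v → dst x (num (rB true φ₀ H)) v (num 0) (num 0) (num 0)) (Remaining.result false φ₁ H rB' rH fB fH))

      choose-ok : ∀ x i j → (cands true φ₀ ≡ [] → cands false φ₁ ≡ [] → ⊥) →
                  Σ Bool λ b → Σ (Literal n) λ ℓ → Σ (List Sym) λ r → Σ V λ z → Σ V λ u →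
                  ⟦ chooseCmd ⟧c (dst x i j (num 0) (num 0) (num 0)) ≡ dst x i j (cur (numB (toℕ (var ℓ)) ++ rb ∷ r)) z u × ℓ ∈ cands b (fam b) ×
                  (∀ b' ℓ' → ℓ' ∈ cands b' (fam b') → Le b b' ℓ ℓ')
      choose-ok x i j ne =
        let (y , z , u , e , b , ℓ , r , ey , m , le) = pick-ok {x} {i} {j} ne (best-ok true) (best-ok false)
        in b , ℓ , _ , z , u , trans (cong ⟦ v8 ≔ adv v8 ▸ v8 ≔ adv v8 ⟧c e) (cong (λ v → dst x i j (advV (advV v)) z u) ey) , m , le

-- Parsing of the input, and agreement of the forms with the given encodings.

module Parsing where

  open import Defs
  open Literal
  open Language hiding (var)
  open Programs
  open Words
  open Counting
  open Numerals
  open Decide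
  open Search
  open Machine
  open import Data.Nat using (ℕ; zero; suc; _+_)
  open import Data.Nat.Properties
  import Data.Nat.Binary.Base as B
  open import Data.Integer using (+_; -[1+_]; ∣_∣)
  open import Data.Rational using (ℚ; ↥_; ↧ₙ_)
  open import Data.Bool using (true; false)
  open import Data.Fin using (zero; suc; toℕ)
  open import Data.List using (List; []; _∷_; _++_; length; map; concatMap)
  import Data.List.Properties as List
  open import Data.Vec using (Vec; []; _∷_; lookup)
  open import Data.Empty using (⊥)
  open import Data.Product using (Σ; _×_; _,_; proj₁; proj₂)
  open import Relation.Binary.PropositionalEquality using (_≡_; refl; sym; trans; cong; subst; _≢_)

  module _ {n : ℕ} (φ₀ φ₁ : List (List (Literal n))) (p c : Vec ℚ n) where

    instW : Form
    instW = bracket (λ r → numW n (familyW φ₀ (familyW φ₁ (vecW p (vecW c r)))))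

  module Parse {n : ℕ} (φ₀ φ₁ : List (List (Literal n))) (H : List (Literal n)) (p c : Vec ℚ n) (w' : List Sym)
               (ew : w' ≡ instW φ₀ φ₁ p c (groupW H (rb ∷ [])))
               (hp : ∀ i → ↥ lookup p i ≡ + ∣ ↥ lookup p i ∣) (hc : ∀ i → ↥ lookup c i ≡ + ∣ ↥ lookup c i ∣) where

    open CountingSpecs lb w'
    open NumeralSpecs lb w' using (passes-vec)

    rH rc rp rB' rA rN : List Sym
    rH  = rb ∷ []
    rc  = rb ∷ groupW H rH
    rp  = vecW c rc
    rB' = vecW p rp
    rA  = familyW φ₁ rB'
    rN  = familyW φ₀ rA

    fI : Fits (instW φ₀ φ₁ p c (groupW H rH))
    fI = ≤-trans (≤-reflexive (sym (cong length ew))) (n≤1+n _)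
    fN : Fits (numW n rN)
    fN = <⇒≤ fI
    fA : Fits (familyW φ₀ rA)
    fA = ≤-trans (passes-longer (passes-num n) rN) fN
    fB : Fits (familyW φ₁ rB')
    fB = ≤-trans (passes-longer (passes-bracket (passes-family φ₀)) rA) fA
    fp : Fits (vecW p rp)
    fp = ≤-trans (passes-longer (passes-bracket (passes-family φ₁)) rB') fB
    fc : Fits (vecW c rc)
    fc = ≤-trans (passes-longer (passes-vec p) rp) fp
    fH : Fits (groupW H rH)
    fH = <⇒≤ (≤-trans (passes-longer (passes-vec c) rc) fc)

    open Levels φ₀ φ₁ H p c using (fam; cands) public
    open SearchSpecs lb w' using (module Choice)
    open Choice φ₀ φ₁ H p c rA rB' rH rp rc fA fB fH fp fc hp hc public using (Outcome; accept; reject; query)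
    open Choice φ₀ φ₁ H p c rA rB' rH rp rc fA fB fH fp fc hp hc using (dst; count-ok; choose-ok)

    parse-ok : ⟦ parseCmd ⟧c (cur (lb ∷ w') ∷ num 0 ∷ num 0 ∷ num 0 ∷ num 0 ∷ num 0 ∷ num 0 ∷ num 0 ∷ num 0 ∷ num 0 ∷ num 0 ∷ []) ≡
               dst (cur (numW n rN)) (num 0) (num 0) (num 0) (num 0) (num 0)
    parse-ok = trans (cong (λ v → ⟦ t₁ ⟧c (cur v ∷ num 0 ∷ num 0 ∷ num 0 ∷ num 0 ∷ num 0 ∷ num 0 ∷ num 0 ∷ num 0 ∷ num 0 ∷ num 0 ∷ [])) ew)
      (trans (cong (λ v → ⟦ t₂ ⟧c (cur (instW φ₀ φ₁ p c (groupW H rH)) ∷ v ∷ num 0 ∷ num 0 ∷ num 0 ∷ num 0 ∷ num 0 ∷ num 0 ∷ num 0 ∷ num 0 ∷ num 0 ∷ [])) (skip-ok passes-inst fI))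
      (trans (cong (λ v → ⟦ t₃ ⟧c (cur (numW n rN) ∷ cur (groupW H rH) ∷ v ∷ num 0 ∷ num 0 ∷ num 0 ∷ num 0 ∷ num 0 ∷ num 0 ∷ num 0 ∷ num 0 ∷ [])) (skip-num n rN fN))
      (trans (cong (λ v → ⟦ t₄ ⟧c (cur (numW n rN) ∷ cur (groupW H rH) ∷ cur rN ∷ v ∷ num 0 ∷ num 0 ∷ num 0 ∷ num 0 ∷ num 0 ∷ num 0 ∷ num 0 ∷ [])) (skip-ok (passes-family φ₀) fA))
      (trans (cong (λ v → ⟦ t₅ ⟧c (cur (numW n rN) ∷ cur (groupW H rH) ∷ cur rN ∷ cur rA ∷ v ∷ num 0 ∷ num 0 ∷ num 0 ∷ num 0 ∷ num 0 ∷ num 0 ∷ [])) (skip-ok (passes-family φ₁) fB))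
      (cong (λ v → cur (numW n rN) ∷ cur (groupW H rH) ∷ cur rN ∷ cur rA ∷ cur rB' ∷ v ∷ num 0 ∷ num 0 ∷ num 0 ∷ num 0 ∷ num 0 ∷ []) (skip-vec p rp fp))))))
      where
        t₁ t₂ t₃ t₄ t₅ : Cmd 11
        t₅ = v5 ≔ call skipP (v4 ∷ [])
        t₄ = v4 ≔ call skipP (v3 ∷ []) ▸ t₅
        t₃ = v3 ≔ call skipP (v2 ∷ []) ▸ t₄
        t₂ = v0 ≔ adv v0 ▸ v2 ≔ call skipP (v0 ∷ []) ▸ t₃
        t₁ = v1 ≔ call skipP (v0 ∷ []) ▸ t₂
        passes-inst : Passes (λ r → numW n (familyW φ₀ (familyW φ₁ (vecW p (vecW c r)))))
        passes-inst = passes-∘ {numW n} {λ r → familyW φ₀ (familyW φ₁ (vecW p (vecW c r)))} (passes-num n)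
          (passes-∘ {familyW φ₀} {λ r → familyW φ₁ (vecW p (vecW c r))} (passes-bracket (passes-family φ₀))
          (passes-∘ {familyW φ₁} {λ r → vecW p (vecW c r)} (passes-bracket (passes-family φ₁)) (passes-∘ {vecW p} {vecW c} (passes-vec p) (passes-vec c))))
        skip-vec : ∀ {m} (qs : Vec ℚ m) r → Fits (vecW qs r) → ⟦ skipP ⟧p (cur (vecW qs r) ∷ []) ≡ cur r
        skip-vec [] r f = skip-ok passes-id f
        skip-vec (q ∷ qs) r f = skip-ok (passes-∘ {ratW q} {vecW qs} (NumeralSpecs.passes-rat lb w' q) (passes-vec qs)) f

    ρ₀ : Vec V 11
    ρ₀ = cur (lb ∷ w') ∷ num 0 ∷ num 0 ∷ num 0 ∷ num 0 ∷ num 0 ∷ num 0 ∷ num 0 ∷ num 0 ∷ num 0 ∷ num 0 ∷ []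

    decide-ok : (rB true φ₀ H ≢ 0 → rB false φ₁ H ≢ 0 → cands true φ₀ ≡ [] → cands false φ₁ ≡ [] → ⊥) →
                Σ (List Sym) λ out → Answer {11} (lb ∷ w') v6 v7 v8 (⟦ decideCmd ⟧c ρ₀) out × Outcome out
    decide-ok ne = let (out , a , o) = cases (rB true φ₀ H) (rB false φ₁ H) refl refl in
      out , subst (λ ρ → Answer {11} (lb ∷ w') v6 v7 v8 ρ out) (sym (cong ⟦ restCmd ⟧c front-ok))
              (subst (λ C → Answer {11} (lb ∷ w') v6 v7 v8 (⟦ C ⟧c (dst x (num (rB true φ₀ H)) (num (rB false φ₁ H)) (num 0) (num 0) (num 0))) out) (sym restCmd-def) a) , o
      where
        x : V
        x = cur (numW n rN)
        front-ok : ⟦ frontCmd ⟧c ρ₀ ≡ dst x (num (rB true φ₀ H)) (num (rB false φ₁ H)) (num 0) (num 0) (num 0)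
        front-ok = trans (cong (λ C → ⟦ C ⟧c ρ₀) frontCmd-def) (trans (cong ⟦ countCmd ⟧c parse-ok) (count-ok x))
        cases : ∀ i j → i ≡ rB true φ₀ H → j ≡ rB false φ₁ H →
                Σ (List Sym) λ out → Answer {11} (lb ∷ w') v6 v7 v8 (⟦ unlessZ v6 (unlessZ v7 chooseCmd) ⟧c (dst x (num i) (num j) (num 0) (num 0) (num 0))) out × Outcome out
        cases zero j e e' = _ , ans1 refl , accept (sym e)
        cases (suc i) zero e e' = _ , ans0 refl refl , reject (λ z → 1+n≢0 (trans e z)) (sym e')
        cases (suc i) (suc j) e e' =
          let ne₁ = λ z → 1+n≢0 (trans e z)
              ne₂ = λ z → 1+n≢0 (trans e' z)
              (b , ℓ , r , z , u , eq , m , le) = choose-ok x (num (suc i)) (num (suc j)) (ne ne₁ ne₂)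
          in _ , subst (λ ρ → Answer {11} (lb ∷ w') v6 v7 v8 ρ (lb ∷ o0 ∷ lb ∷ numB (toℕ (var ℓ)) ++ rb ∷ rb ∷ [])) (sym eq) (ansT refl refl (bits-Bits (binary (toℕ (var ℓ)))) refl) ,
             query b ℓ ne₁ ne₂ m le

  opaque
    unfolding binary

    binary≡ : ∀ m → binary m ≡ B.fromℕ m
    binary≡ m = refl

  encNum : ∀ m r → encℕ m ++ r ≡ numW m r
  encNum m r = trans (cong (lb ∷_) (List.++-assoc (bits (B.fromℕ m)) (rb ∷ []) r)) (cong (λ x → lb ∷ bits x ++ rb ∷ r) (sym (binary≡ m)))

  encBool≡ : ∀ b r → encBool b ++ r ≡ sg b ∷ r
  encBool≡ false r = refl
  encBool≡ true r = refl

  encLit≡ : ∀ {n} (ℓ : Literal n) r → encLit ℓ ++ r ≡ litW ℓ r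
  encLit≡ (lit i s) r = cong (lb ∷_) (trans (List.++-assoc (encFin i) (encBool s ++ rb ∷ []) r)
    (trans (cong (encFin i ++_) (trans (List.++-assoc (encBool s) (rb ∷ []) r) (encBool≡ s (rb ∷ r)))) (encNum (toℕ i) (sg s ∷ rb ∷ r))))

  encList≡ : ∀ {A : Set} {e : A → List Sym} {f : A → Form} → (∀ a r → e a ++ r ≡ f a r) → ∀ as r → encList e as ++ r ≡ bracket (forms f as) r
  encList≡ {e = e} {f} h as r = cong (lb ∷_) (trans (List.++-assoc (concatMap e as) (rb ∷ []) r) (go as))
    where
      go : ∀ as → concatMap e as ++ rb ∷ r ≡ forms f as (rb ∷ r)
      go [] = refl
      go (a ∷ as) = trans (List.++-assoc (e a) (concatMap e as) (rb ∷ r)) (trans (cong (e a ++_) (go as)) (h a _))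

  encInt≡ : ∀ z r → encℤ z ++ r ≡ intW z r
  encInt≡ (+ m) r = cong (λ l → lb ∷ o0 ∷ l) (trans (List.++-assoc (encℕ m) (rb ∷ []) r) (encNum m (rb ∷ r)))
  encInt≡ -[1+ m ] r = cong (λ l → lb ∷ o1 ∷ l) (trans (List.++-assoc (encℕ m) (rb ∷ []) r) (encNum m (rb ∷ r)))

  encRat≡ : ∀ q r → encℚ q ++ r ≡ ratW q r
  encRat≡ q r = cong (lb ∷_) (trans (List.++-assoc (encℤ (↥ q)) (encℕ (↧ₙ q) ++ rb ∷ []) r)
    (trans (cong (encℤ (↥ q) ++_) (trans (List.++-assoc (encℕ (↧ₙ q)) (rb ∷ []) r) (encNum (↧ₙ q) (rb ∷ r)))) (encInt≡ (↥ q) _)))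

  encVec≡ : ∀ {n} (qs : Vec ℚ n) r → encVec encℚ qs ++ r ≡ vecW qs r
  encVec≡ [] r = refl
  encVec≡ (q ∷ qs) r = cong (lb ∷_) (trans (List.++-assoc (encℚ q) (encVec encℚ qs ++ rb ∷ []) r)
    (trans (cong (encℚ q ++_) (trans (List.++-assoc (encVec encℚ qs) (rb ∷ []) r) (encVec≡ qs (rb ∷ r)))) (encRat≡ q _)))

  encFamily≡ : ∀ {n} (F : List (List (Literal n))) r → encList (encList encLit) F ++ r ≡ familyW F r
  encFamily≡ = encList≡ (encList≡ encLit≡)

  encInst≡ : ∀ {n} (φ₀ φ₁ : List (List (Literal n))) p c r → encInstance n φ₀ φ₁ p c ++ r ≡ instW φ₀ φ₁ p c r
  encInst≡ {n} φ₀ φ₁ p c r = cong (lb ∷_)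
    (step (encℕ n) (encNum n) (step (encList (encList encLit) φ₀) (encFamily≡ φ₀) (step (encList (encList encLit) φ₁) (encFamily≡ φ₁)
      (step (encVec encℚ p) (encVec≡ p) (step (encVec encℚ c) (encVec≡ c) refl)))))
    where
      step : ∀ a {f : Form} {x y} → (∀ r → a ++ r ≡ f r) → x ++ r ≡ y → (a ++ x) ++ r ≡ f y
      step a {f} {x} h e = trans (List.++-assoc a x r) (trans (cong (a ++_) e) (h _))

  asLits : ∀ {n} → History n → List (Literal n)
  asLits = map (λ { (i , v) → lit i v })

  encHist≡ : ∀ {n} (h : History n) r → encHistory h ++ r ≡ groupW (asLits h) r
  encHist≡ h r = trans (encList≡ {f = λ e → litW (lit (proj₁ e) (proj₂ e))} (λ { (i , v) → encLit≡ (lit i v) }) h r) (cong (lb ∷_) (go h))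
    where
      go : ∀ h → forms (λ e → litW (lit (proj₁ e) (proj₂ e))) h (rb ∷ r) ≡ forms litW (asLits h) (rb ∷ r)
      go [] = refl
      go ((i , v) ∷ h) = cong (litW (lit i v)) (go h)

-- Every decision halts in time polynomial in the instance.

module Run where

  open import Defs
  open Literal
  open TapeProgram using (machine; exec-halts; Exec)
  open BlockTape using (nonB)
  open Emit using (NB; nb-++)
  open Programs
  open Words
  open Numerals
  open Machine
  open Parsing
  open Poly
  open import Data.Nat using (ℕ; zero; suc; _+_; _*_; _^_; _≤_; z≤n; s≤s)
  open import Data.Nat.Properties
  open import Data.Nat.Binary.Base as B using (2[1+_]; 1+[2_])
  open import Data.Nat.Binary.Properties using (toℕ-fromℕ)
  open import Data.Integer using (+_; -[1+_])
  open import Data.Rational using (ℚ; ↥_; ↧ₙ_)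
  open import Data.Bool using (true; false)
  open import Data.Fin using (zero; suc; toℕ)
  open import Data.Fin.Properties using (toℕ<n)
  open import Data.List using (List; []; _∷_; _++_; length; concatMap)
  import Data.List.Properties as List
  open import Data.Vec using (Vec; []; _∷_)
  open import Data.Empty using (⊥)
  open import Data.Unit using (tt)
  open import Data.Product using (Σ; _×_; _,_; proj₁; proj₂)
  open import Relation.Binary.PropositionalEquality using (_≡_; refl; sym; trans; cong; subst; _≢_)

  nb-bit-words : ∀ x → NB (bits x)
  nb-bit-words x = nb-bits (bits-Bits x)

  nb-sg : ∀ b → nonB (sg b) ≡ true
  nb-sg false = refl
  nb-sg true  = refl

  NBForm : Form → Set
  NBForm f = ∀ {r} → NB r → NB (f r)

  nb-bracket : ∀ {f} → NBForm f → NBForm (bracket f)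
  nb-bracket h nb = refl , h (refl , nb)

  nb-num : ∀ m → NBForm (numW m)
  nb-num m = nb-bracket {numB m ++_} (λ nb → nb-++ {numB m} (nb-bit-words (binary m)) nb)

  nb-forms : ∀ {A : Set} {f : A → Form} → (∀ a → NBForm (f a)) → ∀ as → NBForm (forms f as)
  nb-forms h [] nb = nb
  nb-forms h (a ∷ as) nb = h a (nb-forms h as nb)

  nb-lit : ∀ {n} (ℓ : Literal n) → NBForm (litW ℓ)
  nb-lit ℓ = nb-bracket {λ r → idxW (var ℓ) (sg (positive ℓ) ∷ r)} (λ nb → nb-num (toℕ (var ℓ)) (nb-sg (positive ℓ) , nb))

  nb-group : ∀ {n} (G : List (Literal n)) → NBForm (groupW G)
  nb-group G = nb-bracket {forms litW G} (nb-forms nb-lit G)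

  nb-family : ∀ {n} (F : List (List (Literal n))) → NBForm (familyW F)
  nb-family F = nb-bracket {forms groupW F} (nb-forms nb-group F)

  nb-int : ∀ z → NBForm (intW z)
  nb-int (+ m)    = nb-bracket {λ r → o0 ∷ numW m r} (λ nb → refl , nb-num m nb)
  nb-int -[1+ m ] = nb-bracket {λ r → o1 ∷ numW m r} (λ nb → refl , nb-num m nb)

  nb-rat : ∀ q → NBForm (ratW q)
  nb-rat q = nb-bracket {λ r → intW (↥ q) (numW (↧ₙ q) r)} (λ nb → nb-int (↥ q) (nb-num (↧ₙ q) nb))

  nb-vec : ∀ {n} (qs : Vec ℚ n) → NBForm (vecW qs)
  nb-vec [] = nb-bracket {λ r → r} (λ nb → nb)
  nb-vec (q ∷ qs) = nb-bracket {λ r → ratW q (vecW qs r)} (λ nb → nb-rat q (nb-vec qs nb))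

  open Whole {10} decideCmd v6 v7 v8 using (program) public
  open Whole {10} decideCmd v6 v7 v8 using (halting; input; len; totalTime; p-total)

  -- With a history of length at most `n`, the whole input of a decision is polynomial in the
  -- instance alone. One time bound then serves all decisions of a strategy.
  record Query : Set where
    constructor query'
    field
      n     : ℕ
      φ₀ φ₁ : List (List (Literal n))
      p c   : Vec ℚ n
      h     : History n
      short : length h ≤ n

    inst word : List Sym
    inst = encInstance n φ₀ φ₁ p c
    word = inst ++ encHistory h ++ rb ∷ []

    tail : List Sym
    tail = groupW (asLits h) (rb ∷ [])

    word≡ : word ≡ instW φ₀ φ₁ p c tail
    word≡ = trans (cong (inst ++_) (encHist≡ h (rb ∷ []))) (encInst≡ φ₀ φ₁ p c tail)

    nb : NB (lb ∷ word)
    nb = refl , subst NB (sym word≡) (nb-bracket {λ r → numW n (familyW φ₀ (familyW φ₁ (vecW p (vecW c r))))}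
           (λ z → nb-num n (nb-family φ₀ (nb-family φ₁ (nb-vec p (nb-vec c z))))) (nb-group (asLits h) (refl , tt)))

  querySize : Query → ℕ
  querySize q = length (Query.inst q)

  nonempty : ∀ {l : List Sym} → lb ∷ l ≡ [] → ⊥
  nonempty ()

  toInput : Query → Whole.Input {10} decideCmd v6 v7 v8
  toInput q = input (lb ∷ Query.word q) (Query.nb q) nonempty

  module _ where

    open Specs lb [] using (passes-longer; passes-num; passes-bracket; passes-family)

    -- The numeral for `n` has only logarithmic length, but the vector `p` spends at least one
    -- bracket on every variable.
    n≤inst : ∀ {n} (φ₀ φ₁ : List (List (Literal n))) p c → n ≤ length (encInstance n φ₀ φ₁ p c)
    n≤inst {n} φ₀ φ₁ p c = ≤-trans
      (≤-trans (NumeralSpecs.vec-longer lb [] p (vecW c (rb ∷ [])))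
        (≤-trans (passes-longer (passes-bracket (passes-family φ₁)) (vecW p (vecW c (rb ∷ []))))
        (≤-trans (passes-longer (passes-bracket (passes-family φ₀)) (familyW φ₁ (vecW p (vecW c (rb ∷ [])))))
        (≤-trans (passes-longer (passes-num n) (familyW φ₀ (familyW φ₁ (vecW p (vecW c (rb ∷ []))))))
          (n≤1+n _)))))
      (≤-reflexive (cong length (trans (sym (encInst≡ φ₀ φ₁ p c [])) (List.++-identityʳ _))))

  bits≤ : ∀ x → length (bits x) ≤ B.toℕ x
  bits≤ B.zero = z≤n
  bits≤ 2[1+ x ] = ≤-trans (s≤s (bits≤ x)) (m≤m+n (suc (B.toℕ x)) (suc (B.toℕ x) + 0))
  bits≤ 1+[2 x ] = s≤s (≤-trans (bits≤ x) (m≤m+n (B.toℕ x) _))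

  lit≤ : ∀ {n} (ℓ : Literal n) → length (encLit ℓ) ≤ 5 + n
  lit≤ {n} (lit i s) = ≤-trans (≤-reflexive e) (+-monoʳ-≤ 5 (≤-trans (bits≤ (B.fromℕ (toℕ i))) (≤-trans (≤-reflexive (toℕ-fromℕ (toℕ i))) (<⇒≤ (toℕ<n i)))))
    where
      l = bits (B.fromℕ (toℕ i))
      e : length (encLit (lit i s)) ≡ 5 + length l
      e = trans (cong length (sym (List.++-identityʳ (encLit (lit i s)))))
            (trans (cong length (trans (encLit≡ (lit i s) []) (cong (λ x → lb ∷ lb ∷ bits x ++ rb ∷ sg s ∷ rb ∷ []) (binary≡ (toℕ i)))))
              (cong (λ z → 2 + z) (trans (List.length-++ l) (+-comm (length l) 3))))

  hist≤ : ∀ {n} (h : History n) → length (encHistory h) ≤ 2 + length h * (5 + n)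
  hist≤ {n} h = ≤-trans (≤-reflexive (cong suc (trans (List.length-++ (concatMap _ h)) (+-comm _ 1)))) (s≤s (s≤s (go h)))
    where
      go : ∀ h → length (concatMap (λ { (i , v) → lb ∷ encFin {n} i ++ encBool v ++ rb ∷ [] }) h) ≤ length h * (5 + n)
      go [] = z≤n
      go ((i , v) ∷ h) = ≤-trans (≤-reflexive (List.length-++ (encLit (lit i v)))) (+-mono-≤ (lit≤ (lit i v)) (go h))

  p-query : Poly querySize (λ q → totalTime (toInput q))
  p-query = poly-compose {size = len} {querySize} {totalTime} toInput p-total
    (poly-≤ short-word (poly-+ (poly-const 1) (poly-+ poly-size (poly-+ (poly-+ (poly-const 2) (poly-* poly-size (poly-+ (poly-const 5) poly-size))) (poly-const 1)))))
    where
      short-word : ∀ q → len (toInput q) ≤ 1 + (querySize q + ((2 + querySize q * (5 + querySize q)) + 1))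
      short-word q = s≤s (≤-trans (≤-reflexive (trans (List.length-++ (Query.inst q)) (cong (λ z → querySize q + z) (List.length-++ (encHistory (Query.h q))))))
        (+-monoʳ-≤ (querySize q) (+-monoˡ-≤ 1 (≤-trans (hist≤ (Query.h q)) (+-monoʳ-≤ 2 (*-mono-≤ (≤-trans (Query.short q) n≤) (+-monoʳ-≤ 5 n≤)))))))
        where
          n≤ : Query.n q ≤ querySize q
          n≤ = n≤inst (Query.φ₀ q) (Query.φ₁ q) (Query.p q) (Query.c q)

  module _ (q : Query) where

    open Query q

    module ParseQ = Parse φ₀ φ₁ (asLits h) p c word word≡

    decision-halts : ∀ hp hc →
      (rB true φ₀ (asLits h) ≢ 0 → rB false φ₁ (asLits h) ≢ 0 → ParseQ.cands hp hc true φ₀ ≡ [] → ParseQ.cands hp hc false φ₁ ≡ [] → ⊥) →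
      Σ (List Sym) λ out → HaltsWith (machine program) (proj₁ p-query * suc (querySize q) ^ proj₁ (proj₂ p-query)) (lb ∷ word) out × ParseQ.Outcome hp hc out
    decision-halts hp hc ne =
      let (out , ans , o) = ParseQ.decide-ok hp hc ne
          (τ , pos , x , at) = halting (toInput q) ans
      in out , exec-halts (Exec.xwk (proj₂ (proj₂ p-query) q) x) at , o

-- Expectations over product distributions.

module Expectation where

  open import Defs using (prob; allInputs; expectedCost; costOn)
  open import Data.Nat using (zero; suc)
  open import Data.Bool using (Bool; true; false; if_then_else_)
  open import Data.Fin using (Fin; zero; suc)
  open import Data.List using (List; []; _∷_; _++_; map; foldr)
  open import Data.Vec using (Vec; []; _∷_; lookup; _[_]≔_)
  open import Data.Vec.Relation.Unary.All using (All; []; _∷_)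
  open import Data.Product using (_×_; _,_)
  open import Data.Rational using (ℚ; 0ℚ; 1ℚ; _+_; _*_; _-_; -_; _≤_; nonNegative)
  open import Data.Rational.Properties
  open import Data.Rational.Solver using (module +-*-Solver)
  open import Function using (_∘_)
  open import Relation.Binary.PropositionalEquality using (_≡_; refl; sym; trans; cong; cong₂; subst)

  open +-*-Solver using (solve; _:+_; _:*_; _:-_; :-_; _:=_; con)

  *-mono : ∀ {k a b} → 0ℚ ≤ k → a ≤ b → k * a ≤ k * b
  *-mono {k} h = *-monoˡ-≤-nonNeg k {{nonNegative h}}

  0≤* : ∀ {a b} → 0ℚ ≤ a → 0ℚ ≤ b → 0ℚ ≤ a * b
  0≤* {a} {b} h g = subst (λ z → z ≤ a * b) (*-zeroʳ a) (*-mono h g)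

  0≤+ : ∀ {a b} → 0ℚ ≤ a → 0ℚ ≤ b → 0ℚ ≤ a + b
  0≤+ h g = +-mono-≤ h g

  Prob : ℚ → Set
  Prob q = (0ℚ ≤ q) × (0ℚ ≤ 1ℚ - q)

  -- Probabilities 0 and 1 make sense here, so conditioning on the outcome of a test is a mere
  -- update of the probability vector.
  E : ∀ {n} → Vec ℚ n → (Vec Bool n → ℚ) → ℚ
  E []      F = F []
  E (q ∷ p) F = (1ℚ - q) * E p (F ∘ (false ∷_)) + q * E p (F ∘ (true ∷_))

  E-mono : ∀ {n} {p : Vec ℚ n} {F G} → All Prob p → (∀ x → F x ≤ G x) → E p F ≤ E p G
  E-mono [] h = h []
  E-mono ((a , b) ∷ ps) h = +-mono-≤ (*-mono b (E-mono ps (h ∘ (false ∷_)))) (*-mono a (E-mono ps (h ∘ (true ∷_))))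

  E-ext : ∀ {n} (p : Vec ℚ n) {F G} → (∀ x → F x ≡ G x) → E p F ≡ E p G
  E-ext [] h = h []
  E-ext (q ∷ p) h = cong₂ (λ a b → (1ℚ - q) * a + q * b) (E-ext p (h ∘ (false ∷_))) (E-ext p (h ∘ (true ∷_)))

  E-+ : ∀ {n} (p : Vec ℚ n) F G → E p (λ x → F x + G x) ≡ E p F + E p G
  E-+ [] F G = refl
  E-+ (q ∷ p) F G = trans (cong₂ (λ a b → (1ℚ - q) * a + q * b) (E-+ p _ _) (E-+ p _ _))
    (solve 5 (λ q a b c d → (con 1ℚ :- q) :* (a :+ b) :+ q :* (c :+ d) := ((con 1ℚ :- q) :* a :+ q :* c) :+ ((con 1ℚ :- q) :* b :+ q :* d)) refl
      q (E p (F ∘ (false ∷_))) (E p (G ∘ (false ∷_))) (E p (F ∘ (true ∷_))) (E p (G ∘ (true ∷_))))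

  E-scale : ∀ {n} (p : Vec ℚ n) k F → E p (λ x → k * F x) ≡ k * E p F
  E-scale [] k F = refl
  E-scale (q ∷ p) k F = trans (cong₂ (λ a b → (1ℚ - q) * a + q * b) (E-scale p k _) (E-scale p k _))
    (solve 4 (λ q k a b → (con 1ℚ :- q) :* (k :* a) :+ q :* (k :* b) := k :* ((con 1ℚ :- q) :* a :+ q :* b)) refl
      q k (E p (F ∘ (false ∷_))) (E p (F ∘ (true ∷_))))

  E-const : ∀ {n} (p : Vec ℚ n) k → E p (λ _ → k) ≡ k
  E-const [] k = refl
  E-const (q ∷ p) k = trans (cong₂ (λ a b → (1ℚ - q) * a + q * b) (E-const p k) (E-const p k))
    (solve 2 (λ q k → (con 1ℚ :- q) :* k :+ q :* k := k) refl q k)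

  π : ∀ {n} → Vec ℚ n → Fin n → Bool → ℚ
  π p i v = if v then lookup p i else 1ℚ - lookup p i

  point : Bool → ℚ
  point v = if v then 1ℚ else 0ℚ

  E-cond : ∀ {n} (p : Vec ℚ n) i F → E p F ≡ π p i false * E (p [ i ]≔ 0ℚ) F + π p i true * E (p [ i ]≔ 1ℚ) F
  E-cond (q ∷ p) zero F =
    solve 3 (λ q a b → (con 1ℚ :- q) :* a :+ q :* b :=
      (con 1ℚ :- q) :* ((con 1ℚ :- con 0ℚ) :* a :+ con 0ℚ :* b) :+ q :* ((con 1ℚ :- con 1ℚ) :* a :+ con 1ℚ :* b)) refl
      q (E p (F ∘ (false ∷_))) (E p (F ∘ (true ∷_)))
  E-cond (q ∷ p) (suc i) F = trans (cong₂ (λ a b → (1ℚ - q) * a + q * b) (E-cond p i _) (E-cond p i _))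
    (solve 6 (λ q r a b c d → (con 1ℚ :- q) :* ((con 1ℚ :- r) :* a :+ r :* b) :+ q :* ((con 1ℚ :- r) :* c :+ r :* d) :=
       (con 1ℚ :- r) :* ((con 1ℚ :- q) :* a :+ q :* c) :+ r :* ((con 1ℚ :- q) :* b :+ q :* d)) refl
       q (lookup p i) (E (p [ i ]≔ 0ℚ) (F ∘ (false ∷_))) (E (p [ i ]≔ 1ℚ) (F ∘ (false ∷_))) (E (p [ i ]≔ 0ℚ) (F ∘ (true ∷_))) (E (p [ i ]≔ 1ℚ) (F ∘ (true ∷_))))

  E-on : ∀ {n} (p : Vec ℚ n) i v {F G} → (∀ x → lookup x i ≡ v → F x ≡ G x) → E (p [ i ]≔ point v) F ≡ E (p [ i ]≔ point v) G
  E-on (q ∷ p) zero true {F} {G} h = trans (cong (λ b → (1ℚ - 1ℚ) * E p (F ∘ (false ∷_)) + 1ℚ * b) (E-ext p (λ x → h (true ∷ x) refl)))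
    (solve 3 (λ a b c → (con 1ℚ :- con 1ℚ) :* a :+ con 1ℚ :* b := (con 1ℚ :- con 1ℚ) :* c :+ con 1ℚ :* b) refl (E p (F ∘ (false ∷_))) (E p (G ∘ (true ∷_))) (E p (G ∘ (false ∷_))))
  E-on (q ∷ p) zero false {F} {G} h = trans (cong (λ b → (1ℚ - 0ℚ) * b + 0ℚ * E p (F ∘ (true ∷_))) (E-ext p (λ x → h (false ∷ x) refl)))
    (solve 3 (λ a b c → (con 1ℚ :- con 0ℚ) :* b :+ con 0ℚ :* a := (con 1ℚ :- con 0ℚ) :* b :+ con 0ℚ :* c) refl (E p (F ∘ (true ∷_))) (E p (G ∘ (false ∷_))) (E p (G ∘ (true ∷_))))
  E-on (q ∷ p) (suc i) v h = cong₂ (λ a b → (1ℚ - q) * a + q * b) (E-on p i v (λ x → h (false ∷ x))) (E-on p i v (λ x → h (true ∷ x)))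

  avg : ∀ {n} → Vec ℚ n → Fin n → (Vec Bool n → ℚ) → Vec Bool n → ℚ
  avg p i F x = π p i false * F (x [ i ]≔ false) + π p i true * F (x [ i ]≔ true)

  -- Redrawing coordinate `i` independently preserves a product distribution. This is how the charge
  -- to a test gets averaged over the outcome of that very test.
  E-avg : ∀ {n} (p : Vec ℚ n) i F → E p F ≡ E p (avg p i F)
  E-avg (q ∷ p) zero F =
    sym (trans (cong (λ z → (1ℚ - q) * z + q * z) avg≡)
      (solve 3 (λ q a b → (con 1ℚ :- q) :* ((con 1ℚ :- q) :* a :+ q :* b) :+ q :* ((con 1ℚ :- q) :* a :+ q :* b) := (con 1ℚ :- q) :* a :+ q :* b) refl
        q (E p (F ∘ (false ∷_))) (E p (F ∘ (true ∷_)))))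
    where
      avg≡ : E p (λ x → (1ℚ - q) * F (false ∷ x) + q * F (true ∷ x)) ≡ (1ℚ - q) * E p (F ∘ (false ∷_)) + q * E p (F ∘ (true ∷_))
      avg≡ = trans (E-+ p _ _) (cong₂ _+_ (E-scale p (1ℚ - q) _) (E-scale p q _))
  E-avg (q ∷ p) (suc i) F = cong₂ (λ a b → (1ℚ - q) * a + q * b) (E-avg p i _) (E-avg p i _)

  expectedCost-E : ∀ {n} (p c : Vec ℚ n) t → expectedCost p c t ≡ E p (costOn c t)
  expectedCost-E {n} p c t = sum-E p (costOn c t)
    where
      sum : ∀ {m} → (Vec Bool m → ℚ) → (Vec Bool m → ℚ) → List (Vec Bool m) → ℚ
      sum P F = foldr (λ x r → P x * F x + r) 0ℚ
      sum-++ : ∀ {m} P F (xs ys : List (Vec Bool m)) → sum P F (xs ++ ys) ≡ sum P F xs + sum P F ys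
      sum-++ P F [] ys = sym (+-identityˡ _)
      sum-++ P F (x ∷ xs) ys = trans (cong (P x * F x +_) (sum-++ P F xs ys)) (sym (+-assoc (P x * F x) _ _))
      sum-map : ∀ {m} (P : Vec Bool m → ℚ) (P' : Vec Bool (suc m) → ℚ) k b F (xs : List (Vec Bool m)) → (∀ x → P' (b ∷ x) ≡ k * P x) →
                sum P' F (map (b ∷_) xs) ≡ k * sum P (F ∘ (b ∷_)) xs
      sum-map P P' k b F [] h = sym (*-zeroʳ k)
      sum-map P P' k b F (x ∷ xs) h = trans (cong₂ (λ a r → a * F (b ∷ x) + r) (h x) (sum-map P P' k b F xs h))
        (solve 4 (λ k a f r → (k :* a) :* f :+ k :* r := k :* (a :* f :+ r)) refl k (P x) (F (b ∷ x)) _)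
      sum-E : ∀ {m} (p : Vec ℚ m) F → sum (prob p) F (allInputs m) ≡ E p F
      sum-E [] F = trans (+-identityʳ _) (*-identityˡ (F []))
      sum-E (q ∷ p) F = trans (sum-++ (prob (q ∷ p)) F (map (false ∷_) (allInputs _)) _)
        (cong₂ _+_ (trans (sum-map (prob p) (prob (q ∷ p)) (1ℚ - q) false F (allInputs _) (λ _ → refl)) (cong ((1ℚ - q) *_) (sum-E p _)))
                   (trans (sum-map (prob p) (prob (q ∷ p)) q true F (allInputs _) (λ _ → refl)) (cong (q *_) (sum-E p _))))

-- The bit length as an integer logarithm.

module Logs where

  open Numerals using (bl; blF)
  open import Data.Nat using (ℕ; zero; suc; _+_; _*_; _∸_; _^_; _≤_; _<_; z≤n; s≤s; ⌊_/2⌋)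
  open import Data.Nat.Properties
  open import Data.Nat.Logarithm using (⌈log₂_⌉; ⌈log₂⌉-mono-≤; ⌈log₂2^n⌉≡n)
  open import Data.Product using (Σ; _×_; _,_)
  open import Relation.Binary.PropositionalEquality using (_≡_; refl; sym; trans; cong)

  0<2^ : ∀ n → 1 ≤ 2 ^ n
  0<2^ n = m^n>0 2 n

  half≥ : ∀ n → n ≤ suc (2 * ⌊ n /2⌋)
  half≥ zero = z≤n
  half≥ (suc zero) = ≤-refl
  half≥ (suc (suc n)) = ≤-trans (s≤s (s≤s (half≥ n))) (≤-reflexive (cong suc (sym (*-suc 2 ⌊ n /2⌋))))

  half≤ : ∀ n → 2 * ⌊ n /2⌋ ≤ n
  half≤ zero = z≤n
  half≤ (suc zero) = z≤n
  half≤ (suc (suc n)) = ≤-trans (≤-reflexive (*-suc 2 ⌊ n /2⌋)) (s≤s (s≤s (half≤ n)))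

  blF-upper : ∀ f n → n ≤ f → n < 2 ^ blF f n
  blF-upper f zero l = 0<2^ (blF f zero)
  blF-upper (suc f) (suc n) (s≤s l) =
    ≤-trans (s≤s (half≥ (suc n))) (≤-trans (≤-reflexive (sym (*-suc 2 ⌊ suc n /2⌋)))
      (*-monoʳ-≤ 2 (blF-upper f ⌊ suc n /2⌋ (≤-trans (⌊n/2⌋<n n |≤ l) ≤-refl))))
    where
      _|≤_ : ∀ {a b c} → suc a ≤ suc b → b ≤ c → a ≤ c
      s≤s p |≤ q = ≤-trans p q

  blF-zero : ∀ f → blF f 0 ≡ 0
  blF-zero zero = refl
  blF-zero (suc f) = blF-zero f

  blF-lower : ∀ f n → 1 ≤ n → 2 ^ blF f n ≤ 2 * n
  blF-lower zero n l = ≤-trans l (m≤m+n n _)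
  blF-lower (suc f) (suc zero) l rewrite blF-zero f = ≤-refl
  blF-lower (suc f) (suc (suc n)) l =
    *-monoʳ-≤ 2 (≤-trans (blF-lower f (suc ⌊ n /2⌋) (s≤s z≤n)) (half≤ (suc (suc n))))

  bl-upper : ∀ n → n < 2 ^ bl n
  bl-upper n = blF-upper n n ≤-refl

  bl-lower : ∀ n → 1 ≤ n → 2 ^ bl n ≤ 2 * n
  bl-lower n = blF-lower n n

  2^-cancel-< : ∀ {m n} → 2 ^ m < 2 ^ n → m < n
  2^-cancel-< {m} {n} l = ≰⇒> (λ n≤m → <⇒≱ l (^-monoʳ-≤ 2 n≤m))

  bl-mono : ∀ {m n} → m ≤ n → bl m ≤ bl n
  bl-mono {zero} _ = z≤n
  bl-mono {suc m} {n} l = m<1+n⇒m≤n (2^-cancel-< (≤-<-trans (bl-lower (suc m) (s≤s z≤n)) (*-monoʳ-< 2 (≤-<-trans l (bl-upper n)))))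

  -- The least number of the form 2^k - 1 that is at least `m`. As a substitute for `m` it changes
  -- only when the bit length does.
  ω : ℕ → ℕ
  ω m = 2 ^ bl m ∸ 1

  m≤ω : ∀ m → m ≤ ω m
  m≤ω m = m<n⇒m≤n∸1 (bl-upper m)
    where
      m<n⇒m≤n∸1 : ∀ {m n} → m < n → m ≤ n ∸ 1
      m<n⇒m≤n∸1 (s≤s l) = l

  -- The difference 2^(k+d) - 2^k is the sum of the powers of two from 2^k to 2^(k+d-1). There are
  -- `d` of them, and by hypothesis each is at most `m`.
  doubling : ∀ k d {m} → 2 ^ (k + d) ≤ 2 * m → 2 ^ (k + d) ≤ 2 ^ k + m * d
  doubling k zero {m} l = ≤-trans (≤-reflexive (cong (2 ^_) (+-identityʳ k))) (m≤m+n (2 ^ k) (m * 0))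
  doubling k (suc d) {m} l =
    ≤-trans (≤-reflexive (trans (cong (2 ^_) (+-suc k d)) (cong (2 ^ (k + d) +_) (+-identityʳ _))))
      (≤-trans (+-mono-≤ (doubling k d {m} (≤-trans le (m≤m+n m (m + 0)))) le)
        (≤-reflexive (trans (+-assoc (2 ^ k) (m * d) m) (cong (2 ^ k +_) (trans (+-comm (m * d) m) (sym (*-suc m d)))))))
    where
      le : 2 ^ (k + d) ≤ m
      le = *-cancelˡ-≤ 2 (≤-trans (≤-reflexive (cong (2 ^_) (sym (+-suc k d)))) l)

  -- The discrete form of bounding the integral of dt from m' to m by m times the integral of dt /
  -- t: a fall of `ω` is paid for by the fall of the logarithm.
  ω-step : ∀ {m' m} → m' ≤ m → Σ ℕ λ d → (bl m ≡ bl m' + d) × (ω m ≤ ω m' + m * d)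
  ω-step {m'} {zero} z≤n = 0 , refl , ≤-refl
  ω-step {m'} {suc m} l = bl (suc m) ∸ bl m' , sym (m+[n∸m]≡n (bl-mono l)) ,
    ≤-trans (∸-monoˡ-≤ 1 (≤-trans (≤-reflexive (cong (2 ^_) (sym e))) (doubling (bl m') d (≤-trans (≤-reflexive (cong (2 ^_) e)) (bl-lower (suc m) (s≤s z≤n))))))
      (≤-reflexive (+-∸-comm (suc m * d) (0<2^ (bl m'))))
    where
      d = bl (suc m) ∸ bl m'
      e : bl m' + d ≡ bl (suc m)
      e = m+[n∸m]≡n (bl-mono l)

  ω≤ : ∀ m → ω m ≤ m * bl m
  ω≤ m with ω-step {0} {m} z≤n
  ... | d , e , l = ≤-trans l (≤-reflexive (cong (m *_) (sym e)))

  bl≤log : ∀ q → bl q ≤ suc ⌈log₂ q ⌉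
  bl≤log zero = z≤n
  bl≤log (suc q) = go (bl (suc q)) (bl-lower (suc q) (s≤s z≤n))
    where
      go : ∀ k → 2 ^ k ≤ 2 * suc q → k ≤ suc ⌈log₂ suc q ⌉
      go zero    l = z≤n
      go (suc k) l = s≤s (≤-trans (≤-reflexive (sym (⌈log₂2^n⌉≡n k))) (⌈log₂⌉-mono-≤ {2 ^ k} {suc q} (*-cancelˡ-≤ 2 l)))

-- Competitive analysis of greedy trees.

module Approx where

  open import Defs using (Tree; leaf; test; costOn; History)
  open Expectation
  open Logs
  open Numerals using (bl)
  open import Data.Nat as ℕ using (ℕ; zero; suc)
  import Data.Nat.Properties as ℕ
  open import Data.Bool using (Bool; true; false; if_then_else_; not; _∨_)
  open import Data.Fin using (Fin; zero; suc; _≟_)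
  open import Data.List using ([]; _∷_; _++_)
  open import Data.List.Relation.Unary.All as All using (All; []; _∷_)
  open import Data.List.Relation.Unary.All.Properties using (++⁺)
  open import Data.Vec using (Vec; []; _∷_; lookup; _[_]≔_)
  open import Data.Vec.Properties using (lookup∘update; lookup∘update′)
  import Data.Vec.Relation.Unary.All as VAll
  import Data.Vec.Relation.Unary.All.Properties as VAll
  open import Data.Empty using (⊥; ⊥-elim)
  open import Data.Product using (Σ; _,_; proj₁; proj₂)
  open import Data.Sum using (inj₁; inj₂)
  open import Data.Rational using (ℚ; 0ℚ; 1ℚ; _+_; _*_; _-_; -_; _≤_; _⊔_)
  open import Data.Rational.Properties hiding (_≟_)
  open import Data.Rational.Solver using (module +-*-Solver)
  open import Function using (_∘_)
  open import Relation.Nullary using (yes; no; does)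
  open import Relation.Binary.PropositionalEquality using (_≡_; refl; sym; trans; cong; cong₂; subst; _≢_)

  open +-*-Solver using (solve; _:+_; _:*_; _:-_; :-_; _:=_; con)

  ι : ℕ → ℚ
  ι zero    = 0ℚ
  ι (suc m) = 1ℚ + ι m

  0≤1 : 0ℚ ≤ 1ℚ
  0≤1 = nonNegative⁻¹ 1ℚ

  0≤ι : ∀ m → 0ℚ ≤ ι m
  0≤ι zero    = ≤-refl
  0≤ι (suc m) = 0≤+ 0≤1 (0≤ι m)

  ι-+ : ∀ a b → ι (a ℕ.+ b) ≡ ι a + ι b
  ι-+ zero b = sym (+-identityˡ (ι b))
  ι-+ (suc a) b = trans (cong (1ℚ +_) (ι-+ a b)) (sym (+-assoc 1ℚ (ι a) (ι b)))

  ι-* : ∀ a b → ι (a ℕ.* b) ≡ ι a * ι b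
  ι-* zero b = sym (*-zeroˡ (ι b))
  ι-* (suc a) b = trans (ι-+ b (a ℕ.* b)) (trans (cong (ι b +_) (ι-* a b))
    (solve 2 (λ a b → b :+ a :* b := (con 1ℚ :+ a) :* b) refl (ι a) (ι b)))

  ι-mono : ∀ {a b} → a ℕ.≤ b → ι a ≤ ι b
  ι-mono {b = b} ℕ.z≤n = 0≤ι b
  ι-mono (ℕ.s≤s l) = +-monoʳ-≤ 1ℚ (ι-mono l)

  Sum : ∀ {n} → (Fin n → ℚ) → ℚ
  Sum {zero}  f = 0ℚ
  Sum {suc n} f = f zero + Sum (f ∘ suc)

  Sum-mono : ∀ {n} {f g : Fin n → ℚ} → (∀ j → f j ≤ g j) → Sum f ≤ Sum g
  Sum-mono {zero} h = ≤-refl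
  Sum-mono {suc n} h = +-mono-≤ (h zero) (Sum-mono (h ∘ suc))

  Sum-+ : ∀ {n} (f g : Fin n → ℚ) → Sum (λ j → f j + g j) ≡ Sum f + Sum g
  Sum-+ {zero} f g = refl
  Sum-+ {suc n} f g = trans (cong (f zero + g zero +_) (Sum-+ (f ∘ suc) (g ∘ suc)))
    (solve 4 (λ a b c d → (a :+ b) :+ (c :+ d) := (a :+ c) :+ (b :+ d)) refl (f zero) (g zero) (Sum (f ∘ suc)) (Sum (g ∘ suc)))

  Sum-scale : ∀ {n} k (f : Fin n → ℚ) → Sum (λ j → k * f j) ≡ k * Sum f
  Sum-scale {zero} k f = sym (*-zeroʳ k)
  Sum-scale {suc n} k f = trans (cong (k * f zero +_) (Sum-scale k (f ∘ suc))) (sym (*-distribˡ-+ k (f zero) _))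

  Sum-ext : ∀ {n} {f g : Fin n → ℚ} → (∀ j → f j ≡ g j) → Sum f ≡ Sum g
  Sum-ext {zero} h = refl
  Sum-ext {suc n} h = cong₂ _+_ (h zero) (Sum-ext (h ∘ suc))

  Sum-zero : ∀ n → Sum {n} (λ _ → 0ℚ) ≡ 0ℚ
  Sum-zero zero = refl
  Sum-zero (suc n) = trans (+-identityˡ _) (Sum-zero n)

  E-Sum : ∀ {m n} (p : Vec ℚ m) (F : Fin n → Vec Bool m → ℚ) → E p (λ x → Sum (λ j → F j x)) ≡ Sum (λ j → E p (F j))
  E-Sum {n = zero} p F = E-const p 0ℚ
  E-Sum {n = suc n} p F = trans (E-+ p (F zero) _) (cong (E p (F zero) +_) (E-Sum p (F ∘ suc)))

  only : Bool → ℚ → ℚ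
  only b a = if b then a else 0ℚ

  only-+ : ∀ b a c → only b (a + c) ≡ only b a + only b c
  only-+ true a c = refl
  only-+ false a c = refl

  only-* : ∀ b k a → only b (k * a) ≡ k * only b a
  only-* true k a = refl
  only-* false k a = sym (*-zeroʳ k)

  subtree : ∀ {n} → Bool → Tree n → Tree n → Tree n
  subtree v t₀ t₁ = if v then t₁ else t₀

  mem : ∀ {n} → Tree n → Vec Bool n → Fin n → Bool
  mem (leaf b) x j = false
  mem (test i t₀ t₁) x j = does (j ≟ i) ∨ (if lookup x i then mem t₁ x j else mem t₀ x j)

  -- The value of `x j` can steer the path only after `j` has been tested, and by then the answer is
  -- settled.
  mem-self : ∀ {n} (t : Tree n) x j v → mem t (x [ j ]≔ v) j ≡ mem t x j
  mem-self (leaf b) x j v = refl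
  mem-self (test i t₀ t₁) x j v with j ≟ i
  ... | yes _ = refl
  ... | no ne rewrite lookup∘update′ {i = i} {j} (λ e → ne (sym e)) x v with lookup x i
  ...   | true = mem-self t₁ x j v
  ...   | false = mem-self t₀ x j v

  costOn-test : ∀ {n} (c : Vec ℚ n) i t₀ t₁ x v → lookup x i ≡ v → costOn c (test i t₀ t₁) x ≡ lookup c i + costOn c (subtree v t₀ t₁) x
  costOn-test c i t₀ t₁ x v e with lookup x i
  costOn-test c i t₀ t₁ x .false refl | false = refl
  costOn-test c i t₀ t₁ x .true refl | true = refl

  Consistent : ∀ {n} → History n → Vec Bool n → Set
  Consistent h x = All (λ e → lookup x (proj₁ e) ≡ proj₂ e) h

  π≥0 : ∀ {n} {p : Vec ℚ n} → VAll.All Prob p → ∀ i v → 0ℚ ≤ π p i v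
  π≥0 pp i true  = proj₁ (VAll.lookup⁺ pp i)
  π≥0 pp i false = proj₂ (VAll.lookup⁺ pp i)

  -- Abstracts from formulas: `r w h` stands for the number of unresolved groups of family `w`, and
  -- `u w h j v` for how many of them the outcome `v` of test `j` resolves. The analysis rests only
  -- on the properties collected in `Facts`.
  module Greed {n : ℕ} (p c : Vec ℚ n) (α : ℚ)
               (r : Bool → History n → ℕ) (u : Bool → History n → Fin n → Bool → ℕ) (Untested : Fin n → History n → Set) where

    m : Bool → History n → Fin n → Bool → ℕ
    m w h j v = u w h j v ℕ.* r (not w) h

    Rem : History n → ℕ
    Rem h = r true h ℕ.* r false h

    -- At a node, `θ` is at least the price of the test for some outcome and family, and at most `α`
    -- times the price of every alternative. Both are stated as products instead of quotients, so
    -- that a mass of 0 needs no exception.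
    data Greedy (h : History n) : Tree n → Set where
      stop : ∀ b → Greedy h (leaf b)
      pick : ∀ {i t₀ t₁} θ → 0ℚ ≤ θ → Untested i h →
             (Σ Bool λ v → Σ Bool λ w → lookup c i ≤ θ * (π p i v * ι (m w h i v))) →
             (∀ j v w → Untested j h → θ * (π p j v * ι (m w h j v)) ≤ α * lookup c j) →
             (∀ v → Greedy (h ++ (i , v) ∷ []) (subtree v t₀ t₁)) → Greedy h (test i t₀ t₁)

    V : ∀ {h t} → Greedy h t → ℚ → Vec Bool n → ℚ
    V (stop b) ψ x = 0ℚ
    V {h} (pick {i} θ _ _ _ _ g) ψ x = (ψ ⊔ θ - ψ) * ι (Rem h) + V (g (lookup x i)) (ψ ⊔ θ) x

    -- The charge that family `w` puts on test `j` along the greedy path of `x`. It is defined for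
    -- every variable `j`, whether or not the greedy tree tests it, since the tests to be charged
    -- are those of another strategy.
    S : ∀ {h t} → Bool → Greedy h t → ℚ → Fin n → Vec Bool n → ℚ
    S w (stop b) ψ j x = 0ℚ
    S {h} w (pick {i} θ _ _ _ _ g) ψ j x = (ψ ⊔ θ - ψ) * ι (m w h j (lookup x j)) + S w (g (lookup x i)) (ψ ⊔ θ) j x

    0≤⊔- : ∀ ψ θ → 0ℚ ≤ ψ ⊔ θ - ψ
    0≤⊔- ψ θ = subst (_≤ ψ ⊔ θ - ψ) (+-inverseʳ ψ) (+-monoˡ-≤ (- ψ) (p≤p⊔q ψ θ))

    record Facts : Set where
      field
        probs   : VAll.All Prob p
        costs   : ∀ i → 0ℚ ≤ lookup c i
        0≤α     : 0ℚ ≤ α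
        r-step  : ∀ w h i v → Untested i h → r w (h ++ (i , v) ∷ []) ℕ.+ u w h i v ≡ r w h
        r-mono  : ∀ w h e → r w (h ++ e ∷ []) ℕ.≤ r w h
        u-mono  : ∀ w h e j v → u w (h ++ e ∷ []) j v ℕ.≤ u w h j v
        u≤r     : ∀ w h j v → u w h j v ℕ.≤ r w h
        u-untested : ∀ w h x j → Consistent h x → u w h j (lookup x j) ≢ 0 → Untested j h
        untested-earlier : ∀ j h e → Untested j (h ++ e ∷ []) → Untested j h
        untested-fresh   : ∀ h i v → Untested i (h ++ (i , v) ∷ []) → ⊥

    module Analysis (F : Facts) where
      open Facts F

      -- Family `w` loses exactly `u` groups and the other family gains none, so the product falls
      -- by at least `u` times the old size of the other family, which is the mass.
      gain≤ : ∀ w h i v → Untested i h → Rem (h ++ (i , v) ∷ []) ℕ.+ m w h i v ℕ.≤ Rem h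
      gain≤ true h i v un = ℕ.≤-trans (ℕ.+-monoˡ-≤ (m true h i v) (ℕ.*-monoʳ-≤ (r true h') (r-mono false h (i , v))))
          (ℕ.≤-reflexive (trans (sym (ℕ.*-distribʳ-+ (r false h) (r true h') (u true h i v))) (cong (ℕ._* r false h) (r-step true h i v un))))
        where h' = h ++ (i , v) ∷ []
      gain≤ false h i v un = ℕ.≤-trans (ℕ.+-mono-≤ (ℕ.*-monoˡ-≤ (r false h') (r-mono true h (i , v))) (ℕ.≤-reflexive (ℕ.*-comm (u false h i v) (r true h))))
          (ℕ.≤-reflexive (trans (sym (ℕ.*-distribˡ-+ (r true h) (r false h') (u false h i v))) (cong (r true h ℕ.*_) (r-step false h i v un))))
        where h' = h ++ (i , v) ∷ []

      rem-mono : ∀ h e → Rem (h ++ e ∷ []) ℕ.≤ Rem h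
      rem-mono h e = ℕ.*-mono-≤ (r-mono true h e) (r-mono false h e)

      -- Conditioning on the history alters the probabilities of tested variables only, so the
      -- prices of all others remain those of `p`.
      Agree : History n → Vec ℚ n → Set
      Agree h p' = ∀ j → Untested j h → lookup p' j ≡ lookup p j

      point-prob : ∀ v → Prob (point v)
      point-prob true  = 0≤1 , ≤-refl
      point-prob false = ≤-refl , 0≤1

      all-update : ∀ {k} {q : Vec ℚ k} i {a} → VAll.All Prob q → Prob a → VAll.All Prob (q [ i ]≔ a)
      all-update zero (_ VAll.∷ ps) pa = pa VAll.∷ ps
      all-update (suc i) (x VAll.∷ ps) pa = x VAll.∷ all-update i ps pa

      agree-next : ∀ {h p'} i v a → Agree h p' → Agree (h ++ (i , v) ∷ []) (p' [ i ]≔ a)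
      agree-next {h} {p'} i v a ag j un with j ≟ i
      ... | yes refl = ⊥-elim (untested-fresh h j v un)
      ... | no ne = trans (lookup∘update′ ne p' a) (ag j (untested-earlier j h (i , v) un))

      -- The algebra of one telescoping step from the old maximum `B` to the new one `A`: the budget
      -- `A * R` splits into `B * R`, which was available before, and `(A - B) * R`, the summand of
      -- `V` at this node.
      node : ∀ {C A P₀ P₁ K₀ K₁ X₀ X₁ V₀ V₁ R₀ R₁ R B} → 0ℚ ≤ P₀ → 0ℚ ≤ P₁ → P₀ + P₁ ≡ 1ℚ →
             X₀ ≡ C + K₀ → X₁ ≡ C + K₁ → K₀ ≤ A * R₀ + V₀ → K₁ ≤ A * R₁ + V₁ → C + (P₀ * (A * R₀) + P₁ * (A * R₁)) ≤ A * R →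
             P₀ * X₀ + P₁ * X₁ ≤ B * R + (P₀ * ((A - B) * R + V₀) + P₁ * ((A - B) * R + V₁))
      node {C} {A} {P₀} {P₁} {K₀} {K₁} {_} {_} {V₀} {V₁} {R₀} {R₁} {R} {B} h₀ h₁ e refl refl k₀ k₁ le =
        ≤-trans (+-mono-≤ (*-mono h₀ (+-monoʳ-≤ C k₀)) (*-mono h₁ (+-monoʳ-≤ C k₁)))
        (≤-trans (≤-reflexive e₁) (≤-trans (+-monoˡ-≤ (P₀ * V₀ + P₁ * V₁) le) (≤-reflexive e₂)))
        where
          e₁ : P₀ * (C + (A * R₀ + V₀)) + P₁ * (C + (A * R₁ + V₁)) ≡ (C + (P₀ * (A * R₀) + P₁ * (A * R₁))) + (P₀ * V₀ + P₁ * V₁)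
          e₁ = trans (solve 8 (λ P₀ P₁ C A R₀ R₁ V₀ V₁ → P₀ :* (C :+ (A :* R₀ :+ V₀)) :+ P₁ :* (C :+ (A :* R₁ :+ V₁)) :=
                 ((P₀ :+ P₁) :* C :+ (P₀ :* (A :* R₀) :+ P₁ :* (A :* R₁))) :+ (P₀ :* V₀ :+ P₁ :* V₁)) refl P₀ P₁ C A R₀ R₁ V₀ V₁)
                 (cong (λ z → (z + (P₀ * (A * R₀) + P₁ * (A * R₁))) + (P₀ * V₀ + P₁ * V₁)) (trans (cong (_* C) e) (*-identityˡ C)))
          e₂ : A * R + (P₀ * V₀ + P₁ * V₁) ≡ B * R + (P₀ * ((A - B) * R + V₀) + P₁ * ((A - B) * R + V₁))
          e₂ = sym (trans (solve 7 (λ P₀ P₁ A B R V₀ V₁ → B :* R :+ (P₀ :* ((A :- B) :* R :+ V₀) :+ P₁ :* ((A :- B) :* R :+ V₁)) :=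
                 B :* R :+ ((P₀ :+ P₁) :* ((A :- B) :* R) :+ (P₀ :* V₀ :+ P₁ :* V₁))) refl P₀ P₁ A B R V₀ V₁)
                 (trans (cong (λ z → B * R + (z + (P₀ * V₀ + P₁ * V₁))) (trans (cong (_* ((A - B) * R)) e) (*-identityˡ ((A - B) * R))))
                   (solve 4 (λ A B R W → B :* R :+ ((A :- B) :* R :+ W) := A :* R :+ W) refl A B R (P₀ * V₀ + P₁ * V₁))))

      -- With probability `P` the potential `A * R` falls by at least `A * M`, and otherwise it does
      -- not rise; its expected fall pays the cost `C`.
      charge : ∀ {C A P P' M Rv Rv' R} → 0ℚ ≤ A → 0ℚ ≤ P → 0ℚ ≤ P' → P + P' ≡ 1ℚ → C ≤ A * (P * M) → Rv + M ≤ R → Rv' ≤ R →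
               C + (P * (A * Rv) + P' * (A * Rv')) ≤ A * R
      charge {C} {A} {P} {P'} {M} {Rv} {Rv'} {R} a h h' e le l l' =
        ≤-trans (+-monoˡ-≤ _ le) (≤-trans (≤-reflexive (solve 6 (λ A P P' M X Y → A :* (P :* M) :+ (P :* (A :* X) :+ P' :* (A :* Y)) := A :* P :* (X :+ M) :+ A :* P' :* Y) refl A P P' M Rv Rv'))
        (≤-trans (+-mono-≤ (*-mono (0≤* a h) l) (*-mono (0≤* a h') l'))
          (≤-reflexive (trans (solve 4 (λ A P P' R → A :* P :* R :+ A :* P' :* R := (P :+ P') :* (A :* R)) refl A P P' R) (trans (cong (_* (A * R)) e) (*-identityˡ _))))))

      π-sum : ∀ {k} (q : Vec ℚ k) i → π q i false + π q i true ≡ 1ℚ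
      π-sum q i = solve 1 (λ a → (con 1ℚ :- a) :+ a := con 1ℚ) refl (lookup q i)

      -- The future cost is at most the present budget ψ times `Rem`, plus the budget still to be
      -- added by later rises of ψ. At a node ψ is first raised to at least `θ`, after which the
      -- expected fall of the budget covers the cost of the test. Quantifying over `p'` lets the
      -- induction continue under conditioning.
      cost≤V : ∀ {h t} (g : Greedy h t) ψ → 0ℚ ≤ ψ → ∀ p' → VAll.All Prob p' → Agree h p' →
               E p' (costOn c t) ≤ ψ * ι (Rem h) + E p' (V g ψ)
      cost≤V {h} (stop b) ψ ψ0 p' pr ag =
        ≤-trans (≤-reflexive (trans (E-const p' 0ℚ) (sym (+-identityˡ 0ℚ)))) (+-mono-≤ (0≤* ψ0 (0≤ι (Rem h))) (≤-reflexive (sym (E-const p' 0ℚ))))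
      cost≤V {h} (pick {i} {t₀} {t₁} θ θ0 un (v , w , le) _ g) ψ ψ0 p' pr ag =
        subst₂ _≤_ (sym (E-cond p' i _)) (cong (ψ * ι (Rem h) +_) (sym (trans (E-cond p' i _) (cong₂ (λ a b → π p' i false * a + π p' i true * b) (value false) (value true)))))
          (node {lookup c i} {A} {V₀ = E (p' [ i ]≔ point false) (V (g false) A)} {V₁ = E (p' [ i ]≔ point true) (V (g true) A)} {R₀ = ι (Rem (h' false))} {R₁ = ι (Rem (h' true))} {R = ι (Rem h)} {B = ψ} (π≥0 pr i false) (π≥0 pr i true) (π-sum p' i) (expense false) (expense true) (IH false) (IH true) paid)
        where
          open import Relation.Binary.PropositionalEquality using (subst₂)
          A = ψ ⊔ θ
          A0 : 0ℚ ≤ A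
          A0 = ≤-trans ψ0 (p≤p⊔q ψ θ)
          h' : Bool → History n
          h' b = h ++ (i , b) ∷ []
          expense : ∀ b → E (p' [ i ]≔ point b) (costOn c (test i t₀ t₁)) ≡ lookup c i + E (p' [ i ]≔ point b) (costOn c (subtree b t₀ t₁))
          expense b = trans (E-on p' i b (λ x e → costOn-test c i t₀ t₁ x b e)) (trans (E-+ (p' [ i ]≔ point b) (λ _ → lookup c i) (costOn c (subtree b t₀ t₁))) (cong (_+ E (p' [ i ]≔ point b) (costOn c (subtree b t₀ t₁))) (E-const (p' [ i ]≔ point b) (lookup c i))))
          value : ∀ b → E (p' [ i ]≔ point b) (λ x → (A - ψ) * ι (Rem h) + V (g (lookup x i)) A x) ≡ (A - ψ) * ι (Rem h) + E (p' [ i ]≔ point b) (V (g b) A)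
          value b = trans (E-on p' i b {G = λ x → (A - ψ) * ι (Rem h) + V (g b) A x} (λ { x refl → refl })) (trans (E-+ (p' [ i ]≔ point b) (λ _ → (A - ψ) * ι (Rem h)) (V (g b) A)) (cong (_+ E (p' [ i ]≔ point b) (V (g b) A)) (E-const (p' [ i ]≔ point b) ((A - ψ) * ι (Rem h)))))
          IH : ∀ b → E (p' [ i ]≔ point b) (costOn c (subtree b t₀ t₁)) ≤ A * ι (Rem (h' b)) + E (p' [ i ]≔ point b) (V (g b) A)
          IH b = cost≤V (g b) A A0 (p' [ i ]≔ point b) (all-update i pr (point-prob b)) (agree-next {h} {p'} i b (point b) ag)
          same : ∀ b → π p' i b ≡ π p i b
          same true = ag i un
          same false = cong (λ z → 1ℚ - z) (ag i un)
          c≤ : lookup c i ≤ A * (π p' i v * ι (m w h i v))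
          c≤ = ≤-trans le (≤-trans (*-monoʳ-≤-nonNeg _ {{Data.Rational.nonNegative (0≤* (π≥0 probs i v) (0≤ι (m w h i v)))}} (p≤q⊔p ψ θ)) (≤-reflexive (cong (λ z → A * (z * ι (m w h i v))) (sym (same v)))))
          drop : ι (Rem (h' v)) + ι (m w h i v) ≤ ι (Rem h)
          drop = ≤-trans (≤-reflexive (sym (ι-+ (Rem (h' v)) (m w h i v)))) (ι-mono (gain≤ w h i v un))
          pay : ∀ b {M} → lookup c i ≤ A * (π p' i b * M) → ι (Rem (h' b)) + M ≤ ι (Rem h) →
                lookup c i + (π p' i false * (A * ι (Rem (h' false))) + π p' i true * (A * ι (Rem (h' true)))) ≤ A * ι (Rem h)
          pay false c≤ drop = charge A0 (π≥0 pr i false) (π≥0 pr i true) (π-sum p' i) c≤ drop (ι-mono (rem-mono h (i , true)))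
          pay true c≤ drop = ≤-trans (≤-reflexive (cong (lookup c i +_) (+-comm (π p' i false * (A * ι (Rem (h' false)))) _)))
                (charge A0 (π≥0 pr i true) (π≥0 pr i false) (trans (+-comm (π p' i true) _) (π-sum p' i)) c≤ drop (ι-mono (rem-mono h (i , false))))
          paid : lookup c i + (π p' i false * (A * ι (Rem (h' false))) + π p' i true * (A * ι (Rem (h' true)))) ≤ A * ι (Rem h)
          paid = pay v c≤ drop

      gainOf : History n → Fin n → Vec Bool n → ℚ
      gainOf h j x = ι (m true h j (lookup x j)) + ι (m false h j (lookup x j))

      Total : ∀ {h t} → Greedy h t → ℚ → Fin n → Vec Bool n → ℚ
      Total g ψ j x = S true g ψ j x + S false g ψ j x

      consistent-next : ∀ {h : History n} {x : Vec Bool n} i → Consistent h x → Consistent (h ++ (i , lookup x i) ∷ []) x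
      consistent-next i cs = ++⁺ cs (refl ∷ [])

      -- Each occurrence of `Rem` in `V` is replaced by the masses of the tests in `T`, and the sums
      -- over path and tests are exchanged. For `T` the set of tests made by the other strategy on
      -- `x` will be taken.
      V≤S : (T : Fin n → Bool) (x : Vec Bool n) → (∀ h → Consistent h x → ι (Rem h) ≤ Sum (λ j → only (T j) (gainOf h j x))) →
            ∀ {h t} (g : Greedy h t) ψ → Consistent h x → V g ψ x ≤ Sum (λ j → only (T j) (Total g ψ j x))
      V≤S T x cover (stop b) ψ cs = ≤-reflexive (sym (trans (Sum-ext (λ j → zero-only (T j))) (Sum-zero n)))
        where
          zero-only : ∀ b → only b (0ℚ + 0ℚ) ≡ 0ℚ
          zero-only true = refl
          zero-only false = refl
      V≤S T x cover {h} (pick {i} θ _ _ _ _ g) ψ cs =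
        ≤-trans (+-mono-≤ (*-mono (0≤⊔- ψ θ) (cover h cs)) (V≤S T x cover (g (lookup x i)) (ψ ⊔ θ) (consistent-next {h} {x} i cs)))
          (≤-reflexive (trans (cong (_+ Sum (λ j → only (T j) (Total (g (lookup x i)) (ψ ⊔ θ) j x))) (sym (Sum-scale D (λ j → only (T j) (gainOf h j x))))) (trans (sym (Sum-+ (λ j → D * only (T j) (gainOf h j x)) (λ j → only (T j) (Total (g (lookup x i)) (ψ ⊔ θ) j x)))) (Sum-ext (λ j → merge (T j) j)))))
        where
          D = ψ ⊔ θ - ψ
          merge : ∀ b j → D * only b (gainOf h j x) + only b (Total (g (lookup x i)) (ψ ⊔ θ) j x) ≡
                  only b ((D * ι (m true h j (lookup x j)) + S true (g (lookup x i)) (ψ ⊔ θ) j x) + (D * ι (m false h j (lookup x j)) + S false (g (lookup x i)) (ψ ⊔ θ) j x))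
          merge false j = trans (cong (_+ 0ℚ) (*-zeroʳ D)) (+-identityʳ 0ℚ)
          merge true j = solve 5 (λ D a b s t → D :* (a :+ b) :+ (s :+ t) := (D :* a :+ s) :+ (D :* b :+ t)) refl
            D (ι (m true h j (lookup x j))) (ι (m false h j (lookup x j))) (S true (g (lookup x i)) (ψ ⊔ θ) j x) (S false (g (lookup x i)) (ψ ⊔ θ) j x)

      m-mono : ∀ w h e j v → m w (h ++ e ∷ []) j v ℕ.≤ m w h j v
      m-mono w h e j v = ℕ.*-mono-≤ (u-mono w h e j v) (r-mono (not w) h e)

      module _ (w : Bool) (j : Fin n) (x : Vec Bool n) where

        P K : ℚ
        P = π p j (lookup x j)
        K = α * lookup c j

        mass : History n → ℕ
        mass h = m w h j (lookup x j)

        0≤P : 0ℚ ≤ P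
        0≤P = π≥0 probs j (lookup x j)

        0≤K : 0ℚ ≤ K
        0≤K = 0≤* 0≤α (costs j)

        weight : ∀ {A} M d → 0ℚ ≤ A → A * (P * ι M) ≤ K → A * (P * ι (M ℕ.* d)) ≤ K * ι d
        weight {A} M d a le = ≤-trans (≤-reflexive (trans (cong (λ z → A * (P * z)) (ι-* M d))
            (solve 4 (λ A P M d → A :* (P :* (M :* d)) := (A :* (P :* M)) :* d) refl A P (ι M) (ι d))))
          (*-monoʳ-≤-nonNeg (ι d) {{Data.Rational.nonNegative (0≤ι d)}} le)

        -- A positive mass of `j` under its true outcome shows that `j` has not been tested yet, so
        -- `j` is among the alternatives that bound the price; with mass 0 the left side vanishes.
        θ-bound : ∀ {h} θ → Consistent h x → (∀ j v w → Untested j h → θ * (π p j v * ι (m w h j v)) ≤ α * lookup c j) → θ * (P * ι (mass h)) ≤ K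
        θ-bound {h} θ cs le with u w h j (lookup x j) in eq
        ... | suc k = subst (λ z → θ * (P * ι (z ℕ.* r (not w) h)) ≤ K) eq
                (le j (lookup x j) w (u-untested w h x j cs (λ z → ℕ.1+n≢0 (trans (sym eq) z))))
        ... | zero = ≤-trans (≤-reflexive (trans (cong (θ *_) (*-zeroʳ P)) (*-zeroʳ θ))) 0≤K

        ⊔-bound : ∀ {ψ θ z} → ψ * z ≤ K → θ * z ≤ K → (ψ ⊔ θ) * z ≤ K
        ⊔-bound {ψ} {θ} {z} a b with ≤-total ψ θ
        ... | inj₁ l = subst (λ y → y * z ≤ K) (sym (p≤q⇒p⊔q≡q l)) b
        ... | inj₂ l = subst (λ y → y * z ≤ K) (sym (p≥q⇒p⊔q≡p l)) a

        -- Summation by parts, with `ω` in place of the mass. A rise of ψ to `A` is covered by the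
        -- term with `ω`, since the mass is at most its `ω`. When the mass falls from `M` to `M'`,
        -- `ω-step` bounds the loss of `A * (P * ω)` by `A * (P * M)` per lost bit, hence by `K` per
        -- lost bit, which the right side releases. The hypothesis persists because new prices
        -- satisfy it by `θ-bound` and the mass never grows.
        S≤ : ∀ {h t} (g : Greedy h t) ψ → 0ℚ ≤ ψ → Consistent h x → ψ * (P * ι (mass h)) ≤ K →
             P * S w g ψ j x + ψ * (P * ι (ω (mass h))) ≤ K * ι (bl (mass h))
        S≤ {h} (stop b) ψ ψ0 cs inv =
          ≤-trans (≤-reflexive (trans (cong (_+ ψ * (P * ι (ω (mass h)))) (*-zeroʳ P)) (+-identityˡ _)))
            (≤-trans (*-mono ψ0 (*-mono 0≤P (ι-mono (ω≤ (mass h))))) (weight (mass h) (bl (mass h)) ψ0 inv))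
        S≤ {h} (pick {i} θ θ0 un _ bound g) ψ ψ0 cs inv with ω-step (m-mono w h (i , lookup x i) j (lookup x j))
        ... | d , eλ , eω =
          ≤-trans (+-monoˡ-≤ _ (*-mono 0≤P (+-monoˡ-≤ _ (*-mono (0≤⊔- ψ θ) (ι-mono (m≤ω M))))))
          (≤-trans (≤-reflexive (solve 5 (λ P A B W X → P :* ((A :- B) :* W :+ X) :+ B :* (P :* W) := P :* X :+ A :* (P :* W)) refl P A ψ (ι (ω M)) X))
          (≤-trans (+-monoʳ-≤ (P * X) (*-mono A0 (*-mono 0≤P (≤-trans (ι-mono eω) (≤-reflexive (ι-+ (ω M') (M ℕ.* d)))))))
          (≤-trans (≤-reflexive (solve 5 (λ P X A a b → P :* X :+ A :* (P :* (a :+ b)) := (P :* X :+ A :* (P :* a)) :+ A :* (P :* b)) refl P X A (ι (ω M')) (ι (M ℕ.* d))))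
          (≤-trans (+-mono-≤ (S≤ (g (lookup x i)) A A0 (consistent-next {h} {x} i cs) inv'') (weight M d A0 inv'))
            (≤-reflexive (trans (sym (*-distribˡ-+ K (ι (bl M')) (ι d))) (cong (K *_) (trans (sym (ι-+ (bl M') d)) (cong ι (sym eλ))))))))))
          where
            A X : ℚ
            A = ψ ⊔ θ
            X = S w (g (lookup x i)) A j x
            M M' : ℕ
            M = mass h
            M' = mass (h ++ (i , lookup x i) ∷ [])
            A0 : 0ℚ ≤ A
            A0 = ≤-trans ψ0 (p≤p⊔q ψ θ)
            inv' : A * (P * ι M) ≤ K
            inv' = ⊔-bound {ψ} {θ} {P * ι M} inv (θ-bound θ cs bound)
            inv'' : A * (P * ι M') ≤ K
            inv'' = ≤-trans (*-mono A0 (*-mono 0≤P (ι-mono (m-mono w h (i , lookup x i) j (lookup x j))))) inv'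

        S-total : ∀ {t} (g : Greedy [] t) → P * S w g 0ℚ j x ≤ K * ι (bl (Rem []))
        S-total g = ≤-trans (≤-reflexive (sym (trans (cong (P * S w g 0ℚ j x +_) (*-zeroˡ (P * ι (ω (mass []))))) (+-identityʳ _))))
          (≤-trans (S≤ g 0ℚ ≤-refl [] (≤-trans (≤-reflexive (*-zeroˡ (P * ι (mass [])))) 0≤K)) (*-mono 0≤K (ι-mono (bl-mono mass≤))))
          where
            mass≤ : mass [] ℕ.≤ Rem []
            mass≤ = bound w
              where
                bound : ∀ w → m w [] j (lookup x j) ℕ.≤ Rem []
                bound true = ℕ.*-monoˡ-≤ (r false []) (u≤r true [] j (lookup x j))
                bound false = ℕ.≤-trans (ℕ.*-monoˡ-≤ (r true []) (u≤r false [] j (lookup x j))) (ℕ.≤-reflexive (ℕ.*-comm (r false []) (r true [])))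

      -- Only an inequality, since a tree may test a variable repeatedly and pays every time.
      mem-cost : ∀ (t : Tree n) x → Sum (λ j → only (mem t x j) (lookup c j)) ≤ costOn c t x
      mem-cost (leaf b) x = ≤-reflexive (Sum-zero n)
      mem-cost (test i t₀ t₁) x =
        ≤-trans (Sum-mono (λ j → split (does (j ≟ i)) (if lookup x i then mem t₁ x j else mem t₀ x j) j))
        (≤-trans (≤-reflexive (Sum-+ (λ j → only (does (j ≟ i)) (lookup c j)) (λ j → only (if lookup x i then mem t₁ x j else mem t₀ x j) (lookup c j))))
        (≤-trans (+-mono-≤ (≤-reflexive (Sum-point {cs = c} i)) (below (lookup x i) refl))
          (≤-reflexive (sym (costOn-test c i t₀ t₁ x (lookup x i) refl)))))
        where
          split : ∀ a b j → only (a ∨ b) (lookup c j) ≤ only a (lookup c j) + only b (lookup c j)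
          split true true j = ≤-trans (≤-reflexive (sym (+-identityʳ _))) (+-monoʳ-≤ (lookup c j) (costs j))
          split true false j = ≤-reflexive (sym (+-identityʳ _))
          split false b j = ≤-reflexive (sym (+-identityˡ _))
          below : ∀ v → lookup x i ≡ v → Sum (λ j → only (if lookup x i then mem t₁ x j else mem t₀ x j) (lookup c j)) ≤ costOn c (subtree v t₀ t₁) x
          below true e rewrite e = mem-cost t₁ x
          below false e rewrite e = mem-cost t₀ x
          Sum-point : ∀ {k} {cs : Vec ℚ k} (i : Fin k) → Sum (λ j → only (does (j ≟ i)) (lookup cs j)) ≡ lookup cs i
          Sum-point {suc k} {cs = a ∷ cs} zero = trans (cong (a +_) (Sum-zero k)) (+-identityʳ a)
          Sum-point {cs = a ∷ cs} (suc i) = trans (+-identityˡ _) (Sum-point {cs = cs} i)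

      Λ : ℚ
      Λ = ι (bl (Rem []))

      -- The indicator that `t'` tests `j` does not depend on `x j` and leaves the average. What
      -- remains is `α * Λ` times the cost for each of two outcomes and two families, whence the
      -- factor 4. The weight of an outcome in the average is just the factor `P` required by
      -- `S-total`.
      share : ∀ {t} (g : Greedy [] t) (t' : Tree n) j x →
              avg p j (λ y → only (mem t' y j) (Total g 0ℚ j y)) x ≤ (ι 4 * (α * Λ)) * only (mem t' x j) (lookup c j)
      share g t' j x = ≤-trans (≤-reflexive (cong₂ _+_ (cong (λ b → π p j false * only b (Total g 0ℚ j (x [ j ]≔ false))) (mem-self t' x j false))
                                                        (cong (λ b → π p j true * only b (Total g 0ℚ j (x [ j ]≔ true))) (mem-self t' x j true)))) (go (mem t' x j))
        where
          C = lookup c j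
          half : ∀ v → π p j v * Total g 0ℚ j (x [ j ]≔ v) ≤ (α * C) * Λ + (α * C) * Λ
          half v = ≤-trans (≤-reflexive (*-distribˡ-+ (π p j v) _ _))
            (+-mono-≤ (subst (λ z → π p j z * S true g 0ℚ j (x [ j ]≔ v) ≤ (α * C) * Λ) (lookup∘update j x v) (S-total true j (x [ j ]≔ v) g))
                      (subst (λ z → π p j z * S false g 0ℚ j (x [ j ]≔ v) ≤ (α * C) * Λ) (lookup∘update j x v) (S-total false j (x [ j ]≔ v) g)))
          go : ∀ b → π p j false * only b (Total g 0ℚ j (x [ j ]≔ false)) + π p j true * only b (Total g 0ℚ j (x [ j ]≔ true)) ≤ (ι 4 * (α * Λ)) * only b C
          go true = ≤-trans (+-mono-≤ (half false) (half true))
            (≤-reflexive (solve 3 (λ a C L → ((a :* C) :* L :+ (a :* C) :* L) :+ ((a :* C) :* L :+ (a :* C) :* L) := ((con 1ℚ :+ (con 1ℚ :+ (con 1ℚ :+ (con 1ℚ :+ con 0ℚ)))) :* (a :* L)) :* C) refl α C Λ))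
          go false = ≤-reflexive (trans (cong₂ _+_ (*-zeroʳ (π p j false)) (*-zeroʳ (π p j true))) (trans (+-identityˡ 0ℚ) (sym (*-zeroʳ (ι 4 * (α * Λ))))))

      competitive : ∀ {t} (g : Greedy [] t) (t' : Tree n) →
                    (∀ x h → Consistent h x → ι (Rem h) ≤ Sum (λ j → only (mem t' x j) (gainOf h j x))) →
                    E p (costOn c t) ≤ (ι 4 * (α * Λ)) * E p (costOn c t')
      competitive g t' cover =
        ≤-trans (cost≤V g 0ℚ ≤-refl p probs (λ j _ → refl))
        (≤-trans (≤-reflexive (trans (cong (_+ E p (V g 0ℚ)) (*-zeroˡ (ι (Rem [])))) (+-identityˡ _)))
        (≤-trans (E-mono probs (λ x → V≤S (mem t' x) x (cover x) g 0ℚ []))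
        (≤-trans (≤-reflexive (trans (E-Sum p (λ j x → only (mem t' x j) (Total g 0ℚ j x))) (Sum-ext (λ j → E-avg p j (λ x → only (mem t' x j) (Total g 0ℚ j x))))))
        (≤-trans (Sum-mono (λ j → ≤-trans (E-mono probs (share g t' j)) (≤-reflexive (E-scale p k (λ x → only (mem t' x j) (lookup c j))))))
        (≤-trans (≤-reflexive (trans (Sum-scale k (λ j → E p (λ x → only (mem t' x j) (lookup c j)))) (cong (k *_) (sym (E-Sum p (λ j x → only (mem t' x j) (lookup c j)))))))
          (*-mono 0≤k (E-mono probs (mem-cost t')))))))) 
        where
          k = ι 4 * (α * Λ)
          0≤k : 0ℚ ≤ k
          0≤k = 0≤* (0≤ι 4) (0≤* 0≤α (0≤ι (bl (Rem []))))

-- Literals, groups, counting, and evaluation of formulas.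

module Groups where

  open import Defs using (Literal; lit; History; evalLit; evalClause; evalTerm; evalCNF; evalDNF)
  open Literal
  open Words using (eqᵇ; idxEq; binary; matches; hasB; unresGo; count)
  open Numerals using (module NumeralSpecs)
  open Parsing using (asLits)
  open import Data.Nat using (ℕ; zero; suc; _+_; _≤_; z≤n; s≤s)
  open import Data.Nat.Properties
  open import Data.Nat.Binary.Base as B using (2[1+_]; 1+[2_])
  open import Data.Bool using (Bool; true; false; if_then_else_; not; _∧_; _∨_; _xor_)
  open import Data.Bool.Properties using (not-involutive)
  open import Data.Fin using (Fin; zero; suc; toℕ)
  open import Data.Fin.Properties using (toℕ-injective)
  open import Data.List using (List; []; _∷_; _++_)
  import Data.List.Properties as List
  open import Data.List.Membership.Propositional using (_∈_)
  open import Data.List.Relation.Unary.All as All using ([]; _∷_)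
  open import Data.List.Relation.Unary.Any using (here; there)
  open import Data.Vec using (Vec; lookup)
  open import Data.Empty using (⊥; ⊥-elim)
  open import Data.Product using (Σ; _×_; _,_)
  open import Data.Sum using (_⊎_; inj₁; inj₂)
  open import Relation.Binary.PropositionalEquality using (_≡_; refl; sym; trans; cong; cong₂; _≢_)

  true≢false : true ≡ false → ⊥
  true≢false ()

  eqᵇ-refl : ∀ x → eqᵇ x x ≡ true
  eqᵇ-refl B.zero   = refl
  eqᵇ-refl 2[1+ x ] = eqᵇ-refl x
  eqᵇ-refl 1+[2 x ] = eqᵇ-refl x

  eqᵇ-sound : ∀ x y → eqᵇ x y ≡ true → x ≡ y
  eqᵇ-sound B.zero B.zero e = refl
  eqᵇ-sound 2[1+ x ] 2[1+ y ] e = cong 2[1+_] (eqᵇ-sound x y e)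
  eqᵇ-sound 1+[2 x ] 1+[2 y ] e = cong 1+[2_] (eqᵇ-sound x y e)

  eqᵇ-sym : ∀ x y → eqᵇ x y ≡ eqᵇ y x
  eqᵇ-sym B.zero B.zero = refl
  eqᵇ-sym B.zero 2[1+ y ] = refl
  eqᵇ-sym B.zero 1+[2 y ] = refl
  eqᵇ-sym 2[1+ x ] B.zero = refl
  eqᵇ-sym 2[1+ x ] 2[1+ y ] = eqᵇ-sym x y
  eqᵇ-sym 2[1+ x ] 1+[2 y ] = refl
  eqᵇ-sym 1+[2 x ] B.zero = refl
  eqᵇ-sym 1+[2 x ] 2[1+ y ] = refl
  eqᵇ-sym 1+[2 x ] 1+[2 y ] = eqᵇ-sym x y

  binary-injective : ∀ {a b} → binary a ≡ binary b → a ≡ b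
  binary-injective {a} {b} e = trans (sym (NumeralSpecs.binary-toℕ Defs.lb [] a)) (trans (cong B.toℕ e) (NumeralSpecs.binary-toℕ Defs.lb [] b))
    where import Defs

  idxEq-sound : ∀ {n} {i j : Fin n} → idxEq i j ≡ true → i ≡ j
  idxEq-sound {i = i} {j} e = toℕ-injective (binary-injective (eqᵇ-sound (binary (toℕ i)) (binary (toℕ j)) e))

  flip : Bool → Bool → Bool
  flip b s = if b then not s else s

  -- The value of its variable by which a literal is hit in the family b.
  hitV : Bool → Bool → Bool
  hitV b s = if b then s else not s

  hitV-inv : ∀ b v → hitV b (hitV b v) ≡ v
  hitV-inv true v = refl
  hitV-inv false v = not-involutive v

  flip-hitV : ∀ b s → flip (not b) s ≡ hitV b s
  flip-hitV true s = refl
  flip-hitV false s = refl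

  ∧-left : ∀ {a b} → a ∧ b ≡ true → a ≡ true
  ∧-left {true} e = refl

  ∧-right : ∀ {a b} → a ∧ b ≡ true → b ≡ true
  ∧-right {true} e = e

  ∧-both : ∀ {a b} → a ≡ true → b ≡ true → a ∧ b ≡ true
  ∧-both refl refl = refl

  not-true : ∀ {a} → not a ≡ true → a ≡ false
  not-true {false} e = refl

  module _ {n : ℕ} where

    matches-sound : ∀ opp (ℓ g : Literal n) → matches opp ℓ g ≡ true → g ≡ lit (var ℓ) (flip opp (positive ℓ))
    matches-sound opp (lit i s) (lit j t) e with idxEq-sound {i = i} {j} (∧-left e) | ∧-right {idxEq i j} e
    ... | refl | e' = cong (lit i) (sign opp s t e')
      where
        sign : ∀ opp s t → (if s xor t then opp else not opp) ≡ true → t ≡ flip opp s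
        sign true true false e = refl
        sign true false true e = refl
        sign false true true e = refl
        sign false false false e = refl

    matches-complete : ∀ opp i s → matches opp (lit i s) (lit {n} i (flip opp s)) ≡ true
    matches-complete opp i s rewrite eqᵇ-refl (binary (toℕ i)) = sign opp s
      where
        sign : ∀ opp s → (if s xor flip opp s then opp else not opp) ≡ true
        sign true true = refl
        sign true false = refl
        sign false true = refl
        sign false false = refl

    has-sound : ∀ opp (ℓ : Literal n) G → hasB opp ℓ G ≡ true → lit (var ℓ) (flip opp (positive ℓ)) ∈ G
    has-sound opp ℓ (g ∷ G) e with matches opp ℓ g in m
    ... | true  = here (sym (matches-sound opp ℓ g m))
    ... | false = there (has-sound opp ℓ G e)

    has-complete : ∀ opp i s G → lit {n} i (flip opp s) ∈ G → hasB opp (lit i s) G ≡ true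
    has-complete opp i s (g ∷ G) (here refl) rewrite matches-complete opp i s = refl
    has-complete opp i s (g ∷ G) (there m) with matches opp (lit i s) g
    ... | true  = refl
    ... | false = has-complete opp i s G m

    unres-all : ∀ b H G K → unresGo b H G K ≡ true → ∀ (ℓ : Literal n) → ℓ ∈ K → hasB true ℓ G ≡ false × hasB (not b) ℓ H ≡ false
    unres-all b H G (g ∷ K) e .g (here refl) = not-true (∧-left {not (hasB true g G)} e') , not-true (∧-right {not (hasB true g G)} e')
      where
        e' = ∧-left {not (hasB true g G) ∧ not (hasB (not b) g H)} e
    unres-all b H G (g ∷ K) e ℓ (there m) = unres-all b H G K (∧-right {not (hasB true g G) ∧ not (hasB (not b) g H)} e) ℓ m

    resolved-some : ∀ b H G K → unresGo b H G K ≡ false → Σ (Literal n) λ ℓ → ℓ ∈ K × (hasB true ℓ G ≡ true ⊎ hasB (not b) ℓ H ≡ true)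
    resolved-some b H G (g ∷ K) e with hasB true g G in e₁ | hasB (not b) g H in e₂
    ... | true  | _     = g , here refl , inj₁ e₁
    ... | false | true  = g , here refl , inj₂ e₂
    ... | false | false = let (ℓ , m , r) = resolved-some b H G K e in ℓ , there m , r

    has-snoc : ∀ opp (ℓ : Literal n) H g → hasB opp ℓ (H ++ g ∷ []) ≡ hasB opp ℓ H ∨ matches opp ℓ g
    has-snoc opp ℓ [] g = go (matches opp ℓ g)
      where
        go : ∀ b → b ∨ false ≡ b
        go true = refl
        go false = refl
    has-snoc opp ℓ (h ∷ H) g = trans (cong (matches opp ℓ h ∨_) (has-snoc opp ℓ H g)) (assoc (matches opp ℓ h) _ _)
      where
        assoc : ∀ a b c → a ∨ (b ∨ c) ≡ (a ∨ b) ∨ c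
        assoc true b c = refl
        assoc false b c = refl

    -- Turns a search of the history for something that hits `ℓ` into a comparison of `ℓ` with the
    -- one literal that outcome `v` of `i` hits in family `b`.
    hit-match : ∀ b (ℓ : Literal n) i v → matches (not b) ℓ (lit i v) ≡ matches false (lit i (hitV b v)) ℓ
    hit-match b ℓ i v rewrite eqᵇ-sym (binary (toℕ (var ℓ))) (binary (toℕ i)) = cong (idxEq i (var ℓ) ∧_) (sign b (positive ℓ) v)
      where
        sign : ∀ b s v → (if s xor v then not b else not (not b)) ≡ (if hitV b v xor s then false else true)
        sign true true true = refl
        sign true true false = refl
        sign true false true = refl
        sign true false false = refl
        sign false true true = refl
        sign false true false = refl
        sign false false true = refl
        sign false false false = refl

    -- A new outcome resolves exactly the groups containing the literal it hits; for this reason the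
    -- count `u` is precisely the decrement of `r`.
    unres-snoc : ∀ b H G K i v → unresGo b (H ++ lit {n} i v ∷ []) G K ≡ unresGo b H G K ∧ not (hasB false (lit i (hitV b v)) K)
    unres-snoc b H G [] i v = refl
    unres-snoc b H G (ℓ ∷ K) i v =
      trans (cong₂ (λ a z → (not (hasB true ℓ G) ∧ not a) ∧ z) (trans (has-snoc (not b) ℓ H (lit i v)) (cong (hasB (not b) ℓ H ∨_) (hit-match b ℓ i v))) (unres-snoc b H G K i v))
        (shuffle (not (hasB true ℓ G)) (hasB (not b) ℓ H) (matches false (lit i (hitV b v)) ℓ) (unresGo b H G K) (hasB false (lit i (hitV b v)) K))
      where
        shuffle : ∀ t h m u k → (t ∧ not (h ∨ m)) ∧ (u ∧ not k) ≡ ((t ∧ not h) ∧ u) ∧ not (m ∨ k)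
        shuffle false h m u k = refl
        shuffle true true m u k = refl
        shuffle true false true true k = refl
        shuffle true false true false k = refl
        shuffle true false false u k = refl

    count-ext : ∀ {A : Set} {f g : A → Bool} (xs : List A) → (∀ x → f x ≡ g x) → count f xs ≡ count g xs
    count-ext [] h = refl
    count-ext (x ∷ xs) h = cong₂ (λ b k → (if b then 1 else 0) + k) (h x) (count-ext xs h)

    count-mono : ∀ {A : Set} {f g : A → Bool} (xs : List A) → (∀ x → f x ≡ true → g x ≡ true) → count f xs ≤ count g xs
    count-mono [] h = z≤n
    count-mono {f = f} {g} (x ∷ xs) h with f x in e | g x in e'
    ... | true  | true  = s≤s (count-mono xs h)
    ... | true  | false = ⊥-elim (true≢false (trans (sym (h x e)) e'))
    ... | false | true  = m≤n⇒m≤1+n (count-mono xs h)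
    ... | false | false = count-mono xs h

    count-split : ∀ {A : Set} (f g : A → Bool) (xs : List A) → count (λ x → f x ∧ not (g x)) xs + count (λ x → f x ∧ g x) xs ≡ count f xs
    count-split f g [] = refl
    count-split f g (x ∷ xs) with f x | g x
    ... | true  | true  = trans (+-suc _ _) (cong suc (count-split f g xs))
    ... | true  | false = cong suc (count-split f g xs)
    ... | false | _     = count-split f g xs

    count-find : ∀ {A : Set} (f : A → Bool) (xs : List A) → count f xs ≢ 0 → Σ A λ x → x ∈ xs × f x ≡ true
    count-find f [] ne = ⊥-elim (ne refl)
    count-find f (x ∷ xs) ne with f x in e
    ... | true  = x , here refl , e
    ... | false = let (y , m , e') = count-find f xs ne in y , there m , e'

    count-none : ∀ {A : Set} (f : A → Bool) {xs : List A} → count f xs ≡ 0 → ∀ x → x ∈ xs → f x ≡ false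
    count-none f {x ∷ xs} e .x (here refl) with f x
    ... | false = refl
    count-none f {x ∷ xs} e y (there m) with f x
    ... | false = count-none f e y m

    count-pos : ∀ {A : Set} (f : A → Bool) {xs : List A} x → x ∈ xs → f x ≡ true → 1 ≤ count f xs
    count-pos f {x ∷ xs} .x (here refl) e rewrite e = s≤s z≤n
    count-pos f {x ∷ xs} y (there m) e = ≤-trans (count-pos f y m e) (m≤n+m _ (if f x then 1 else 0))

    ∈-asLits : ∀ {i v} {h : History n} → (i , v) ∈ h → lit i v ∈ asLits h
    ∈-asLits (here refl) = here refl
    ∈-asLits (there m) = there (∈-asLits m)

    asLits-∈ : ∀ {i v} {h : History n} → lit i v ∈ asLits h → (i , v) ∈ h
    asLits-∈ {h = e ∷ h} (here refl) = here refl
    asLits-∈ {h = e ∷ h} (there m) = there (asLits-∈ m)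

    asLits-snoc : ∀ (h : History n) i v → asLits (h ++ (i , v) ∷ []) ≡ asLits h ++ lit i v ∷ []
    asLits-snoc h i v = List.map-++ _ h ((i , v) ∷ [])

    clause-true : ∀ a {G} (ℓ : Literal n) → ℓ ∈ G → evalLit a ℓ ≡ true → evalClause a G ≡ true
    clause-true a ℓ (here refl) e rewrite e = refl
    clause-true a {g ∷ G} ℓ (there m) e with evalLit a g
    ... | true  = refl
    ... | false = clause-true a ℓ m e

    clause-false : ∀ a G → (∀ (ℓ : Literal n) → ℓ ∈ G → evalLit a ℓ ≡ false) → evalClause a G ≡ false
    clause-false a [] h = refl
    clause-false a (g ∷ G) h rewrite h g (here refl) = clause-false a G (λ ℓ m → h ℓ (there m))

    term-false : ∀ a {G} (ℓ : Literal n) → ℓ ∈ G → evalLit a ℓ ≡ false → evalTerm a G ≡ false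
    term-false a ℓ (here refl) e rewrite e = refl
    term-false a {g ∷ G} ℓ (there m) e with evalLit a g
    ... | true  = term-false a ℓ m e
    ... | false = refl

    term-true : ∀ a G → (∀ (ℓ : Literal n) → ℓ ∈ G → evalLit a ℓ ≡ true) → evalTerm a G ≡ true
    term-true a [] h = refl
    term-true a (g ∷ G) h rewrite h g (here refl) = term-true a G (λ ℓ m → h ℓ (there m))

    cnf-true : ∀ a F → (∀ G → G ∈ F → evalClause a G ≡ true) → evalCNF {n} F a ≡ true
    cnf-true a [] h = refl
    cnf-true a (G ∷ F) h rewrite h G (here refl) = cnf-true a F (λ G m → h G (there m))

    cnf-false : ∀ a {F} G → G ∈ F → evalClause a G ≡ false → evalCNF {n} F a ≡ false
    cnf-false a G (here refl) e rewrite e = refl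
    cnf-false a {C ∷ F} G (there m) e with evalClause a C
    ... | true  = cnf-false a G m e
    ... | false = refl

    dnf-true : ∀ a {F} G → G ∈ F → evalTerm a G ≡ true → evalDNF {n} F a ≡ true
    dnf-true a G (here refl) e rewrite e = refl
    dnf-true a {C ∷ F} G (there m) e with evalTerm a C
    ... | true  = refl
    ... | false = dnf-true a G m e

    dnf-false : ∀ a F → (∀ G → G ∈ F → evalTerm a G ≡ false) → evalDNF {n} F a ≡ false
    dnf-false a [] h = refl
    dnf-false a (G ∷ F) h rewrite h G (here refl) = dnf-false a F (λ G m → h G (there m))

    Hits : Bool → Vec Bool n → Literal n → Set
    Hits b a ℓ = lookup a (var ℓ) ≡ hitV b (positive ℓ)

    hit-clause : ∀ a ℓ → Hits true a ℓ → evalLit a ℓ ≡ true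
    hit-clause a (lit i true) e = e
    hit-clause a (lit i false) e = trans (cong not e) refl

    hit-term : ∀ a ℓ → Hits false a ℓ → evalLit a ℓ ≡ false
    hit-term a (lit i true) e = e
    hit-term a (lit i false) e = cong not e

    Misses : Bool → Vec Bool n → Literal n → Set
    Misses b a ℓ = lookup a (var ℓ) ≡ not (hitV b (positive ℓ))

    miss-clause : ∀ a ℓ → Misses true a ℓ → evalLit a ℓ ≡ false
    miss-clause a (lit i true) e = e
    miss-clause a (lit i false) e = cong not e

    miss-term : ∀ a ℓ → Misses false a ℓ → evalLit a ℓ ≡ true
    miss-term a (lit i true) e = e
    miss-term a (lit i false) e = cong not e

-- Bit lengths as approximate logarithms, and clearing of denominators.

module Ratio where

  open Approx using (ι; ι-*; ι-mono)
  open Logs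
  open Words using (binary; numB)
  open Numerals
  open import Defs using (bits)
  open import Data.Nat as ℕ using (ℕ; zero; suc; _^_; ⌊_/2⌋; pred)
  import Data.Nat.Properties as ℕ
  open import Data.Nat.Binary.Base as B using (2[1+_]; 1+[2_])
  open import Data.Nat.Solver using () renaming (module +-*-Solver to ℕSolver)
  open import Data.Integer as ℤ using (+_)
  import Data.Integer.Properties as ℤ
  open import Data.List using (length)
  open import Data.Product using (Σ; _×_; _,_; proj₁; proj₂)
  open import Data.Rational using (mkℚ; 1ℚ; _+_; _*_; _≤_; _/_; ↥_; ↧ₙ_; toℚᵘ; positive)
  open import Data.Rational.Properties hiding (_≟_)
  open import Data.Rational.Solver using (module +-*-Solver)
  open import Data.Rational.Unnormalised as ℚᵘ using (ℚᵘ; mkℚᵘ; *≡*)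
  import Data.Rational.Unnormalised.Properties as ℚᵘ
  open import Data.Empty using (⊥-elim)
  open import Data.Sum using (_⊎_; inj₁; inj₂)
  open import Relation.Binary.PropositionalEquality using (_≡_; refl; sym; trans; cong; cong₂; subst; subst₂; _≢_)

  ιᵘ : ∀ m → toℚᵘ (ι m) ℚᵘ.≃ mkℚᵘ (+ m) 0
  ιᵘ zero = ℚᵘ.≃-refl
  ιᵘ (suc m) = ℚᵘ.≃-trans (toℚᵘ-homo-+ 1ℚ (ι m)) (ℚᵘ.≃-trans (ℚᵘ.+-cong (ℚᵘ.≃-refl {toℚᵘ 1ℚ}) (ιᵘ m)) (*≡* (trans (ℤ.*-identityʳ (+ 1 ℤ.* + 1 ℤ.+ + m ℤ.* + 1)) (trans (cong (λ z → + 1 ℤ.+ z) (ℤ.*-identityʳ (+ m))) (sym (ℤ.*-identityʳ (+ suc m)))))))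

  ι≡ : ∀ m → ι m ≡ + m / 1
  ι≡ m = toℚᵘ-injective (ℚᵘ.≃-trans (ιᵘ m) (ℚᵘ.≃-sym (toℚᵘ-fromℚᵘ (mkℚᵘ (+ m) 0))))

  num-den : ∀ q {a} → ↥ q ≡ + a → q * ι (↧ₙ q) ≡ ι a
  num-den q@(mkℚ .(+ a) d _) {a} refl = toℚᵘ-injective (ℚᵘ.≃-trans (toℚᵘ-homo-* q (ι (suc d)))
    (ℚᵘ.≃-trans (ℚᵘ.*-cong (ℚᵘ.≃-refl {toℚᵘ q}) (ιᵘ (suc d)))
    (ℚᵘ.≃-trans (*≡* (trans (ℤ.*-identityʳ (+ a ℤ.* + suc d)) (cong (λ z → + a ℤ.* + z) (sym (ℕ.*-identityʳ (suc d)))))) (ℚᵘ.≃-sym (ιᵘ a)))))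

  -- States that `l` is log₂ x up to an error of `k`. Under multiplication both the logarithms and
  -- the errors add.
  record Ap (k l x : ℕ) : Set where
    constructor within
    field
      below : 2 ^ l ℕ.≤ 2 ^ k ℕ.* x
      above : x ℕ.≤ 2 ^ k ℕ.* 2 ^ l

  ap-* : ∀ {j k l m x y} → Ap j l x → Ap k m y → Ap (j ℕ.+ k) (l ℕ.+ m) (x ℕ.* y)
  ap-* {j} {k} {l} {m} {x} {y} (within a b) (within c d) = within
    (ℕ.≤-trans (ℕ.≤-reflexive (ℕ.^-distribˡ-+-* 2 l m)) (ℕ.≤-trans (ℕ.*-mono-≤ a c)
      (ℕ.≤-reflexive (trans (shuffle (2 ^ j) x (2 ^ k) y) (cong (ℕ._* (x ℕ.* y)) (sym (ℕ.^-distribˡ-+-* 2 j k)))))))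
    (ℕ.≤-trans (ℕ.*-mono-≤ b d) (ℕ.≤-reflexive (trans (shuffle (2 ^ j) (2 ^ l) (2 ^ k) (2 ^ m))
      (cong₂ ℕ._*_ (sym (ℕ.^-distribˡ-+-* 2 j k)) (sym (ℕ.^-distribˡ-+-* 2 l m))))))
    where
      open ℕSolver
      shuffle : ∀ a b c d → (a ℕ.* b) ℕ.* (c ℕ.* d) ≡ (a ℕ.* c) ℕ.* (b ℕ.* d)
      shuffle = solve 4 (λ a b c d → (a :* b) :* (c :* d) := (a :* c) :* (b :* d)) refl

  ap-compare : ∀ {k l m x y} → Ap k l x → Ap k m y → l ℕ.≤ m → x ℕ.≤ (2 ^ k ℕ.* 2 ^ k) ℕ.* y
  ap-compare {k} {l} {m} {x} {y} (within _ a) (within b _) le = ℕ.≤-trans a (ℕ.≤-trans (ℕ.*-monoʳ-≤ (2 ^ k) (ℕ.≤-trans (ℕ.^-monoʳ-≤ 2 le) b))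
    (ℕ.≤-reflexive (sym (ℕ.*-assoc (2 ^ k) (2 ^ k) y))))

  -- With L bijective digits the smallest value, all digits 1, is 2^L - 1, and the largest, all
  -- digits 2, is 2^(L+1) - 2.
  bits-bounds : ∀ x → (2 ^ length (bits x) ℕ.≤ suc (B.toℕ x)) × (2 ℕ.+ B.toℕ x ℕ.≤ 2 ^ suc (length (bits x)))
  bits-bounds B.zero = ℕ.≤-refl , ℕ.≤-refl
  bits-bounds 2[1+ x ] = let (l , u) = bits-bounds x in
    ℕ.≤-trans (ℕ.*-monoʳ-≤ 2 l) (ℕ.n≤1+n _) ,
    ℕ.≤-trans (ℕ.≤-reflexive (solve 1 (λ x → con 2 :+ con 2 :* (con 1 :+ x) := con 2 :* (con 2 :+ x)) refl (B.toℕ x))) (ℕ.*-monoʳ-≤ 2 u)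
    where open ℕSolver
  bits-bounds 1+[2 x ] = let (l , u) = bits-bounds x in
    ℕ.≤-trans (ℕ.*-monoʳ-≤ 2 l) (ℕ.≤-reflexive (solve 1 (λ x → con 2 :* (con 1 :+ x) := con 1 :+ (con 1 :+ con 2 :* x)) refl (B.toℕ x))) ,
    ℕ.≤-trans (ℕ.n≤1+n _) (ℕ.≤-trans (ℕ.≤-reflexive (solve 1 (λ x → con 1 :+ (con 2 :+ (con 1 :+ con 2 :* x)) := con 2 :* (con 2 :+ x)) refl (B.toℕ x))) (ℕ.*-monoʳ-≤ 2 u))
    where open ℕSolver

  binary-toℕ : ∀ m → B.toℕ (binary m) ≡ m
  binary-toℕ = NumeralSpecs.binary-toℕ Defs.lb Data.List.[]
    where import Defs
          import Data.List

  ap-num : ∀ m → 1 ℕ.≤ m → Ap 1 (length (numB m)) m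
  ap-num m pos with bits-bounds (binary m)
  ... | l , u rewrite binary-toℕ m =
    within (ℕ.≤-trans l (ℕ.≤-trans (ℕ.+-monoˡ-≤ m pos) (ℕ.+-monoʳ-≤ m (ℕ.≤-reflexive (sym (ℕ.+-identityʳ m))))))
    (ℕ.≤-trans (ℕ.m≤n+m m 2) u)

  ap-bl : ∀ m → 1 ℕ.≤ m → Ap 1 (bl m) m
  ap-bl m pos = within (bl-lower m pos) (ℕ.≤-trans (ℕ.<⇒≤ (bl-upper m)) (ℕ.m≤m+n (2 ^ bl m) _))

  topBit : ℕ → ℕ → ℕ → ℕ
  topBit zero    p t = t
  topBit (suc T) p t = suc T ℕ.+ p

  -- Over the integers, `value` says that b - a plus the initial carry C - 1 equals R + 2^j (C' -
  -- 1): `R` is the number formed by the `j` binary digits produced, and C' - 1 the final carry. `T`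
  -- is the bit length of `R`.
  record Digits (a b C p t : ℕ) (res : ℕ × ℕ × ℕ) : Set where
    field
      C' j R T : ℕ
      shape : res ≡ (C' , j ℕ.+ p , topBit T p t)
      value : b ℕ.+ C ℕ.+ 2 ^ j ≡ a ℕ.+ 1 ℕ.+ R ℕ.+ 2 ^ j ℕ.* C'
      upper : R ℕ.< 2 ^ T
      lower : T ≢ 0 → 2 ^ T ℕ.≤ 2 ℕ.* R
      short : T ℕ.≤ j
      carry : C' ℕ.≤ 2

  par-half : ∀ s → s ≡ par s ℕ.+ 2 ℕ.* ⌊ s /2⌋
  par-half 0 = refl
  par-half 1 = refl
  par-half (suc (suc s)) = trans (cong (λ z → suc (suc z)) (par-half s)) (solve 2 (λ a b → con 2 :+ (a :+ con 2 :* b) := a :+ con 2 :* (con 1 :+ b)) refl (par s) ⌊ s /2⌋)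
    where open ℕSolver

  par01 : ∀ s → par s ≡ 0 ⊎ par s ≡ 1
  par01 0 = inj₁ refl
  par01 1 = inj₂ refl
  par01 (suc (suc s)) = par01 s

  n<1 : ∀ {n} → n ℕ.< 1 → n ≡ 0
  n<1 {zero} _ = refl
  n<1 {suc n} (ℕ.s≤s ())

  -- Puts one low-order digit below a finished computation. The new binary digit `par s` can be the
  -- top bit only if all higher ones vanish, hence the cases on `T`.
  digit : ∀ {a b C p t} s da db {res} → C ℕ.+ 1 ℕ.+ db ≡ da ℕ.+ s →
          Digits a b ⌊ s /2⌋ (suc p) (topOf (par s) (suc p) t) res → Digits (da ℕ.+ 2 ℕ.* a) (db ℕ.+ 2 ℕ.* b) C p t res
  digit {a} {b} {C} {p} {t} s da db {res} e D = go (par01 s) (T D) refl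
    where
      open Digits
      open ℕSolver
      value' : ∀ β → s ≡ β ℕ.+ 2 ℕ.* ⌊ s /2⌋ → (db ℕ.+ 2 ℕ.* b) ℕ.+ C ℕ.+ 2 ^ suc (j D) ≡ (da ℕ.+ 2 ℕ.* a) ℕ.+ 1 ℕ.+ (β ℕ.+ 2 ℕ.* R D) ℕ.+ 2 ^ suc (j D) ℕ.* C' D
      value' β es = ℕ.suc-injective (trans (solve 4 (λ db b C w → con 1 :+ ((db :+ con 2 :* b) :+ C :+ con 2 :* w) := (C :+ con 1 :+ db) :+ con 2 :* (b :+ w)) refl db b C (2 ^ j D))
        (trans (cong (ℕ._+ 2 ℕ.* (b ℕ.+ 2 ^ j D)) (trans e (cong (da ℕ.+_) es)))
        (trans (solve 5 (λ da β h b w → (da :+ (β :+ con 2 :* h)) :+ con 2 :* (b :+ w) := da :+ β :+ con 2 :* (b :+ h :+ w)) refl da β ⌊ s /2⌋ b (2 ^ j D))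
        (trans (cong (λ z → da ℕ.+ β ℕ.+ 2 ℕ.* z) (value D))
          (solve 6 (λ da β a R w c → da :+ β :+ con 2 :* (a :+ con 1 :+ R :+ w :* c) := con 1 :+ ((da :+ con 2 :* a) :+ con 1 :+ (β :+ con 2 :* R) :+ (con 2 :* w) :* c)) refl da β a (R D) (2 ^ j D) (C' D))))))
      posn : j D ℕ.+ suc p ≡ suc (j D) ℕ.+ p
      posn = ℕ.+-suc (j D) p
      eqs : ∀ β → par s ≡ β → s ≡ β ℕ.+ 2 ℕ.* ⌊ s /2⌋
      eqs β eβ = trans (par-half s) (cong (ℕ._+ 2 ℕ.* ⌊ s /2⌋) eβ)
      make : ∀ β T' → par s ≡ β → topBit (T D) (suc p) (topOf (par s) (suc p) t) ≡ topBit T' p t → β ℕ.+ 2 ℕ.* R D ℕ.< 2 ^ T' →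
             (T' ≢ 0 → 2 ^ T' ℕ.≤ 2 ℕ.* (β ℕ.+ 2 ℕ.* R D)) → T' ℕ.≤ suc (j D) → Digits (da ℕ.+ 2 ℕ.* a) (db ℕ.+ 2 ℕ.* b) C p t res
      make β T' eβ et up lo sh = record { C' = C' D ; j = suc (j D) ; R = β ℕ.+ 2 ℕ.* R D ; T = T'
        ; shape = trans (shape D) (cong₂ (λ x y → C' D , x , y) posn et) ; value = value' β (eqs β eβ)
        ; upper = up ; lower = lo ; short = sh ; carry = carry D }
      go : par s ≡ 0 ⊎ par s ≡ 1 → ∀ T' → T' ≡ T D → Digits (da ℕ.+ 2 ℕ.* a) (db ℕ.+ 2 ℕ.* b) C p t res
      go c zero eT with n<1 (subst (λ z → R D ℕ.< 2 ^ z) (sym eT) (upper D))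
      go (inj₁ eβ) zero eT | r0 = make 0 0 eβ (trans (cong (λ z → topBit z (suc p) (topOf (par s) (suc p) t)) (sym eT)) (cong (λ z → topOf z (suc p) t) eβ))
        (subst (λ z → 2 ℕ.* z ℕ.< 1) (sym r0) (ℕ.s≤s ℕ.z≤n)) (λ n → ⊥-elim (n refl)) ℕ.z≤n
      go (inj₂ eβ) zero eT | r0 = make 1 1 eβ (trans (cong (λ z → topBit z (suc p) (topOf (par s) (suc p) t)) (sym eT)) (cong (λ z → topOf z (suc p) t) eβ))
        (subst (λ z → 1 ℕ.+ 2 ℕ.* z ℕ.< 2) (sym r0) (ℕ.s≤s (ℕ.s≤s ℕ.z≤n)))
        (λ _ → subst (λ z → 2 ℕ.≤ 2 ℕ.* (1 ℕ.+ 2 ℕ.* z)) (sym r0) (ℕ.s≤s (ℕ.s≤s ℕ.z≤n))) (ℕ.s≤s ℕ.z≤n)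
      go c (suc T') eT = make (par s) (suc (suc T')) refl
        (trans (cong (λ z → topBit z (suc p) (topOf (par s) (suc p) t)) (sym eT)) (cong suc (ℕ.+-suc T' p)))
        (ℕ.≤-trans (ℕ.s≤s (ℕ.+-monoˡ-≤ (2 ℕ.* R D) (par≤1 c))) (ℕ.≤-trans (ℕ.≤-reflexive (sym (ℕ.*-suc 2 (R D)))) (ℕ.*-monoʳ-≤ 2 (subst (λ z → R D ℕ.< 2 ^ z) (sym eT) (upper D)))))
        (λ _ → ℕ.*-monoʳ-≤ 2 (ℕ.≤-trans (subst (λ z → 2 ^ z ℕ.≤ 2 ℕ.* R D) (sym eT) (lower D (λ z → ℕ.1+n≢0 (trans eT z)))) (ℕ.m≤n+m (2 ℕ.* R D) (par s))))
        (ℕ.s≤s (subst (ℕ._≤ j D) (sym eT) (short D)))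
        where
          par≤1 : par s ≡ 0 ⊎ par s ≡ 1 → par s ℕ.≤ 1
          par≤1 (inj₁ e) = ℕ.≤-trans (ℕ.≤-reflexive e) ℕ.z≤n
          par≤1 (inj₂ e) = ℕ.≤-reflexive e

  half≤2 : ∀ {s} → s ℕ.≤ 5 → ⌊ s /2⌋ ℕ.≤ 2
  half≤2 l = ℕ.⌊n/2⌋-mono l

  -- The run ends with the digits of `b`, so `a` must not be the longer numeral; otherwise its
  -- remaining digits would be ignored.
  digits : ∀ a b C p t → length (bits a) ℕ.≤ length (bits b) → C ℕ.≤ 2 → Digits (B.toℕ a) (B.toℕ b) C p t (diffD a b C p t)
  digits B.zero B.zero C p t l lC = record { C' = C ; j = 0 ; R = 0 ; T = 0 ; shape = refl ; value = solve 1 (λ C → C :+ con 1 := con 1 :+ (C :+ con 0)) refl C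
    ; upper = ℕ.s≤s ℕ.z≤n ; lower = λ n → ⊥-elim (n refl) ; short = ℕ.z≤n ; carry = lC }
    where open ℕSolver
  digits B.zero 1+[2 b ] C p t l lC =
    (digit (2 ℕ.+ C) 0 1 (solve 1 (λ C → C :+ con 1 :+ con 1 := con 0 :+ (con 2 :+ C)) refl C) (digits B.zero b _ (suc p) _ ℕ.z≤n (half≤2 (ℕ.s≤s (ℕ.s≤s (ℕ.≤-trans lC (ℕ.s≤s (ℕ.s≤s ℕ.z≤n))))))))
    where open ℕSolver
  digits 1+[2 a ] 1+[2 b ] C p t (ℕ.s≤s l) lC =
    (digit (1 ℕ.+ C) 1 1 (solve 1 (λ C → C :+ con 1 :+ con 1 := con 1 :+ (con 1 :+ C)) refl C) (digits a b _ (suc p) _ l (half≤2 (ℕ.s≤s (ℕ.≤-trans lC (ℕ.s≤s (ℕ.s≤s ℕ.z≤n)))))))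
    where open ℕSolver
  digits 2[1+ a ] 1+[2 b ] C p t (ℕ.s≤s l) lC =
    subst₂ (λ x y → Digits x y C p t (diffD 2[1+ a ] 1+[2 b ] C p t)) (sym (ℕ.*-suc 2 (B.toℕ a))) refl (digit C 2 1 (solve 1 (λ C → C :+ con 1 :+ con 1 := con 2 :+ (con 0 :+ C)) refl C) (digits a b _ (suc p) _ l (half≤2 (ℕ.≤-trans lC (ℕ.s≤s (ℕ.s≤s ℕ.z≤n))))))
    where open ℕSolver
  digits B.zero 2[1+ b ] C p t l lC =
    subst₂ (λ x y → Digits x y C p t (diffD B.zero 2[1+ b ] C p t)) refl (sym (ℕ.*-suc 2 (B.toℕ b))) (digit (3 ℕ.+ C) 0 2 (solve 1 (λ C → C :+ con 1 :+ con 2 := con 0 :+ (con 3 :+ C)) refl C) (digits B.zero b _ (suc p) _ ℕ.z≤n (half≤2 (ℕ.s≤s (ℕ.s≤s (ℕ.s≤s lC))))))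
    where open ℕSolver
  digits 1+[2 a ] 2[1+ b ] C p t (ℕ.s≤s l) lC =
    subst₂ (λ x y → Digits x y C p t (diffD 1+[2 a ] 2[1+ b ] C p t)) refl (sym (ℕ.*-suc 2 (B.toℕ b))) (digit (2 ℕ.+ C) 1 2 (solve 1 (λ C → C :+ con 1 :+ con 2 := con 1 :+ (con 2 :+ C)) refl C) (digits a b _ (suc p) _ l (half≤2 (ℕ.s≤s (ℕ.s≤s (ℕ.≤-trans lC (ℕ.s≤s (ℕ.s≤s ℕ.z≤n))))))))
    where open ℕSolver
  digits 2[1+ a ] 2[1+ b ] C p t (ℕ.s≤s l) lC =
    subst₂ (λ x y → Digits x y C p t (diffD 2[1+ a ] 2[1+ b ] C p t)) (sym (ℕ.*-suc 2 (B.toℕ a))) (sym (ℕ.*-suc 2 (B.toℕ b))) (digit (1 ℕ.+ C) 2 2 (solve 1 (λ C → C :+ con 1 :+ con 2 := con 2 :+ (con 1 :+ C)) refl C) (digits a b _ (suc p) _ l (half≤2 (ℕ.s≤s (ℕ.≤-trans lC (ℕ.s≤s (ℕ.s≤s ℕ.z≤n)))))))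
    where open ℕSolver

  shorter : ∀ x y → B.toℕ x ℕ.≤ B.toℕ y → length (bits x) ℕ.≤ length (bits y)
  shorter x y l = ℕ.≮⇒≥ (λ lt → ℕ.<⇒≱ (proj₂ (bits-bounds y)) (ℕ.≤-trans (ℕ.^-monoʳ-≤ 2 lt) (ℕ.≤-trans (proj₁ (bits-bounds x)) (ℕ.s≤s l))))

  -- The initial 1 encodes the carry 0. A final `C'` of 0 would be an outstanding borrow and mean b
  -- < a; with 1 the digits `R` are the difference; with 2 there is one more bit above all `j`
  -- digits.
  ap-diff : ∀ a b k → a ℕ.< b → Σ ℕ λ L → diffRes (diffD (binary a) (binary b) 1 k k) ≡ k ℕ.+ L × Ap 1 L (b ℕ.∸ a)
  ap-diff a b k lt = finish (C' D) refl
    where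
      open Digits
      D : Digits (B.toℕ (binary a)) (B.toℕ (binary b)) 1 k k (diffD (binary a) (binary b) 1 k k)
      D = digits (binary a) (binary b) 1 k k (shorter (binary a) (binary b) (subst₂ ℕ._≤_ (sym (binary-toℕ a)) (sym (binary-toℕ b)) (ℕ.<⇒≤ lt))) (ℕ.s≤s ℕ.z≤n)
      J : ℕ
      J = 2 ^ j D
      val : b ℕ.+ J ≡ a ℕ.+ R D ℕ.+ J ℕ.* C' D
      val = ℕ.suc-injective (trans (solve 2 (λ b J → con 1 :+ (b :+ J) := b :+ con 1 :+ J) refl b J)
        (trans (subst₂ (λ x y → y ℕ.+ 1 ℕ.+ J ≡ x ℕ.+ 1 ℕ.+ R D ℕ.+ J ℕ.* C' D) (binary-toℕ a) (binary-toℕ b) (value D))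
          (solve 3 (λ a R X → a :+ con 1 :+ R :+ X := con 1 :+ (a :+ R :+ X)) refl a (R D) (J ℕ.* C' D))))
        where open ℕSolver
      R<J : R D ℕ.< J
      R<J = ℕ.≤-trans (upper D) (ℕ.^-monoʳ-≤ 2 (short D))
      topBit≡ : ∀ T → topBit T k k ≡ k ℕ.+ T
      topBit≡ zero = sym (ℕ.+-identityʳ k)
      topBit≡ (suc T) = ℕ.+-comm (suc T) k
      res : ∀ c → C' D ≡ c → diffRes (diffD (binary a) (binary b) 1 k k) ≡ topOf (pred c) (suc (j D ℕ.+ k)) (topBit (T D) k k)
      res c ec = trans (cong diffRes (shape D)) (cong (λ z → topOf (pred z) (suc (j D ℕ.+ k)) (topBit (T D) k k)) ec)
      finish : ∀ c → C' D ≡ c → Σ ℕ λ L → diffRes (diffD (binary a) (binary b) 1 k k) ≡ k ℕ.+ L × Ap 1 L (b ℕ.∸ a)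
      finish 0 ec = ⊥-elim (ℕ.<⇒≱ (ℕ.+-monoʳ-< a R<J) (ℕ.≤-trans (ℕ.+-monoˡ-≤ J (ℕ.<⇒≤ lt))
        (ℕ.≤-reflexive (trans val (trans (cong (λ z → a ℕ.+ R D ℕ.+ J ℕ.* z) ec) (trans (cong (a ℕ.+ R D ℕ.+_) (ℕ.*-zeroʳ J)) (ℕ.+-identityʳ _)))))))
      finish 1 ec = T D , trans (res 1 ec) (topBit≡ (T D)) , subst (Ap 1 (T D)) (sym diff) (within (low (T D) refl) (ℕ.≤-trans (ℕ.<⇒≤ (upper D)) (ℕ.m≤m+n (2 ^ T D) _)))
        where
          beq : b ≡ a ℕ.+ R D
          beq = ℕ.+-cancelʳ-≡ J b (a ℕ.+ R D) (trans val (trans (cong (λ z → a ℕ.+ R D ℕ.+ J ℕ.* z) ec) (cong (a ℕ.+ R D ℕ.+_) (ℕ.*-identityʳ J))))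
          diff : b ℕ.∸ a ≡ R D
          diff = trans (cong (ℕ._∸ a) beq) (ℕ.m+n∸m≡n a (R D))
          low : ∀ T' → T' ≡ T D → 2 ^ T D ℕ.≤ 2 ℕ.* R D
          low zero eT = ⊥-elim (ℕ.<⇒≢ lt (sym (trans beq (trans (cong (a ℕ.+_) (n<1 (subst (λ z → R D ℕ.< 2 ^ z) (sym eT) (upper D)))) (ℕ.+-identityʳ a)))))
          low (suc T') eT = lower D (λ z → ℕ.1+n≢0 (trans eT z))
      finish 2 ec = suc (j D) , trans (res 2 ec) (ℕ.+-comm (suc (j D)) k) , subst (Ap 1 (suc (j D))) (sym diff)
          (within (ℕ.*-monoʳ-≤ 2 (ℕ.m≤n+m J (R D))) (ℕ.≤-trans (ℕ.<⇒≤ (ℕ.+-monoˡ-< J R<J)) (ℕ.≤-trans (ℕ.+-monoʳ-≤ J (ℕ.m≤m+n J 0)) (ℕ.m≤m+n (2 ℕ.* J) _))))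
        where
          open ℕSolver
          beq : b ≡ a ℕ.+ (R D ℕ.+ J)
          beq = ℕ.+-cancelʳ-≡ J b (a ℕ.+ (R D ℕ.+ J)) (trans val (trans (cong (λ z → a ℕ.+ R D ℕ.+ J ℕ.* z) ec)
            (solve 3 (λ a R J → a :+ R :+ J :* con 2 := (a :+ (R :+ J)) :+ J) refl a (R D) J)))
          diff : b ℕ.∸ a ≡ R D ℕ.+ J
          diff = trans (cong (ℕ._∸ a) beq) (ℕ.m+n∸m≡n a (R D ℕ.+ J))
      finish (suc (suc (suc c))) ec = ⊥-elim (ℕ.<⇒≱ (ℕ.s≤s (ℕ.s≤s (ℕ.s≤s (ℕ.z≤n {c})))) (ℕ.≤-trans (ℕ.≤-reflexive (sym ec)) (carry D)))

  -- Multiplication by the product `D` of the four denominators turns both sides into the natural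
  -- numbers compared in the last hypothesis.
  scale : ∀ {cᵢ cⱼ πᵢ πⱼ} α {s t s' t' a b a' b' m m'} → 0 ℕ.< t ℕ.* b' ℕ.* (t' ℕ.* b) →
          cᵢ * ι t ≡ ι s → cⱼ * ι t' ≡ ι s' → πᵢ * ι b ≡ ι a → πⱼ * ι b' ≡ ι a' →
          s ℕ.* b ℕ.* (t' ℕ.* a' ℕ.* m') ℕ.≤ α ℕ.* (s' ℕ.* b' ℕ.* (t ℕ.* a ℕ.* m)) →
          cᵢ * (πⱼ * ι m') ≤ ι α * (cⱼ * (πᵢ * ι m))
  scale {cᵢ} {cⱼ} {πᵢ} {πⱼ} α {s} {t} {s'} {t'} {a} {b} {a'} {b'} {m} {m'} pos e₁ e₂ e₃ e₄ le =
    *-cancelʳ-≤-pos (ι D) {{positive (<-≤-trans (positive⁻¹ 1ℚ) (ι-mono {1} pos |1))}} (subst₂ _≤_ (sym left) (sym right) (ι-mono le))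
    where
      D : ℕ
      D = t ℕ.* b' ℕ.* (t' ℕ.* b)
      _|1 : ι 1 ≤ ι D → 1ℚ ≤ ι D
      _|1 = subst (_≤ ι D) (+-identityʳ 1ℚ)
      open +-*-Solver
      ι4 : ∀ x y z u → ι (x ℕ.* y ℕ.* (z ℕ.* u)) ≡ (ι x * ι y) * (ι z * ι u)
      ι4 x y z u = trans (ι-* (x ℕ.* y) (z ℕ.* u)) (cong₂ _*_ (ι-* x y) (ι-* z u))
      ι5 : ∀ x y z u v → ι (x ℕ.* y ℕ.* (z ℕ.* u ℕ.* v)) ≡ (ι x * ι y) * ((ι z * ι u) * ι v)
      ι5 x y z u v = trans (ι4 x y (z ℕ.* u) v) (cong (λ w → (ι x * ι y) * (w * ι v)) (ι-* z u))
      left : (cᵢ * (πⱼ * ι m')) * ι D ≡ ι (s ℕ.* b ℕ.* (t' ℕ.* a' ℕ.* m'))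
      left = trans (cong ((cᵢ * (πⱼ * ι m')) *_) (ι4 t b' t' b))
        (trans (solve 7 (λ c π m t b' t' b → (c :* (π :* m)) :* ((t :* b') :* (t' :* b)) := (c :* t :* b) :* ((t' :* (π :* b')) :* m)) refl cᵢ πⱼ (ι m') (ι t) (ι b') (ι t') (ι b))
        (trans (cong₂ (λ x y → (x * ι b) * ((ι t' * y) * ι m')) e₁ e₄) (sym (ι5 s b t' a' m'))))
      right : (ι α * (cⱼ * (πᵢ * ι m))) * ι D ≡ ι (α ℕ.* (s' ℕ.* b' ℕ.* (t ℕ.* a ℕ.* m)))
      right = trans (cong ((ι α * (cⱼ * (πᵢ * ι m))) *_) (ι4 t b' t' b))
        (trans (solve 8 (λ α c π m t b' t' b → (α :* (c :* (π :* m))) :* ((t :* b') :* (t' :* b)) := α :* ((c :* t' :* b') :* ((t :* (π :* b)) :* m))) refl (ι α) cⱼ πᵢ (ι m) (ι t) (ι b') (ι t') (ι b))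
        (trans (cong₂ (λ x y → ι α * ((x * ι b') * ((ι t * y) * ι m))) e₂ e₃)
          (trans (cong (ι α *_) (sym (ι5 s' b' t a m))) (sym (ι-* α (s' ℕ.* b' ℕ.* (t ℕ.* a ℕ.* m)))))))

-- Unresolved groups, certificates, and existence of candidates.

module Resolution where

  open import Defs
  open Literal
  open Words using (hasB; unresB; rB; uB)
  open Parsing using (asLits)
  open Decide using (module Levels)
  open Groups
  open Approx using (Consistent)
  open import Data.Nat using (ℕ; _+_; _≤_)
  open import Data.Bool using (Bool; true; false; if_then_else_; not; _∧_; _≟_)
  open import Data.Bool.Properties using (¬-not)
  open import Data.Fin using (Fin)
  open import Data.List using (List; []; _∷_; _++_)
  open import Data.List.Membership.Propositional using (_∈_)
  open import Data.List.Membership.Propositional.Properties using (∈-++⁺ˡ; ∈-++⁺ʳ; ∈-++⁻)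
  open import Data.List.Relation.Unary.All as All using (All; []; _∷_)
  open import Data.List.Relation.Unary.All.Properties using (++⁻ˡ; ++⁻ʳ)
  open import Data.List.Relation.Unary.Any using (here; there)
  open import Data.Vec using (Vec; lookup)
  open import Data.Rational using (ℚ)
  open import Data.Empty using (⊥; ⊥-elim)
  open import Data.Product using (Σ; _×_; _,_; proj₁; proj₂)
  open import Data.Sum using (inj₁; inj₂)
  open import Relation.Nullary using (yes; no)
  open import Relation.Binary.PropositionalEquality using (_≡_; refl; sym; trans; cong; subst; _≢_)

  Untested : ∀ {n} → Fin n → History n → Set
  Untested i h = All (λ e → i ≢ proj₁ e) h

  module Status {n : ℕ} (φ₀ φ₁ : List (List (Literal n))) where

    family : Bool → List (List (Literal n))
    family b = if b then φ₀ else φ₁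

    r : Bool → History n → ℕ
    r w h = rB w (family w) (asLits h)

    u : Bool → History n → Fin n → Bool → ℕ
    u w h i v = uB w (family w) (asLits h) (lit i (hitV w v))

    unres-step : ∀ w (h : History n) (i : Fin n) v (G : List (Literal n)) → unresB w (asLits (h ++ (i , v) ∷ [])) G ≡ unresB w (asLits h) G ∧ not (hasB false (lit i (hitV w v)) G)
    unres-step w h i v G = trans (cong (λ H → unresB w H G) (asLits-snoc h i v)) (unres-snoc w (asLits h) G G i v)

    unres-earlier : ∀ w (h : History n) e (G : List (Literal n)) → unresB w (asLits (h ++ e ∷ [])) G ≡ true → unresB w (asLits h) G ≡ true
    unres-earlier w h (i , v) G t = ∧-left {unresB w (asLits h) G} {not (hasB false (lit i (hitV w v)) G)} (trans (sym (unres-step w h i v G)) t)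

    r-step : ∀ w h i v → Untested i h → r w (h ++ (i , v) ∷ []) + u w h i v ≡ r w h
    r-step w h i v _ = trans (cong (_+ u w h i v) (count-ext {n} {f = unresB w (asLits (h ++ (i , v) ∷ []))} {λ G → unresB w (asLits h) G ∧ not (hasB false (lit i (hitV w v)) G)} (family w) (λ G → unres-step w h i v G)))
      (count-split {n} (unresB w (asLits h)) (hasB false (lit i (hitV w v))) (family w))

    r-mono : ∀ w h e → r w (h ++ e ∷ []) ≤ r w h
    r-mono w h e = count-mono {n} {f = unresB w (asLits (h ++ e ∷ []))} {unresB w (asLits h)} (family w) (unres-earlier w h e)

    u-mono : ∀ w h e j v → u w (h ++ e ∷ []) j v ≤ u w h j v
    u-mono w h e j v = count-mono {n} {f = λ G → unresB w (asLits (h ++ e ∷ [])) G ∧ hasB false (lit j (hitV w v)) G} {λ G → unresB w (asLits h) G ∧ hasB false (lit j (hitV w v)) G} (family w) (λ G t → ∧-both {unresB w (asLits h) G} {hasB false (lit j (hitV w v)) G} (unres-earlier w h e G (∧-left {unresB w (asLits (h ++ e ∷ [])) G} {hasB false (lit j (hitV w v)) G} t)) (∧-right {unresB w (asLits (h ++ e ∷ [])) G} {hasB false (lit j (hitV w v)) G} t))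

    u≤r : ∀ w h j v → u w h j v ≤ r w h
    u≤r w h j v = count-mono {n} {f = λ G → unresB w (asLits h) G ∧ hasB false (lit j (hitV w v)) G} {unresB w (asLits h)} (family w) (λ G t → ∧-left {unresB w (asLits h) G} {hasB false (lit j (hitV w v)) G} t)

    -- If `j` had been tested, a consistent history would show its value `lookup x j`, and every
    -- group counted by `u` would have been resolved by that outcome.
    u-untested : ∀ w h x j → Consistent h x → u w h j (lookup x j) ≢ 0 → Untested j h
    u-untested w h x j cs ne = All.tabulate (λ {e} m eq → absurd e m eq)
      where
        ℓ : Literal n
        ℓ = lit j (hitV w (lookup x j))
        absurd : ∀ e → e ∈ h → j ≡ proj₁ e → ⊥
        absurd (.j , b) m refl with count-find {n} _ (family w) ne
        ... | G , _ , t = true≢false (trans (sym (has-complete (not w) j (hitV w (lookup x j)) (asLits h)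
                (subst (λ z → lit j z ∈ asLits h) (sym value) (∈-asLits m)))) (proj₂ (unres-all w (asLits h) G G (∧-left {unresB w (asLits h) G} {hasB false ℓ G} t) ℓ
                (has-sound false ℓ G (∧-right {unresB w (asLits h) G} {hasB false ℓ G} t)))))
          where
            value : flip (not w) (hitV w (lookup x j)) ≡ b
            value = trans (flip-hitV w _) (trans (hitV-inv w (lookup x j)) (All.lookup cs m))

    untested-earlier : ∀ (j : Fin n) h e → Untested j (h ++ e ∷ []) → Untested j h
    untested-earlier j h e un = ++⁻ˡ h un

    untested-fresh : ∀ h (i : Fin n) (v : Bool) → Untested i (h ++ (i , v) ∷ []) → ⊥
    untested-fresh h i v un with ++⁻ʳ h un
    ... | ne ∷ [] = ne refl

    history-value : ∀ {h a opp} {ℓ : Literal n} → Consistent h a → hasB opp ℓ (asLits h) ≡ true → lookup a (var ℓ) ≡ flip opp (positive ℓ)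
    history-value {h} {opp = opp} {ℓ} cs e = All.lookup cs (asLits-∈ {h = h} (has-sound opp ℓ (asLits h) e))

    -- A group resolved by an observation is hit by it. A tautological group contains a literal and
    -- its complement, and every input hits one of the two.
    resolved-hit : ∀ w h a G → Consistent h a → unresB w (asLits h) G ≡ false → Σ (Literal n) λ ℓ → ℓ ∈ G × Hits w a ℓ
    resolved-hit w h a G cs e with resolved-some w (asLits h) G G e
    ... | ℓ , m , inj₂ t = ℓ , m , trans (history-value {h} {a} {ℓ = ℓ} cs t) (flip-hitV w (positive ℓ))
    ... | ℓ , m , inj₁ t with lookup a (var ℓ) ≟ hitV w (positive ℓ)
    ...   | yes hit = ℓ , m , hit
    ...   | no miss = lit (var ℓ) (not (positive ℓ)) , has-sound true ℓ G t , trans (¬-not miss) (complement w (positive ℓ))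
      where
        complement : ∀ w s → not (hitV w s) ≡ hitV w (not s)
        complement true s = refl
        complement false s = refl

    module _ (same : ∀ x → evalCNF φ₀ x ≡ evalDNF φ₁ x) where

      certify : ∀ w h a → r w h ≡ 0 → Consistent h a → evalDNF φ₁ a ≡ w
      certify true h a z cs = trans (sym (same a)) (cnf-true a φ₀ (λ G m →
        let (ℓ , m' , hit) = resolved-hit true h a G cs (count-none {n} _ z G m) in clause-true a ℓ m' (hit-clause a ℓ hit)))
      certify false h a z cs = dnf-false a φ₁ (λ G m →
        let (ℓ , m' , hit) = resolved-hit false h a G cs (count-none {n} _ z G m) in term-false a ℓ m' (hit-term a ℓ hit))

      missed-clause : ∀ a G → G ∈ φ₀ → (∀ ℓ → ℓ ∈ G → Misses true a ℓ) → evalDNF φ₁ a ≡ false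
      missed-clause a G m miss = trans (sym (same a)) (cnf-false a G m (clause-false a G (λ ℓ m' → miss-clause a ℓ (miss ℓ m'))))

      missed-term : ∀ a G → G ∈ φ₁ → (∀ ℓ → ℓ ∈ G → Misses false a ℓ) → evalDNF φ₁ a ≡ true
      missed-term a G m miss = dnf-true a G m (term-true a G (λ ℓ m' → miss-term a ℓ (miss ℓ m')))

      missed : ∀ w a G → G ∈ family w → (∀ ℓ → ℓ ∈ G → Misses w a ℓ) → evalDNF φ₁ a ≡ not w
      missed true = missed-clause
      missed false = missed-term

    module _ (h : History n) (p c : Vec ℚ n) where

      open Levels φ₀ φ₁ (asLits h) p c using (untested; candsL; cands)

      candsL-sound : ∀ {ℓ} G → ℓ ∈ candsL G → ℓ ∈ G × untested ℓ ≡ true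
      candsL-sound (g ∷ G) m with untested g in e
      candsL-sound (g ∷ G) (here refl) | true = here refl , e
      candsL-sound (g ∷ G) (there m) | true = let (m' , e') = candsL-sound G m in there m' , e'
      candsL-sound (g ∷ G) m | false = let (m' , e') = candsL-sound G m in there m' , e'

      candsL-complete : ∀ {ℓ} G → ℓ ∈ G → untested ℓ ≡ true → ℓ ∈ candsL G
      candsL-complete (g ∷ G) (here refl) e rewrite e = here refl
      candsL-complete (g ∷ G) (there m) e = ∈-++⁺ʳ (if untested g then g ∷ [] else []) (candsL-complete G m e)

      cands-sound : ∀ b {ℓ} F → ℓ ∈ cands b F → Σ (List (Literal n)) λ G → G ∈ F × unresB b (asLits h) G ≡ true × ℓ ∈ G × untested ℓ ≡ true
      cands-sound b (G ∷ F) m with unresB b (asLits h) G in e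
      ... | false = let (G' , m' , s) = cands-sound b F m in G' , there m' , s
      ... | true with ∈-++⁻ (candsL G) m
      ...   | inj₁ m' = G , here refl , e , candsL-sound G m'
      ...   | inj₂ m' = let (G' , m'' , s) = cands-sound b F m' in G' , there m'' , s

      cands-complete : ∀ b {ℓ G} F → G ∈ F → unresB b (asLits h) G ≡ true → ℓ ∈ G → untested ℓ ≡ true → ℓ ∈ cands b F
      cands-complete b (G ∷ F) (here refl) e m u rewrite e = ∈-++⁺ˡ (candsL-complete G m u)
      cands-complete b (G ∷ F) (there m') e m u = ∈-++⁺ʳ (if unresB b (asLits h) G then candsL G else []) (cands-complete b F m' e m u)

      untested-true : ∀ ℓ → Untested (var ℓ) h → untested ℓ ≡ true
      untested-true ℓ un = ∧-both (absent false) (absent true)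
        where
          absent : ∀ opp → not (hasB opp ℓ (asLits h)) ≡ true
          absent opp with hasB opp ℓ (asLits h) in e
          ... | false = refl
          ... | true  = ⊥-elim (All.lookup un (asLits-∈ {h = h} (has-sound opp ℓ (asLits h) e)) refl)

      untested-sound : ∀ ℓ → untested ℓ ≡ true → Untested (var ℓ) h
      untested-sound ℓ e = All.tabulate (λ {d} m eq → absurd d m eq)
        where
          ef : hasB false ℓ (asLits h) ≡ false
          ef = not-true (∧-left {not (hasB false ℓ (asLits h))} {not (hasB true ℓ (asLits h))} e)
          et : hasB true ℓ (asLits h) ≡ false
          et = not-true (∧-right {not (hasB false ℓ (asLits h))} {not (hasB true ℓ (asLits h))} e)
          absurd : ∀ d → d ∈ h → var ℓ ≡ proj₁ d → ⊥
          absurd (_ , v) m refl with v ≟ positive ℓ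
          ... | yes refl = true≢false (trans (sym (has-complete false (var ℓ) (positive ℓ) (asLits h) (∈-asLits m))) ef)
          ... | no ne = true≢false (trans (sym (has-complete true (var ℓ) (positive ℓ) (asLits h) (subst (λ z → lit (var ℓ) z ∈ asLits h) (¬-not ne) (∈-asLits m)))) et)

      module _ (same : ∀ x → evalCNF φ₀ x ≡ evalDNF φ₁ x) (a : Vec Bool n) (cs : Consistent h a) where

        -- In an unresolved group without candidates all literals have been tested and none was hit,
        -- so every consistent input misses the whole group.
        stuck-misses : ∀ w → r w h ≢ 0 → cands w (family w) ≡ [] → evalDNF φ₁ a ≡ not w
        stuck-misses w ne e with count-find {n} _ (family w) ne
        ... | G , m , t = missed same w a G m miss
          where
            split : ∀ ℓ → untested ℓ ≡ false → ∀ w → hasB (not w) ℓ (asLits h) ≡ false → hasB w ℓ (asLits h) ≡ true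
            split ℓ e true e' with hasB false ℓ (asLits h) | hasB true ℓ (asLits h)
            ... | false | true = refl
            split ℓ e false e' with hasB false ℓ (asLits h) | hasB true ℓ (asLits h)
            ... | true | false = refl
            sign : ∀ w s → flip w s ≡ not (hitV w s)
            sign true s = refl
            sign false true = refl
            sign false false = refl
            miss : ∀ ℓ → ℓ ∈ G → Misses w a ℓ
            miss ℓ m' with untested ℓ in et
            ... | true = ⊥-elim (none (subst (ℓ ∈_) e (cands-complete w (family w) m t m' et)))
              where
                none : ∀ {ℓ : Literal n} → ℓ ∈ [] → ⊥
                none ()
            ... | false = trans (history-value {h} {a} {ℓ = ℓ} cs (split ℓ et w (proj₂ (unres-all w (asLits h) G G t ℓ m')))) (sign w (positive ℓ))

        -- A fully missed clause forces the value 0 and a fully missed term the value 1; both at the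
        -- same consistent input `a` is absurd.
        candidate-exists : r true h ≢ 0 → r false h ≢ 0 → cands true φ₀ ≡ [] → cands false φ₁ ≡ [] → ⊥
        candidate-exists ne₁ ne₂ e₁ e₂ = true≢false (trans (sym (stuck-misses false ne₂ e₂)) (stuck-misses true ne₁ e₁))

-- What an arbitrary evaluating tree has to test.

module Covering where

  open import Defs
  open Literal
  open Words using (hasB; unresB; count)
  open Parsing using (asLits)
  open Groups
  open Expectation using (*-mono)
  open Approx
  open Resolution
  open import Data.Nat as ℕ using (ℕ; zero; suc)
  import Data.Nat.Properties as ℕ
  open import Data.Bool using (Bool; true; false; if_then_else_; not; _∧_)
  import Data.Bool as Bool
  open import Data.Bool.Properties using (¬-not)
  open import Data.Fin using (Fin; zero; suc; _≟_)
  open import Data.List using (List; []; _∷_)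
  open import Data.List.Membership.Propositional using (_∈_; find; lose)
  import Data.List.Relation.Unary.Any as Any
  open import Data.List.Relation.Unary.Any using (here; there)
  open import Data.Maybe using (just; nothing)
  open import Data.Vec using (Vec; lookup; tabulate; replicate; _[_]≔_)
  open import Data.Vec.Properties using (lookup∘tabulate; lookup-replicate; lookup∘update; lookup∘update′)
  open import Data.Rational using (ℚ; 0ℚ; 1ℚ; _+_; _*_; _≤_)
  open import Data.Rational.Properties hiding (_≟_)
  open import Data.Empty using (⊥; ⊥-elim)
  open import Data.Product using (Σ; _×_; _,_; proj₁; proj₂)
  open import Data.Sum using (_⊎_; inj₁; inj₂)
  open import Function using (_∘_)
  open import Relation.Nullary using (yes; no)
  open import Relation.Nullary.Decidable using (_×-dec_)
  open import Relation.Binary.PropositionalEquality using (_≡_; refl; sym; trans; cong; cong₂; subst)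

  0≤only : ∀ b {a} → 0ℚ ≤ a → 0ℚ ≤ only b a
  0≤only true h = h
  0≤only false h = ≤-refl

  only-mono : ∀ b {a c} → a ≤ c → only b a ≤ only b c
  only-mono true h = h
  only-mono false h = ≤-refl

  0≤Sum : ∀ {n} {f : Fin n → ℚ} → (∀ j → 0ℚ ≤ f j) → 0ℚ ≤ Sum f
  0≤Sum {zero} h = ≤-refl
  0≤Sum {suc n} h = +-mono-≤ (h zero) (0≤Sum (h ∘ suc))

  Sum-element : ∀ {n} {f : Fin n → ℚ} → (∀ j → 0ℚ ≤ f j) → ∀ j → f j ≤ Sum f
  Sum-element {suc n} {f} h zero = subst (_≤ Sum f) (+-identityʳ (f zero)) (+-monoʳ-≤ (f zero) (0≤Sum (h ∘ suc)))
  Sum-element {suc n} {f} h (suc j) = subst (_≤ Sum f) (+-identityˡ (f (suc j))) (+-mono-≤ (h zero) (Sum-element (h ∘ suc) j))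

  -- A union bound: each element counted on the left is counted again on the right under at least
  -- one index in `T`.
  count-cover : ∀ {A : Set} {n} (f : A → Bool) (g : Fin n → A → Bool) (T : Fin n → Bool) (xs : List A) →
                (∀ x → x ∈ xs → f x ≡ true → Σ (Fin n) λ j → T j ≡ true × g j x ≡ true) →
                ι (count f xs) ≤ Sum (λ j → only (T j) (ι (count (λ x → f x ∧ g j x) xs)))
  count-cover f g T [] h = 0≤Sum (λ j → 0≤only (T j) ≤-refl)
  count-cover f g T (x ∷ xs) h with f x in e
  ... | false = count-cover f g T xs (λ y m → h y (there m))
  ... | true = ≤-trans (+-mono-≤ head (count-cover f g T xs (λ y m → h y (there m))))
      (≤-reflexive (trans (sym (Sum-+ (λ j → only (T j) (ι (hit j))) (λ j → only (T j) (ι (rest j)))))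
        (Sum-ext (λ j → trans (sym (only-+ (T j) (ι (hit j)) (ι (rest j)))) (cong (only (T j)) (sym (ι-+ (hit j) (rest j))))))))
    where
      hit rest : _ → ℕ
      hit j = if g j x then 1 else 0
      rest j = count (λ y → f y ∧ g j y) xs
      head : 1ℚ ≤ Sum (λ j → only (T j) (ι (hit j)))
      head with h x (here refl) e
      ... | j , t , k = ≤-trans (≤-reflexive (sym (trans (cong₂ (λ a b → only a (ι (if b then 1 else 0))) t k) (+-identityʳ 1ℚ))))
        (Sum-element (λ j → 0≤only (T j) (0≤ι (hit j))) j)

  run-lookup : ∀ {n} (t : Tree n) x b i y → lookup (proj₂ (runTree t x b)) i ≡ just y →
               lookup b i ≡ just y ⊎ (mem t x i ≡ true × lookup x i ≡ y)
  run-lookup (leaf v) x b i y e = inj₁ e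
  run-lookup (test k t₀ t₁) x b i y e with lookup x k in ek
  run-lookup (test k t₀ t₁) x b i y e | v with i ≟ k
  run-lookup (test k t₀ t₁) x b i y e | false | yes refl with run-lookup t₀ x (b [ i ]≔ just false) i y e
  ... | inj₂ (_ , e') = inj₂ (refl , e')
  ... | inj₁ e' with trans (sym (lookup∘update i b (just false))) e'
  ...   | refl = inj₂ (refl , ek)
  run-lookup (test k t₀ t₁) x b i y e | true | yes refl with run-lookup t₁ x (b [ i ]≔ just true) i y e
  ... | inj₂ (_ , e') = inj₂ (refl , e')
  ... | inj₁ e' with trans (sym (lookup∘update i b (just true))) e'
  ...   | refl = inj₂ (refl , ek)
  run-lookup (test k t₀ t₁) x b i y e | false | no ne with run-lookup t₀ x (b [ k ]≔ just false) i y e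
  ... | inj₂ s = inj₂ s
  ... | inj₁ e' = inj₁ (trans (sym (lookup∘update′ ne b (just false))) e')
  run-lookup (test k t₀ t₁) x b i y e | true | no ne with run-lookup t₁ x (b [ k ]≔ just true) i y e
  ... | inj₂ s = inj₂ s
  ... | inj₁ e' = inj₁ (trans (sym (lookup∘update′ ne b (just true))) e')

  module Certificates {n : ℕ} (φ₀ φ₁ : List (List (Literal n))) (same : ∀ x → evalCNF φ₀ x ≡ evalDNF φ₁ x)
                      (t : Tree n) (ev : Evaluates (evalDNF φ₁) t) (x : Vec Bool n) where

    open Status φ₀ φ₁

    value : Bool
    value = proj₁ (runTree t x (replicate n nothing))

    Covers : List (Literal n) → Set
    Covers G = Σ (Literal n) λ ℓ → ℓ ∈ G × mem t x (var ℓ) ≡ true × Hits value x ℓ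

    -- If the tested literals left the group unhit, setting the other ones to miss it as well would
    -- give an input that agrees with the observations but has the opposite value.
    covers : ∀ h G → G ∈ family value → unresB value (asLits h) G ≡ true → Covers G
    covers h G m un with Any.any? (λ ℓ → (mem t x (var ℓ) Bool.≟ true) ×-dec (lookup x (var ℓ) Bool.≟ hitV value (positive ℓ))) G
    ... | yes found = let (ℓ , m' , k , hit) = find found in ℓ , m' , k , hit
    ... | no none = ⊥-elim (clash value (trans (sym (ev x a agrees)) (missed same value a G m misses)))
      where
        clash : ∀ b → b ≡ not b → ⊥
        clash true ()
        clash false ()
        -- `hasB false (lit i true) G` is the sign with which `i` occurs in `G`; it is unique
        -- because an unresolved group is not tautological. For a variable that does not occur in
        -- `G` the value is an arbitrary default.
        choice : Fin n → Bool
        choice i = if mem t x i then lookup x i else not (hitV value (hasB false (lit i true) G))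
        a : Vec Bool n
        a = tabulate choice
        agrees : Agrees a (proj₂ (runTree t x (replicate n nothing)))
        agrees i y e with run-lookup t x (replicate n nothing) i y e
        ... | inj₁ e' with trans (sym (lookup-replicate i nothing)) e'
        ...   | ()
        agrees i y e | inj₂ (k , e') = trans (lookup∘tabulate choice i) (trans (cong (λ b → if b then lookup x i else not (hitV value (hasB false (lit i true) G))) k) e')
        sign : ∀ i s → lit i s ∈ G → hasB false (lit i true) G ≡ s
        sign i true m' = has-complete false i true G m'
        sign i false m' with hasB false (lit i true) G in e
        ... | false = refl
        ... | true = ⊥-elim (true≢false (trans (sym (has-complete true i true G m')) (proj₁ (unres-all value (asLits h) G G un (lit i true) (has-sound false (lit i true) G e)))))
        misses : ∀ ℓ → ℓ ∈ G → Misses value a ℓ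
        misses ℓ m' = trans (lookup∘tabulate choice (var ℓ)) (go (mem t x (var ℓ)) refl)
          where
            go : ∀ b → mem t x (var ℓ) ≡ b → (if b then lookup x (var ℓ) else not (hitV value (hasB false (lit (var ℓ) true) G))) ≡ not (hitV value (positive ℓ))
            go true k = ¬-not (λ hit → none (lose m' (k , hit)))
            go false k = cong (λ s → not (hitV value s)) (sign (var ℓ) (positive ℓ) m')

    r-cover : ∀ h → ι (r value h) ≤ Sum (λ j → only (mem t x j) (ι (u value h j (lookup x j))))
    r-cover h = count-cover (unresB value (asLits h)) (λ j G → hasB false (lit j (hitV value (lookup x j))) G) (mem t x) (family value)
      (λ G m un → let (ℓ , m' , k , hit) = covers h G m un in
        var ℓ , k , has-complete false (var ℓ) _ G (subst (λ s → lit (var ℓ) s ∈ G) (sym (trans (cong (hitV value) hit) (hitV-inv value (positive ℓ)))) m'))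

    module _ (p c : Vec ℚ n) (α : ℚ) where

      open Greed p c α r u Untested using (Rem; m)

      -- Only the family belonging to the value computed on `x` is known to be covered. Multiplying
      -- its cover by the count of the other family turns numbers of groups into masses, and the
      -- masses of the other family are just added on the right.
      rem-cover : ∀ h → ι (Rem h) ≤ Sum (λ j → only (mem t x j) (ι (m true h j (lookup x j)) + ι (m false h j (lookup x j))))
      rem-cover h = ≤-trans (≤-reflexive (trans (cong ι (rem≡ value)) (ι-* (r (not value) h) (r value h))))
        (≤-trans (*-mono (0≤ι (r (not value) h)) (r-cover h))
        (≤-trans (≤-reflexive (sym (Sum-scale (ι (r (not value) h)) (λ j → only (mem t x j) (ι (u value h j (lookup x j)))))))
          (Sum-mono (λ j → ≤-trans (≤-reflexive (trans (sym (only-* (mem t x j) (ι (r (not value) h)) (ι (u value h j (lookup x j)))))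
              (cong (only (mem t x j)) (trans (*-comm (ι (r (not value) h)) (ι (u value h j (lookup x j)))) (sym (ι-* (u value h j (lookup x j)) (r (not value) h)))))))
            (only-mono (mem t x j) (part value j))))))
        where
          rem≡ : ∀ w → Rem h ≡ r (not w) h ℕ.* r w h
          rem≡ true = ℕ.*-comm (r true h) (r false h)
          rem≡ false = refl
          part : ∀ w j → ι (m w h j (lookup x j)) ≤ ι (m true h j (lookup x j)) + ι (m false h j (lookup x j))
          part true j = subst (_≤ ι (m true h j (lookup x j)) + ι (m false h j (lookup x j))) (+-identityʳ _) (+-monoʳ-≤ (ι (m true h j (lookup x j))) (0≤ι (m false h j (lookup x j))))
          part false j = subst (_≤ ι (m true h j (lookup x j)) + ι (m false h j (lookup x j))) (+-identityˡ _) (+-monoˡ-≤ (ι (m false h j (lookup x j))) (0≤ι (m true h j (lookup x j))))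

-- The choice of the machine is greedy up to a constant.

module Choice where

  open import Defs hiding (L; R; S)
  open Literal
  open Words using (hasB; unresB; uB; binary; numB)
  open Numerals using (bl)
  open Parsing using (asLits)
  open Decide using (module Levels; nlen; isNil)
  open Groups
  open Expectation using (*-mono; 0≤*; π)
  open Approx
  open Ratio
  open Resolution
  open import Data.Nat as ℕ using (ℕ; zero; suc; _^_)
  import Data.Nat.Properties as ℕ
  import Data.Nat.Binary.Base as B
  open import Data.Nat.Binary.Properties using (toℕ-injective)
  open import Data.Integer as ℤ using (+_; -[1+_]; ∣_∣)
  open import Data.Bool using (Bool; true; false; not; _∧_)
  open import Data.Fin using (Fin)
  open import Data.List using (List; []; _∷_; _++_)
  open import Data.List.Membership.Propositional using (_∈_)
  open import Data.Vec using (Vec; lookup)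
  open import Data.Vec.Relation.Unary.All as VAll using ()
  import Data.Vec.Relation.Unary.All.Properties as VAll
  import Data.Rational
  open import Data.Rational using (ℚ; mkℚ; 0ℚ; 1ℚ; _+_; _*_; _-_; _≤_; _<_; 1/_; ↥_; ↧ₙ_; nonNegative) renaming (positive to isPositive)
  open import Data.Rational.Properties hiding (_≟_)
  open import Data.Rational.Solver using (module +-*-Solver)
  open import Data.Empty using (⊥-elim)
  open import Data.Product using (Σ; _×_; _,_; proj₁; proj₂)
  open import Data.Sum using (_⊎_; inj₁; inj₂)
  open import Relation.Nullary using (yes; no)
  open import Relation.Binary.PropositionalEquality using (_≡_; refl; sym; trans; cong; cong₂; subst; subst₂; _≢_)

  open +-*-Solver using (solve; _:+_; _:*_; _:-_; _:=_; con)

  opaque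
    -- Each side of a comparison is a product of six factors: numerator of a cost, denominator of a
    -- probability, denominator of the other cost, numerator of the other probability, and two
    -- counts. Every length misjudges its factor by at most 2 in either direction, which gives 2^6
    -- once for each side.
    α₀ : ℕ
    α₀ = 2 ^ 6 ℕ.* 2 ^ 6

    α₀-def : α₀ ≡ 2 ^ 6 ℕ.* 2 ^ 6
    α₀-def = refl

  reciprocal : ∀ {X} → 0ℚ < X → Σ ℚ λ ρ → 0ℚ ≤ ρ × ρ * X ≡ 1ℚ
  reciprocal {X} X>0 = 1/ X , <⇒≤ (positive⁻¹ (1/ X) {{1/pos⇒pos X}}) , *-inverseˡ X
    where
      instance
        _ = isPositive X>0
        _ = pos⇒nonZero X

  numerator-nonneg : ∀ q → 0ℚ ≤ q → ↥ q ≡ + ∣ ↥ q ∣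
  numerator-nonneg (mkℚ (+ m) d _) h = refl
  numerator-nonneg q@(mkℚ -[1+ m ] d _) h with nonNegative h
  ... | record { nonNeg = () }

  isNil-numB : ∀ m → isNil (numB m) ≡ true → m ≡ 0
  isNil-numB m e = trans (sym (binary-toℕ m)) (go (binary m) e)
    where
      go : ∀ x → isNil (bits x) ≡ true → B.toℕ x ≡ 0
      go B.zero e = refl

  isNil-zero : ∀ m → isNil (numB m) ≡ false → 1 ℕ.≤ m
  isNil-zero (suc m) e = ℕ.s≤s ℕ.z≤n
  isNil-zero zero e = ⊥-elim (true≢false (trans (sym (cong (λ x → isNil (bits x)) zero≡)) e))
    where
      zero≡ : binary 0 ≡ B.zero
      zero≡ = toℕ-injective (binary-toℕ 0)

  1≤den : ∀ q → 1 ℕ.≤ ↧ₙ q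
  1≤den q = ℕ.s≤s ℕ.z≤n

  0<ι : ∀ {m} → 1 ℕ.≤ m → 0ℚ < ι m
  0<ι {m} l = <-≤-trans (positive⁻¹ 1ℚ) (subst (_≤ ι m) (+-identityʳ 1ℚ) (ι-mono l))

  ι≡0 : ∀ m → m ≡ 0 → ι m ≡ 0ℚ
  ι≡0 m refl = refl

  module Prices {n : ℕ} (p c : Vec ℚ n) (0<p<1 : VAll.All (λ q → (0ℚ < q) × (q < 1ℚ)) p) (0≤c : VAll.All (λ q → 0ℚ ≤ q) c) where

    hp : ∀ i → ↥ lookup p i ≡ + ∣ ↥ lookup p i ∣
    hp i = numerator-nonneg (lookup p i) (<⇒≤ (proj₁ (VAll.lookup⁺ 0<p<1 i)))

    hc : ∀ i → ↥ lookup c i ≡ + ∣ ↥ lookup c i ∣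
    hc i = numerator-nonneg (lookup c i) (VAll.lookup⁺ 0≤c i)

    numer : Fin n → Bool → ℕ
    numer i true  = ∣ ↥ lookup p i ∣
    numer i false = ↧ₙ lookup p i ℕ.∸ ∣ ↥ lookup p i ∣

    module _ (i : Fin n) where

      q : ℚ
      q = lookup p i

      D a : ℕ
      D = ↧ₙ q
      a = ∣ ↥ q ∣

      qD : q * ι D ≡ ι a
      qD = num-den q (hp i)

      0<D : 0ℚ < ι D
      0<D = 0<ι {D} (ℕ.s≤s ℕ.z≤n)

      a<D : a ℕ.< D
      a<D = ℕ.≰⇒> (λ le → <-irrefl refl (<-≤-trans below (ι-mono le)))
        where
          below : ι a < ι D
          below = subst₂ _<_ qD (*-identityˡ (ι D)) (*-monoˡ-<-pos (ι D) {{isPositive 0<D}} (proj₂ (VAll.lookup⁺ 0<p<1 i)))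

      1≤a : 1 ℕ.≤ a
      1≤a = ℕ.≰⇒> (λ le → <-irrefl refl (<-≤-trans above (ι-mono le)))
        where
          above : 0ℚ < ι a
          above = subst₂ _<_ (*-zeroˡ (ι D)) qD (*-monoˡ-<-pos (ι D) {{isPositive 0<D}} (proj₁ (VAll.lookup⁺ 0<p<1 i)))

      π-numer : ∀ v → π p i v * ι D ≡ ι (numer i v)
      π-numer true = qD
      π-numer false = trans (trans (solve 2 (λ q D → (con 1ℚ :- q) :* D := D :- q :* D) refl q (ι D)) (cong₂ _-_ split qD))
        (solve 2 (λ a d → (a :+ d) :- a := d) refl (ι a) (ι (D ℕ.∸ a)))
        where
          split : ι D ≡ ι a + ι (D ℕ.∸ a)
          split = trans (cong ι (sym (ℕ.m+[n∸m]≡n (ℕ.<⇒≤ a<D)))) (ι-+ a (D ℕ.∸ a))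

      0<π : ∀ v → 0ℚ < π p i v
      0<π true = proj₁ (VAll.lookup⁺ 0<p<1 i)
      0<π false = subst (_< 1ℚ - q) (+-inverseʳ q) (+-monoˡ-< (Data.Rational.- q) (proj₂ (VAll.lookup⁺ 0<p<1 i)))

    module Node (φ₀ φ₁ : List (List (Literal n))) (h : History n) where

      open Status φ₀ φ₁ using (r; u; family)
      open Levels φ₀ φ₁ (asLits h) p c using (free; hitLen; level; gain; Le; cands)
      open Greed p c (ι α₀) r u Untested using (m; Greedy; pick)

      hit-length : ∀ b (ℓ : Literal n) k → Σ ℕ λ L → hitLen b ℓ k ≡ k ℕ.+ L × Ap 1 L (numer (var ℓ) (hitV b (positive ℓ)))
      hit-length b ℓ k with hitV b (positive ℓ)
      ... | true  = nlen (a (var ℓ)) , refl , ap-num (a (var ℓ)) (1≤a (var ℓ))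
      ... | false = ap-diff (a (var ℓ)) (D (var ℓ)) k (a<D (var ℓ))

      numC denC : Fin n → ℕ
      numC i = ∣ ↥ lookup c i ∣
      denC i = ↧ₙ lookup c i

      gainNumber : Bool → Literal n → ℕ
      gainNumber b ℓ = ((denC (var ℓ) ℕ.* numer (var ℓ) (hitV b (positive ℓ))) ℕ.* u b h (var ℓ) (hitV b (positive ℓ))) ℕ.* r (not b) h

      u-literal : ∀ b ℓ → uB b (family b) (asLits h) ℓ ≡ u b h (var ℓ) (hitV b (positive ℓ))
      u-literal b ℓ = cong (λ s → uB b (family b) (asLits h) (lit (var ℓ) s)) (sym (hitV-inv b (positive ℓ)))

      gain-ap : ∀ b ℓ → 1 ℕ.≤ u b h (var ℓ) (hitV b (positive ℓ)) → 1 ℕ.≤ r (not b) h → Ap 4 (gain b ℓ) (gainNumber b ℓ)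
      gain-ap b ℓ pu pr with hit-length b ℓ (nlen (denC (var ℓ)))
      ... | L , e , ap = subst (λ z → Ap 4 z (gainNumber b ℓ)) (sym (cong₂ (λ x y → (x ℕ.+ bl y) ℕ.+ bl (r (not b) h)) e (u-literal b ℓ)))
        (ap-* {3} {1} (ap-* {2} {1} (ap-* {1} {1} (ap-num (denC (var ℓ)) (ℕ.s≤s ℕ.z≤n)) ap) (ap-bl _ pu)) (ap-bl _ pr))

      level-ap : ∀ ℓ → 1 ℕ.≤ numC (var ℓ) → Ap 2 (level ℓ) (numC (var ℓ) ℕ.* D (var ℓ))
      level-ap ℓ pos = ap-* {1} {1} (ap-num (numC (var ℓ)) pos) (ap-num (D (var ℓ)) (ℕ.s≤s ℕ.z≤n))

      Free : ∀ {i} → numC i ≡ 0 → lookup c i ≡ 0ℚ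
      Free {i} e = ↥p≡0⇒p≡0 (lookup c i) (trans (hc i) (cong +_ e))

      module _ (b : Bool) (ℓ : Literal n) (1≤u : 1 ℕ.≤ u b h (var ℓ) (hitV b (positive ℓ))) (1≤r : 1 ℕ.≤ r (not b) h) where

        i : Fin n
        i = var ℓ

        v : Bool
        v = hitV b (positive ℓ)

        X : ℚ
        X = π p i v * ι (m b h i v)

        0<X : 0ℚ < X
        0<X = subst (_< X) (*-zeroʳ (π p i v)) (*-monoʳ-<-pos (π p i v) {{isPositive (0<π i v)}} (0<ι (ℕ.*-mono-≤ 1≤u 1≤r)))

        0≤bound : ∀ {j} → 0ℚ ≤ ι α₀ * (lookup c j * X)
        0≤bound {j} = 0≤* (0≤ι α₀) (0≤* (VAll.lookup⁺ 0≤c j) (<⇒≤ 0<X))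

        compare : ∀ b' ℓ' → 1 ℕ.≤ numC i → 1 ℕ.≤ numC (var ℓ') → 1 ℕ.≤ u b' h (var ℓ') (hitV b' (positive ℓ')) → 1 ℕ.≤ r (not b') h →
                  level ℓ ℕ.+ gain b' ℓ' ℕ.≤ level ℓ' ℕ.+ gain b ℓ →
                  lookup c i * (π p (var ℓ') (hitV b' (positive ℓ')) * ι (m b' h (var ℓ') (hitV b' (positive ℓ')))) ≤ ι α₀ * (lookup c (var ℓ') * X)
        compare b' ℓ' pc pc' pu' pr' le =
          scale {lookup c i} {lookup c j} {π p i v} {π p j v'} α₀ {numC i} {denC i} {numC j} {denC j} {numer i v} {D i} {numer j v'} {D j} {m b h i v} {m b' h j v'}
            (ℕ.*-mono-≤ (ℕ.*-mono-≤ (1≤den (lookup c i)) (1≤den (lookup p j))) (ℕ.*-mono-≤ (1≤den (lookup c j)) (1≤den (lookup p i))))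
            (num-den (lookup c i) (hc i)) (num-den (lookup c j) (hc j)) (π-numer i v) (π-numer j v')
            (subst₂ ℕ._≤_ (cong (numC i ℕ.* D i ℕ.*_) (ℕ.*-assoc (denC j ℕ.* numer j v') (u b' h j v') (r (not b') h)))
              (cong₂ ℕ._*_ (sym α₀-def) (cong (numC j ℕ.* D j ℕ.*_) (ℕ.*-assoc (denC i ℕ.* numer i v) (u b h i v) (r (not b) h))))
              (ap-compare {6} (ap-* {2} {4} (level-ap ℓ pc) (gain-ap b' ℓ' pu' pr')) (ap-* {2} {4} (level-ap ℓ' pc') (gain-ap b ℓ 1≤u 1≤r)) le))
          where
            j : Fin n
            j = var ℓ'
            v' : Bool
            v' = hitV b' (positive ℓ')

        module _ (best : ∀ b' ℓ' → ℓ' ∈ cands b' (family b') → Le b b' ℓ ℓ') where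

          -- An alternative of positive mass occurs as a literal of some unresolved group, so the
          -- search of the machine has met it.
          candidate : ∀ b' j v' → Untested j h → u b' h j v' ≢ 0 → lit j (hitV b' v') ∈ cands b' (family b')
          candidate b' j v' un ne with count-find {n} _ (family b') ne
          ... | G , mem' , t = cands-complete φ₀ φ₁ h p c b' (family b') mem' (∧-left {unresB b' (asLits h) G} {hasB false ℓ' G} t)
                (has-sound false ℓ' G (∧-right {unresB b' (asLits h) G} {hasB false ℓ' G} t)) (untested-true φ₀ φ₁ h p c ℓ' un)
            where
              open Status using (cands-complete; untested-true)
              ℓ' : Literal n
              ℓ' = lit j (hitV b' v')

          zero-left : ∀ x y j → x ≡ 0ℚ ⊎ y ≡ 0ℚ → x * y ≤ ι α₀ * (lookup c j * X)
          zero-left x y j (inj₁ refl) = ≤-trans (≤-reflexive (*-zeroˡ y)) (0≤bound {j})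
          zero-left x y j (inj₂ refl) = ≤-trans (≤-reflexive (*-zeroʳ x)) (0≤bound {j})

          -- The comparison of prices before division by `X`. Mass 0 of the alternative and cost 0
          -- of the choice make the left side vanish; in all other cases the factors are positive
          -- and the bit lengths are meaningful. An alternative of cost 0 cannot lose to a choice of
          -- positive cost, by the form of `Le`.
          node-bound : ∀ j v' b' → Untested j h → lookup c i * (π p j v' * ι (m b' h j v')) ≤ ι α₀ * (lookup c j * X)
          node-bound j v' b' un with m b' h j v' ℕ.≟ 0
          ... | yes z = zero-left (lookup c i) (π p j v' * ι (m b' h j v')) j (inj₂ (trans (cong (π p j v' *_) (ι≡0 _ z)) (*-zeroʳ (π p j v'))))
          ... | no ne with numC i ℕ.≟ 0
          ...   | yes z = zero-left (lookup c i) (π p j v' * ι (m b' h j v')) j (inj₁ (Free z))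
          ...   | no ci with best b' (lit j (hitV b' v')) (candidate b' j v' un (λ z → ne (cong (ℕ._* r (not b') h) z)))
          ...     | inj₁ f = zero-left (lookup c i) (π p j v' * ι (m b' h j v')) j (inj₁ (Free (isNil-numB (numC i) f)))
          ...     | inj₂ (f , le) = subst (λ s → lookup c i * (π p j s * ι (m b' h j s)) ≤ ι α₀ * (lookup c j * X)) (hitV-inv b' v')
                      (compare b' (lit j (hitV b' v')) (ℕ.n≢0⇒n>0 ci) (isNil-zero (numC j) f)
                        (subst (λ s → 1 ℕ.≤ u b' h j s) (sym (hitV-inv b' v')) (ℕ.n≢0⇒n>0 (λ z → ne (cong (ℕ._* r (not b') h) z))))
                        (ℕ.n≢0⇒n>0 (λ z → ne (trans (cong (u b' h j v' ℕ.*_) z) (ℕ.*-zeroʳ (u b' h j v')))))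
                        le)

          -- The witness is the exact price `lookup c i / X`. Rounding affected only which literal
          -- was chosen, so the loss `α₀` appears solely in the comparison with the alternatives.
          price : Σ ℚ λ θ → 0ℚ ≤ θ × lookup c i ≤ θ * X ×
                  (∀ j v' b' → Untested j h → θ * (π p j v' * ι (m b' h j v')) ≤ ι α₀ * lookup c j)
          price with reciprocal 0<X
          ... | ρ , 0≤ρ , e = lookup c i * ρ , 0≤* (VAll.lookup⁺ 0≤c i) 0≤ρ ,
            ≤-reflexive (sym (trans (*-assoc (lookup c i) ρ X) (trans (cong (lookup c i *_) e) (*-identityʳ (lookup c i))))) ,
            λ j v' b' un → ≤-trans (≤-reflexive (swap (lookup c i) ρ (π p j v' * ι (m b' h j v'))))
              (≤-trans (*-mono 0≤ρ (node-bound j v' b' un))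
                (≤-reflexive (trans (regroup ρ (ι α₀) (lookup c j) X) (trans (cong ((ι α₀ * lookup c j) *_) e) (*-identityʳ (ι α₀ * lookup c j))))))
            where
              swap : ∀ a b c → (a * b) * c ≡ b * (a * c)
              swap = solve 3 (λ a b c → (a :* b) :* c := b :* (a :* c)) refl
              regroup : ∀ a b c d → a * (b * (c * d)) ≡ (b * c) * (a * d)
              regroup = solve 4 (λ a b c d → a :* (b :* (c :* d)) := (b :* c) :* (a :* d)) refl

      greedy-step : ∀ b ℓ → r true h ≢ 0 → r false h ≢ 0 → ℓ ∈ cands b (family b) → (∀ b' ℓ' → ℓ' ∈ cands b' (family b') → Le b b' ℓ ℓ') →
                    Untested (var ℓ) h ×
                    (∀ {t₀ t₁} → (∀ v → Greedy (h ++ (var ℓ , v) ∷ []) (subtree v t₀ t₁)) → Greedy h (test (var ℓ) t₀ t₁))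
      greedy-step b ℓ ne₁ ne₂ mem best =
        let (G , m' , un , ∈G , unt) = Status.cands-sound φ₀ φ₁ h p c b (family b) mem
            fresh = Status.untested-sound φ₀ φ₁ h p c ℓ unt
            (θ , 0≤θ , own , others) = price b ℓ (1≤u G m' un ∈G) (ℕ.n≢0⇒n>0 (nonzero b)) best
        in fresh , pick θ 0≤θ fresh (hitV b (positive ℓ) , b , own) (λ j v w → others j v w)
        where
          1≤u : ∀ G → G ∈ family b → unresB b (asLits h) G ≡ true → ℓ ∈ G → 1 ℕ.≤ u b h (var ℓ) (hitV b (positive ℓ))
          1≤u G m' un ∈G = subst (1 ℕ.≤_) (u-literal b ℓ) (count-pos {n} (λ G → unresB b (asLits h) G ∧ hasB false ℓ G) G m'
                  (∧-both {unresB b (asLits h) G} {hasB false ℓ G} un (has-complete false (var ℓ) (positive ℓ) G ∈G)))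
          nonzero : ∀ b → r (not b) h ≢ 0
          nonzero true = ne₂
          nonzero false = ne₁

-- Unrolling the decisions into a tree, and the approximation factor.

module Strategy where

  open import Defs hiding (L; R; S)
  open Literal
  open TapeProgram using (machine)
  open Words using (unresB; count≤)
  open Numerals using (bl)
  open Parsing using (encNum)
  open Run using (Query; query'; program; p-query; decision-halts; module ParseQ)
  open Logs
  open Expectation
  open Approx
  open Ratio using (ι≡)
  open Resolution
  open Covering
  open Choice
  open import Data.Nat as ℕ using (ℕ; zero; suc; _^_)
  import Data.Nat.Properties as ℕ
  open import Data.Nat.Logarithm using (⌈log₂_⌉)
  open import Data.Integer using (+_)
  open import Data.Bool using (Bool; true; false)
  open import Data.Fin using (Fin; zero; suc; toℕ)
  open import Data.List using (List; []; _∷_; _++_; length)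
  import Data.List.Properties as List
  open import Data.List.Relation.Unary.All as All using (All; []; _∷_)
  open import Data.List.Relation.Unary.All.Properties using (++⁺; ++⁻ˡ; ++⁻ʳ)
  open import Data.Maybe using (just; nothing; fromMaybe)
  open import Data.Vec as Vec using (Vec; []; _∷_; lookup; replicate; _[_]≔_)
  open import Data.Vec.Properties using (lookup-map; lookup-replicate; lookup∘update; lookup∘update′)
  open import Data.Vec.Relation.Unary.All as VAll using ()
  import Data.Vec.Relation.Unary.All.Properties as VAll
  open import Data.Rational using (ℚ; 0ℚ; 1ℚ; _+_; _*_; _-_; -_; _≤_; _<_; _/_; nonNegative)
  open import Data.Rational.Properties hiding (_≟_)
  open import Data.Empty using (⊥-elim)
  open import Data.Product using (Σ; _×_; _,_; proj₁; proj₂)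
  open import Relation.Binary.PropositionalEquality using (_≡_; refl; sym; trans; cong; subst; subst₂; _≢_)

  nothings : ∀ {n} → Partial n → ℕ
  nothings []            = 0
  nothings (nothing ∷ b) = suc (nothings b)
  nothings (just _ ∷ b)  = nothings b

  nothings-set : ∀ {n} (b : Partial n) i v → lookup b i ≡ nothing → nothings b ≡ suc (nothings (b [ i ]≔ just v))
  nothings-set (nothing ∷ b) zero v e = refl
  nothings-set (nothing ∷ b) (suc i) v e = cong suc (nothings-set b i v e)
  nothings-set (just _ ∷ b) (suc i) v e = nothings-set b i v e

  nothings-replicate : ∀ n → nothings (replicate n nothing) ≡ n
  nothings-replicate zero = refl
  nothings-replicate (suc n) = cong suc (nothings-replicate n)

  costOn≥0 : ∀ {n} (c : Vec ℚ n) → (∀ i → 0ℚ ≤ lookup c i) → ∀ t x → 0ℚ ≤ costOn c t x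
  costOn≥0 c h (leaf v) x = ≤-refl
  costOn≥0 c h (test i t₀ t₁) x with lookup x i
  ... | false = 0≤+ (h i) (costOn≥0 c h t₀ x)
  ... | true  = 0≤+ (h i) (costOn≥0 c h t₁ x)

  exponent coefficient : ℕ
  coefficient = proj₁ p-query
  exponent    = proj₁ (proj₂ p-query)

  algorithm : TM
  algorithm = machine program

  module Algorithm {n : ℕ} (φ₀ : CNF n) (φ₁ : DNF n) (same : ∀ x → evalCNF φ₀ x ≡ evalDNF φ₁ x) (p c : Vec ℚ n)
                   (0<p<1 : VAll.All (λ q → (0ℚ < q) × (q < 1ℚ)) p) (0≤c : VAll.All (λ q → 0ℚ ≤ q) c) where

    open Status φ₀ φ₁
    open Prices p c 0<p<1 0≤c using (hp; hc; module Node)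
    open Greed p c (ι α₀) r u Untested using (Greedy; stop; pick; Rem; Facts; module Analysis)

    inst : List Sym
    inst = encInstance n φ₀ φ₁ p c

    T : ℕ
    T = coefficient ℕ.* suc (length inst) ^ exponent

    data Verdict (h : History n) : List Sym → Set where
      decided : ∀ w → r w h ≡ 0 → Verdict h (encOutput w)
      ask     : ∀ i → Untested i h →
                (∀ {t₀ t₁} → (∀ v → Greedy (h ++ (i , v) ∷ []) (subtree v t₀ t₁)) → Greedy h (test i t₀ t₁)) → Verdict h (encTest i)

    module _ (h : History n) (short : length h ℕ.≤ n) where

      q : Query
      q = query' n φ₀ φ₁ p c h short

      judge : ∀ {out} → ParseQ.Outcome q hp hc out → Verdict h out
      judge (ParseQ.accept e) = decided true e
      judge (ParseQ.reject _ e) = decided false e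
      judge (ParseQ.query b ℓ ne₁ ne₂ mem best) = subst (Verdict h) (cong (λ l → lb ∷ o0 ∷ l) (encNum (toℕ (var ℓ)) (rb ∷ [])))
        (ask (var ℓ) (proj₁ step) (proj₂ step))
        where
          step = Node.greedy-step φ₀ φ₁ h b ℓ ne₁ ne₂ mem best

      opaque
        decide : ∀ a → Consistent h a → Σ (List Sym) λ out → HaltsWith algorithm T (lb ∷ inst ++ encHistory h ++ rb ∷ []) out × Verdict h out
        decide a cs = let (out , halts , o) = decision-halts q hp hc (candidate-exists h p c same a cs) in out , halts , judge o

    Certified : Tree n → Partial n → Set
    Certified t b = ∀ x → IsCertificate (evalDNF φ₁) (proj₁ (runTree t x b)) (proj₂ (runTree t x b))

    Built : History n → Partial n → Set
    Built h b = Σ (Tree n) λ t → Implements algorithm T inst h t × Greedy h t × Certified t b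

    record Tracks (h : History n) (b : Partial n) : Set where
      field
        seen   : All (λ e → lookup b (proj₁ e) ≡ just (proj₂ e)) h
        unseen : ∀ i → Untested i h → lookup b i ≡ nothing

    open Tracks

    tracks-next : ∀ {h b} i v → Untested i h → Tracks h b → Tracks (h ++ (i , v) ∷ []) (b [ i ]≔ just v)
    tracks-next {h} {b} i v un tr = record
      { seen   = ++⁺ (All.zipWith (λ (ne , e) → trans (lookup∘update′ (λ z → ne (sym z)) b (just v)) e) (un , seen tr)) (lookup∘update i b (just v) ∷ [])
      ; unseen = λ j un' → trans (lookup∘update′ (fresh j (++⁻ʳ h un')) b (just v)) (unseen tr j (++⁻ˡ h un')) }
      where
        fresh : ∀ j → All (λ (e : Fin n × Bool) → j ≢ proj₁ e) ((i , v) ∷ []) → j ≢ i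
        fresh j (ne ∷ []) = ne

    certified-test : ∀ i t₀ t₁ b → Certified t₀ (b [ i ]≔ just false) → Certified t₁ (b [ i ]≔ just true) → Certified (test i t₀ t₁) b
    certified-test i t₀ t₁ b h₀ h₁ x with lookup x i
    ... | false = h₀ x
    ... | true  = h₁ x

    join : ∀ {h b} i → HaltsWith algorithm T (lb ∷ inst ++ encHistory h ++ rb ∷ []) (encTest i) →
           (∀ {t₀ t₁} → (∀ v → Greedy (h ++ (i , v) ∷ []) (subtree v t₀ t₁)) → Greedy h (test i t₀ t₁)) →
           Built (h ++ (i , false) ∷ []) (b [ i ]≔ just false) → Built (h ++ (i , true) ∷ []) (b [ i ]≔ just true) → Built h b
    join {h} {b} i halts greedy (t₀ , run₀ , g₀ , cert₀) (t₁ , run₁ , g₁ , cert₁) =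
      test i t₀ t₁ , (halts , run₀ , run₁) , greedy (λ { true → g₁ ; false → g₀ }) , certified-test i t₀ t₁ b cert₀ cert₁

    -- Recursion on the number `k` of untested variables: every query is fresh, so it decreases. The
    -- equation with `length h` keeps histories within `n`, as the time bound requires.
    build : ∀ k h b → length h ℕ.+ k ≡ n → nothings b ≡ k → Tracks h b → Built h b
    build k h b el eb tr = grow k eb el (decide h (subst (length h ℕ.≤_) el (ℕ.m≤m+n (length h) k)) a
        (All.map (λ {e} s → trans (lookup-map (proj₁ e) (fromMaybe false) b) (cong (fromMaybe false) s)) (seen tr)))
      where
        -- The decision needs some input consistent with the history as evidence that not both
        -- families are stuck; untested variables are set to 0.
        a : Vec Bool n
        a = Vec.map (fromMaybe false) b
        grow : ∀ k → nothings b ≡ k → length h ℕ.+ k ≡ n →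
               (Σ (List Sym) λ out → HaltsWith algorithm T (lb ∷ inst ++ encHistory h ++ rb ∷ []) out × Verdict h out) → Built h b
        grow k eb el (_ , halts , decided w e) = leaf w , halts , stop w ,
          λ x a' ag → certify same w h a' e (All.map (λ {d} s → ag (proj₁ d) (proj₂ d) s) (seen tr))
        grow zero eb el (_ , halts , ask i un _) = ⊥-elim (ℕ.1+n≢0 (trans (sym (nothings-set b i false (unseen tr i un))) eb))
        grow (suc k) eb el (_ , halts , ask i un greedy) = join i halts greedy (sub false) (sub true)
          where
            sub : ∀ v → Built (h ++ (i , v) ∷ []) (b [ i ]≔ just v)
            sub v = build k (h ++ (i , v) ∷ []) (b [ i ]≔ just v)
              (trans (cong (ℕ._+ k) (List.length-++ h)) (trans (ℕ.+-assoc (length h) 1 k) el))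
              (ℕ.suc-injective (trans (sym (nothings-set b i v (unseen tr i un))) eb)) (tracks-next i v un tr)

    opaque
      built : Built [] (replicate n nothing)
      built = build n [] (replicate n nothing) refl (nothings-replicate n) (record { seen = [] ; unseen = λ i _ → lookup-replicate i nothing })

    probs : VAll.All Prob p
    probs = VAll.map (λ {q} (l , g) → <⇒≤ l , subst (_≤ 1ℚ - q) (+-inverseʳ q) (+-monoˡ-≤ (- q) (<⇒≤ g))) 0<p<1

    facts : Facts
    facts = record
      { probs = probs ; costs = VAll.lookup⁺ 0≤c ; 0≤α = 0≤ι α₀
      ; r-step = r-step ; r-mono = r-mono ; u-mono = u-mono ; u≤r = u≤r
      ; u-untested = u-untested ; untested-earlier = untested-earlier ; untested-fresh = untested-fresh }

    -- At the start at most all clauses and all terms are unresolved, so `Rem []` is at most their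
    -- product. A bit length exceeds the rounded-up logarithm by at most one, which is the origin of
    -- the `suc`.
    factor : ι 4 * (ι α₀ * ι (bl (Rem []))) ≤ + (4 ℕ.* α₀ ℕ.* suc ⌈log₂ (length φ₀ ℕ.* length φ₁) ⌉) / 1
    factor = ≤-trans (≤-reflexive (trans (cong (ι 4 *_) (sym (ι-* α₀ (bl (Rem []))))) (sym (ι-* 4 (α₀ ℕ.* bl (Rem []))))))
      (≤-trans (ι-mono (ℕ.≤-trans (ℕ.≤-reflexive (sym (ℕ.*-assoc 4 α₀ (bl (Rem [])))))
        (ℕ.*-monoʳ-≤ (4 ℕ.* α₀) (ℕ.≤-trans (bl-mono (ℕ.*-mono-≤ (count≤ (unresB true []) φ₀) (count≤ (unresB false []) φ₁))) (bl≤log (length φ₀ ℕ.* length φ₁))))))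
        (≤-reflexive (ι≡ (4 ℕ.* α₀ ℕ.* suc ⌈log₂ (length φ₀ ℕ.* length φ₁) ⌉))))

    approximates : ∀ t' → Evaluates (evalDNF φ₁) t' →
                   expectedCost p c (proj₁ built) ≤ (+ (4 ℕ.* α₀ ℕ.* suc ⌈log₂ (length φ₀ ℕ.* length φ₁) ⌉) / 1) * expectedCost p c t'
    approximates t' ev = subst₂ (λ x y → x ≤ (+ (4 ℕ.* α₀ ℕ.* suc ⌈log₂ (length φ₀ ℕ.* length φ₁) ⌉) / 1) * y)
        (sym (expectedCost-E p c (proj₁ built))) (sym (expectedCost-E p c t'))
      (≤-trans (Analysis.competitive facts (proj₁ (proj₂ (proj₂ built))) t' (λ x h _ → Certificates.rem-cover φ₀ φ₁ same t' ev x p c (ι α₀) h))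
        (*-monoʳ-≤-nonNeg (E p (costOn c t')) {{nonNegative cost≥0}} factor))
      where
        cost≥0 : 0ℚ ≤ E p (costOn c t')
        cost≥0 = ≤-trans (≤-reflexive (sym (E-const p 0ℚ))) (E-mono probs (costOn≥0 c (VAll.lookup⁺ 0≤c) t'))

open import Defs
open import Data.Nat using (ℕ; suc; _+_; _*_; _^_)
open import Data.Nat.Logarithm using (⌈log₂_⌉)
open import Data.Integer using (+_)
open import Data.Rational using (ℚ; 0ℚ; 1ℚ; _/_; _≤_; _<_) renaming (_*_ to _*ℚ_)
open import Data.Bool using (Bool)
open import Data.List using (List; []; length)
open import Data.Vec using (Vec)
open import Data.Vec.Relation.Unary.All using (All)
open import Data.Product using (Σ; _×_; _,_)
open import Relation.Binary.PropositionalEquality using (_≡_)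

theorem1 : Σ TM λ M → Σ ℕ λ a → Σ ℕ λ e → Σ ℕ λ C →
    (n : ℕ) (φ0 : CNF n) (φ1 : DNF n) →
    ((x : Vec Bool n) → evalCNF φ0 x ≡ evalDNF φ1 x) →
    (p c : Vec ℚ n) →
    All (λ q → (0ℚ < q) × (q < 1ℚ)) p →
    All (λ q → 0ℚ ≤ q) c →
    Σ (Tree n) λ t →
    Implements M (a * suc (length (encInstance n φ0 φ1 p c)) ^ e)
    (encInstance n φ0 φ1 p c) [] t
    × Evaluates (evalDNF φ1) t
    × ((t' : Tree n) → Evaluates (evalDNF φ1) t' →
    expectedCost p c t
    ≤ ((+ (C * suc ⌈log₂ (length φ0 * length φ1) ⌉) / 1) *ℚ expectedCost p c t'))
theorem1 = Strategy.algorithm , Strategy.coefficient , Strategy.exponent , 4 * Choice.α₀ , λ n φ0 φ1 same p c 0<p<1 0≤c →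
  let open Strategy.Algorithm φ0 φ1 same p c 0<p<1 0≤c
      (t , implements , _ , certified) = built
  in t , implements , certified , approximates
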